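{- Let $d$ and $r$ be positive integers and $0<\delta<1$ real. Let $P$ be an intersective integer polynomial of degree $d$ satisfying $1\leq P(x)<P(y)$ for all real $1\leq x<y$. Let $s\geq1$, $t\geq0$ be integers with $s+t\geq s_0(d)$. Let $L_1(\mathbf{x})\in\mathbb{Z}[x_1,\ldots,x_s]$ be a non-degenerate linear form whose coefficients have greatest common divisor $1$ and with $L_1(1,\ldots,1)=0$, and let $L_2(\mathbf{y})\in\mathbb{Z}[y_1,\ldots,y_t]$ be a non-degenerate linear form. Then there is $c>0$ depending only on $L_1,L_2,P,r,\delta$ (not on $D$) such that the following holds. Let $D,Z\in\mathbb{N}$ with $Z\geq Z_0(D,r,\delta,L_1,L_2,P)$ for a suitable threshold $Z_0$, set $N=P_D(Z)$, and let $\mathcal{A}_1,\ldots,\mathcal{A}_r\subseteq[N]$ with $|\mathcal{A}_i|\geq\delta N$ for each $i$. If $[Z]=\mathcal{C}_1\cup\cdots\cup\mathcal{C}_r$, then there exists $k\in[r]$ such that $$\#\{(\mathbf{n},\mathbf{z})\in\mathcal{A}_i^s\times\mathcal{C}_k^t: L_1(\mathbf{n})=L_2(P_D(\mathbf{z}))\}\geq cN^{s-1}Z^t\qquad(1\leq i\leq r).$$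
   Context: $[X]=\{1,\ldots,X\}$. A polynomial is intersective if for every positive integer $n$ it has an integer zero modulo $n$. A linear form $b_1x_1+\cdots+b_tx_t$ is non-degenerate if all $b_j$ are non-zero integers; if $t=0$, $L_2$ is taken to be $0$. $T(d)$ is the least positive integer $T$ such that for every integer polynomial $P$ of degree $d$ and every $\varepsilon>0$, the number of $\mathbf{x}\in[X]^{2T}$ with $P(x_1)+\cdots+P(x_T)=P(x_{T+1})+\cdots+P(x_{2T})$ is $O_{P,\varepsilon}(X^{2T-d+\varepsilon})$; $s_0(d)=2T(d)+1$. Auxiliary polynomial: for each prime $p$ fix $z_p\in\mathbb{Z}_p$ with $P(z_p)=0$, with multiplicity $m_p$; $\lambda(D)=\prod_p p^{m_p\mathrm{ord}_p(D)}$; $r_D$ is the unique integer in $(-D,0]$ with $r_D\equiv z_p\pmod{p^{\mathrm{ord}_p(D)}\mathbb{Z}_p}$ for all $p$; $P_D(x)=P(r_D+Dx)/\lambda(D)\in\mathbb{Z}[x]$, and $P_D(\mathbf{z})=(P_D(z_1),\ldots,P_D(z_t))$. -}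

module Defs where

open import Data.Nat as ℕ using (ℕ; zero; suc)
open import Data.Nat.GCD using (gcd)
open import Data.Nat.Combinatorics using (_C_)
open import Data.Nat.Primality using (Prime; prime?)
open import Data.Nat.Divisibility using (_∣?_)
open import Data.Integer as ℤ using (ℤ; +_)
open import Data.Integer.Divisibility as ℤD using ()
open import Data.Rational as ℚ using (ℚ)
open import Data.Bool using (Bool; true; false; if_then_else_; _∧_)
open import Data.List using (List; []; _∷_; concatMap; map; foldr; upTo)
open import Data.Vec as V using (Vec; []; _∷_)
open import Data.Product using (Σ; _×_; ∃)
open import Data.Empty using (⊥)
open import Relation.Nullary using (¬_)
open import Relation.Nullary.Decidable using (⌊_⌋)
open import Relation.Binary.PropositionalEquality using (_≡_; _≢_)

-- Integer polynomials of degree ≤ d as coefficient vectors,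
-- lowest degree first:  a₀ + a₁ x + ... + a_d x^d.

Poly : ℕ → Set
Poly d = Vec ℤ (suc d)

HasDegree : ∀ {d} → Poly d → Set
HasDegree P = V.last P ≢ + 0

evalℤ : ∀ {n} → Vec ℤ n → ℤ → ℤ
evalℤ [] x = + 0
evalℤ (a ∷ as) x = a ℤ.+ x ℤ.* evalℤ as x

evalℚ : ∀ {n} → Vec ℤ n → ℚ → ℚ
evalℚ [] x = ℚ.0ℚ
evalℚ (a ∷ as) x = (a ℚ./ 1) ℚ.+ x ℚ.* evalℚ as x

-- j-th Taylor coefficient of P at a :  Σ_i C(i,j) a_i a^(i-j)
-- (the coefficient of x^j in P(x + a)).
taylorFrom : ∀ {n} → ℕ → Vec ℤ n → ℕ → ℤ → ℤ
taylorFrom i [] j a = + 0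
taylorFrom i (c ∷ cs) j a =
  (+ (i C j)) ℤ.* c ℤ.* (a ℤ.^ (i ℕ.∸ j)) ℤ.+ taylorFrom (suc i) cs j a

taylor : ∀ {d} → Poly d → ℕ → ℤ → ℤ
taylor P j a = taylorFrom 0 P j a

Intersective : ∀ {d} → Poly d → Set
Intersective P = (n : ℕ) → 1 ℕ.≤ n → ∃ λ (x : ℤ) → (+ n) ℤD.∣ evalℤ P x

-- p-adic zeros.  A p-adic integer z_p is represented by a coherent
-- sequence of integer approximations  zs k  (zs k ≡ z_p mod p^k), i.e.
-- p^k ∣ zs (k+1) - zs k.  An element  f(z_p)  of ℤ_p (f an integer
-- polynomial expression) vanishes iff  p^k ∣ f(zs k)  for every k.

Coherent : ℕ → (ℕ → ℤ) → Set
Coherent p zs = ∀ k → (+ (p ℕ.^ k)) ℤD.∣ (zs (suc k) ℤ.- zs k)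

IsPAdicZero : ∀ {d} → Poly d → ℕ → (ℕ → ℤ) → Set
IsPAdicZero P p zs = ∀ k → (+ (p ℕ.^ k)) ℤD.∣ evalℤ P (zs k)

TaylorVanishes : ∀ {d} → Poly d → ℕ → (ℕ → ℤ) → ℕ → Set
TaylorVanishes P p zs j = ∀ k → (+ (p ℕ.^ k)) ℤD.∣ taylor P j (zs k)

HasMultiplicity : ∀ {d} → Poly d → ℕ → (ℕ → ℤ) → ℕ → Set
HasMultiplicity P p zs m =
  (∀ j → j ℕ.< m → TaylorVanishes P p zs j) × ¬ TaylorVanishes P p zs m

record PAdicZeros {d} (P : Poly d) : Set where
  field
    zs   : ℕ → ℕ → ℤ
    mult : ℕ → ℕ
    coherent : ∀ p → Prime p → Coherent p (zs p)
    isZero   : ∀ p → Prime p → IsPAdicZero P p (zs p)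
    isMult   : ∀ p → Prime p → HasMultiplicity P p (zs p) (mult p)

ordFuel : ℕ → ℕ → ℕ → ℕ
ordFuel zero    p       n = 0
ordFuel (suc f) zero    n = 0
ordFuel (suc f) (suc q) n =
  if ⌊ suc q ∣? n ⌋ ∧ ⌊ 1 ℕ.≤? q ⌋ ∧ ⌊ 1 ℕ.≤? n ⌋
  then suc (ordFuel f (suc q) (n ℕ./ suc q))
  else 0

-- ord p D : the exponent of the prime p in D (D ≥ 1); fuel D suffices
ord : ℕ → ℕ → ℕ
ord p D = ordFuel D p D

prodℕ : List ℕ → ℕ
prodℕ = foldr ℕ._*_ 1

-- λ(D) = ∏_p p^(m_p · ord_p D)  (only primes p ≤ D contribute)
lam : (ℕ → ℕ) → ℕ → ℕ
lam m D = prodℕ (map (λ p → if ⌊ prime? p ⌋ then p ℕ.^ (m p ℕ.* ord p D) else 1)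
                     (upTo (suc D)))

IsRD : (ℕ → ℕ → ℤ) → ℕ → ℤ → Set
IsRD zs D r =
  (ℤ.- (+ D) ℤ.< r) × (r ℤ.≤ + 0) ×
  (∀ p → Prime p → (+ (p ℕ.^ ord p D)) ℤD.∣ (r ℤ.- zs p (ord p D)))

-- division by a natural number (λ(D) ≥ 1 always; the zero case is unused)
divℕ : ℤ → ℕ → ℤ
divℕ a zero = + 0
divℕ a (suc n) = a ℤ./ℕ suc n

PD : ∀ {d} → Poly d → (m : ℕ → ℕ) → (D : ℕ) → (r : ℤ) → ℤ → ℤ
PD P m D r x = divℕ (evalℤ P (r ℤ.+ (+ D) ℤ.* x)) (lam m D)

tuples : (k M : ℕ) → List (Vec ℕ k)
tuples zero    M = [] ∷ []
tuples (suc k) M = concatMap (λ x → map (x ∷_) (tuples k M)) (upTo M ++1)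
  where
  _++1 : List ℕ → List ℕ
  xs ++1 = map suc xs

count : {A : Set} → (A → Bool) → List A → ℕ
count p [] = 0
count p (x ∷ xs) = (if p x then 1 else 0) ℕ.+ count p xs

allV : ∀ {k} → (ℕ → Bool) → Vec ℕ k → Bool
allV p [] = true
allV p (x ∷ xs) = p x ∧ allV p xs

linear : ∀ {k} → Vec ℤ k → Vec ℤ k → ℤ
linear [] [] = + 0
linear (b ∷ bs) (x ∷ xs) = b ℤ.* x ℤ.+ linear bs xs

NonDegenerate : ∀ {k} → Vec ℤ k → Set
NonDegenerate bs = ∀ i → V.lookup bs i ≢ + 0

gcdV : ∀ {k} → Vec ℤ k → ℕ
gcdV [] = 0
gcdV (b ∷ bs) = gcd ℤ.∣ b ∣ (gcdV bs)

ones : ∀ k → Vec ℤ k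
ones k = V.replicate k (+ 1)

sumP : ∀ {d k} → Poly d → Vec ℕ k → ℤ
sumP P [] = + 0
sumP P (x ∷ xs) = evalℤ P (+ x) ℤ.+ sumP P xs

vinoCount : ∀ {d} → Poly d → (T X : ℕ) → ℕ
vinoCount P T X =
  count (λ x → ⌊ sumP P (V.take T x) ℤ.≟ sumP P (V.drop T x) ⌋) (tuples (T ℕ.+ T) X)

-- HuaBound d T : for every integer polynomial P of degree d and every
-- (rational) ε = a/b > 0, vinoCount P T X = O_{P,ε}(X^{2T-d+ε}), written
-- without fractional/negative exponents as
--   (vinoCount P T X)^b · X^{d b} ≤ C^b · X^{2T b + a}   for all X ≥ 1.
HuaBound : ℕ → ℕ → Set
HuaBound d T =
  (P : Poly d) → HasDegree P →
  (a b : ℕ) → 1 ℕ.≤ a → 1 ℕ.≤ b →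
  ∃ λ (C : ℕ) → (X : ℕ) → 1 ℕ.≤ X →
    (vinoCount P T X) ℕ.^ b ℕ.* X ℕ.^ (d ℕ.* b)
      ℕ.≤ C ℕ.^ b ℕ.* X ℕ.^ ((T ℕ.+ T) ℕ.* b ℕ.+ a)

IsT : ℕ → ℕ → Set
IsT d T = 1 ℕ.≤ T × HuaBound d T × (∀ T' → 1 ℕ.≤ T' → HuaBound d T' → T ℕ.≤ T')

S0≤ : ℕ → ℕ → Set
S0≤ d n = ∃ λ T → IsT d T × suc (T ℕ.+ T) ℕ.≤ n

IncreasingPos : ∀ {d} → Poly d → Set
IncreasingPos P = (x y : ℚ) → ℚ.1ℚ ℚ.≤ x → x ℚ.< y →
  (ℚ.1ℚ ℚ.≤ evalℚ P x) × (evalℚ P x ℚ.< evalℚ P y)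

range : ℕ → List ℕ
range M = map suc (upTo M)

card : (ℕ → Bool) → ℕ → ℕ
card A M = count A (range M)

solCount : ∀ {s t} → Vec ℤ s → Vec ℤ t → (ℕ → ℤ) →
           (ℕ → Bool) → (ℕ → Bool) → (N Z : ℕ) → ℕ
solCount {s} {t} L₁ L₂ f 𝒜 𝒞 N Z =
  count (λ nz → allV 𝒜 (Data.Product.proj₁ nz) ∧ allV 𝒞 (Data.Product.proj₂ nz) ∧
                ⌊ linear L₁ (V.map +_ (Data.Product.proj₁ nz))
                    ℤ.≟ linear L₂ (V.map f (Data.Product.proj₂ nz)) ⌋)
        (concatMap (λ n → map (λ z → n Data.Product., z) (tuples t Z)) (tuples s N))
  where import Data.Product

-- Only those z are counted that lie in a progression z₁ + |b₁| w on which P_D is divisible by the first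
-- coefficient b₁ of L₁, say P_D(z₁ + |b₁| w) = |b₁| R(w). Then L₂(P_D(z)) = b₁ h, where h is a combination of the
-- values R(w_j), and translating n₁ by h turns solutions of L₁(n) = 0 in A ∩ (A - h) into solutions of
-- L₁(n) = L₂(P_D(z)) in A. If A ∩ (A - h) is dense, Varnavides' form of Roth's theorem (proved here from
-- Szemerédi's cube lemma and a density increment) supplies the N^(s-1) choices of n.
--
-- That A_i ∩ (A_i - h) is dense for a positive proportion of w, simultaneously for all i and for the choices made so
-- far in every colour, is a Sárközy-type recurrence theorem in a product of cyclic systems; recursing on the number
-- of variables still missing in each colour, the pigeonhole principle settles on a colour.
--
-- The recurrence theorem avoids Fourier analysis. Van der Corput differencing bounds averages of shifts along a
-- polynomial by averages along a progression, ‖avg T^R(z) f‖² ≤ ‖f‖²/κ + κ′ ‖avg T^(aql) f‖². The energy of the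
-- projection of f to a scale is bounded, so it is nearly constant between some two successive scales, where f is
-- close to its own average along the values R(w) divisible by q; the p-adic zeros provide such w.
module Submission where

open import Defs
open import Data.Nat as ℕ using (ℕ; zero; suc; _+_; _*_; _∸_; _^_; _≤_; _<_; z≤n; s≤s; _≤?_; _<?_; _!)
open import Data.Nat.Properties as ℕP using (≤-trans; ≤-reflexive; *-monoʳ-≤; m≤m+n; m≤n+m; <⇒≤; ≤-refl; +-mono-≤; *-monoˡ-≤; *-assoc; *-mono-≤; +-identityʳ; +-monoʳ-≤; +-comm; +-monoˡ-≤; *-zeroʳ; *-identityʳ; *-cancelˡ-≤; m<n⇒m<1+n; *-comm; ≰⇒>; <⇒≱; *-identityˡ; n≤1+n; m+[n∸m]≡n; +-assoc; ≤-pred; m∸n+n≡m; *-distribˡ-+; +-cancelˡ-≤; +-cancelʳ-≤; ^-monoˡ-≤; ≤∧≢⇒<; ^-distribˡ-+-*; m≤n⇒m≤1+n; +-monoʳ-<; +-suc; *-cancelʳ-≤; *-distribʳ-+; n≢0⇒n>0; 1≤n!; +-cancelʳ-≡; <-irrefl; ⊔-lub; n≮n; m∸n≤m; n≤0⇒n≡0; +-∸-assoc; +-mono-<-≤; ≤-total)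
import Data.Nat.DivMod as ℕDM
import Data.Nat.Divisibility as ℕD
open import Data.Nat.Combinatorics as ℕC using (nCk+nC[k+1]≡[n+1]C[k+1]; k>n⇒nCk≡0)
open import Data.Nat.Coprimality as Cop using (Coprime)
open import Data.Nat.GCD using (module Bézout)
open import Data.Nat.Induction using (<-rec)
open import Data.Nat.ListAction using (product)
open import Data.Nat.Primality using (Prime; prime?; prime⇒irreducible; prime⇒nonTrivial)
open import Data.Nat.Primality.Factorisation using (factorise; PrimeFactorisation)
open import Data.Integer as ℤ using (ℤ; +_; -[1+_])
import Data.Integer.Properties as ℤP
import Data.Integer.DivMod as ℤDM
import Data.Integer.Divisibility as ℤDv
open import Data.Integer.Divisibility.Signed as Sg using (divides; _∣_; ∣m∣n⇒∣m+n; ∣n⇒∣m*n; ∣m⇒∣m*n; ∣m∣n⇒∣m-n)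
open import Data.Rational as ℚ using (ℚ)
import Data.Rational.Properties as ℚP
open import Data.Rational.Unnormalised as ℚᵘ using (mkℚᵘ; *≡*)
import Data.Rational.Unnormalised.Properties as ℚᵘP
open import Algebra.Bundles using (CommutativeRing; RawRing)
open import Algebra.Structures using (IsCommutativeRing)
import Algebra.Solver.Ring
open import Algebra.Solver.Ring.AlmostCommutativeRing using (AlmostCommutativeRing; fromCommutativeRing; _-Raw-AlmostCommutative⟶_)
open import Data.Bool as Bool using (Bool; true; false; if_then_else_; _∧_; _∨_; not)
open import Data.Bool.Properties using (¬-not; T-∧)
open import Data.Fin as Fin using (Fin; zero; suc)
import Data.Fin.Properties as FinP
open import Data.List as List using (List; []; _∷_; length; concatMap; upTo; applyUpTo; _++_)
open import Data.List.Relation.Unary.All using (All; []; _∷_)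
open import Data.List.Relation.Unary.Unique.Propositional using (Unique; []; _∷_)
open import Data.List.Relation.Unary.Unique.Propositional.Properties using (upTo⁺)
open import Data.Vec as V using (Vec; []; _∷_; last; toList)
open import Data.Vec.Properties using (length-toList; lookup-map)
open import Data.Vec.Functional using (updateAt)
open import Data.Vec.Functional.Properties using (updateAt-updates; updateAt-minimal)
import Data.Maybe
open import Data.Unit using (⊤; tt)
open import Data.Empty using (⊥; ⊥-elim)
open import Data.Sum using (_⊎_; inj₁; inj₂; [_,_]′)
open import Data.Product using (Σ; _×_; ∃; _,_; proj₁; proj₂)
open import Function.Bundles using (Equivalence)
open import Relation.Nullary using (¬_; yes; no; contradiction; Dec)
open import Relation.Nullary.Decidable using (⌊_⌋; dec⇒maybe)
open import Relation.Binary.PropositionalEquality using (_≡_; _≢_; refl; sym; trans; cong; cong₂; subst; subst₂; module ≡-Reasoning)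

-- The obstacle is uniformity: the final constant may not depend on `D`, while the coefficients of
-- P_D vary with it. Every inequality for polynomial shifts therefore fixes its constants from the
-- degree and the densities before a system or a polynomial appears, and the steps of all comparison
-- progressions are multiples of the coefficients themselves, so that their size never matters. The
-- polynomial enters only through thresholds. Lower coefficients may be huge compared with the
-- leading one, so a scale is not one progression but a product of one for each degree j >= 1, with
-- step a_j q and length y^j. Moving the argument of the polynomial by a multiple of q, by much less
-- than y, changes its value by a translation which this product hardly notices. Different choices
-- of a variable may lead to different colours. Partial choices are therefore kept for all colours
-- at once, and the colour is named only when some colour is certain to succeed.

infixl 6 _⊕_ _⊝_
infixl 7 _⊗_
infix 8 ⊖_
infix 4 _≼_

-- The ordered field of values.

opaque
  F : Set
  F = ℚ
  _⊕_ _⊗_ : F → F → F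
  _⊕_ = ℚ._+_
  _⊗_ = ℚ._*_
  ⊖_ : F → F
  ⊖_ = ℚ.-_
  0F 1F : F
  0F = ℚ.0ℚ
  1F = ℚ.1ℚ
  _≼_ : F → F → Set
  _≼_ = ℚ._≤_
  ιℤ : ℤ → F
  ιℤ i = ℚ.fromℚᵘ (mkℚᵘ i 0)
  inv : ℕ → F
  -- The default value 0 keeps `0≼inv` and the monotonicity of averages free of side conditions.
  inv zero = ℚ.0ℚ
  inv (suc n) = ℚ.fromℚᵘ (mkℚᵘ (+ 1) n)

  F-isCommutativeRing : IsCommutativeRing _≡_ _⊕_ _⊗_ ⊖_ 0F 1F
  F-isCommutativeRing = ℚP.+-*-isCommutativeRing

  ιℤ-+ : ∀ i j → ιℤ (i ℤ.+ j) ≡ ιℤ i ⊕ ιℤ j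
  ιℤ-+ i j = ℚP.toℚᵘ-injective (begin
    ℚ.toℚᵘ (ιℤ (i ℤ.+ j)) ≈⟨ ℚP.toℚᵘ-fromℚᵘ _ ⟩
    mkℚᵘ (i ℤ.+ j) 0 ≈⟨ *≡* (cong (ℤ._* + 1) (cong₂ ℤ._+_ (sym (ℤP.*-identityʳ i)) (sym (ℤP.*-identityʳ j)))) ⟩
    mkℚᵘ i 0 ℚᵘ.+ mkℚᵘ j 0 ≈⟨ ℚᵘP.+-cong (ℚᵘP.≃-sym (ℚP.toℚᵘ-fromℚᵘ (mkℚᵘ i 0))) (ℚᵘP.≃-sym (ℚP.toℚᵘ-fromℚᵘ (mkℚᵘ j 0))) ⟩
    ℚ.toℚᵘ (ιℤ i) ℚᵘ.+ ℚ.toℚᵘ (ιℤ j) ≈⟨ ℚᵘP.≃-sym (ℚP.toℚᵘ-homo-+ (ιℤ i) (ιℤ j)) ⟩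
    ℚ.toℚᵘ (ιℤ i ⊕ ιℤ j) ∎)
    where
    open ℚᵘP.≃-Reasoning

  ιℤ-* : ∀ i j → ιℤ (i ℤ.* j) ≡ ιℤ i ⊗ ιℤ j
  ιℤ-* i j = ℚP.toℚᵘ-injective (begin
    ℚ.toℚᵘ (ιℤ (i ℤ.* j)) ≈⟨ ℚP.toℚᵘ-fromℚᵘ _ ⟩
    mkℚᵘ i 0 ℚᵘ.* mkℚᵘ j 0 ≈⟨ ℚᵘP.*-cong (ℚᵘP.≃-sym (ℚP.toℚᵘ-fromℚᵘ (mkℚᵘ i 0))) (ℚᵘP.≃-sym (ℚP.toℚᵘ-fromℚᵘ (mkℚᵘ j 0))) ⟩
    ℚ.toℚᵘ (ιℤ i) ℚᵘ.* ℚ.toℚᵘ (ιℤ j) ≈⟨ ℚᵘP.≃-sym (ℚP.toℚᵘ-homo-* (ιℤ i) (ιℤ j)) ⟩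
    ℚ.toℚᵘ (ιℤ i ⊗ ιℤ j) ∎)
    where
    open ℚᵘP.≃-Reasoning

  ιℤ-neg : ∀ i → ιℤ (ℤ.- i) ≡ ⊖ ιℤ i
  ιℤ-neg i = ℚP.toℚᵘ-injective (begin
    ℚ.toℚᵘ (ιℤ (ℤ.- i)) ≈⟨ ℚP.toℚᵘ-fromℚᵘ _ ⟩
    ℚᵘ.- mkℚᵘ i 0 ≈⟨ ℚᵘP.-‿cong (ℚᵘP.≃-sym (ℚP.toℚᵘ-fromℚᵘ (mkℚᵘ i 0))) ⟩
    ℚᵘ.- ℚ.toℚᵘ (ιℤ i) ≈⟨ ℚᵘP.≃-sym (ℚP.toℚᵘ-homo‿- (ιℤ i)) ⟩
    ℚ.toℚᵘ (⊖ ιℤ i) ∎)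
    where
    open ℚᵘP.≃-Reasoning

  ιℤ-0 : ιℤ (+ 0) ≡ 0F
  ιℤ-0 = refl
  ιℤ-1 : ιℤ (+ 1) ≡ 1F
  ιℤ-1 = refl

  ι-inv : ∀ n → 1 ≤ n → ιℤ (+ n) ⊗ inv n ≡ 1F
  ι-inv (suc n) _ = ℚP.toℚᵘ-injective (begin
    ℚ.toℚᵘ (ιℤ (+ suc n) ⊗ inv (suc n)) ≈⟨ ℚP.toℚᵘ-homo-* (ιℤ (+ suc n)) (inv (suc n)) ⟩
    ℚ.toℚᵘ (ιℤ (+ suc n)) ℚᵘ.* ℚ.toℚᵘ (inv (suc n)) ≈⟨ ℚᵘP.*-cong (ℚP.toℚᵘ-fromℚᵘ (mkℚᵘ (+ suc n) 0)) (ℚP.toℚᵘ-fromℚᵘ (mkℚᵘ (+ 1) n)) ⟩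
    mkℚᵘ (+ suc n) 0 ℚᵘ.* mkℚᵘ (+ 1) n ≈⟨ *≡* (trans (cong (ℤ._* + 1) (ℤP.*-identityʳ (+ suc n))) (trans (ℤP.*-identityʳ (+ suc n)) (trans (cong (λ z → + suc z) (sym (+-identityʳ n))) (sym (ℤP.*-identityˡ _))))) ⟩
    ℚᵘ.1ℚᵘ ∎)
    where
    open ℚᵘP.≃-Reasoning

  ≼-refl : ∀ {a} → a ≼ a
  ≼-refl = ℚP.≤-refl
  ≼-trans : ∀ {a b c} → a ≼ b → b ≼ c → a ≼ c
  ≼-trans = ℚP.≤-trans
  ≼-total : ∀ a b → a ≼ b ⊎ b ≼ a
  ≼-total = ℚP.≤-total
  ⊕-mono : ∀ {a b c d} → a ≼ b → c ≼ d → a ⊕ c ≼ b ⊕ d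
  ⊕-mono = ℚP.+-mono-≤
  ⊗-monoˡ : ∀ {a b c} → 0F ≼ c → a ≼ b → c ⊗ a ≼ c ⊗ b
  ⊗-monoˡ {c = c} p = ℚP.*-monoˡ-≤-nonNeg c {{ℚ.nonNegative p}}

  ιℤ-mono : ∀ {i j} → i ℤ.≤ j → ιℤ i ≼ ιℤ j
  ιℤ-mono {i} {j} p = ℚP.toℚᵘ-cancel-≤ (ℚᵘP.≤-respˡ-≃ (ℚᵘP.≃-sym (ℚP.toℚᵘ-fromℚᵘ (mkℚᵘ i 0)))
      (ℚᵘP.≤-respʳ-≃ (ℚᵘP.≃-sym (ℚP.toℚᵘ-fromℚᵘ (mkℚᵘ j 0))) (ℚᵘ.*≤* (ℤP.*-monoʳ-≤-nonNeg (+ 1) p))))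

  ιℤ-cancel : ∀ {i j} → ιℤ i ≼ ιℤ j → i ℤ.≤ j
  ιℤ-cancel {i} {j} p with ℚᵘP.≤-respˡ-≃ (ℚP.toℚᵘ-fromℚᵘ (mkℚᵘ i 0)) (ℚᵘP.≤-respʳ-≃ (ℚP.toℚᵘ-fromℚᵘ (mkℚᵘ j 0)) (ℚP.toℚᵘ-mono-≤ p))
  ... | ℚᵘ.*≤* q = ℤP.*-cancelʳ-≤-pos i j (+ 1) q

  0≼inv : ∀ n → 0F ≼ inv n
  0≼inv zero = ℚP.≤-refl
  0≼inv (suc n) = ℚP.toℚᵘ-cancel-≤ (ℚᵘP.≤-respʳ-≃ (ℚᵘP.≃-sym (ℚP.toℚᵘ-fromℚᵘ (mkℚᵘ (+ 1) n))) (ℚᵘ.*≤* (ℤ.+≤+ z≤n)))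

F-ring : CommutativeRing _ _
F-ring = record { isCommutativeRing = F-isCommutativeRing }

F-acr : AlmostCommutativeRing _ _
F-acr = fromCommutativeRing F-ring

ℤ-raw : RawRing _ _
ℤ-raw = record { Carrier = ℤ ; _≈_ = _≡_ ; _+_ = ℤ._+_ ; _*_ = ℤ._*_ ; -_ = ℤ.-_ ; 0# = + 0 ; 1# = + 1 }

ιℤ-morphism : ℤ-raw -Raw-AlmostCommutative⟶ F-acr
ιℤ-morphism = record { ⟦_⟧ = ιℤ ; +-homo = ιℤ-+ ; *-homo = ιℤ-* ; -‿homo = ιℤ-neg ; 0-homo = ιℤ-0 ; 1-homo = ιℤ-1 }

module FS = Algebra.Solver.Ring ℤ-raw F-acr ιℤ-morphism (λ i j → Data.Maybe.map (cong ιℤ) (dec⇒maybe (i ℤ.≟ j)))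
open FS using (solve; _:=_; _:+_; _:*_; :-_; con; _:-_)

_⊝_ : F → F → F
a ⊝ b = a ⊕ ⊖ b

open CommutativeRing F-ring public using () renaming
  (+-comm to ⊕-comm; +-assoc to ⊕-assoc; *-comm to ⊗-comm; *-assoc to ⊗-assoc; +-identityʳ to ⊕-idʳ; +-identityˡ to ⊕-idˡ;
   *-identityʳ to ⊗-idʳ; *-identityˡ to ⊗-idˡ; zeroˡ to ⊗-zeroˡ; zeroʳ to ⊗-zeroʳ; distribˡ to ⊗-distribˡ; distribʳ to ⊗-distribʳ)

ι : ℕ → F
ι n = ιℤ (+ n)

≼-reflexive : ∀ {a b} → a ≡ b → a ≼ b
≼-reflexive refl = ≼-refl

0≼1 : 0F ≼ 1F
0≼1 = subst (_≼ 1F) ιℤ-0 (subst (ιℤ (+ 0) ≼_) ιℤ-1 (ιℤ-mono (ℤ.+≤+ z≤n)))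

0≼ι : ∀ n → 0F ≼ ι n
0≼ι n = subst (_≼ ι n) ιℤ-0 (ιℤ-mono (ℤ.+≤+ z≤n))

ι-mono : ∀ {m n} → m ≤ n → ι m ≼ ι n
ι-mono p = ιℤ-mono (ℤ.+≤+ p)

ι-cancel : ∀ {m n} → ι m ≼ ι n → m ≤ n
ι-cancel p = ℤP.drop‿+≤+ (ιℤ-cancel p)

ι-+ : ∀ m n → ι (m + n) ≡ ι m ⊕ ι n
ι-+ m n = trans (cong ιℤ (ℤP.pos-+ m n)) (ιℤ-+ (+ m) (+ n))

ι-* : ∀ m n → ι (m * n) ≡ ι m ⊗ ι n
ι-* m n = trans (cong ιℤ (ℤP.pos-* m n)) (ιℤ-* (+ m) (+ n))

ι-suc : ∀ n → ι (suc n) ≡ 1F ⊕ ι n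
ι-suc n = trans (ι-+ 1 n) (cong (_⊕ ι n) ιℤ-1)

⊕-nonneg : ∀ {a b} → 0F ≼ a → 0F ≼ b → 0F ≼ a ⊕ b
⊕-nonneg {a} {b} p q = subst (_≼ a ⊕ b) (⊕-idˡ 0F) (⊕-mono p q)

⊗-nonneg : ∀ {a b} → 0F ≼ a → 0F ≼ b → 0F ≼ a ⊗ b
⊗-nonneg {a} {b} p q = subst (_≼ a ⊗ b) (⊗-zeroʳ a) (⊗-monoˡ p q)

≼-add : ∀ {a b r} → 0F ≼ r → b ≡ a ⊕ r → a ≼ b
≼-add {a} {r = r} p refl = subst (_≼ a ⊕ r) (⊕-idʳ a) (⊕-mono ≼-refl p)

≼-diff : ∀ {a b} → a ≼ b → 0F ≼ b ⊝ a
≼-diff {a} {b} p = subst (_≼ b ⊝ a) (solve 1 (λ a → a :- a := con (+ 0)) refl a ⟨≡⟩ ιℤ-0) (⊕-mono p ≼-refl)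
  where _⟨≡⟩_ : ∀ {x y z : F} → x ≡ y → y ≡ z → x ≡ z
        _⟨≡⟩_ = trans

⊗-monoʳ : ∀ {a b c} → 0F ≼ c → a ≼ b → a ⊗ c ≼ b ⊗ c
⊗-monoʳ {a} {b} {c} p q = subst (_≼ b ⊗ c) (⊗-comm c a) (subst (c ⊗ a ≼_) (⊗-comm c b) (⊗-monoˡ p q))

⊗-mono : ∀ {a b c d} → 0F ≼ b → 0F ≼ c → a ≼ b → c ≼ d → a ⊗ c ≼ b ⊗ d
⊗-mono pb pc ab cd = ≼-trans (⊗-monoʳ pc ab) (⊗-monoˡ pb cd)

sq-nonneg : ∀ a → 0F ≼ a ⊗ a
sq-nonneg a with ≼-total 0F a
... | inj₁ p = ⊗-nonneg p p
... | inj₂ p = subst (0F ≼_) (solve 1 (λ a → (:- a) :* (:- a) := a :* a) refl a) (⊗-nonneg q q)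
  where q : 0F ≼ ⊖ a
        q = subst (0F ≼_) (⊕-idˡ (⊖ a)) (≼-diff p)

inv-ι : ∀ n → 1 ≤ n → inv n ⊗ ι n ≡ 1F
inv-ι n p = trans (⊗-comm _ _) (ι-inv n p)

inv-* : ∀ m n → 1 ≤ m → 1 ≤ n → inv (m * n) ≡ inv m ⊗ inv n
inv-* m n p q = begin
  inv (m * n) ≡⟨ sym (⊗-idʳ _) ⟩
  inv (m * n) ⊗ 1F ≡⟨ cong (inv (m * n) ⊗_) (sym (trans (cong₂ _⊗_ (ι-inv m p) (ι-inv n q)) (⊗-idʳ 1F))) ⟩
  inv (m * n) ⊗ ((ι m ⊗ inv m) ⊗ (ι n ⊗ inv n)) ≡⟨ solve 5 (λ x a b c d → x :* ((a :* b) :* (c :* d)) := (x :* (a :* c)) :* (b :* d)) refl _ _ _ _ _ ⟩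
  (inv (m * n) ⊗ (ι m ⊗ ι n)) ⊗ (inv m ⊗ inv n) ≡⟨ cong (λ z → (inv (m * n) ⊗ z) ⊗ (inv m ⊗ inv n)) (sym (ι-* m n)) ⟩
  (inv (m * n) ⊗ ι (m * n)) ⊗ (inv m ⊗ inv n) ≡⟨ cong (_⊗ (inv m ⊗ inv n)) (inv-ι (m * n) (*-mono-≤ p q)) ⟩
  1F ⊗ (inv m ⊗ inv n) ≡⟨ ⊗-idˡ _ ⟩
  inv m ⊗ inv n ∎
  where
  open ≡-Reasoning

inv-mono : ∀ {m n} → 1 ≤ m → m ≤ n → inv n ≼ inv m
inv-mono {m} {n} p q = subst₂ _≼_ e₁ e₂ (⊗-monoˡ (⊗-nonneg (0≼inv m) (0≼inv n)) (ι-mono q))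
  where
  e₁ : inv m ⊗ inv n ⊗ ι m ≡ inv n
  e₁ = trans (solve 3 (λ a b c → a :* b :* c := b :* (a :* c)) refl _ _ _) (trans (cong (inv n ⊗_) (inv-ι m p)) (⊗-idʳ _))
  e₂ : inv m ⊗ inv n ⊗ ι n ≡ inv m
  e₂ = trans (⊗-assoc _ _ _) (trans (cong (inv m ⊗_) (inv-ι n (≤-trans p q))) (⊗-idʳ _))

ι⊗inv≼ : ∀ K a b → 1 ≤ K → K * a ≤ b → 1 ≤ b → ι a ⊗ inv b ≼ inv K
ι⊗inv≼ K a b K1 h b1 = subst₂ _≼_ e₁ e₂ (⊗-monoˡ (⊗-nonneg (0≼inv K) (0≼inv b)) (ι-mono h))
  where
  e₁ : inv K ⊗ inv b ⊗ ι (K * a) ≡ ι a ⊗ inv b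
  e₁ = trans (cong (inv K ⊗ inv b ⊗_) (ι-* K a)) (trans (solve 4 (λ i j k a → i :* j :* (k :* a) := (i :* k) :* (a :* j)) refl _ _ _ _)
        (trans (cong (_⊗ (ι a ⊗ inv b)) (inv-ι K K1)) (⊗-idˡ _)))
  e₂ : inv K ⊗ inv b ⊗ ι b ≡ inv K
  e₂ = trans (⊗-assoc _ _ _) (trans (cong (inv K ⊗_) (inv-ι b b1)) (⊗-idʳ _))

inv≼1 : ∀ K → 1 ≤ K → inv K ≼ 1F
inv≼1 K K1 = subst (inv K ≼_) (trans (sym (⊗-idˡ _)) (trans (cong (_⊗ inv 1) (sym ιℤ-1)) (ι-inv 1 ≤-refl))) (inv-mono ≤-refl K1)

ι⊗inv* : ∀ m n → 1 ≤ m → 1 ≤ n → ι m ⊗ inv (m * n) ≡ inv n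
ι⊗inv* m n p q = trans (cong (ι m ⊗_) (inv-* m n p q)) (trans (sym (⊗-assoc _ _ _)) (trans (cong (_⊗ inv n) (ι-inv m p)) (⊗-idˡ _)))

infixl 6 _⊹_
infixl 7 _⋆_
infix 8 ~_

-- Identities in ℕ and ℤ are checked in F, where normalisation is cheap because the operations do not unfold.
data Expr (n : ℕ) : Set where
  var : Fin n → Expr n
  lit : ℤ → Expr n
  _⊹_ _⋆_ : Expr n → Expr n → Expr n
  ~_ : Expr n → Expr n

⟨_⟩ : ∀ {n} → ℕ → Expr n
⟨ k ⟩ = lit (+ k)

⟦_⟧ℤ : ∀ {n} → Expr n → Vec ℤ n → ℤ
⟦ var i ⟧ℤ ρ = V.lookup ρ i
⟦ lit c ⟧ℤ ρ = c
⟦ p ⊹ q ⟧ℤ ρ = ⟦ p ⟧ℤ ρ ℤ.+ ⟦ q ⟧ℤ ρ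
⟦ p ⋆ q ⟧ℤ ρ = ⟦ p ⟧ℤ ρ ℤ.* ⟦ q ⟧ℤ ρ
⟦ ~ p ⟧ℤ ρ = ℤ.- ⟦ p ⟧ℤ ρ

-- only meaningful on positive expressions
⟦_⟧ℕ : ∀ {n} → Expr n → Vec ℕ n → ℕ
⟦ var i ⟧ℕ ρ = V.lookup ρ i
⟦ lit c ⟧ℕ ρ = ℤ.∣ c ∣
⟦ p ⊹ q ⟧ℕ ρ = ⟦ p ⟧ℕ ρ + ⟦ q ⟧ℕ ρ
⟦ p ⋆ q ⟧ℕ ρ = ⟦ p ⟧ℕ ρ * ⟦ q ⟧ℕ ρ
⟦ ~ p ⟧ℕ ρ = 0

positive : ∀ {n} → Expr n → Bool
positive (var i) = true
positive (lit (+ _)) = true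
positive (lit -[1+ _ ]) = false
positive (p ⊹ q) = positive p ∧ positive q
positive (p ⋆ q) = positive p ∧ positive q
positive (~ p) = false

poly : ∀ {n} → Expr n → FS.Polynomial n
poly (var i) = FS.var i
poly (lit c) = FS.con c
poly (p ⊹ q) = poly p FS.:+ poly q
poly (p ⋆ q) = poly p FS.:* poly q
poly (~ p) = FS.:- poly p

poly-ℤ : ∀ {n} (e : Expr n) ρ → FS.⟦ poly e ⟧ (V.map ιℤ ρ) ≡ ιℤ (⟦ e ⟧ℤ ρ)
poly-ℤ (var i) ρ = lookup-map i ιℤ ρ
poly-ℤ (lit c) ρ = refl
poly-ℤ (p ⊹ q) ρ = trans (cong₂ _⊕_ (poly-ℤ p ρ) (poly-ℤ q ρ)) (sym (ιℤ-+ _ _))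
poly-ℤ (p ⋆ q) ρ = trans (cong₂ _⊗_ (poly-ℤ p ρ) (poly-ℤ q ρ)) (sym (ιℤ-* _ _))
poly-ℤ (~ p) ρ = trans (cong ⊖_ (poly-ℤ p ρ)) (sym (ιℤ-neg _))

poly-ℕ : ∀ {n} (e : Expr n) ρ → Bool.T (positive e) → FS.⟦ poly e ⟧ (V.map ι ρ) ≡ ι (⟦ e ⟧ℕ ρ)
poly-ℕ (var i) ρ h = lookup-map i ι ρ
poly-ℕ (lit (+ _)) ρ h = refl
poly-ℕ (p ⊹ q) ρ h = trans (cong₂ _⊕_ (poly-ℕ p ρ (proj₁ (Equivalence.to T-∧ h))) (poly-ℕ q ρ (proj₂ (Equivalence.to (T-∧ {positive p}) h)))) (sym (ι-+ _ _))
poly-ℕ (p ⋆ q) ρ h = trans (cong₂ _⊗_ (poly-ℕ p ρ (proj₁ (Equivalence.to T-∧ h))) (poly-ℕ q ρ (proj₂ (Equivalence.to (T-∧ {positive p}) h)))) (sym (ι-* _ _))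

ιℤ-injective : ∀ {i j} → ιℤ i ≡ ιℤ j → i ≡ j
ιℤ-injective e = ℤP.≤-antisym (ιℤ-cancel (≼-reflexive e)) (ιℤ-cancel (≼-reflexive (sym e)))

ι-injective : ∀ {m n} → ι m ≡ ι n → m ≡ n
ι-injective e = ℤP.+-injective (ιℤ-injective e)

abstract
  ringℤ : ∀ {n} (ρ : Vec ℤ n) (p q : Expr n) → FS.⟦ poly p ⟧↓ (V.map ιℤ ρ) ≡ FS.⟦ poly q ⟧↓ (V.map ιℤ ρ) → ⟦ p ⟧ℤ ρ ≡ ⟦ q ⟧ℤ ρ
  ringℤ ρ p q e = ιℤ-injective (trans (sym (poly-ℤ p ρ)) (trans (FS.prove (V.map ιℤ ρ) (poly p) (poly q) e) (poly-ℤ q ρ)))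

  ringℕ : ∀ {n} (ρ : Vec ℕ n) (p q : Expr n) {_ : Bool.T (positive p)} {_ : Bool.T (positive q)} → FS.⟦ poly p ⟧↓ (V.map ι ρ) ≡ FS.⟦ poly q ⟧↓ (V.map ι ρ) → ⟦ p ⟧ℕ ρ ≡ ⟦ q ⟧ℕ ρ
  ringℕ ρ p q {hp} {hq} e = ι-injective (trans (sym (poly-ℕ p ρ hp)) (trans (FS.prove (V.map ι ρ) (poly p) (poly q) e) (poly-ℕ q ρ hq)))

$0 : ∀ {n} → Expr (1 + n)
$0 = var zero
$1 : ∀ {n} → Expr (2 + n)
$1 = var (suc zero)
$2 : ∀ {n} → Expr (3 + n)
$2 = var (suc (suc zero))
$3 : ∀ {n} → Expr (4 + n)
$3 = var (suc (suc (suc zero)))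
$4 : ∀ {n} → Expr (5 + n)
$4 = var (suc (suc (suc (suc zero))))
$5 : ∀ {n} → Expr (6 + n)
$5 = var (suc (suc (suc (suc (suc zero)))))
$6 : ∀ {n} → Expr (7 + n)
$6 = var (suc (suc (suc (suc (suc (suc zero))))))
$7 : ∀ {n} → Expr (8 + n)
$7 = var (suc (suc (suc (suc (suc (suc (suc zero)))))))

-- Averages in a system with a ℤ-action

sumF : ℕ → (ℕ → F) → F
sumF zero g = 0F
sumF (suc n) g = sumF n g ⊕ g n

avg : ℕ → (ℕ → F) → F
avg n g = inv n ⊗ sumF n g

sumF-cong< : ∀ n {g h} → (∀ i → i < n → g i ≡ h i) → sumF n g ≡ sumF n h
sumF-cong< zero p = refl
sumF-cong< (suc n) p = cong₂ _⊕_ (sumF-cong< n (λ i q → p i (m<n⇒m<1+n q))) (p n ≤-refl)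

sumF-cong : ∀ n {g h} → (∀ i → g i ≡ h i) → sumF n g ≡ sumF n h
sumF-cong n p = sumF-cong< n (λ i _ → p i)

sumF-mono : ∀ n {g h} → (∀ i → i < n → g i ≼ h i) → sumF n g ≼ sumF n h
sumF-mono zero p = ≼-refl
sumF-mono (suc n) p = ⊕-mono (sumF-mono n (λ i q → p i (m<n⇒m<1+n q))) (p n ≤-refl)

sumF-add : ∀ n g h → sumF n (λ i → g i ⊕ h i) ≡ sumF n g ⊕ sumF n h
sumF-add zero g h = sym (⊕-idʳ 0F)
sumF-add (suc n) g h = trans (cong (_⊕ (g n ⊕ h n)) (sumF-add n g h))
  (solve 4 (λ a b c d → a :+ b :+ (c :+ d) := a :+ c :+ (b :+ d)) refl _ _ _ _)

sumF-scale : ∀ n c g → sumF n (λ i → c ⊗ g i) ≡ c ⊗ sumF n g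
sumF-scale zero c g = sym (⊗-zeroʳ c)
sumF-scale (suc n) c g = trans (cong (_⊕ c ⊗ g n) (sumF-scale n c g)) (sym (⊗-distribˡ c _ _))

sumF-const : ∀ n c → sumF n (λ _ → c) ≡ ι n ⊗ c
sumF-const zero c = sym (trans (cong (_⊗ c) ιℤ-0) (⊗-zeroˡ c))
sumF-const (suc n) c = trans (cong (_⊕ c) (sumF-const n c))
  (trans (solve 2 (λ m c → m :* c :+ c := (con (+ 1) :+ m) :* c) refl (ι n) c)
  (cong (_⊗ c) (trans (cong (_⊕ ι n) ιℤ-1) (sym (ι-suc n)))))

sumF-nonneg : ∀ n {g} → (∀ i → 0F ≼ g i) → 0F ≼ sumF n g
sumF-nonneg zero p = ≼-refl
sumF-nonneg (suc n) p = ⊕-nonneg (sumF-nonneg n p) (p n)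

sumF-swap : ∀ m n (g : ℕ → ℕ → F) → sumF m (λ i → sumF n (g i)) ≡ sumF n (λ j → sumF m (λ i → g i j))
sumF-swap zero n g = sym (trans (sumF-const n 0F) (⊗-zeroʳ _))
sumF-swap (suc m) n g = trans (cong (_⊕ sumF n (g m)) (sumF-swap m n g)) (sym (sumF-add n _ _))

sumF-split : ∀ a b g → sumF (a + b) g ≡ sumF a g ⊕ sumF b (λ i → g (a + i))
sumF-split a zero g = trans (cong (λ z → sumF z g) (+-identityʳ a)) (sym (⊕-idʳ _))
sumF-split a (suc b) g = trans (cong (λ z → sumF z g) (+-suc a b))
  (trans (cong (_⊕ g (a + b)) (sumF-split a b g)) (⊕-assoc _ _ _))

avg-cong : ∀ n {g h} → (∀ i → g i ≡ h i) → avg n g ≡ avg n h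
avg-cong n p = cong (inv n ⊗_) (sumF-cong n p)

avg-mono : ∀ n {g h} → (∀ i → i < n → g i ≼ h i) → avg n g ≼ avg n h
avg-mono n p = ⊗-monoˡ (0≼inv n) (sumF-mono n p)

avg-nonneg : ∀ n {g} → (∀ i → 0F ≼ g i) → 0F ≼ avg n g
avg-nonneg n p = ⊗-nonneg (0≼inv n) (sumF-nonneg n p)

avg-add : ∀ n g h → avg n (λ i → g i ⊕ h i) ≡ avg n g ⊕ avg n h
avg-add n g h = trans (cong (inv n ⊗_) (sumF-add n g h)) (⊗-distribˡ _ _ _)

avg-scale : ∀ n c g → avg n (λ i → c ⊗ g i) ≡ c ⊗ avg n g
avg-scale n c g = trans (cong (inv n ⊗_) (sumF-scale n c g)) (solve 3 (λ a b c → a :* (b :* c) := b :* (a :* c)) refl _ _ _)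

avg-const : ∀ n c → 1 ≤ n → avg n (λ _ → c) ≡ c
avg-const n c p = trans (cong (inv n ⊗_) (sumF-const n c)) (trans (sym (⊗-assoc _ _ _)) (trans (cong (_⊗ c) (inv-ι n p)) (⊗-idˡ c)))

avg-≼ : ∀ n {g c} → 1 ≤ n → (∀ i → i < n → g i ≼ c) → avg n g ≼ c
avg-≼ n {c = c} p q = ≼-trans (avg-mono n q) (≼-reflexive (avg-const n c p))

≼-avg : ∀ n {g c} → 1 ≤ n → (∀ i → i < n → c ≼ g i) → c ≼ avg n g
≼-avg n {c = c} p q = ≼-trans (≼-reflexive (sym (avg-const n c p))) (avg-mono n q)

avg-swap : ∀ m n (g : ℕ → ℕ → F) → avg m (λ i → avg n (g i)) ≡ avg n (λ j → avg m (λ i → g i j))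
avg-swap m n g = trans (cong (inv m ⊗_) (sumF-scale m (inv n) _))
  (trans (cong (λ z → inv m ⊗ (inv n ⊗ z)) (sumF-swap m n g))
  (trans (solve 3 (λ a b c → a :* (b :* c) := b :* (a :* c)) refl _ _ _)
  (cong (inv n ⊗_) (sym (sumF-scale n (inv m) _)))))

avg-neg : ∀ n g → avg n (λ i → ⊖ g i) ≡ ⊖ avg n g
avg-neg n g = trans (avg-cong n (λ i → neg1 (g i))) (trans (avg-scale n (⊖ 1F) g) (sym (neg1 _)))
  where neg1 : ∀ a → ⊖ a ≡ ⊖ 1F ⊗ a
        neg1 a = trans (solve 1 (λ a → :- a := :- con (+ 1) :* a) refl a) (cong (λ z → ⊖ z ⊗ a) ιℤ-1)

avg-sub : ∀ n g h → avg n (λ i → g i ⊝ h i) ≡ avg n g ⊝ avg n h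
avg-sub n g h = trans (avg-add n g _) (cong (avg n g ⊕_) (avg-neg n h))

two-ab : ∀ a b → ι 2 ⊗ (a ⊗ b) ≼ a ⊗ a ⊕ b ⊗ b
two-ab a b = ≼-add (sq-nonneg (a ⊝ b))
  (solve 2 (λ a b → a :* a :+ b :* b := con (+ 2) :* (a :* b) :+ (a :- b) :* (a :- b)) refl a b)

sumF-sq : ∀ n g → sumF n g ⊗ sumF n g ≼ ι n ⊗ sumF n (λ i → g i ⊗ g i)
sumF-sq zero g = ≼-reflexive (trans (⊗-zeroˡ _) (sym (⊗-zeroʳ _)))
sumF-sq (suc n) g = subst₂ _≼_ e₁ e₂ (⊕-mono (⊕-mono (sumF-sq n g) cross) ≼-refl)
  where
  x s Q : F
  x = g n
  s = sumF n g
  Q = sumF n (λ i → g i ⊗ g i)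
  cross : ι 2 ⊗ (s ⊗ x) ≼ Q ⊕ ι n ⊗ (x ⊗ x)
  cross = subst₂ _≼_ (trans (sumF-cong n (λ i → solve 3 (λ t a b → t :* (a :* b) := (t :* b) :* a) refl (ι 2) (g i) x)) (trans (sumF-scale n (ι 2 ⊗ x) g) (solve 3 (λ t a b → (t :* b) :* a := t :* (a :* b)) refl (ι 2) s x)))
     (trans (sumF-add n _ _) (cong (Q ⊕_) (sumF-const n _))) (sumF-mono n (λ i _ → two-ab (g i) x))
  e₁ : s ⊗ s ⊕ ι 2 ⊗ (s ⊗ x) ⊕ x ⊗ x ≡ (s ⊕ x) ⊗ (s ⊕ x)
  e₁ = solve 2 (λ s x → s :* s :+ con (+ 2) :* (s :* x) :+ x :* x := (s :+ x) :* (s :+ x)) refl s x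
  e₂ : ι n ⊗ Q ⊕ (Q ⊕ ι n ⊗ (x ⊗ x)) ⊕ x ⊗ x ≡ ι (suc n) ⊗ (Q ⊕ x ⊗ x)
  e₂ = trans (solve 3 (λ m Q x → m :* Q :+ (Q :+ m :* (x :* x)) :+ x :* x := (con (+ 1) :+ m) :* (Q :+ x :* x)) refl (ι n) Q x)
    (cong (_⊗ (Q ⊕ x ⊗ x)) (trans (cong (_⊕ ι n) ιℤ-1) (sym (ι-suc n))))

avg-sq : ∀ n g → 1 ≤ n → avg n g ⊗ avg n g ≼ avg n (λ i → g i ⊗ g i)
avg-sq n g p = subst₂ _≼_ (solve 2 (λ a b → a :* a :* (b :* b) := (a :* b) :* (a :* b)) refl (inv n) (sumF n g))
  (trans (solve 3 (λ a n b → a :* a :* (n :* b) := (a :* n) :* (a :* b)) refl (inv n) (ι n) (sumF n (λ i → g i ⊗ g i))) (trans (cong (_⊗ avg n _) (inv-ι n p)) (⊗-idˡ _)))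
  (⊗-monoˡ (sq-nonneg (inv n)) (sumF-sq n g))

-- Meant for a row of a Gram matrix: the diagonal entry has only the trivial bound `b`, while all
-- other entries share the small bound `c`.
sumF-except : ∀ m j {g b c} → 0F ≼ b → 0F ≼ c → g j ≼ b → (∀ i → i < m → i ≢ j → g i ≼ c) → sumF m g ≼ b ⊕ ι m ⊗ c
sumF-except m j {g} {b} {c} pb pc pj pi with m ℕ.≤? j
... | yes m≤j = ≼-trans (sumF-mono m (λ i q → pi i q (λ e → <-irrefl e (ℕP.<-≤-trans q m≤j))))
       (≼-add pb (trans (⊕-comm _ _) (cong (_⊕ b) (sym (sumF-const m c)))))
sumF-except zero j pb pc pj pi | no m≰j = contradiction z≤n m≰j
sumF-except (suc m) j {g} {b} {c} pb pc pj pi | no m≰j with m ℕ.≟ j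
... | yes refl = subst₂ _≼_ refl (⊕-comm _ _) (⊕-mono (≼-trans (≼-trans (sumF-mono m (λ i q → pi i (m<n⇒m<1+n q) (λ e → <-irrefl e q))) (≼-reflexive (sumF-const m c))) (⊗-monoʳ pc (ι-mono (n≤1+n m)))) pj)
... | no m≢j = subst (sumF m g ⊕ g m ≼_) (trans (⊕-assoc _ _ _) (cong (b ⊕_) e)) (⊕-mono (sumF-except m j pb pc pj (λ i q → pi i (m<n⇒m<1+n q))) (pi m ≤-refl m≢j))
  where e : ι m ⊗ c ⊕ c ≡ ι (suc m) ⊗ c
        e = trans (sym (cong (_⊕ c) (sumF-const m c))) (sumF-const (suc m) c)

-- A finite substitute for a measure-preserving action of the integers: a positive functional `S`
-- invariant under `act`. It is not normalised; the value of `S` at 1 plays the part of the total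
-- mass.
record Sys : Set₁ where
  field
    X : Set
    S : (X → F) → F
    S-cong : ∀ {f g} → (∀ x → f x ≡ g x) → S f ≡ S g
    S-add : ∀ f g → S (λ x → f x ⊕ g x) ≡ S f ⊕ S g
    S-scale : ∀ c f → S (λ x → c ⊗ f x) ≡ c ⊗ S f
    S-nonneg : ∀ {f} → (∀ x → 0F ≼ f x) → 0F ≼ S f
    act : ℤ → X → X
    act-0 : ∀ x → act (+ 0) x ≡ x
    act-+ : ∀ a b x → act a (act b x) ≡ act (a ℤ.+ b) x
    S-inv : ∀ a f → S (λ x → f (act a x)) ≡ S f

module Ops (𝕊 : Sys) where
  open Sys 𝕊 using (X; S; S-cong; S-add; S-scale; S-nonneg; act; S-inv)

  V : Set
  V = X → F

  infixl 6 _⊞_ _⊟_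
  _⊞_ _⊟_ : V → V → V
  (f ⊞ g) x = f x ⊕ g x
  (f ⊟ g) x = f x ⊝ g x

  ⟪_,_⟫ : V → V → F
  ⟪ f , g ⟫ = S (λ x → f x ⊗ g x)

  N : V → F
  N f = ⟪ f , f ⟫

  T : ℤ → V → V
  T a f x = f (act a x)

  A : ℕ → (ℕ → V) → V
  A n v x = avg n (λ i → v i x)

  Av : ℕ → (ℕ → ℤ) → V → V
  Av n h f = A n (λ i → T (h i) f)

  step : ℤ → ℕ → ℤ
  step s l = s ℤ.* + l

  M : ℤ → ℕ → V → V
  M s L = Av L (step s)

  S-sub : ∀ f g → S (λ x → f x ⊝ g x) ≡ S f ⊝ S g
  S-sub f g = trans (S-add f (λ x → ⊖ g x)) (cong (S f ⊕_) (trans (S-cong (λ x → neg1 (g x))) (trans (S-scale (⊖ 1F) g) (sym (neg1 (S g))))))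
    where neg1 : ∀ a → ⊖ a ≡ ⊖ 1F ⊗ a
          neg1 a = trans (solve 1 (λ a → :- a := :- con (+ 1) :* a) refl a) (cong (λ z → ⊖ z ⊗ a) ιℤ-1)

  S-zero : S (λ _ → 0F) ≡ 0F
  S-zero = trans (S-cong (λ _ → sym (⊗-zeroˡ 0F))) (trans (S-scale 0F (λ _ → 0F)) (⊗-zeroˡ _))

  S-mono : ∀ {f g} → (∀ x → f x ≼ g x) → S f ≼ S g
  S-mono {f} {g} p = ≼-add (S-nonneg (λ x → ≼-diff (p x))) (trans (solve 2 (λ a b → b := a :+ (b :- a)) refl (S f) (S g)) (cong (S f ⊕_) (sym (S-sub g f))))

  S-sumF : ∀ n (v : ℕ → V) → S (λ x → sumF n (λ i → v i x)) ≡ sumF n (λ i → S (v i))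
  S-sumF zero v = S-zero
  S-sumF (suc n) v = trans (S-add _ _) (cong (_⊕ S (v n)) (S-sumF n v))

  S-avg : ∀ n (v : ℕ → V) → S (A n v) ≡ avg n (λ i → S (v i))
  S-avg n v = trans (S-scale (inv n) _) (cong (inv n ⊗_) (S-sumF n v))

  N-cong : ∀ {f g} → (∀ x → f x ≡ g x) → N f ≡ N g
  N-cong p = S-cong (λ x → cong₂ _⊗_ (p x) (p x))

  N-nonneg : ∀ f → 0F ≼ N f
  N-nonneg f = S-nonneg (λ x → sq-nonneg (f x))

  N-T : ∀ a f → N (T a f) ≡ N f
  N-T a f = S-inv a (λ x → f x ⊗ f x)

  N-add : ∀ f g → N (f ⊞ g) ≼ ι 2 ⊗ N f ⊕ ι 2 ⊗ N g
  N-add f g = subst (N (f ⊞ g) ≼_) e (S-mono (λ x → ≼-add (sq-nonneg (f x ⊝ g x))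
     (solve 2 (λ a b → con (+ 2) :* (a :* a) :+ con (+ 2) :* (b :* b) := (a :+ b) :* (a :+ b) :+ (a :- b) :* (a :- b)) refl (f x) (g x))))
    where e : S (λ x → ι 2 ⊗ (f x ⊗ f x) ⊕ ι 2 ⊗ (g x ⊗ g x)) ≡ ι 2 ⊗ N f ⊕ ι 2 ⊗ N g
          e = trans (S-add _ _) (cong₂ _⊕_ (S-scale _ _) (S-scale _ _))

  N-sub : ∀ f g → N (f ⊟ g) ≼ ι 2 ⊗ N f ⊕ ι 2 ⊗ N g
  N-sub f g = subst (λ z → N (f ⊟ g) ≼ ι 2 ⊗ N f ⊕ ι 2 ⊗ z) (S-cong (λ x → solve 1 (λ a → (:- a) :* (:- a) := a :* a) refl (g x))) (N-add f (λ x → ⊖ g x))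

  N-via : ∀ f g → N f ≼ ι 2 ⊗ N g ⊕ ι 2 ⊗ N (f ⊟ g)
  N-via f g = subst (_≼ ι 2 ⊗ N g ⊕ ι 2 ⊗ N (f ⊟ g)) (N-cong (λ x → solve 2 (λ a b → b :+ (a :- b) := a) refl (f x) (g x))) (N-add g (f ⊟ g))

  N-sub-sym : ∀ f g → N (f ⊟ g) ≡ N (g ⊟ f)
  N-sub-sym f g = S-cong (λ x → solve 2 (λ a b → (a :- b) :* (a :- b) := (b :- a) :* (b :- a)) refl (f x) (g x))

  N-scale : ∀ c f → N (λ x → c ⊗ f x) ≡ c ⊗ c ⊗ N f
  N-scale c f = trans (S-cong (λ x → solve 2 (λ c a → c :* a :* (c :* a) := c :* c :* (a :* a)) refl c (f x))) (S-scale _ _)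

  N-A : ∀ n v → 1 ≤ n → N (A n v) ≼ avg n (λ i → N (v i))
  N-A n v p = subst (N (A n v) ≼_) (S-avg n _) (S-mono (λ x → avg-sq n (λ i → v i x) p))

  N-A-≼ : ∀ n v {B} → 1 ≤ n → (∀ i → i < n → N (v i) ≼ B) → N (A n v) ≼ B
  N-A-≼ n v p q = ≼-trans (N-A n v p) (avg-≼ n p q)

  amgm : ∀ K f g → 1 ≤ K → ι 2 ⊗ ⟪ f , g ⟫ ≼ inv K ⊗ N f ⊕ ι K ⊗ N g
  amgm K f g p = subst₂ _≼_ (S-scale _ _) (trans (S-add _ _) (cong₂ _⊕_ (S-scale _ _) (S-scale _ _)))
    (S-mono (λ x → ≼-add (⊗-nonneg (0≼inv K) (sq-nonneg (f x ⊝ ι K ⊗ g x))) (e x)))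
    where
    e : ∀ x → inv K ⊗ (f x ⊗ f x) ⊕ ι K ⊗ (g x ⊗ g x) ≡ ι 2 ⊗ (f x ⊗ g x) ⊕ inv K ⊗ ((f x ⊝ ι K ⊗ g x) ⊗ (f x ⊝ ι K ⊗ g x))
    e x = sym (trans (solve 4 (λ i k a b → con (+ 2) :* (a :* b) :+ i :* ((a :- k :* b) :* (a :- k :* b))
              := i :* (a :* a) :+ (i :* k) :* (k :* (b :* b)) :+ con (+ 2) :* (a :* b) :- con (+ 2) :* ((i :* k) :* (a :* b))) refl (inv K) (ι K) (f x) (g x))
           (trans (cong (λ z → inv K ⊗ (f x ⊗ f x) ⊕ z ⊗ (ι K ⊗ (g x ⊗ g x)) ⊕ ι 2 ⊗ (f x ⊗ g x) ⊝ ι 2 ⊗ (z ⊗ (f x ⊗ g x))) (trans (inv-ι K p) (sym ιℤ-1)))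
           (solve 4 (λ i k a b → i :* (a :* a) :+ con (+ 1) :* (k :* (b :* b)) :+ con (+ 2) :* (a :* b) :- con (+ 2) :* (con (+ 1) :* (a :* b)) := i :* (a :* a) :+ k :* (b :* b)) refl (inv K) (ι K) (f x) (g x))))

  -- Two windows of length `Z` at distance `h` differ only near their ends. The difference is
  -- `h / Z` times a difference of two averages of length `h`, which makes the bound quadratic in
  -- `h / Z`.
  A-shift : ∀ Z h (v : ℕ → V) {B} → 0F ≼ B → (∀ i → N (v i) ≼ B) →
    N (A Z v ⊟ A Z (λ i → v (h + i))) ≼ ι 4 ⊗ ((ι h ⊗ inv Z) ⊗ (ι h ⊗ inv Z)) ⊗ B
  A-shift Z zero v {B} pB q = ≼-trans (≼-reflexive (trans (N-cong {g = λ _ → 0F} (λ x → trans (solve 1 (λ a → a :- a := con (+ 0)) refl (A Z v x)) ιℤ-0)) (trans (S-cong (λ _ → ⊗-zeroˡ 0F)) S-zero)))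
      (⊗-nonneg (⊗-nonneg (0≼ι 4) (sq-nonneg _)) pB)
  A-shift Z (suc h′) v {B} pB q = ≼-trans (≼-reflexive (trans (N-cong e) (N-scale (ι h ⊗ inv Z) _)))
      (≼-trans (⊗-monoˡ (sq-nonneg _) (≼-trans (N-sub _ _) (⊕-mono (⊗-monoˡ (0≼ι 2) (N-A-≼ h v (s≤s z≤n) (λ i _ → q i)))
        (⊗-monoˡ (0≼ι 2) (N-A-≼ h (λ i → v (Z + i)) (s≤s z≤n) (λ i _ → q _))))))
      (≼-reflexive (solve 2 (λ c b → c :* (con (+ 2) :* b :+ con (+ 2) :* b) := con (+ 4) :* c :* b) refl _ B)))
    where
    h = suc h′
    e : ∀ x → (A Z v ⊟ A Z (λ i → v (h + i))) x ≡ ι h ⊗ inv Z ⊗ (A h v x ⊝ A h (λ i → v (Z + i)) x)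
    e x = begin
      inv Z ⊗ a ⊝ inv Z ⊗ b ≡⟨ solve 3 (λ i a b → i :* a :- i :* b := i :* (a :- b)) refl (inv Z) a b ⟩
      inv Z ⊗ (a ⊝ b) ≡⟨ cong (inv Z ⊗_) tel ⟩
      inv Z ⊗ (c ⊝ d) ≡⟨ sym (trans (cong (λ z → z ⊗ (inv Z ⊗ (c ⊝ d))) (ι-inv h (s≤s z≤n))) (⊗-idˡ _)) ⟩
      ι h ⊗ inv h ⊗ (inv Z ⊗ (c ⊝ d)) ≡⟨ solve 5 (λ h ih i c d → h :* ih :* (i :* (c :- d)) := h :* i :* (ih :* c :- ih :* d)) refl (ι h) (inv h) (inv Z) c d ⟩
      ι h ⊗ inv Z ⊗ (inv h ⊗ c ⊝ inv h ⊗ d) ∎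
      where
      open ≡-Reasoning
      g : ℕ → F
      g i = v i x
      a = sumF Z g
      b = sumF Z (λ i → g (h + i))
      c = sumF h g
      d = sumF h (λ i → g (Z + i))
      -- Both sides are the sum of length `Z + h`, split after `Z` and after `h`.
      same : a ⊕ d ≡ c ⊕ b
      same = trans (sym (sumF-split Z h g)) (trans (cong (λ z → sumF z g) (+-comm Z h)) (sumF-split h Z g))
      tel : a ⊝ b ≡ c ⊝ d
      tel = trans (solve 3 (λ a b d → a :- b := (a :+ d) :- b :- d) refl a b d) (trans (cong (λ z → z ⊝ b ⊝ d) same) (solve 3 (λ b c d → (c :+ b) :- b :- d := c :- d) refl b c d))

≼-half : ∀ {a b} → 0F ≼ b → ι 2 ⊗ a ≼ b → a ≼ b
≼-half {a} {b} p q with ≼-total a 0F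
... | inj₁ r = ≼-trans r p
... | inj₂ r = ≼-trans (≼-add r (solve 1 (λ a → con (+ 2) :* a := a :+ a) refl a)) q

0≼ιinv : ∀ m n → 0F ≼ ι m ⊗ inv n
0≼ιinv m n = ⊗-nonneg (0≼ι m) (0≼inv n)

module Absorption (𝕊 : Sys) where
  open Sys 𝕊 using (S-cong; act; act-0; act-+; S-inv)
  open Ops 𝕊 using (V; _⊞_; _⊟_; ⟪_,_⟫; N; T; A; Av; step; M; S-avg; N-cong; N-nonneg; N-T; N-add; N-via; N-sub-sym; N-A-≼; A-shift)

  -- Stands for a composite of averages of translates. Linearity, contraction and commuting with
  -- every translation are all that is needed to carry an estimate from one factor to the whole
  -- composite.
  record Op : Set where
    field
      ap : V → V
      ap-cong : ∀ {f g} → (∀ x → f x ≡ g x) → ∀ x → ap f x ≡ ap g x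
      ap-add : ∀ f g x → ap (f ⊞ g) x ≡ ap f x ⊕ ap g x
      ap-scale : ∀ c f x → ap (λ y → c ⊗ f y) x ≡ c ⊗ ap f x
      ap-T : ∀ a f x → ap (T a f) x ≡ T a (ap f) x
      ap-N : ∀ f → N (ap f) ≼ N f
  open Op public

  Op-id : Op
  Op-id = record { ap = λ f → f ; ap-cong = λ p → p ; ap-add = λ _ _ _ → refl ; ap-scale = λ _ _ _ → refl ; ap-T = λ _ _ _ → refl ; ap-N = λ _ → ≼-refl }

  Op-comp : Op → Op → Op
  Op-comp P Q = record
    { ap = λ f → ap P (ap Q f)
    ; ap-cong = λ p → ap-cong P (ap-cong Q p)
    ; ap-add = λ f g x → trans (ap-cong P (ap-add Q f g) x) (ap-add P _ _ x)
    ; ap-scale = λ c f x → trans (ap-cong P (ap-scale Q c f) x) (ap-scale P c _ x)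
    ; ap-T = λ a f x → trans (ap-cong P (ap-T Q a f) x) (ap-T P a _ x)
    ; ap-N = λ f → ≼-trans (ap-N P _) (ap-N Q f) }

  act-comm : ∀ a b x → act a (act b x) ≡ act b (act a x)
  act-comm a b x = trans (act-+ a b x) (trans (cong (λ z → act z x) (ℤP.+-comm a b)) (sym (act-+ b a x)))

  Op-Av : ∀ n → 1 ≤ n → (ℕ → ℤ) → Op
  Op-Av n p h = record
    { ap = Av n h
    ; ap-cong = λ q x → avg-cong n (λ i → q _)
    ; ap-add = λ f g x → avg-add n _ _
    ; ap-scale = λ c f x → avg-scale n c _
    ; ap-T = λ a f x → avg-cong n (λ i → cong f (act-comm a (h i) x))
    ; ap-N = λ f → N-A-≼ n _ p (λ i _ → ≼-reflexive (N-T (h i) f)) }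

  Op-M : ℤ → ∀ L → 1 ≤ L → Op
  Op-M s L p = Op-Av L p (step s)

  ap-neg : ∀ O f x → ap O (λ y → ⊖ f y) x ≡ ⊖ ap O f x
  ap-neg O f x = trans (ap-cong O (λ y → neg1 (f y)) x) (trans (ap-scale O (⊖ 1F) f x) (sym (neg1 _)))
    where neg1 : ∀ a → ⊖ a ≡ ⊖ 1F ⊗ a
          neg1 a = trans (solve 1 (λ a → :- a := :- con (+ 1) :* a) refl a) (cong (λ z → ⊖ z ⊗ a) ιℤ-1)

  ap-sub : ∀ O f g x → ap O (f ⊟ g) x ≡ ap O f x ⊝ ap O g x
  ap-sub O f g x = trans (ap-add O f (λ y → ⊖ g y) x) (cong (ap O f x ⊕_) (ap-neg O g x))

  ap-sumF : ∀ O n (v : ℕ → V) x → ap O (λ y → sumF n (λ i → v i y)) x ≡ sumF n (λ i → ap O (v i) x)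
  ap-sumF O zero v x = trans (ap-cong O (λ y → sym (⊗-zeroˡ 0F)) x) (trans (ap-scale O 0F (λ _ → 0F) x) (⊗-zeroˡ _))
  ap-sumF O (suc n) v x = trans (ap-add O _ _ x) (cong (_⊕ ap O (v n) x) (ap-sumF O n v x))

  ap-A : ∀ O n (v : ℕ → V) x → ap O (A n v) x ≡ A n (λ i → ap O (v i)) x
  ap-A O n v x = trans (ap-scale O (inv n) _ x) (cong (inv n ⊗_) (ap-sumF O n v x))

  ap-Av : ∀ O n h f x → ap O (Av n h f) x ≡ Av n h (ap O f) x
  ap-Av O n h f x = trans (ap-A O n _ x) (avg-cong n (λ i → ap-T O (h i) f x))

  -- Near invariance, measured after applying `O`: the operator absorbs the translation by `a` at
  -- cost `ε`.
  Abs : Op → ℤ → F → Set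
  Abs O a ε = ∀ f → N (ap O (f ⊟ T a f)) ≼ ε ⊗ N f

  abs-post : ∀ P O {a ε} → Abs O a ε → Abs (Op-comp P O) a ε
  abs-post P O p f = ≼-trans (ap-N P _) (p f)

  abs-pre : ∀ O P {a ε} → 0F ≼ ε → Abs O a ε → Abs (Op-comp O P) a ε
  abs-pre O P {a} {ε} pε p f = ≼-trans (≼-reflexive (N-cong (ap-cong O (λ x → trans (ap-sub P f (T a f) x) (cong (ap P f x ⊝_) (ap-T P a f x))))))
     (≼-trans (p (ap P f)) (⊗-monoˡ pε (ap-N P f)))

  -- Comes from f - T^(a+b) f = (f - T^a f) + T^a (f - T^b f), the second bracket being translated
  -- without change of norm.
  abs-+ : ∀ O {a b ε ε′} → Abs O a ε → Abs O b ε′ → Abs O (a ℤ.+ b) (ι 2 ⊗ ε ⊕ ι 2 ⊗ ε′)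
  abs-+ O {a} {b} {ε} {ε′} p q f = ≼-trans (≼-reflexive (N-cong e)) (≼-trans (N-add _ _)
     (≼-trans (⊕-mono (⊗-monoˡ (0≼ι 2) (p f)) (⊗-monoˡ (0≼ι 2) (≼-trans (≼-reflexive (N-T a _)) (q f))))
     (≼-reflexive (solve 3 (λ e e′ n → con (+ 2) :* (e :* n) :+ con (+ 2) :* (e′ :* n) := (con (+ 2) :* e :+ con (+ 2) :* e′) :* n) refl ε ε′ (N f)))))
    where
    e : ∀ x → ap O (f ⊟ T (a ℤ.+ b) f) x ≡ (ap O (f ⊟ T a f) ⊞ T a (ap O (f ⊟ T b f))) x
    e x = trans (ap-cong O {g = (f ⊟ T a f) ⊞ T a (f ⊟ T b f)} (λ y → trans (cong (f y ⊝_) (cong f (trans (cong (λ z → act z y) (ℤP.+-comm a b)) (sym (act-+ b a y)))))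
           (solve 3 (λ u v w → u :- w := u :- v :+ (v :- w)) refl (f y) (f (act a y)) (f (act b (act a y))))) x)
         (trans (ap-add O _ _ x) (cong (ap O (f ⊟ T a f) x ⊕_) (ap-T O a (f ⊟ T b f) x)))

  abs-≼ : ∀ O {a ε ε′} → ε ≼ ε′ → Abs O a ε → Abs O a ε′
  abs-≼ O q p f = ≼-trans (p f) (⊗-monoʳ (N-nonneg f) q)

  abs-avg : ∀ O n h {ε} → 1 ≤ n → (∀ l → l < n → Abs O (h l) ε) → ∀ f → N (ap O (f ⊟ Av n h f)) ≼ ε ⊗ N f
  abs-avg O n h p q f = ≼-trans (≼-reflexive (N-cong (λ x → trans (ap-cong O {g = A n (λ i → f ⊟ T (h i) f)}
       (λ y → trans (cong (_⊝ Av n h f y) (sym (avg-const n (f y) p))) (sym (avg-sub n (λ _ → f y) _))) x) (ap-A O n _ x))))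
     (N-A-≼ n _ p (λ i r → q i r f))

  -- `O` hardly distinguishes `f` from `Av n h f`, because it absorbs every single shift `h l`, and
  -- `O` contracts. Hence a long average is controlled by any average whose shifts it absorbs.
  absorb : ∀ O n h {ε} → 1 ≤ n → (∀ l → l < n → Abs O (h l) ε) → ∀ f →
    N (ap O f) ≼ ι 2 ⊗ N (Av n h f) ⊕ ι 2 ⊗ (ε ⊗ N f)
  absorb O n h p q f = ≼-trans (N-via (ap O f) (ap O (Av n h f))) (⊕-mono (⊗-monoˡ (0≼ι 2) (ap-N O _))
     (⊗-monoˡ (0≼ι 2) (≼-trans (≼-reflexive (N-cong (λ x → sym (ap-sub O f _ x)))) (abs-avg O n h p q f))))

  -- The translation moves a window of length `L` by `∣ j ∣` terms, at most the proportion `1 / K`.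
  -- The bound `4 / K²` from `A-shift` is weakened to `4 / K`, and a negative `j` is reduced to
  -- `- j` by translating the whole difference.
  abs-M : ∀ s L p K j → 1 ≤ K → K * ℤ.∣ j ∣ ≤ L → Abs (Op-M s L p) (s ℤ.* j) (ι 4 ⊗ inv K)
  abs-M s L p K j K1 q = go j q
    where
    nat : ∀ h → K * h ≤ L → Abs (Op-M s L p) (s ℤ.* + h) (ι 4 ⊗ inv K)
    nat h q f = ≼-trans (≼-reflexive (N-cong (λ x → trans (ap-sub (Op-M s L p) f (T (s ℤ.* + h) f) x) (cong (M s L f x ⊝_) (avg-cong L (λ i →
         cong f (trans (act-+ (s ℤ.* + h) (s ℤ.* + i) x) (cong (λ z → act z x) (trans (sym (ℤP.*-distribˡ-+ s (+ h) (+ i))) (cong (s ℤ.*_) (sym (ℤP.pos-+ h i))))))))))))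
       (≼-trans (A-shift L h (λ i → T (step s i) f) (N-nonneg f) (λ i → ≼-reflexive (N-T _ f)))
        (⊗-monoʳ (N-nonneg f) (⊗-monoˡ (0≼ι 4) (≼-trans (⊗-mono (0≼inv K) (0≼ιinv h L) r r) (≼-trans (⊗-monoˡ (0≼inv K) (inv≼1 K K1)) (≼-reflexive (⊗-idʳ _)))))))
      where r : ι h ⊗ inv L ≼ inv K
            r = ι⊗inv≼ K h L K1 q p
    go : ∀ j → K * ℤ.∣ j ∣ ≤ L → Abs (Op-M s L p) (s ℤ.* j) (ι 4 ⊗ inv K)
    go (+ h) q = nat h q
    go j@(-[1+ h ]) q f = ≼-trans (≼-reflexive (trans (sym (N-T a (ap O (f ⊟ T (s ℤ.* j) f)))) (trans (N-cong e) (N-sub-sym _ _))))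
        (≼-trans (≼-reflexive (N-cong (λ x → sym (trans (ap-sub O f (T a f) x) (cong (ap O f x ⊝_) (ap-T O a f x)))))) (nat (suc h) q f))
      where
      O = Op-M s L p
      a = s ℤ.* + suc h
      e : ∀ x → T a (ap O (f ⊟ T (s ℤ.* j) f)) x ≡ (T a (ap O f) ⊟ ap O f) x
      e x = trans (ap-sub O f (T (s ℤ.* j) f) (act a x)) (cong (ap O f (act a x) ⊝_) (trans (ap-T O (s ℤ.* j) f (act a x)) (cong (ap O f) (trans (act-+ _ a x) (trans (cong (λ z → act z x) z0) (act-0 x))))))
        where z0 : s ℤ.* -[1+ h ] ℤ.+ s ℤ.* + suc h ≡ + 0
              z0 = trans (sym (ℤP.*-distribˡ-+ s -[1+ h ] (+ suc h))) (trans (cong (s ℤ.*_) (ℤP.+-inverseˡ (+ suc h))) (ℤP.*-zeroʳ s))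

  inner-avgˡ : ∀ n v g → ⟪ A n v , g ⟫ ≡ avg n (λ i → ⟪ v i , g ⟫)
  inner-avgˡ n v g = trans (S-cong (λ x → trans (⊗-comm _ _) (trans (sym (avg-scale n (g x) _)) (avg-cong n (λ i → ⊗-comm _ _))))) (S-avg n _)

  inner-comm : ∀ f g → ⟪ f , g ⟫ ≡ ⟪ g , f ⟫
  inner-comm f g = S-cong (λ x → ⊗-comm _ _)

  inner-avgʳ : ∀ n v g → ⟪ g , A n v ⟫ ≡ avg n (λ i → ⟪ g , v i ⟫)
  inner-avgʳ n v g = trans (inner-comm g _) (trans (inner-avgˡ n v g) (avg-cong n (λ i → inner-comm _ _)))

  inner-T : ∀ a f g → ⟪ T a f , g ⟫ ≡ ⟪ f , T (ℤ.- a) g ⟫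
  inner-T a f g = trans (sym (S-inv (ℤ.- a) _)) (S-cong (λ x → cong (λ z → f z ⊗ g (act (ℤ.- a) x))
      (trans (act-+ a (ℤ.- a) x) (trans (cong (λ z → act z x) (ℤP.+-inverseʳ a)) (act-0 x)))))

  Adj : ∀ n → (ℕ → ℤ) → V → V
  Adj n h = Av n (λ i → ℤ.- h i)

  inner-Av : ∀ n h f g → ⟪ Av n h f , g ⟫ ≡ ⟪ f , Adj n h g ⟫
  inner-Av n h f g = trans (inner-avgˡ n _ g) (trans (avg-cong n (λ i → inner-T (h i) f g)) (sym (inner-avgʳ n _ f)))

  -- Averages with steps `s k` and `s k′` jointly absorb multiples of `s (k - k′)`. Divide `m = e l`
  -- by `k′`, so that `m = b + Q k′`; then `(k - k′) m = k b + k′ ((k - k′) Q - b)`. Each of the two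
  -- averages thus has to absorb only a short translation, of `b` and of `(k - k′) Q - b` steps.
  abs-two : ∀ s L p K (k k′ : ℕ) (E : ℤ) l a → 1 ≤ K → 1 ≤ k′ →
    (∃ λ e → E ≡ (+ k ℤ.- + k′) ℤ.* e × ℤ.∣ e ∣ * l ≤ a * k′) → K * (ℤ.∣ + k ℤ.- + k′ ∣ * (a + 1) + k′) ≤ L →
    Abs (Op-comp (Op-M (s ℤ.* + k′) L p) (Op-M (s ℤ.* + k) L p)) (s ℤ.* E ℤ.* + l) (ι 16 ⊗ inv K)
  abs-two s L p K k k′@(suc k″) E l a K1 _ (e , Ee , bnd) cond = subst (λ z → Abs O z (ι 16 ⊗ inv K)) (sym decomp)
      (abs-≼ O (≼-reflexive (solve 1 (λ i → con (+ 2) :* (con (+ 4) :* i) :+ con (+ 2) :* (con (+ 4) :* i) := con (+ 16) :* i) refl (inv K)))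
       (abs-+ O {a = (s ℤ.* + k) ℤ.* + b} {b = (s ℤ.* + k′) ℤ.* (c ℤ.* Q ℤ.- + b)}
         (abs-post P₁ P₂ (abs-M (s ℤ.* + k) L p K (+ b) K1 (≤-trans (*-monoʳ-≤ K b≤) cond)))
         (abs-pre P₁ P₂ (0≼ιinv 4 K) (abs-M (s ℤ.* + k′) L p K (c ℤ.* Q ℤ.- + b) K1 (≤-trans (*-monoʳ-≤ K r≤) cond)))))
    where
    P₁ = Op-M (s ℤ.* + k′) L p
    P₂ = Op-M (s ℤ.* + k) L p
    O = Op-comp P₁ P₂
    c m Q : ℤ
    c = + k ℤ.- + k′
    m = e ℤ.* + l
    Q = m ℤ./ℕ k′
    b : ℕ
    b = m ℤ.%ℕ k′
    meq : m ≡ + b ℤ.+ Q ℤ.* + k′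
    meq = ℤDM.a≡a%ℕn+[a/ℕn]*n m k′
    b<k′ : b < k′
    b<k′ = ℤDM.n%ℕd<d m k′
    decomp : s ℤ.* E ℤ.* + l ≡ (s ℤ.* + k) ℤ.* + b ℤ.+ (s ℤ.* + k′) ℤ.* (c ℤ.* Q ℤ.- + b)
    decomp = trans (cong (λ z → s ℤ.* z ℤ.* + l) Ee) (trans (lem₁ s c e (+ l)) (trans (cong (λ z → s ℤ.* (c ℤ.* z)) meq) (lem₂ s (+ k) (+ k′) (+ b) Q)))
      where
      lem₁ : ∀ s c e l → s ℤ.* (c ℤ.* e) ℤ.* l ≡ s ℤ.* (c ℤ.* (e ℤ.* l))
      lem₁ s c e l = ringℤ (s ∷ c ∷ e ∷ l ∷ []) ($0 ⋆ ($1 ⋆ $2) ⋆ $3) ($0 ⋆ ($1 ⋆ ($2 ⋆ $3))) refl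
      lem₂ : ∀ s k k′ b Q → s ℤ.* ((k ℤ.- k′) ℤ.* (b ℤ.+ Q ℤ.* k′)) ≡ (s ℤ.* k) ℤ.* b ℤ.+ (s ℤ.* k′) ℤ.* ((k ℤ.- k′) ℤ.* Q ℤ.- b)
      lem₂ s k k′ b Q = ringℤ (s ∷ k ∷ k′ ∷ b ∷ Q ∷ []) ($0 ⋆ (($1 ⊹ ~ $2) ⋆ ($3 ⊹ $4 ⋆ $2))) (($0 ⋆ $1) ⋆ $3 ⊹ ($0 ⋆ $2) ⋆ (($1 ⊹ ~ $2) ⋆ $4 ⊹ ~ $3)) refl
    |Q| : ℤ.∣ Q ∣ ≤ a + 1
    |Q| = *-cancelʳ-≤ ℤ.∣ Q ∣ (a + 1) k′ (≤-trans (≤-reflexive (sym (ℤP.abs-* Q (+ k′)))) (≤-trans (≤-reflexive (cong ℤ.∣_∣ q=)) (≤-trans (ℤP.∣i-j∣≤∣i∣+∣j∣ m (+ b))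
          (≤-trans (+-mono-≤ (≤-trans (≤-reflexive (ℤP.abs-* e (+ l))) bnd) (<⇒≤ b<k′)) (≤-reflexive (sym (trans (*-distribʳ-+ k′ a 1) (cong (λ z → a * k′ + z) (*-identityˡ k′)))))))))
      where q= : Q ℤ.* + k′ ≡ m ℤ.- + b
            q= = sym (trans (cong (ℤ._- + b) meq) (lem (+ b) (Q ℤ.* + k′)))
              where lem : ∀ x y → x ℤ.+ y ℤ.- x ≡ y
                    lem x y = ringℤ (x ∷ y ∷ []) ($0 ⊹ $1 ⊹ ~ $0) ($1) refl
    b≤ : b ≤ ℤ.∣ c ∣ * (a + 1) + k′
    b≤ = ≤-trans (<⇒≤ b<k′) (m≤n+m k′ _)
    r≤ : ℤ.∣ c ℤ.* Q ℤ.- + b ∣ ≤ ℤ.∣ c ∣ * (a + 1) + k′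
    r≤ = ≤-trans (ℤP.∣i-j∣≤∣i∣+∣j∣ (c ℤ.* Q) (+ b)) (+-mono-≤ (≤-trans (≤-reflexive (ℤP.abs-* c Q)) (*-monoʳ-≤ ℤ.∣ c ∣ |Q|)) (<⇒≤ b<k′))

∣n! : ∀ m n → 1 ≤ m → m ≤ n → m ℕD.∣ n !
∣n! (suc m) n _ p = ℕD.∣-trans (ℕD.m∣m*n (m !)) (ℕD.m≤n⇒m!∣n! p)

∣c∣-fact : ∀ n (c : ℤ) → 1 ≤ ℤ.∣ c ∣ → ℤ.∣ c ∣ ≤ n → ∃ λ e → + (n !) ≡ c ℤ.* e × ℤ.∣ e ∣ ≤ n !
∣c∣-fact n (+ c) p q with ∣n! c n p q
... | ℕD.divides e eq = + e , trans (cong +_ (trans eq (*-comm e c))) (ℤP.pos-* c e) ,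
      ≤-trans (ℕP.m≤m*n e c {{ℕ.>-nonZero p}}) (≤-reflexive (sym eq))
∣c∣-fact n -[1+ c ] p q with ∣n! (suc c) n p q
... | ℕD.divides e eq = ℤ.- + e , trans (cong +_ (trans eq (*-comm e (suc c)))) (trans (ℤP.pos-* (suc c) e) (lem (+ suc c) (+ e))) ,
      ≤-trans (≤-reflexive (ℤP.∣-i∣≡∣i∣ (+ e))) (≤-trans (ℕP.m≤m*n e (suc c)) (≤-reflexive (sym eq)))
  where lem : ∀ c e → c ℤ.* e ≡ (ℤ.- c) ℤ.* (ℤ.- e)
        lem c e = ringℤ (c ∷ e ∷ []) ($0 ⋆ $1) ((~ $0) ⋆ (~ $1)) refl

ι⊗inv-cancel : ∀ m n k → 1 ≤ m → 1 ≤ n → k ≡ m * n → ι m ⊗ inv k ≡ inv n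
ι⊗inv-cancel m n k p q refl = ι⊗inv* m n p q

-- Van der Corput's inequality and polynomial averages

module Blocks (𝕊 : Sys) where
  open Sys 𝕊 using (S-cong)
  open Ops 𝕊 using (V; ⟪_,_⟫; N; A; step; M; N-nonneg; amgm)
  open Absorption 𝕊 using (Op; Op-comp; Op-Av; Op-M; ap-Av; absorb; inner-avgˡ; inner-comm; inner-avgʳ; Adj; inner-Av; abs-two; ap-N)

  -- Almost orthogonality. The left side is ⟨f, w⟩ with w the average of M_k* M_k f, and the square
  -- of w involves pairs k, k′. For k different from k′ the product of the two averages absorbs
  -- multiples of `s (k - k′)`, hence the steps `s E l`, as `E` is a common multiple of all the
  -- differences. So the factor k disappears from the step at the price of averaging over a block of
  -- `κ₃` values of k.
  average-over-blocks : ∀ κ → 1 ≤ κ → let κ₃ = 3 * κ * κ in ∀ s L → 1 ≤ L → ∀ H L′ → 1 ≤ L′ → ∀ (E : ℤ) a →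
    (∀ c → 1 ≤ ℤ.∣ c ∣ → ℤ.∣ c ∣ ≤ κ₃ → ∃ λ e → E ≡ c ℤ.* e × ℤ.∣ e ∣ ≤ ℤ.∣ E ∣) → ℤ.∣ E ∣ * L′ ≤ a * H →
    32 * (κ₃ * κ₃) * (κ₃ * (a + 1) + (H + κ₃)) ≤ L → ∀ f →
    avg κ₃ (λ i → N (M (s ℤ.* + (H + suc i)) L f)) ≼ ι 2 ⊗ inv κ ⊗ N f ⊕ ι (2 * (κ * κ₃)) ⊗ N (M (s ℤ.* E) L′ f)
  average-over-blocks κ κ1 s L L1 H L′ L′1 E a divs Ea cond f = ≼-trans (≼-half rhs0 (subst (λ z → ι 2 ⊗ z ≼ inv κ ⊗ D ⊕ ι κ ⊗ N w) fw (amgm κ f w κ1))) total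
    where
    -- In ‖w‖² the norm ‖f‖² occurs with factor `3 / n`, once from the diagonal and twice from `C`;
    -- after multiplication by `κ` this is `1 / κ`.
    n = 3 * κ * κ
    n1 : 1 ≤ n
    n1 = *-mono-≤ {1} {3 * κ} (*-mono-≤ {1} {3} (s≤s z≤n) κ1) κ1
    -- Absorption costs `16 / K`; doubled by `absorb` and multiplied by `n` in `amgm` it becomes
    -- `1 / n`.
    K = 32 * (n * n)
    K1 : 1 ≤ K
    K1 = *-mono-≤ {1} {32} (s≤s z≤n) (*-mono-≤ n1 n1)
    D = N f
    G = N (M (s ℤ.* E) L′ f)
    sk : ℕ → ℤ
    sk i = s ℤ.* + (H + suc i)
    Mk Mk* : ℕ → V → V
    Mk i = M (sk i) L
    Mk* i = Adj L (step (sk i))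
    OM = λ i → Op-M (sk i) L L1
    OM* = λ i → Op-Av L L1 (λ l → ℤ.- step (sk i) l)
    v : ℕ → V
    v i = Mk* i (Mk i f)
    w = A n v
    fw : ⟪ f , w ⟫ ≡ avg n (λ i → N (Mk i f))
    fw = trans (inner-avgʳ n v f) (avg-cong n (λ i → sym (inner-Av L (step (sk i)) f (Mk i f))))
    rhs0 : 0F ≼ inv κ ⊗ D ⊕ ι κ ⊗ N w
    rhs0 = ⊕-nonneg (⊗-nonneg (0≼inv κ) (N-nonneg f)) (⊗-nonneg (0≼ι κ) (N-nonneg w))
    C = ι 2 ⊗ inv n ⊗ D ⊕ ι 2 ⊗ ι n ⊗ G
    C0 : 0F ≼ C
    C0 = ⊕-nonneg (⊗-nonneg (0≼ιinv 2 n) (N-nonneg f)) (⊗-nonneg (⊗-nonneg (0≼ι 2) (0≼ι n)) (N-nonneg _))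
    vN : ∀ i → N (v i) ≼ D
    vN i = ≼-trans (ap-N (OM* i) _) (ap-N (OM i) f)
    cross : ∀ i j → i < n → j < n → i ≢ j → ⟪ v i , v j ⟫ ≼ C
    cross i j i<n j<n i≢j = ≼-half C0 (≼-trans (≼-reflexive (cong (ι 2 ⊗_) re)) (≼-trans (amgm n (Mk j f) (Mk* i (Mk j (Mk i f))) n1)
        (≼-trans (⊕-mono (⊗-monoˡ (0≼inv n) (ap-N (OM j) f)) (⊗-monoˡ (0≼ι n) (≼-trans (ap-N (OM* i) _) ab)))
          (≼-reflexive fin))))
      where
      c : ℤ
      c = + (H + suc i) ℤ.- + (H + suc j)
      cij : ℤ.∣ c ∣ ≡ ℤ.∣ + i ℤ.- + j ∣
      cij = cong ℤ.∣_∣ (trans (cong₂ (λ a b → a ℤ.- b) (ℤP.pos-+ H (suc i)) (ℤP.pos-+ H (suc j))) (lem (+ H) (+ i) (+ j)))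
        where lem : ∀ H i j → (H ℤ.+ (+ 1 ℤ.+ i)) ℤ.- (H ℤ.+ (+ 1 ℤ.+ j)) ≡ i ℤ.- j
              lem H i j = ringℤ (H ∷ i ∷ j ∷ []) (($0 ⊹ (⟨ 1 ⟩ ⊹ $1)) ⊹ ~ ($0 ⊹ (⟨ 1 ⟩ ⊹ $2))) ($1 ⊹ ~ $2) refl
      c≤ : ℤ.∣ c ∣ ≤ n
      c≤ = ≤-trans (≤-reflexive cij) (≤-trans (≤-reflexive (cong ℤ.∣_∣ (ℤP.m-n≡m⊖n i j))) (≤-trans (ℤP.∣m⊝n∣≤m⊔n i j) (⊔-lub (<⇒≤ i<n) (<⇒≤ j<n))))
      c1 : 1 ≤ ℤ.∣ c ∣
      c1 = n≢0⇒n>0 (λ z → i≢j (ℤP.+-injective (ℤP.i-j≡0⇒i≡j (+ i) (+ j) (ℤP.∣i∣≡0⇒i≡0 (trans (sym cij) z)))))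
      e = proj₁ (divs c c1 c≤)
      ab : N (Mk j (Mk i f)) ≼ ι 2 ⊗ G ⊕ ι 2 ⊗ (ι 16 ⊗ inv K ⊗ D)
      ab = absorb (Op-comp (OM j) (OM i)) L′ (step (s ℤ.* E)) L′1 (λ l l<L′ →
           abs-two s L L1 K (H + suc i) (H + suc j) E l a K1 (≤-trans (s≤s z≤n) (m≤n+m (suc j) H))
             (e , proj₁ (proj₂ (divs c c1 c≤)) , ≤-trans (*-mono-≤ (proj₂ (proj₂ (divs c c1 c≤))) (<⇒≤ l<L′)) (≤-trans Ea (*-monoʳ-≤ a (m≤m+n H (suc j)))))
             (≤-trans (*-monoʳ-≤ K (+-mono-≤ (*-monoˡ-≤ (a + 1) c≤) (+-monoʳ-≤ H j<n))) cond)) f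
      -- All averages commute, so the adjoint of the `j`-th one can be moved to the other side,
      -- which leaves the product of two averages treated by `abs-two`.
      re : ⟪ v i , v j ⟫ ≡ ⟪ Mk j f , Mk* i (Mk j (Mk i f)) ⟫
      re = trans (inner-comm (v i) (v j)) (trans (trans (inner-comm _ _) (sym (inner-Av L (step (sk j)) (v i) (Mk j f)))) (trans (inner-comm _ _)
           (S-cong (λ x → cong (Mk j f x ⊗_) (sym (ap-Av (OM* i) L (step (sk j)) (Mk i f) x))))))
      fin : inv n ⊗ D ⊕ ι n ⊗ (ι 2 ⊗ G ⊕ ι 2 ⊗ (ι 16 ⊗ inv K ⊗ D)) ≡ C
      fin = trans (solve 5 (λ i m g k d → i :* d :+ m :* (con (+ 2) :* g :+ con (+ 2) :* (con (+ 16) :* k :* d)) := i :* d :+ con (+ 2) :* m :* g :+ (con (+ 32) :* m :* k) :* d) refl (inv n) (ι n) G (inv K) D)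
         (trans (cong (λ z → inv n ⊗ D ⊕ ι 2 ⊗ ι n ⊗ G ⊕ z ⊗ D) (trans (cong (_⊗ inv K) (sym (ι-* 32 n))) (ι⊗inv-cancel (32 * n) n K (*-mono-≤ {1} {32} (s≤s z≤n) n1) n1 (sym (*-assoc 32 n n)))))
         (solve 4 (λ i m g d → i :* d :+ con (+ 2) :* m :* g :+ i :* d := con (+ 2) :* i :* d :+ con (+ 2) :* m :* g) refl (inv n) (ι n) G D))
    Nw : N w ≼ inv n ⊗ D ⊕ C
    Nw = ≼-trans (≼-reflexive (trans (inner-avgˡ n v w) (avg-cong n (λ i → inner-avgʳ n v (v i)))))
      (avg-≼ n n1 (λ i i<n → ≼-trans (⊗-monoˡ (0≼inv n) (sumF-except n i {b = D} {c = C} (N-nonneg f) C0 (vN i) (λ j j<n j≢i → cross i j i<n j<n (λ e → j≢i (sym e)))))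
        (≼-reflexive (trans (⊗-distribˡ _ _ _) (cong (inv n ⊗ D ⊕_) (trans (sym (⊗-assoc _ _ _)) (trans (cong (_⊗ C) (inv-ι n n1)) (⊗-idˡ C))))))))
    total : inv κ ⊗ D ⊕ ι κ ⊗ N w ≼ ι 2 ⊗ inv κ ⊗ D ⊕ ι (2 * (κ * n)) ⊗ G
    total = ≼-trans (⊕-mono ≼-refl (⊗-monoˡ (0≼ι κ) Nw)) (≼-reflexive
      (trans (solve 6 (λ ik k i m g d → ik :* d :+ k :* (i :* d :+ (con (+ 2) :* i :* d :+ con (+ 2) :* m :* g)) := ik :* d :+ (con (+ 3) :* k :* i) :* d :+ (con (+ 2) :* (k :* m)) :* g) refl (inv κ) (ι κ) (inv n) (ι n) G D)
      (trans (cong₂ (λ y z → inv κ ⊗ D ⊕ y ⊗ D ⊕ z ⊗ G) (trans (cong (_⊗ inv n) (sym (ι-* 3 κ))) (ι⊗inv-cancel (3 * κ) κ n (*-mono-≤ {1} {3} (s≤s z≤n) κ1) κ1 refl))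
          (sym (trans (ι-* 2 (κ * n)) (cong (ι 2 ⊗_) (ι-* κ n)))))
      (cong (_⊕ ι (2 * (κ * n)) ⊗ G) (solve 2 (λ i d → i :* d :+ i :* d := con (+ 2) :* i :* d) refl (inv κ) D)))))

-- R behaves like a polynomial of degree at most d whose d-th difference is a
-- (so a is d! times the leading coefficient).
data Pol : ℕ → ℤ → (ℕ → ℤ) → Set where
  constant : ∀ {a R} → (∀ z → R z ≡ a) → Pol 0 a R
  differences : ∀ {d a R} → (∀ h h′ → Pol d ((+ h ℤ.- + h′) ℤ.* a) (λ z → R (h + z) ℤ.- R (h′ + z))) → Pol (suc d) a R

Pol-const : ∀ {a R} → Pol 0 a R → ∀ z → R z ≡ a
Pol-const (constant p) = p

Pol-Δ : ∀ {d a R} → Pol (suc d) a R → ∀ h h′ → Pol d ((+ h ℤ.- + h′) ℤ.* a) (λ z → R (h + z) ℤ.- R (h′ + z))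
Pol-Δ (differences p) = p

-- A qualitative Weyl inequality. `κ′`, `q`, `e` and `Y` come before the system, the vector and the
-- polynomial, and the step is measured in units of the `d`-th difference `a`. The scale `y` is free
-- between `Y` and `Z / e`.
record Weyl (d κ : ℕ) : Set₁ where
  field
    κ′ q e Y : ℕ
    q≥1 : 1 ≤ q
    e≥1 : 1 ≤ e
    Y≥1 : 1 ≤ Y
    bound : ∀ (𝕊 : Sys) (f : Ops.V 𝕊) a R → Pol d a R → ∀ y Z → Y ≤ y → e * y ≤ Z →
      Ops.N 𝕊 (Ops.Av 𝕊 Z R f) ≼ inv κ ⊗ Ops.N 𝕊 f ⊕ ι κ′ ⊗ Ops.N 𝕊 (Ops.M 𝕊 (a ℤ.* + q) (y ^ d) f)

1≤m* : ∀ {m n} → 1 ≤ m → 1 ≤ n → 1 ≤ m * n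
1≤m* p q = *-mono-≤ p q

1≤^ : ∀ {m} d → 1 ≤ m → 1 ≤ m ^ d
1≤^ zero p = s≤s z≤n
1≤^ (suc d) p = 1≤m* p (1≤^ d p)

m≤m*n : ∀ m {n} → 1 ≤ n → m ≤ m * n
m≤m*n m {suc n} _ = ℕP.m≤m*n m (suc n)

m≤n*m : ∀ m {n} → 1 ≤ n → m ≤ n * m
m≤n*m m {suc n} _ = ℕP.m≤n*m m (suc n)

m≤m^ : ∀ m d → 1 ≤ d → 1 ≤ m → m ≤ m ^ d
m≤m^ m (suc d) _ p = m≤m*n m (1≤^ d p)

*-^ : ∀ m n d → (m * n) ^ d ≡ m ^ d * n ^ d
*-^ m n zero = refl
*-^ m n (suc d) = trans (cong (m * n *_) (*-^ m n d)) (lem m n (m ^ d) (n ^ d))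
  where lem : ∀ a b c d → a * b * (c * d) ≡ a * c * (b * d)
        lem a b c d = ringℕ (a ∷ b ∷ c ∷ d ∷ []) ($0 ⋆ $1 ⋆ ($2 ⋆ $3)) ($0 ⋆ $2 ⋆ ($1 ⋆ $3)) refl

Pol-linear : ∀ a R → Pol 1 a R → ∀ z → R z ≡ R 0 ℤ.+ a ℤ.* + z
Pol-linear a R P z = trans (lem₁ (R z) (R 0)) (cong (λ w → R 0 ℤ.+ w) (trans (cong (λ w → R w ℤ.- R 0) (sym (+-identityʳ z))) (trans (Pol-const (Pol-Δ P z 0) 0) (lem₂ a (+ z)))))
  where
  lem₁ : ∀ a b → a ≡ b ℤ.+ (a ℤ.- b)
  lem₁ a b = ringℤ (a ∷ b ∷ []) ($0) ($1 ⊹ ($0 ⊹ ~ $1)) refl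
  lem₂ : ∀ a z → (z ℤ.- + 0) ℤ.* a ≡ a ℤ.* z
  lem₂ a z = ringℤ (a ∷ z ∷ []) (($1 ⊹ ~ ⟨ 0 ⟩) ⋆ $0) ($0 ⋆ $1) refl

-- In degree one the average is a translate of `M a Z`, which absorbs its own short steps. The error
-- is `2 · 4 / (8 κ) = 1 / κ`.
weyl₁ : ∀ κ → 1 ≤ κ → Weyl 1 κ
weyl₁ κ κ1 = record { κ′ = 2 ; q = 1 ; e = 8 * κ ; Y = 1 ; q≥1 = s≤s z≤n ; e≥1 = 1≤m* {8} (s≤s z≤n) κ1 ; Y≥1 = s≤s z≤n ; bound = bound }
  where
  bound : ∀ (𝕊 : Sys) (f : Ops.V 𝕊) a R → Pol 1 a R → ∀ y Z → 1 ≤ y → 8 * κ * y ≤ Z →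
      Ops.N 𝕊 (Ops.Av 𝕊 Z R f) ≼ inv κ ⊗ Ops.N 𝕊 f ⊕ ι 2 ⊗ Ops.N 𝕊 (Ops.M 𝕊 (a ℤ.* + 1) (y ^ 1) f)
  bound 𝕊 f a R P y Z y1 ez = ≼-trans (≼-reflexive (trans (N-cong e₁) (N-T (R 0) (M a Z f))))
      (≼-trans (absorb (Op-M a Z Z1) (y ^ 1) (step (a ℤ.* + 1)) (1≤^ 1 y1) near f)
      (≼-reflexive (trans (⊕-comm _ _) (cong (_⊕ ι 2 ⊗ G) (trans (solve 2 (λ i n → con (+ 2) :* (con (+ 4) :* i :* n) := con (+ 8) :* i :* n) refl (inv (8 * κ)) (N f)) (cong (_⊗ N f) (ι⊗inv* 8 κ (s≤s z≤n) κ1)))))))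
    where
    open Sys 𝕊 using (act; act-+)
    open Ops 𝕊 using (N; T; Av; step; M; N-cong; N-T)
    open Absorption 𝕊 using (Op-M; Abs; absorb; abs-M)
    G = N (M (a ℤ.* + 1) (y ^ 1) f)
    Z1 : 1 ≤ Z
    Z1 = ≤-trans (1≤m* (1≤m* {8} (s≤s z≤n) κ1) y1) ez
    e₁ : ∀ x → Av Z R f x ≡ T (R 0) (M a Z f) x
    e₁ x = avg-cong Z (λ i → cong f (trans (cong (λ w → act w x) (trans (Pol-linear a R P i) (ℤP.+-comm (R 0) (a ℤ.* + i)))) (sym (act-+ (a ℤ.* + i) (R 0) x))))
    near : ∀ l → l < y ^ 1 → Abs (Op-M a Z Z1) (step (a ℤ.* + 1) l) (ι 4 ⊗ inv (8 * κ))
    near l l<y = subst (λ z → Abs (Op-M a Z Z1) (z ℤ.* + l) (ι 4 ⊗ inv (8 * κ))) (sym (ℤP.*-identityʳ a))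
       (abs-M a Z Z1 (8 * κ) (+ l) (1≤m* {8} (s≤s z≤n) κ1) (≤-trans (*-monoʳ-≤ (8 * κ) (≤-trans (<⇒≤ l<y) (≤-reflexive (*-identityʳ y)))) ez))

fact-multiple : ∀ n c x → (∃ λ e → + (n !) ≡ c ℤ.* e × ℤ.∣ e ∣ ≤ n !) → ∃ λ e → x ℤ.* + (n !) ≡ c ℤ.* e × ℤ.∣ e ∣ ≤ ℤ.∣ x ℤ.* + (n !) ∣
fact-multiple n c x (e , eq , le) = e ℤ.* x , trans (cong (x ℤ.*_) eq) (lem x c e) , ≤-trans (≤-reflexive (trans (ℤP.abs-* e x) (*-comm ℤ.∣ e ∣ _))) (≤-trans (*-monoʳ-≤ ℤ.∣ x ∣ le) (≤-reflexive (sym (ℤP.abs-* x (+ (n !))))))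
  where lem : ∀ x c e → x ℤ.* (c ℤ.* e) ≡ c ℤ.* (e ℤ.* x)
        lem x c e = ringℤ (x ∷ c ∷ e ∷ []) ($0 ⋆ ($1 ⋆ $2)) ($1 ⋆ ($2 ⋆ $0)) refl

-- Van der Corput's step. Up to a small error, z may be replaced by `j k + z` averaged over `j < m`.
-- Opening the square gives shifts by `R (j k + z) - R (j′ k + z)`, of degree `d` with `d`-th
-- difference `(j - j′) k a`. The inductive bound then carries the unwanted factor `k` in its step,
-- and `average-over-blocks` removes it, `k` running from `y + 1` to `y + n`.
module WeylStep (d : ℕ) (d1 : 1 ≤ d) (IH : ∀ κ → 1 ≤ κ → Weyl d κ) (κ : ℕ) (κ1 : 1 ≤ κ) where
  μ m ν κ₁ : ℕ
  -- There are five errors of size ‖f‖² / `μ`: the diagonal, `amgm`, the inductive bound, the blocks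
  -- and the smoothing.
  μ = 5 * κ
  m = 2 * μ
  ν = 2 * μ
  κ₁ = 2 * ν * μ
  μ1 : 1 ≤ μ
  μ1 = 1≤m* {5} (s≤s z≤n) κ1
  m1 : 1 ≤ m
  m1 = 1≤m* {2} (s≤s z≤n) μ1
  κ₁1 : 1 ≤ κ₁
  κ₁1 = 1≤m* (1≤m* {2} (s≤s z≤n) m1) μ1
  module I = Weyl (IH κ₁ κ₁1)
  c₁ κ₂ n : ℕ
  c₁ = suc I.κ′
  κ₂ = 4 * ν * c₁ * μ
  κ₂1 : 1 ≤ κ₂
  κ₂1 = 1≤m* (1≤m* (1≤m* {4} (s≤s z≤n) m1) (s≤s z≤n)) μ1
  n = 3 * κ₂ * κ₂
  n1 : 1 ≤ n
  n1 = 1≤m* (1≤m* {3} (s≤s z≤n) κ₂1) κ₂1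
  K₁ E₀ e₁ q Y e κ′ : ℕ
  K₁ = 8 * μ
  -- `m !` is a multiple of all differences `j - j′`, and `n !` of all differences between two
  -- values of `k`.
  E₀ = m ! * n !
  -- Makes progressions of length `(e₁ y) ^ d` long enough for `cond`.
  e₁ = 32 * (n * n) * (n * E₀ + n + 2)
  q = I.q * E₀
  Y = n + I.Y
  e = I.e * e₁ + K₁ * (m * 2)
  κ′ = 2 * (ν * (c₁ * (2 * (κ₂ * n))))
  E₀1 : 1 ≤ E₀
  E₀1 = 1≤m* (1≤n! m) (1≤n! n)
  e₁1 : 1 ≤ e₁
  e₁1 = 1≤m* (1≤m* {32} (s≤s z≤n) (1≤m* n1 n1)) (≤-trans (s≤s z≤n) (m≤n+m 2 (n * E₀ + n)))
  q1 : 1 ≤ q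
  q1 = 1≤m* I.q≥1 E₀1

  module _ (𝕊 : Sys) where
   open Sys 𝕊 using (S-cong; act-+)
   open Ops 𝕊 using (V; _⊟_; ⟪_,_⟫; N; T; A; Av; M; N-cong; N-nonneg; N-T; N-via; N-A; N-A-≼; amgm; A-shift)
   open Absorption 𝕊 using (inner-avgˡ; inner-comm; inner-avgʳ; inner-T)
   open Blocks 𝕊 using (average-over-blocks)

   module _ (f : V) (a : ℤ) (R : ℕ → ℤ) (P : Pol (suc d) a R) (y Z : ℕ) (Yy : Y ≤ y) (ez : e * y ≤ Z) where
    n≤y : n ≤ y
    n≤y = ≤-trans (m≤m+n n I.Y) Yy
    y1 : 1 ≤ y
    y1 = ≤-trans n1 n≤y
    y₁ = e₁ * y
    y≤y₁ : y ≤ y₁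
    y≤y₁ = m≤n*m y e₁1
    L L′ : ℕ
    L = y₁ ^ d
    L′ = y ^ suc d
    L1 : 1 ≤ L
    L1 = 1≤^ d (≤-trans y1 y≤y₁)
    L′1 : 1 ≤ L′
    L′1 = 1≤^ (suc d) y1
    ez₁ : I.e * y₁ ≤ Z
    ez₁ = ≤-trans (≤-trans (≤-reflexive (sym (*-assoc I.e e₁ y))) (*-monoˡ-≤ y (m≤m+n (I.e * e₁) _))) ez
    ez₂ : K₁ * (m * (2 * y)) ≤ Z
    ez₂ = ≤-trans (≤-trans (≤-reflexive (lem K₁ m y)) (*-monoˡ-≤ y (m≤n+m (K₁ * (m * 2)) (I.e * e₁)))) ez
      where lem : ∀ K m y → K * (m * (2 * y)) ≡ K * (m * 2) * y
            lem K m y = ringℕ (K ∷ m ∷ y ∷ []) ($0 ⋆ ($1 ⋆ (⟨ 2 ⟩ ⋆ $2))) ($0 ⋆ ($1 ⋆ ⟨ 2 ⟩) ⋆ $2) refl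
    Z1 : 1 ≤ Z
    Z1 = ≤-trans (1≤m* I.e≥1 (≤-trans y1 y≤y₁)) ez₁
    D G : F
    D = N f
    G = N (M (a ℤ.* + q) L′ f)
    k : ℕ → ℕ
    k i = y + suc i
    k≤ : ∀ i → i < n → k i ≤ 2 * y
    k≤ i i<n = +-monoʳ-≤ y (≤-trans i<n (≤-trans n≤y (m≤m+n y 0)))
    v : ℕ → V
    v z = T (R z) f
    w : ℕ → ℕ → V
    w k z = A m (λ j → v (j * k + z))
    B : ℕ → ℕ → ℕ → F
    B k j j′ = avg Z (λ z → ⟪ v (j * k + z) , v (j′ * k + z) ⟫)
    smooth : ∀ i → i < n → N (A Z v ⊟ A Z (w (k i))) ≼ ι 4 ⊗ inv K₁ ⊗ D
    smooth i i<n = ≼-trans (≼-reflexive (N-cong (λ x → trans (cong (A Z v x ⊝_) (avg-swap Z m _)) (trans (cong (_⊝ A m (λ j → A Z (λ z → v (j * k i + z))) x) (sym (avg-const m (A Z v x) m1))) (sym (avg-sub m _ _))))))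
       (N-A-≼ m (λ j → A Z v ⊟ A Z (λ z → v (j * k i + z))) m1 (λ j j<m → ≼-trans (A-shift Z (j * k i) v (N-nonneg f) (λ z → ≼-reflexive (N-T (R z) f)))
         (⊗-monoʳ (N-nonneg f) (⊗-monoˡ (0≼ι 4) (r² j j<m)))))
      where
      K₁1 : 1 ≤ K₁
      K₁1 = 1≤m* {8} (s≤s z≤n) μ1
      r : ∀ j → j < m → ι (j * k i) ⊗ inv Z ≼ inv K₁
      r j j<m = ι⊗inv≼ K₁ (j * k i) Z K₁1 (≤-trans (*-monoʳ-≤ K₁ (*-mono-≤ (<⇒≤ j<m) (k≤ i i<n))) ez₂) Z1
      r² : ∀ j → j < m → (ι (j * k i) ⊗ inv Z) ⊗ (ι (j * k i) ⊗ inv Z) ≼ inv K₁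
      r² j j<m = ≼-trans (⊗-mono (0≼inv K₁) (0≼ιinv (j * k i) Z) (r j j<m) (r j j<m)) (≼-trans (⊗-monoˡ (0≼inv K₁) (inv≼1 K₁ K₁1)) (≼-reflexive (⊗-idʳ _)))
    main : ∀ i → N (A Z (w (k i))) ≼ avg m (λ j → avg m (λ j′ → B (k i) j j′))
    main i = ≼-trans (N-A Z (w (k i)) Z1) (≼-reflexive (trans (avg-cong Z (λ z → trans (inner-avgˡ m _ _) (avg-cong m (λ j → inner-avgʳ m _ _))))
       (trans (avg-swap Z m _) (avg-cong m (λ j → avg-swap Z m _)))))
    C : F
    C = inv ν ⊗ D ⊕ ι ν ⊗ (inv κ₁ ⊗ D ⊕ ι c₁ ⊗ (ι 2 ⊗ inv κ₂ ⊗ D ⊕ ι (2 * (κ₂ * n)) ⊗ G))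
    C0 : 0F ≼ C
    C0 = ⊕-nonneg (⊗-nonneg (0≼inv ν) (N-nonneg f)) (⊗-nonneg (0≼ι ν) (⊕-nonneg (⊗-nonneg (0≼inv κ₁) (N-nonneg f))
          (⊗-nonneg (0≼ι c₁) (⊕-nonneg (⊗-nonneg (0≼ιinv 2 κ₂) (N-nonneg f)) (⊗-nonneg (0≼ι _) (N-nonneg _))))))
    diag : ∀ j → avg n (λ i → B (k i) j j) ≼ D
    diag j = avg-≼ n n1 (λ i _ → avg-≼ Z Z1 (λ z _ → ≼-reflexive (N-T _ f)))
    off : ∀ j j′ → j < m → j′ < m → j ≢ j′ → avg n (λ i → B (k i) j j′) ≼ C
    off j j′ j<m j′<m j≢j′ = ≼-half C0 (≼-trans (≼-reflexive (sym (avg-scale n (ι 2) _))) (≼-trans (avg-mono n one) (≼-trans (≼-reflexive split)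
          (⊕-mono ≼-refl (⊗-monoˡ (0≼ι ν) (⊕-mono ≼-refl (⊗-mono (0≼ι c₁) (avg-nonneg n (λ i → N-nonneg (M (s ℤ.* + (y + suc i)) L f))) (ι-mono (n≤1+n _)) LB)))))))
      where
      c : ℤ
      c = + j ℤ.- + j′
      c≤ : ℤ.∣ c ∣ ≤ m
      c≤ = ≤-trans (≤-reflexive (cong ℤ.∣_∣ (ℤP.m-n≡m⊖n j j′))) (≤-trans (ℤP.∣m⊝n∣≤m⊔n j j′) (⊔-lub (<⇒≤ j<m) (<⇒≤ j′<m)))
      c1 : 1 ≤ ℤ.∣ c ∣
      c1 = n≢0⇒n>0 (λ z → j≢j′ (ℤP.+-injective (ℤP.i-j≡0⇒i≡j (+ j) (+ j′) (ℤP.∣i∣≡0⇒i≡0 z))))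
      ed = ∣c∣-fact m c c1 c≤
      ej E s : ℤ
      ej = proj₁ ed
      E = ej ℤ.* + (n !)
      s = c ℤ.* a ℤ.* + I.q
      |E| : ℤ.∣ E ∣ ≤ E₀
      |E| = ≤-trans (≤-reflexive (ℤP.abs-* ej (+ (n !)))) (*-monoˡ-≤ (n !) (proj₂ (proj₂ ed)))
      -- The factor `j - j′` hidden in `s` is completed to `m !`, so the final step is the same for
      -- all pairs.
      sE : s ℤ.* E ≡ a ℤ.* + q
      sE = trans (lem c a (+ I.q) ej (+ (n !))) (cong (a ℤ.*_) (trans (cong (λ z → + I.q ℤ.* (z ℤ.* + (n !))) (sym (proj₁ (proj₂ ed)))) (trans (cong (+ I.q ℤ.*_) (sym (ℤP.pos-* (m !) (n !)))) (sym (ℤP.pos-* I.q E₀)))))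
        where lem : ∀ c a q e n → c ℤ.* a ℤ.* q ℤ.* (e ℤ.* n) ≡ a ℤ.* (q ℤ.* (c ℤ.* e ℤ.* n))
              lem c a q e n = ringℤ (c ∷ a ∷ q ∷ e ∷ n ∷ []) ($0 ⋆ $1 ⋆ $2 ⋆ ($3 ⋆ $4)) ($1 ⋆ ($2 ⋆ ($0 ⋆ $3 ⋆ $4))) refl
      divs : ∀ c → 1 ≤ ℤ.∣ c ∣ → ℤ.∣ c ∣ ≤ n → ∃ λ e → E ≡ c ℤ.* e × ℤ.∣ e ∣ ≤ ℤ.∣ E ∣
      divs c p r = fact-multiple n c ej (∣c∣-fact n c p r)
      cond : 32 * (n * n) * (n * (E₀ * y ^ d + 1) + (y + n)) ≤ L
      cond = ≤-trans (*-monoʳ-≤ (32 * (n * n)) bb) (≤-trans (≤-reflexive (sym (*-assoc (32 * (n * n)) (n * E₀ + n + 2) (y ^ d))))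
             (≤-trans (*-monoˡ-≤ (y ^ d) (m≤m^ e₁ d d1 e₁1)) (≤-reflexive (sym (*-^ e₁ y d)))))
        where
        yd1 = 1≤^ d y1
        y≤yd = m≤m^ y d d1 y1
        bb : n * (E₀ * y ^ d + 1) + (y + n) ≤ (n * E₀ + n + 2) * y ^ d
        bb = ≤-trans (+-mono-≤ (*-monoʳ-≤ n (+-monoʳ-≤ (E₀ * y ^ d) yd1)) (+-mono-≤ y≤yd (≤-trans n≤y y≤yd))) (≤-reflexive (lem n E₀ (y ^ d)))
          where lem : ∀ n E Y → n * (E * Y + Y) + (Y + Y) ≡ (n * E + n + 2) * Y
                lem n E Y = ringℕ (n ∷ E ∷ Y ∷ []) ($0 ⋆ ($1 ⋆ $2 ⊹ $2) ⊹ ($2 ⊹ $2)) (($0 ⋆ $1 ⊹ $0 ⊹ ⟨ 2 ⟩) ⋆ $2) refl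
      LB : avg n (λ i → N (M (s ℤ.* + (y + suc i)) L f)) ≼ ι 2 ⊗ inv κ₂ ⊗ D ⊕ ι (2 * (κ₂ * n)) ⊗ G
      LB = subst (λ z → avg n (λ i → N (M (s ℤ.* + (y + suc i)) L f)) ≼ ι 2 ⊗ inv κ₂ ⊗ D ⊕ ι (2 * (κ₂ * n)) ⊗ N (M z L′ f)) sE
           (average-over-blocks κ₂ κ₂1 s L L1 y L′ L′1 E (E₀ * y ^ d) divs (≤-trans (*-monoˡ-≤ L′ |E|) (≤-reflexive (lem E₀ y (y ^ d)))) cond f)
        where lem : ∀ E y Y → E * (y * Y) ≡ E * Y * y
              lem E y Y = ringℕ (E ∷ y ∷ Y ∷ []) ($0 ⋆ ($1 ⋆ $2)) ($0 ⋆ $2 ⋆ $1) refl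
      one : ∀ i → i < n → ι 2 ⊗ B (k i) j j′ ≼ inv ν ⊗ D ⊕ ι ν ⊗ (inv κ₁ ⊗ D ⊕ ι I.κ′ ⊗ N (M (s ℤ.* + (y + suc i)) L f))
      one i i<n = ≼-trans (≼-reflexive (cong (ι 2 ⊗_) re)) (≼-trans (amgm ν f (Av Z R′ f) m1) (⊕-mono ≼-refl (⊗-monoˡ (0≼ι ν) (≼-trans
           (I.bound 𝕊 f a′ R′ (Pol-Δ P (j * k i) (j′ * k i)) y₁ Z (≤-trans (m≤n+m I.Y n) (≤-trans Yy y≤y₁)) ez₁)
           (≼-reflexive (cong (λ z → inv κ₁ ⊗ D ⊕ ι I.κ′ ⊗ N (M z L f)) aq))))))
        where
        R′ : ℕ → ℤ
        R′ z = R (j * k i + z) ℤ.- R (j′ * k i + z)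
        a′ : ℤ
        a′ = (+ (j * k i) ℤ.- + (j′ * k i)) ℤ.* a
        aq : a′ ℤ.* + I.q ≡ s ℤ.* + (y + suc i)
        aq = trans (cong₂ (λ u v → (u ℤ.- v) ℤ.* a ℤ.* + I.q) (ℤP.pos-* j (k i)) (ℤP.pos-* j′ (k i))) (lem (+ j) (+ j′) (+ k i) a (+ I.q))
          where lem : ∀ j j′ k a q → (j ℤ.* k ℤ.- j′ ℤ.* k) ℤ.* a ℤ.* q ≡ (j ℤ.- j′) ℤ.* a ℤ.* q ℤ.* k
                lem j j′ k a q = ringℤ (j ∷ j′ ∷ k ∷ a ∷ q ∷ []) (($0 ⋆ $2 ⊹ ~ ($1 ⋆ $2)) ⋆ $3 ⋆ $4) (($0 ⊹ ~ $1) ⋆ $3 ⋆ $4 ⋆ $2) refl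
        re : B (k i) j j′ ≡ ⟪ f , Av Z R′ f ⟫
        re = trans (avg-cong Z (λ z → trans (inner-comm _ _) (trans (inner-T (R (j′ * k i + z)) f _) (S-cong (λ x → cong (f x ⊗_) (cong f (act-+ (R (j * k i + z)) (ℤ.- R (j′ * k i + z)) x)))))))
            (sym (inner-avgʳ Z _ f))
      split : avg n (λ i → inv ν ⊗ D ⊕ ι ν ⊗ (inv κ₁ ⊗ D ⊕ ι I.κ′ ⊗ N (M (s ℤ.* + (y + suc i)) L f))) ≡
              inv ν ⊗ D ⊕ ι ν ⊗ (inv κ₁ ⊗ D ⊕ ι I.κ′ ⊗ avg n (λ i → N (M (s ℤ.* + (y + suc i)) L f)))
      split = trans (avg-add n _ _) (cong₂ _⊕_ (avg-const n _ n1) (trans (avg-scale n (ι ν) _) (cong (ι ν ⊗_) (trans (avg-add n _ _) (cong₂ _⊕_ (avg-const n _ n1) (avg-scale n (ι I.κ′) _))))))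
    avgB : avg n (λ i → avg m (λ j → avg m (λ j′ → B (k i) j j′))) ≼ inv m ⊗ D ⊕ C
    avgB = ≼-trans (≼-reflexive (trans (avg-swap n m _) (avg-cong m (λ j → avg-swap n m _))))
       (avg-≼ m m1 (λ j j<m → ≼-trans (⊗-monoˡ (0≼inv m) (sumF-except m j {b = D} {c = C} (N-nonneg f) C0 (diag j) (λ j′ j′<m ne → off j j′ j<m j′<m (λ e → ne (sym e)))))
         (≼-reflexive (trans (⊗-distribˡ _ _ _) (cong (inv m ⊗ D ⊕_) (trans (sym (⊗-assoc _ _ _)) (trans (cong (_⊗ C) (inv-ι m m1)) (⊗-idˡ C))))))))
    result : N (Av Z R f) ≼ inv κ ⊗ D ⊕ ι κ′ ⊗ G
    result = ≼-trans (≼-avg n {g = λ i → ι 2 ⊗ avg m (λ j → avg m (λ j′ → B (k i) j j′)) ⊕ ι 2 ⊗ (ι 4 ⊗ inv K₁ ⊗ D)} n1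
        (λ i i<n → ≼-trans (N-via (A Z v) (A Z (w (k i)))) (⊕-mono (⊗-monoˡ (0≼ι 2) (main i)) (⊗-monoˡ (0≼ι 2) (smooth i i<n)))))
      (≼-trans (≼-reflexive (trans (avg-add n _ _) (cong₂ _⊕_ (avg-scale n (ι 2) _) (avg-const n _ n1))))
      (≼-trans (⊕-mono (⊗-monoˡ (0≼ι 2) avgB) ≼-refl) (≼-reflexive fin)))
      where
      x1 : ι 2 ⊗ inv m ≡ inv μ
      x1 = ι⊗inv* 2 μ (s≤s z≤n) μ1
      x2 : ι 2 ⊗ ι ν ⊗ inv κ₁ ≡ inv μ
      x2 = trans (cong (_⊗ inv κ₁) (sym (ι-* 2 ν))) (ι⊗inv* (2 * ν) μ (1≤m* {2} (s≤s z≤n) m1) μ1)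
      x3 : ι 4 ⊗ ι ν ⊗ ι c₁ ⊗ inv κ₂ ≡ inv μ
      x3 = trans (cong (_⊗ inv κ₂) (trans (cong (_⊗ ι c₁) (sym (ι-* 4 ν))) (sym (ι-* (4 * ν) c₁)))) (ι⊗inv* (4 * ν * c₁) μ (1≤m* (1≤m* {4} (s≤s z≤n) m1) (s≤s z≤n)) μ1)
      x4 : ι 8 ⊗ inv K₁ ≡ inv μ
      x4 = ι⊗inv* 8 μ (s≤s z≤n) μ1
      x5 : ι 5 ⊗ inv μ ≡ inv κ
      x5 = ι⊗inv* 5 κ (s≤s z≤n) κ1
      x6 : ι κ′ ≡ ι 2 ⊗ (ι ν ⊗ (ι c₁ ⊗ ι (2 * (κ₂ * n))))
      x6 = trans (ι-* 2 _) (cong (ι 2 ⊗_) (trans (ι-* ν _) (cong (ι ν ⊗_) (ι-* c₁ _))))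
      fin : ι 2 ⊗ (inv m ⊗ D ⊕ C) ⊕ ι 2 ⊗ (ι 4 ⊗ inv K₁ ⊗ D) ≡ inv κ ⊗ D ⊕ ι κ′ ⊗ G
      fin = begin
        ι 2 ⊗ (inv m ⊗ D ⊕ C) ⊕ ι 2 ⊗ (ι 4 ⊗ inv K₁ ⊗ D)
          ≡⟨ FS.solve 10 (λ im il l i1 c i2 b g ik d → con (+ 2) :* (im :* d :+ (il :* d :+ l :* (i1 :* d :+ c :* (con (+ 2) :* i2 :* d :+ b :* g)))) :+ con (+ 2) :* (con (+ 4) :* ik :* d)
               := (con (+ 2) :* im) :* d :+ (con (+ 2) :* il) :* d :+ (con (+ 2) :* l :* i1) :* d :+ (con (+ 4) :* l :* c :* i2) :* d :+ (con (+ 8) :* ik) :* d :+ (con (+ 2) :* (l :* (c :* b))) :* g) refl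
               (inv m) (inv ν) (ι ν) (inv κ₁) (ι c₁) (inv κ₂) (ι (2 * (κ₂ * n))) G (inv K₁) D ⟩
        ι 2 ⊗ inv m ⊗ D ⊕ ι 2 ⊗ inv ν ⊗ D ⊕ ι 2 ⊗ ι ν ⊗ inv κ₁ ⊗ D ⊕ ι 4 ⊗ ι ν ⊗ ι c₁ ⊗ inv κ₂ ⊗ D ⊕ ι 8 ⊗ inv K₁ ⊗ D ⊕ ι 2 ⊗ (ι ν ⊗ (ι c₁ ⊗ ι (2 * (κ₂ * n)))) ⊗ G
          ≡⟨ cong₂ _⊕_ (cong₂ _⊕_ (cong₂ _⊕_ (cong₂ _⊕_ (cong₂ _⊕_ (cong (_⊗ D) x1) (cong (_⊗ D) x1)) (cong (_⊗ D) x2)) (cong (_⊗ D) x3)) (cong (_⊗ D) x4)) (cong (_⊗ G) (sym x6)) ⟩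
        inv μ ⊗ D ⊕ inv μ ⊗ D ⊕ inv μ ⊗ D ⊕ inv μ ⊗ D ⊕ inv μ ⊗ D ⊕ ι κ′ ⊗ G
          ≡⟨ solve 3 (λ i d g → i :* d :+ i :* d :+ i :* d :+ i :* d :+ i :* d :+ g := con (+ 5) :* i :* d :+ g) refl (inv μ) D (ι κ′ ⊗ G) ⟩
        ι 5 ⊗ inv μ ⊗ D ⊕ ι κ′ ⊗ G
          ≡⟨ cong (λ z → z ⊗ D ⊕ ι κ′ ⊗ G) x5 ⟩
        inv κ ⊗ D ⊕ ι κ′ ⊗ G ∎
        where
        open ≡-Reasoning

  weyl-suc : Weyl (suc d) κ
  weyl-suc = record { κ′ = κ′ ; q = q ; e = e ; Y = Y ; q≥1 = q1
    ; e≥1 = ≤-trans (1≤m* I.e≥1 e₁1) (m≤m+n _ _)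
    ; Y≥1 = ≤-trans n1 (m≤m+n n I.Y) ; bound = result }

weyl : ∀ d κ → 1 ≤ κ → Weyl (suc d) κ
weyl zero κ κ1 = weyl₁ κ κ1
weyl (suc d) κ κ1 = WeylStep.weyl-suc (suc d) (s≤s z≤n) (weyl d) κ κ1

Pol-cong : ∀ d {a a′ R R′} → a ≡ a′ → (∀ z → R z ≡ R′ z) → Pol d a R → Pol d a′ R′
Pol-cong zero refl q P = constant (λ z → trans (sym (q z)) (Pol-const P z))
Pol-cong (suc d) refl q P = differences (λ h h′ → Pol-cong d refl (λ z → cong₂ ℤ._-_ (q _) (q _)) (Pol-Δ P h h′))

Pol-add : ∀ d {a b R S} → Pol d a R → Pol d b S → Pol d (a ℤ.+ b) (λ z → R z ℤ.+ S z)
Pol-add zero P Q = constant (λ z → cong₂ ℤ._+_ (Pol-const P z) (Pol-const Q z))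
Pol-add (suc d) {a} {b} {R} {S} P Q = differences λ h h′ → Pol-cong d (sym (ℤP.*-distribˡ-+ (+ h ℤ.- + h′) a b)) (λ z → lem (R (h + z)) (R (h′ + z)) (S (h + z)) (S (h′ + z))) (Pol-add d (Pol-Δ P h h′) (Pol-Δ Q h h′))
  where lem : ∀ a b c d → (a ℤ.- b) ℤ.+ (c ℤ.- d) ≡ (a ℤ.+ c) ℤ.- (b ℤ.+ d)
        lem a b c d = ringℤ (a ∷ b ∷ c ∷ d ∷ []) (($0 ⊹ ~ $1) ⊹ ($2 ⊹ ~ $3)) (($0 ⊹ $2) ⊹ ~ ($1 ⊹ $3)) refl

Pol-scale : ∀ d c {a R} → Pol d a R → Pol d (c ℤ.* a) (λ z → c ℤ.* R z)
Pol-scale zero c P = constant (λ z → cong (c ℤ.*_) (Pol-const P z))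
Pol-scale (suc d) c {a} {R} P = differences λ h h′ → Pol-cong d (lem₁ c (+ h) (+ h′) a) (λ z → lem₂ c (R (h + z)) (R (h′ + z))) (Pol-scale d c (Pol-Δ P h h′))
  where
  lem₁ : ∀ c h h′ a → c ℤ.* ((h ℤ.- h′) ℤ.* a) ≡ (h ℤ.- h′) ℤ.* (c ℤ.* a)
  lem₁ c h h′ a = ringℤ (c ∷ h ∷ h′ ∷ a ∷ []) ($0 ⋆ (($1 ⊹ ~ $2) ⋆ $3)) (($1 ⊹ ~ $2) ⋆ ($0 ⋆ $3)) refl
  lem₂ : ∀ c a b → c ℤ.* (a ℤ.- b) ≡ c ℤ.* a ℤ.- c ℤ.* b
  lem₂ c a b = ringℤ (c ∷ a ∷ b ∷ []) ($0 ⋆ ($1 ⊹ ~ $2)) ($0 ⋆ $1 ⊹ ~ ($0 ⋆ $2)) refl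

Pol-shift : ∀ d h {a R} → Pol d a R → Pol d a (λ z → R (h + z))
Pol-shift zero h P = constant (λ z → Pol-const P (h + z))
Pol-shift (suc d) h {a} {R} P = differences λ k k′ → Pol-cong d (cong (ℤ._* a) (trans (cong₂ ℤ._-_ (ℤP.pos-+ h k) (ℤP.pos-+ h k′)) (lem (+ h) (+ k) (+ k′))))
   (λ z → cong₂ (λ u v → R u ℤ.- R v) (+-assoc h k z) (+-assoc h k′ z)) (Pol-Δ P (h + k) (h + k′))
  where lem : ∀ h k k′ → (h ℤ.+ k) ℤ.- (h ℤ.+ k′) ≡ k ℤ.- k′
        lem h k k′ = ringℤ (h ∷ k ∷ k′ ∷ []) (($0 ⊹ $1) ⊹ ~ ($0 ⊹ $2)) ($1 ⊹ ~ $2) refl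

Pol-lift : ∀ d {a R} → Pol d a R → Pol (suc d) (+ 0) R
Pol-lift d {a} {R} P = differences λ h h′ → Pol-cong d (trans (lem a) (sym (ℤP.*-zeroʳ (+ h ℤ.- + h′)))) (λ z → lem₂ (R (h + z)) (R (h′ + z))) (Pol-add d (Pol-shift d h P) (Pol-scale d (ℤ.- + 1) (Pol-shift d h′ P)))
  where
  lem : ∀ a → a ℤ.+ (ℤ.- + 1) ℤ.* a ≡ + 0
  lem a = ringℤ (a ∷ []) ($0 ⊹ (~ ⟨ 1 ⟩) ⋆ $0) (⟨ 0 ⟩) refl
  lem₂ : ∀ a b → a ℤ.+ (ℤ.- + 1) ℤ.* b ≡ a ℤ.- b
  lem₂ a b = ringℤ (a ∷ b ∷ []) ($0 ⊹ (~ ⟨ 1 ⟩) ⋆ $1) ($0 ⊹ ~ $1) refl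

-- Leibniz rule: a difference of the product is the affine factor times a difference of `R`, of
-- degree one less and treated by induction, plus multiples of translates of `R`. Each step adds one
-- more `b a` to the leading difference, whence the factor `suc d`.
Pol-affine* : ∀ d x b {a R} → Pol d a R → Pol (suc d) (+ suc d ℤ.* b ℤ.* a) (λ u → (x ℤ.+ b ℤ.* + u) ℤ.* R u)
Pol-affine* zero x b {a} {R} P = differences λ h h′ → constant λ z → trans (cong₂ (λ r r′ → (x ℤ.+ b ℤ.* + (h + z)) ℤ.* r ℤ.- (x ℤ.+ b ℤ.* + (h′ + z)) ℤ.* r′) (Pol-const P (h + z)) (Pol-const P (h′ + z)))
     (trans (cong₂ (λ u v → (x ℤ.+ b ℤ.* u) ℤ.* a ℤ.- (x ℤ.+ b ℤ.* v) ℤ.* a) (ℤP.pos-+ h z) (ℤP.pos-+ h′ z)) (lem x b a (+ h) (+ h′) (+ z)))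
  where lem : ∀ x b a h h′ z → (x ℤ.+ b ℤ.* (h ℤ.+ z)) ℤ.* a ℤ.- (x ℤ.+ b ℤ.* (h′ ℤ.+ z)) ℤ.* a ≡ (h ℤ.- h′) ℤ.* (+ 1 ℤ.* b ℤ.* a)
        lem x b a h h′ z = ringℤ (x ∷ b ∷ a ∷ h ∷ h′ ∷ z ∷ []) (($0 ⊹ $1 ⋆ ($3 ⊹ $5)) ⋆ $2 ⊹ ~ (($0 ⊹ $1 ⋆ ($4 ⊹ $5)) ⋆ $2)) (($3 ⊹ ~ $4) ⋆ (⟨ 1 ⟩ ⋆ $1 ⋆ $2)) refl
Pol-affine* (suc d) x b {a} {R} P = differences λ h h′ → Pol-cong (suc d) (lead h h′) (val h h′)
   (Pol-add (suc d) (Pol-affine* d x b (Pol-Δ P h h′)) (Pol-add (suc d) (Pol-scale (suc d) (b ℤ.* + h) (Pol-shift (suc d) h P)) (Pol-scale (suc d) (ℤ.- (b ℤ.* + h′)) (Pol-shift (suc d) h′ P))))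
  where
  lead : ∀ h h′ → + suc d ℤ.* b ℤ.* ((+ h ℤ.- + h′) ℤ.* a) ℤ.+ (b ℤ.* + h ℤ.* a ℤ.+ ℤ.- (b ℤ.* + h′) ℤ.* a) ≡ (+ h ℤ.- + h′) ℤ.* (+ suc (suc d) ℤ.* b ℤ.* a)
  lead h h′ = trans (lem (+ suc d) b (+ h) (+ h′) a) (cong (λ z → (+ h ℤ.- + h′) ℤ.* (z ℤ.* b ℤ.* a)) (sym (ℤP.pos-+ 1 (suc d))))
    where lem : ∀ D b h h′ a → D ℤ.* b ℤ.* ((h ℤ.- h′) ℤ.* a) ℤ.+ (b ℤ.* h ℤ.* a ℤ.+ ℤ.- (b ℤ.* h′) ℤ.* a) ≡ (h ℤ.- h′) ℤ.* ((+ 1 ℤ.+ D) ℤ.* b ℤ.* a)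
          lem D b h h′ a = ringℤ (D ∷ b ∷ h ∷ h′ ∷ a ∷ []) ($0 ⋆ $1 ⋆ (($2 ⊹ ~ $3) ⋆ $4) ⊹ ($1 ⋆ $2 ⋆ $4 ⊹ ~ ($1 ⋆ $3) ⋆ $4)) (($2 ⊹ ~ $3) ⋆ ((⟨ 1 ⟩ ⊹ $0) ⋆ $1 ⋆ $4)) refl
  val : ∀ h h′ z → (x ℤ.+ b ℤ.* + z) ℤ.* (R (h + z) ℤ.- R (h′ + z)) ℤ.+ (b ℤ.* + h ℤ.* R (h + z) ℤ.+ ℤ.- (b ℤ.* + h′) ℤ.* R (h′ + z))
        ≡ (x ℤ.+ b ℤ.* + (h + z)) ℤ.* R (h + z) ℤ.- (x ℤ.+ b ℤ.* + (h′ + z)) ℤ.* R (h′ + z)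
  val h h′ z = trans (lem x b (+ z) (+ h) (+ h′) (R (h + z)) (R (h′ + z))) (cong₂ (λ u v → (x ℤ.+ b ℤ.* u) ℤ.* R (h + z) ℤ.- (x ℤ.+ b ℤ.* v) ℤ.* R (h′ + z)) (sym (ℤP.pos-+ h z)) (sym (ℤP.pos-+ h′ z)))
    where lem : ∀ x b z h h′ r s → (x ℤ.+ b ℤ.* z) ℤ.* (r ℤ.- s) ℤ.+ (b ℤ.* h ℤ.* r ℤ.+ ℤ.- (b ℤ.* h′) ℤ.* s) ≡ (x ℤ.+ b ℤ.* (h ℤ.+ z)) ℤ.* r ℤ.- (x ℤ.+ b ℤ.* (h′ ℤ.+ z)) ℤ.* s
          lem x b z h h′ r s = ringℤ (x ∷ b ∷ z ∷ h ∷ h′ ∷ r ∷ s ∷ []) (($0 ⊹ $1 ⋆ $2) ⋆ ($5 ⊹ ~ $6) ⊹ ($1 ⋆ $3 ⋆ $5 ⊹ ~ ($1 ⋆ $4) ⋆ $6)) (($0 ⊹ $1 ⋆ ($3 ⊹ $2)) ⋆ $5 ⊹ ~ (($0 ⊹ $1 ⋆ ($4 ⊹ $2)) ⋆ $6)) refl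

Pol-pow : ∀ d x b → Pol d (+ (d ! * b ^ d)) (λ u → (x ℤ.+ + b ℤ.* + u) ℤ.^ d)
Pol-pow zero x b = constant (λ z → refl)
Pol-pow (suc d) x b = Pol-cong (suc d) lead (λ _ → refl) (Pol-affine* d x (+ b) (Pol-pow d x b))
  where lead : + suc d ℤ.* + b ℤ.* + (d ! * b ^ d) ≡ + (suc d ! * b ^ suc d)
        lead = trans (cong (ℤ._* + (d ! * b ^ d)) (sym (ℤP.pos-* (suc d) b))) (trans (sym (ℤP.pos-* (suc d * b) (d ! * b ^ d))) (cong +_ (lem (suc d) b (d !) (b ^ d))))
          where lem : ∀ s b f p → s * b * (f * p) ≡ s * f * (b * p)
                lem s b f p = ringℕ (s ∷ b ∷ f ∷ p ∷ []) ($0 ⋆ $1 ⋆ ($2 ⋆ $3)) ($0 ⋆ $2 ⋆ ($1 ⋆ $3)) refl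

-- The coefficients form a sequence rather than a vector, so that the inductions on the degree can
-- drop the top term and keep `a`.
ev : ℕ → (ℕ → ℤ) → ℤ → ℤ
ev zero a x = a 0
ev (suc d) a x = ev d a x ℤ.+ a (suc d) ℤ.* x ℤ.^ suc d

Pol-ev : ∀ d a x b → Pol d (a d ℤ.* + (d ! * b ^ d)) (λ u → ev d a (x ℤ.+ + b ℤ.* + u))
Pol-ev zero a x b = constant (λ z → sym (ℤP.*-identityʳ (a 0)))
Pol-ev (suc d) a x b = Pol-cong (suc d) (ℤP.+-identityˡ _) (λ _ → refl) (Pol-add (suc d) (Pol-lift d (Pol-ev d a x b)) (Pol-scale (suc d) (a (suc d)) (Pol-pow (suc d) x b)))

pow-diff : ∀ n X (q t B : ℕ) → ℤ.∣ X ∣ + q * t ≤ B → ∃ λ j → (X ℤ.+ + q ℤ.* + t) ℤ.^ suc n ≡ X ℤ.^ suc n ℤ.+ + q ℤ.* j × ℤ.∣ j ∣ ≤ suc n * (t * B ^ n)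
pow-diff zero X q t B h = + t , lem X (+ q ℤ.* + t) , ≤-reflexive (sym (trans (+-identityʳ _) (*-identityʳ t)))
  where lem : ∀ X u → (X ℤ.+ u) ℤ.* + 1 ≡ X ℤ.* + 1 ℤ.+ u
        lem X u = ringℤ (X ∷ u ∷ []) (($0 ⊹ $1) ⋆ ⟨ 1 ⟩) ($0 ⋆ ⟨ 1 ⟩ ⊹ $1) refl
pow-diff (suc n) X q t B h with pow-diff n X q t B h
... | j , eq , le = + t ℤ.* X ℤ.^ suc n ℤ.+ W ℤ.* j ,
    trans (cong (W ℤ.*_) eq) (lem X (+ q) (+ t) (X ℤ.^ suc n) j) ,
    ≤-trans (ℤP.∣i+j∣≤∣i∣+∣j∣ (+ t ℤ.* X ℤ.^ suc n) (W ℤ.* j)) (+-mono-≤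
      (≤-trans (≤-reflexive (ℤP.abs-* (+ t) (X ℤ.^ suc n))) (*-monoʳ-≤ t (pw X (suc n) (≤-trans (m≤m+n _ _) h))))
      (≤-trans (≤-reflexive (ℤP.abs-* W j)) (≤-trans (*-mono-≤ W≤ le) (≤-reflexive (lem₂ B (suc n) t (B ^ n))))))
  where
  W : ℤ
  W = X ℤ.+ + q ℤ.* + t
  W≤ : ℤ.∣ W ∣ ≤ B
  W≤ = ≤-trans (ℤP.∣i+j∣≤∣i∣+∣j∣ X (+ q ℤ.* + t)) (≤-trans (+-monoʳ-≤ ℤ.∣ X ∣ (≤-reflexive (ℤP.abs-* (+ q) (+ t)))) h)
  pw : ∀ X n → ℤ.∣ X ∣ ≤ B → ℤ.∣ X ℤ.^ n ∣ ≤ B ^ n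
  pw X zero _ = ≤-refl
  pw X (suc n) h = ≤-trans (≤-reflexive (ℤP.abs-* X (X ℤ.^ n))) (*-mono-≤ h (pw X n h))
  lem : ∀ X q t P j → (X ℤ.+ q ℤ.* t) ℤ.* (P ℤ.+ q ℤ.* j) ≡ X ℤ.* P ℤ.+ q ℤ.* (t ℤ.* P ℤ.+ (X ℤ.+ q ℤ.* t) ℤ.* j)
  lem X q t P j = ringℤ (X ∷ q ∷ t ∷ P ∷ j ∷ []) (($0 ⊹ $1 ⋆ $2) ⋆ ($3 ⊹ $1 ⋆ $4)) ($0 ⋆ $3 ⊹ $1 ⋆ ($2 ⋆ $3 ⊹ ($0 ⊹ $1 ⋆ $2) ⋆ $4)) refl
  lem₂ : ∀ B n t P → B * (n * (t * P)) ≡ n * (t * (B * P))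
  lem₂ B n t P = ringℕ (B ∷ n ∷ t ∷ P ∷ []) ($0 ⋆ ($1 ⋆ ($2 ⋆ $3))) ($1 ⋆ ($2 ⋆ ($0 ⋆ $3))) refl

quot-scale : ∀ p Z → 1 ≤ p → p ≤ Z → ∃ λ V → 1 ≤ V × p * V ≤ Z × Z ≤ 2 * p * V
quot-scale (suc p) Z _ pZ = V , V1 , ≤-trans (≤-reflexive (*-comm (suc p) V)) (ℕDM.m/n*n≤m Z (suc p)) ,
   ≤-trans (≤-reflexive (ℕDM.m≡m%n+[m/n]*n Z (suc p))) (≤-trans (+-monoˡ-≤ (V * suc p) (≤-trans (<⇒≤ (ℕDM.m%n<n Z (suc p))) (m≤n*m (suc p) V1)))
     (≤-reflexive (lem V (suc p))))
  where
  V = Z ℕ./ suc p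
  V1 : 1 ≤ V
  V1 = ℕDM.m≥n⇒m/n>0 pZ
  lem : ∀ V p → V * p + V * p ≡ 2 * p * V
  lem V p = ringℕ (V ∷ p ∷ []) ($0 ⋆ $1 ⊹ $0 ⋆ $1) (⟨ 2 ⟩ ⋆ $1 ⋆ $0) refl

module Products (𝕊 : Sys) where
  open Ops 𝕊 using (V; M)
  open Absorption 𝕊 using (Op; Op-id; Op-comp; Op-M; ap)

  -- One progression for each degree from 1 to `d`. The product absorbs any sum of translations
  -- `a j * q * t` with `t` small against `y ^ j`, and such a sum is exactly what a polynomial gains
  -- when its argument moves by a multiple of `q`.
  PM : ℕ → (ℕ → ℤ) → ℕ → ℕ → V → V
  PM zero a q y f = f
  PM (suc d) a q y f = PM d a q y (M (a (suc d) ℤ.* + q) (y ^ suc d) f)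

  Op-PM : ∀ (d : ℕ) (a : ℕ → ℤ) (q y : ℕ) → 1 ≤ y → Op
  Op-PM zero a q y y1 = Op-id
  Op-PM (suc d) a q y y1 = Op-comp (Op-PM d a q y y1) (Op-M (a (suc d) ℤ.* + q) (y ^ suc d) (1≤^ (suc d) y1))

  ap-PM : ∀ (d : ℕ) (a : ℕ → ℤ) (q y : ℕ) (y1 : 1 ≤ y) f → ap (Op-PM d a q y y1) f ≡ PM d a q y f
  ap-PM zero a q y y1 f = refl
  ap-PM (suc d) a q y y1 f = ap-PM d a q y y1 _

-- The Weyl bound with the whole product `PM` instead of the leading progression alone. Sampling
-- along `x + b u` is built in because the induction on the degree passes to subprogressions; `c₀`
-- controls their starting points relative to `Z`.
record Prog (d κ b c₀ : ℕ) : Set₁ where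
  field
    κ′ q e Y t : ℕ
    q≡ : q ≡ b * t
    t≥1 : 1 ≤ t
    e≥1 : 1 ≤ e
    Y≥1 : 1 ≤ Y
    bound : ∀ (𝕊 : Sys) (f : Ops.V 𝕊) a x y Z → Y ≤ y → e * y ≤ Z → ℤ.∣ x ∣ ≤ c₀ * Z →
      Ops.N 𝕊 (Ops.Av 𝕊 Z (λ u → ev d a (x ℤ.+ + b ℤ.* + u)) f) ≼ inv κ ⊗ Ops.N 𝕊 f ⊕ ι κ′ ⊗ Ops.N 𝕊 (Products.PM 𝕊 d a q y f)

prog₀ : ∀ κ b c₀ → 1 ≤ κ → 1 ≤ b → Prog 0 κ b c₀
prog₀ κ b c₀ κ1 b1 = record { κ′ = 1 ; q = b ; e = 1 ; Y = 1 ; t = 1 ; q≡ = sym (*-identityʳ b) ; t≥1 = s≤s z≤n ; e≥1 = s≤s z≤n ; Y≥1 = s≤s z≤n ; bound = bound }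
  where
  bound : ∀ (𝕊 : Sys) (f : Ops.V 𝕊) a x y Z → 1 ≤ y → 1 * y ≤ Z → ℤ.∣ x ∣ ≤ c₀ * Z →
      Ops.N 𝕊 (Ops.Av 𝕊 Z (λ u → ev 0 a (x ℤ.+ + b ℤ.* + u)) f) ≼ inv κ ⊗ Ops.N 𝕊 f ⊕ ι 1 ⊗ Ops.N 𝕊 (Products.PM 𝕊 0 a b y f)
  bound 𝕊 f a x y Z y1 yZ _ = ≼-trans (≼-reflexive (trans (N-cong (λ x → avg-const Z _ (≤-trans y1 (≤-trans (≤-reflexive (sym (*-identityˡ y))) yZ)))) (N-T (a 0) f)))
      (≼-add (⊗-nonneg (0≼inv κ) (N-nonneg f)) (trans (cong (λ z → inv κ ⊗ N f ⊕ z ⊗ N f) ιℤ-1) (trans (cong (inv κ ⊗ N f ⊕_) (⊗-idˡ (N f))) (⊕-comm _ _))))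
    where
    open Ops 𝕊 using (N; N-cong; N-nonneg; N-T)

-- Let `g` be the average of `f` along the progression of the top coefficient. The Weyl bound makes
-- the contribution of `f - g` small. For `g` the top term is nearly constant: as the argument moves
-- through a short block in steps of `q″`, that term changes by `s` times a small number, which `g`
-- absorbs. What is left has degree `d`.
module ProgStep (d : ℕ) (IH : ∀ κ b c₀ → 1 ≤ κ → 1 ≤ b → Prog d κ b c₀) (κ b c₀ : ℕ) (κ1 : 1 ≤ κ) (b1 : 1 ≤ b) where
  μ κ₁ : ℕ
  -- Six errors of size ‖f‖² / `μ` are added up in `fin`.
  μ = 6 * κ
  κ₁ = 8 * μ
  μ1 : 1 ≤ μ
  μ1 = 1≤m* {6} (s≤s z≤n) κ1
  κ₁1 : 1 ≤ κ₁
  κ₁1 = 1≤m* {8} (s≤s z≤n) μ1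
  module W = Weyl (weyl d κ₁ κ₁1)
  cW K K₁ K₂ g″ q″ p₁ p₂ c₁ Q p : ℕ
  cW = suc W.κ′
  K = 8 * cW * μ
  K₁ = 16 * μ
  K₂ = 32 * μ
  g″ = suc d ! * b ^ suc d
  q″ = g″ * W.q
  p₁ = W.e * K
  p₂ = 2 * p₁
  c₁ = c₀ + b
  Q = K₂ * (suc d * (b * (((c₁ + 1) * p₂) ^ d)))
  -- Blocks have length about `Z / p`. The three summands keep the change of the top term small
  -- against `L₂`, the block short against `Z`, and all arguments below `(c₁ + 1) Z`.
  p = p₂ * Q + K₁ * q″ + q″ * b
  K1 : 1 ≤ K
  K1 = 1≤m* {8 * cW} (1≤m* {8} {cW} (s≤s z≤n) (s≤s z≤n)) μ1
  K₁1 : 1 ≤ K₁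
  K₁1 = 1≤m* {16} (s≤s z≤n) μ1
  K₂1 : 1 ≤ K₂
  K₂1 = 1≤m* {32} (s≤s z≤n) μ1
  q″1 : 1 ≤ q″
  q″1 = 1≤m* (1≤m* (1≤n! (suc d)) (1≤^ (suc d) b1)) W.q≥1
  p₁1 : 1 ≤ p₁
  p₁1 = 1≤m* W.e≥1 K1
  p₂1 : 1 ≤ p₂
  p₂1 = 1≤m* {2} (s≤s z≤n) p₁1
  p1 : 1 ≤ p
  p1 = ≤-trans (1≤m* q″1 b1) (m≤n+m (q″ * b) _)
  module r = Prog (IH κ₁ (b * q″) (c₁ * (2 * p)) κ₁1 (1≤m* b1 q″1))
  cr K₃ t₃ e Y κ′ : ℕ
  cr = suc r.κ′
  K₃ = 64 * cr * μ
  t₃ = b * r.t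
  e = 2 * p * r.e + p₂ * (K₃ * t₃)
  Y = W.Y + r.Y
  κ′ = 16 * cr
  K₃1 : 1 ≤ K₃
  K₃1 = 1≤m* {64 * cr} (1≤m* {64} {cr} (s≤s z≤n) (s≤s z≤n)) μ1
  t₃1 : 1 ≤ t₃
  t₃1 = 1≤m* b1 r.t≥1
  qr≡ : r.q ≡ q″ * t₃
  qr≡ = trans r.q≡ (lem b q″ r.t)
    where lem : ∀ b q t → b * q * t ≡ q * (b * t)
          lem b q t = ringℕ (b ∷ q ∷ t ∷ []) ($0 ⋆ $1 ⋆ $2) ($1 ⋆ ($0 ⋆ $2)) refl

  module _ (𝕊 : Sys) where
   open Sys 𝕊 using (X; act; act-+)
   open Ops 𝕊 using (V; _⊟_; N; T; A; Av; step; M; N-cong; N-nonneg; N-T; N-sub; N-via; N-sub-sym; N-A-≼; A-shift)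
   open Absorption 𝕊 using (Op; Op-comp; Op-Av; Op-M; ap-sub; ap-Av; Abs; abs-post; abs-avg; abs-M; ap; ap-T; ap-N)
   open Products 𝕊 using (PM; Op-PM; ap-PM)

   module _ (f : V) (a : ℕ → ℤ) (x : ℤ) (y Z : ℕ) (Yy : Y ≤ y) (ez : e * y ≤ Z) (xb : ℤ.∣ x ∣ ≤ c₀ * Z) where
    y1 : 1 ≤ y
    y1 = ≤-trans W.Y≥1 (≤-trans (m≤m+n W.Y r.Y) Yy)
    e≤Z : e ≤ Z
    e≤Z = ≤-trans (m≤m*n e y1) ez
    p≤Z : p ≤ Z
    p≤Z = ≤-trans (≤-trans (m≤n*m p {2} (s≤s z≤n)) (≤-trans (m≤m*n (2 * p) r.e≥1) (m≤m+n (2 * p * r.e) _))) e≤Z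
    p₁≤Z : p₁ ≤ Z
    p₁≤Z = ≤-trans (≤-trans (m≤n*m p₁ {2} (s≤s z≤n)) (≤-trans (m≤m*n p₂ (1≤m* K₃1 t₃1)) (m≤n+m _ (2 * p * r.e)))) e≤Z
    Vd = quot-scale p Z p1 p≤Z
    yd = quot-scale p₁ Z p₁1 p₁≤Z
    Vn y₂ : ℕ
    Vn = proj₁ Vd
    V1 : 1 ≤ Vn
    V1 = proj₁ (proj₂ Vd)
    pV≤ : p * Vn ≤ Z
    pV≤ = proj₁ (proj₂ (proj₂ Vd))
    ≤pV : Z ≤ 2 * p * Vn
    ≤pV = proj₂ (proj₂ (proj₂ Vd))
    y₂ = proj₁ yd
    p₁y₂≤ : p₁ * y₂ ≤ Z
    p₁y₂≤ = proj₁ (proj₂ (proj₂ yd))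
    ≤p₂y₂ : Z ≤ p₂ * y₂
    ≤p₂y₂ = proj₂ (proj₂ (proj₂ yd))
    y₂1 : 1 ≤ y₂
    y₂1 = proj₁ (proj₂ yd)
    Z1 : 1 ≤ Z
    Z1 = ≤-trans p1 p≤Z
    y₂≥ : K₃ * t₃ * y ≤ y₂
    y₂≥ = *-cancelˡ-≤ p₂ {{ℕ.>-nonZero p₂1}} (≤-trans (≤-reflexive (sym (*-assoc p₂ (K₃ * t₃) y))) (≤-trans (*-monoˡ-≤ y (m≤n+m (p₂ * (K₃ * t₃)) (2 * p * r.e))) (≤-trans ez ≤p₂y₂)))
    yW : ℕ
    yW = K * y₂
    yW≥ : W.Y ≤ yW
    yW≥ = ≤-trans (≤-trans (m≤m+n W.Y r.Y) Yy) (≤-trans (m≤n*m y (1≤m* K₃1 t₃1)) (≤-trans y₂≥ (m≤n*m y₂ K1)))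
    eWyW : W.e * yW ≤ Z
    eWyW = ≤-trans (≤-reflexive (sym (*-assoc W.e K y₂))) p₁y₂≤
    yW1 : 1 ≤ yW
    yW1 = 1≤m* K1 y₂1
    Vr : r.e * y ≤ Vn
    Vr = *-cancelˡ-≤ (2 * p) {{ℕ.>-nonZero (1≤m* {2} (s≤s z≤n) p1)}} (≤-trans (≤-reflexive (sym (*-assoc (2 * p) r.e y))) (≤-trans (*-monoˡ-≤ y (m≤m+n (2 * p * r.e) _)) (≤-trans ez ≤pV)))
    D G : F
    D = N f
    G = N (PM (suc d) a r.q y f)
    a⁺ s : ℤ
    a⁺ = a (suc d)
    s = a⁺ ℤ.* + q″
    L₂ LW : ℕ
    L₂ = y₂ ^ suc d
    LW = yW ^ suc d
    L₂1 : 1 ≤ L₂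
    L₂1 = 1≤^ (suc d) y₂1
    LW1 : 1 ≤ LW
    LW1 = 1≤^ (suc d) yW1
    OM₂ = Op-M s L₂ L₂1
    g : V
    g = M s L₂ f
    gN : N g ≼ D
    gN = ap-N OM₂ f
    h : ℕ → ℤ
    h u = ev (suc d) a (x ℤ.+ + b ℤ.* + u)
    OΦ = Op-Av Z Z1 h
    KL₂ : K * L₂ ≤ LW
    KL₂ = ≤-trans (*-monoˡ-≤ L₂ (m≤m^ K (suc d) (s≤s z≤n) K1)) (≤-reflexive (sym (*-^ K y₂ (suc d))))
    -- The progression of length `LW` absorbs all shifts of the one of length `L₂`, which is at most
    -- `LW / K`. So it nearly annihilates `f - g`.
    partA : N (Av Z h (f ⊟ g)) ≼ inv κ₁ ⊗ (ι 4 ⊗ D) ⊕ ι cW ⊗ (ι 4 ⊗ inv K ⊗ D)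
    partA = ≼-trans (W.bound 𝕊 (f ⊟ g) (a⁺ ℤ.* + g″) h (Pol-ev (suc d) a x b) yW Z yW≥ eWyW)
       (⊕-mono (⊗-monoˡ (0≼inv κ₁) (≼-trans (N-sub f g) (≼-trans (⊕-mono ≼-refl (⊗-monoˡ (0≼ι 2) gN)) (≼-reflexive (solve 1 (λ d → con (+ 2) :* d :+ con (+ 2) :* d := con (+ 4) :* d) refl D)))))
         (⊗-mono (0≼ι cW) (N-nonneg _) (ι-mono (n≤1+n W.κ′)) (subst (λ z → N (M z LW (f ⊟ g)) ≼ ι 4 ⊗ inv K ⊗ D) (sym sW)
           (abs-avg (Op-M s LW LW1) L₂ (step s) L₂1 (λ l l<L → abs-M s LW LW1 K (+ l) K1 (≤-trans (*-monoʳ-≤ K (<⇒≤ l<L)) KL₂)) f))))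
      where sW : a⁺ ℤ.* + g″ ℤ.* + W.q ≡ s
            sW = trans (ℤP.*-assoc a⁺ (+ g″) (+ W.q)) (cong (a⁺ ℤ.*_) (sym (ℤP.pos-* g″ W.q)))
    w : ℕ → V
    w u = T (h u) g
    smooth : N (A Z w ⊟ A Z (λ u → A Vn (λ v → w (q″ * v + u)))) ≼ ι 4 ⊗ inv K₁ ⊗ D
    smooth = ≼-trans (≼-reflexive (N-cong (λ x → trans (cong (A Z w x ⊝_) (avg-swap Z Vn _)) (trans (cong (_⊝ A Vn (λ v → A Z (λ u → w (q″ * v + u))) x) (sym (avg-const Vn (A Z w x) V1))) (sym (avg-sub Vn _ _))))))
       (N-A-≼ Vn (λ v → A Z w ⊟ A Z (λ u → w (q″ * v + u))) V1 (λ v v<V → ≼-trans (A-shift Z (q″ * v) w (N-nonneg f) (λ u → ≼-trans (≼-reflexive (N-T (h u) g)) gN))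
         (⊗-monoʳ (N-nonneg f) (⊗-monoˡ (0≼ι 4) (r² v v<V)))))
      where
      rr : ∀ v → v < Vn → ι (q″ * v) ⊗ inv Z ≼ inv K₁
      rr v v<V = ι⊗inv≼ K₁ (q″ * v) Z K₁1 (≤-trans (≤-trans (≤-reflexive (sym (*-assoc K₁ q″ v))) (*-mono-≤ (≤-trans (m≤n+m (K₁ * q″) (p₂ * Q)) (m≤m+n _ (q″ * b))) (<⇒≤ v<V))) pV≤) Z1
      r² : ∀ v → v < Vn → (ι (q″ * v) ⊗ inv Z) ⊗ (ι (q″ * v) ⊗ inv Z) ≼ inv K₁
      r² v v<V = ≼-trans (⊗-mono (0≼inv K₁) (0≼ιinv (q″ * v) Z) (rr v v<V) (rr v v<V)) (≼-trans (⊗-monoˡ (0≼inv K₁) (inv≼1 K₁ K₁1)) (≼-reflexive (⊗-idʳ _)))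
    Inner : F
    Inner = ι 2 ⊗ (inv κ₁ ⊗ D ⊕ ι cr ⊗ (ι 2 ⊗ G ⊕ ι 2 ⊗ (ι 4 ⊗ inv K₃ ⊗ D))) ⊕ ι 2 ⊗ (ι 4 ⊗ inv K₂ ⊗ D)
    -- Within the block the top term is frozen at its value `c` for `v = 0`; `near` is the price,
    -- and `main` applies the induction to the rest.
    inner : ∀ u → u < Z → N (A Vn (λ v → w (q″ * v + u))) ≼ Inner
    inner u u<Z = ≼-trans (N-via _ (A Vn flat)) (⊕-mono (⊗-monoˡ (0≼ι 2) main) (⊗-monoˡ (0≼ι 2) near))
      where
      x′ c : ℤ
      x′ = x ℤ.+ + b ℤ.* + u
      c = a⁺ ℤ.* x′ ℤ.^ suc d
      h′ : ℕ → ℤ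
      h′ v = ev d a (x′ ℤ.+ + (b * q″) ℤ.* + v)
      flat : ℕ → V
      flat v = T (h′ v ℤ.+ c) g
      x′b : ℤ.∣ x′ ∣ ≤ c₁ * Z
      x′b = ≤-trans (ℤP.∣i+j∣≤∣i∣+∣j∣ x (+ b ℤ.* + u)) (≤-trans (+-mono-≤ xb (≤-trans (≤-reflexive (ℤP.abs-* (+ b) (+ u))) (*-monoʳ-≤ b (<⇒≤ u<Z)))) (≤-reflexive (sym (*-distribʳ-+ Z c₀ b))))
      near : N (A Vn (λ v → w (q″ * v + u)) ⊟ A Vn flat) ≼ ι 4 ⊗ inv K₂ ⊗ D
      near = ≼-trans (≼-reflexive (N-cong (λ x → sym (avg-sub Vn _ _)))) (N-A-≼ Vn (λ v → w (q″ * v + u) ⊟ flat v) V1 each)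
        where
        each : ∀ v → v < Vn → N (w (q″ * v + u) ⊟ flat v) ≼ ι 4 ⊗ inv K₂ ⊗ D
        each v v<V = ≼-trans (≼-reflexive (trans (N-sub-sym _ _) (trans (N-cong e₁) (trans (N-T (h′ v ℤ.+ c) _) (N-cong (λ z → sym (trans (ap-sub OM₂ f (T (s ℤ.* j) f) z) (cong (g z ⊝_) (ap-T OM₂ (s ℤ.* j) f z)))))))))
            (abs-M s L₂ L₂1 K₂ j K₂1 jb f)
          where
          Bd : ℕ
          Bd = (c₁ + 1) * Z
          qtB : ℤ.∣ x′ ∣ + q″ * (b * v) ≤ Bd
          qtB = ≤-trans (+-mono-≤ x′b (≤-trans (≤-reflexive (sym (*-assoc q″ b v))) (≤-trans (*-mono-≤ (m≤n+m (q″ * b) (p₂ * Q + K₁ * q″)) (<⇒≤ v<V)) pV≤))) (≤-reflexive (lem c₁ Z))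
            where lem : ∀ c Z → c * Z + Z ≡ (c + 1) * Z
                  lem c Z = ringℕ (c ∷ Z ∷ []) ($0 ⋆ $1 ⊹ $1) (($0 ⊹ ⟨ 1 ⟩) ⋆ $1) refl
          pd = pow-diff d x′ q″ (b * v) Bd qtB
          j : ℤ
          j = proj₁ pd
          QV : Q * Vn ≤ y₂
          QV = *-cancelˡ-≤ p₂ {{ℕ.>-nonZero p₂1}} (≤-trans (≤-reflexive (sym (*-assoc p₂ Q Vn))) (≤-trans (*-monoˡ-≤ Vn (≤-trans (m≤m+n (p₂ * Q) (K₁ * q″)) (m≤m+n _ (q″ * b)))) (≤-trans pV≤ ≤p₂y₂)))
          jb : K₂ * ℤ.∣ j ∣ ≤ L₂
          jb = ≤-trans (*-monoʳ-≤ K₂ (≤-trans (proj₂ (proj₂ pd)) (*-monoʳ-≤ (suc d) (*-mono-≤ (*-monoʳ-≤ b (<⇒≤ v<V))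
                 (≤-trans (^-monoˡ-≤ d (≤-trans (*-monoʳ-≤ (c₁ + 1) ≤p₂y₂) (≤-reflexive (sym (*-assoc (c₁ + 1) p₂ y₂))))) (≤-reflexive (*-^ ((c₁ + 1) * p₂) y₂ d)))))))
               (≤-trans (≤-reflexive (lem K₂ (suc d) b Vn (((c₁ + 1) * p₂) ^ d) (y₂ ^ d))) (*-monoˡ-≤ (y₂ ^ d) QV))
            where lem : ∀ K s b V P Y → K * (s * (b * V * (P * Y))) ≡ K * (s * (b * P)) * V * Y
                  lem K s b V P Y = ringℕ (K ∷ s ∷ b ∷ V ∷ P ∷ Y ∷ []) ($0 ⋆ ($1 ⋆ ($2 ⋆ $3 ⋆ ($4 ⋆ $5)))) ($0 ⋆ ($1 ⋆ ($2 ⋆ $4)) ⋆ $3 ⋆ $5) refl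
          arg : x ℤ.+ + b ℤ.* + (q″ * v + u) ≡ x′ ℤ.+ + (b * q″) ℤ.* + v
          arg = trans (cong (λ z → x ℤ.+ + b ℤ.* z) (trans (ℤP.pos-+ (q″ * v) u) (cong (ℤ._+ + u) (ℤP.pos-* q″ v)))) (trans (lem x (+ b) (+ q″) (+ v) (+ u)) (cong (λ z → x′ ℤ.+ z ℤ.* + v) (sym (ℤP.pos-* b q″))))
            where lem : ∀ x b q v u → x ℤ.+ b ℤ.* (q ℤ.* v ℤ.+ u) ≡ x ℤ.+ b ℤ.* u ℤ.+ (b ℤ.* q) ℤ.* v
                  lem x b q v u = ringℤ (x ∷ b ∷ q ∷ v ∷ u ∷ []) ($0 ⊹ $1 ⋆ ($2 ⋆ $3 ⊹ $4)) ($0 ⊹ $1 ⋆ $4 ⊹ ($1 ⋆ $2) ⋆ $3) refl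
          arg₂ : x′ ℤ.+ + (b * q″) ℤ.* + v ≡ x′ ℤ.+ + q″ ℤ.* + (b * v)
          arg₂ = cong (λ z → x′ ℤ.+ z) (trans (sym (ℤP.pos-* (b * q″) v)) (trans (cong +_ (lem b q″ v)) (ℤP.pos-* q″ (b * v))))
            where lem : ∀ b q v → b * q * v ≡ q * (b * v)
                  lem b q v = ringℕ (b ∷ q ∷ v ∷ []) ($0 ⋆ $1 ⋆ $2) ($1 ⋆ ($0 ⋆ $2)) refl
          hh : h (q″ * v + u) ≡ s ℤ.* j ℤ.+ (h′ v ℤ.+ c)
          hh = trans (cong (ev (suc d) a) arg) (trans (cong (λ z → h′ v ℤ.+ a⁺ ℤ.* z) (trans (cong (ℤ._^ suc d) arg₂) (proj₁ (proj₂ pd)))) (lem (h′ v) a⁺ (x′ ℤ.^ suc d) (+ q″) j))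
            where lem : ∀ h a X q j → h ℤ.+ a ℤ.* (X ℤ.+ q ℤ.* j) ≡ a ℤ.* q ℤ.* j ℤ.+ (h ℤ.+ a ℤ.* X)
                  lem h a X q j = ringℤ (h ∷ a ∷ X ∷ q ∷ j ∷ []) ($0 ⊹ $1 ⋆ ($2 ⊹ $3 ⋆ $4)) ($1 ⋆ $3 ⋆ $4 ⊹ ($0 ⊹ $1 ⋆ $2)) refl
          e₁ : ∀ z → (flat v ⊟ w (q″ * v + u)) z ≡ T (h′ v ℤ.+ c) (g ⊟ T (s ℤ.* j) g) z
          e₁ z = cong (λ t → flat v z ⊝ g t) (trans (cong (λ k → act k z) hh) (sym (act-+ (s ℤ.* j) (h′ v ℤ.+ c) z)))
      qq : a⁺ ℤ.* + r.q ≡ s ℤ.* + t₃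
      qq = trans (cong (a⁺ ℤ.*_) (trans (cong +_ qr≡) (ℤP.pos-* q″ t₃))) (sym (ℤP.*-assoc a⁺ (+ q″) (+ t₃)))
      OPM = Op-PM d a r.q y y1
      Lr = y ^ suc d
      -- `g` is already averaged with step `s`, and the steps of the missing factor of degree
      -- `suc d` are short multiples of `s`. That factor can therefore be inserted at small cost.
      PMg : N (PM d a r.q y g) ≼ ι 2 ⊗ G ⊕ ι 2 ⊗ (ι 4 ⊗ inv K₃ ⊗ D)
      PMg = ≼-trans (≼-reflexive (cong N (sym (ap-PM d a r.q y y1 g)))) (≼-trans (N-via (ap OO f) (ap OO f′)) (⊕-mono (⊗-monoˡ (0≼ι 2) first) (⊗-monoˡ (0≼ι 2)
           (≼-trans (≼-reflexive (N-cong (λ z → sym (ap-sub OO f f′ z)))) (abs-avg OO Lr (step (a⁺ ℤ.* + r.q)) (1≤^ (suc d) y1) shift f)))))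
        where
        OO = Op-comp OPM OM₂
        f′ = M (a⁺ ℤ.* + r.q) Lr f
        first : N (ap OO f′) ≼ G
        first = ≼-trans (≼-reflexive (N-cong (λ z → ap-Av OPM L₂ (step s) f′ z))) (≼-trans (ap-N OM₂ (ap OPM f′)) (≼-reflexive (cong N (ap-PM d a r.q y y1 f′))))
        shift : ∀ l → l < Lr → Abs OO (step (a⁺ ℤ.* + r.q) l) (ι 4 ⊗ inv K₃)
        shift l l<L = subst (λ z → Abs OO z (ι 4 ⊗ inv K₃)) (sym st) (abs-post OPM OM₂ (abs-M s L₂ L₂1 K₃ (+ (t₃ * l)) K₃1 bd))
          where
          st : step (a⁺ ℤ.* + r.q) l ≡ s ℤ.* + (t₃ * l)
          st = trans (cong (ℤ._* + l) qq) (trans (ℤP.*-assoc s (+ t₃) (+ l)) (cong (s ℤ.*_) (sym (ℤP.pos-* t₃ l))))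
          bd : K₃ * (t₃ * l) ≤ L₂
          bd = ≤-trans (≤-reflexive (sym (*-assoc K₃ t₃ l))) (≤-trans (*-mono-≤ (m≤m^ (K₃ * t₃) (suc d) (s≤s z≤n) (1≤m* K₃1 t₃1)) (<⇒≤ l<L)) (≤-trans (≤-reflexive (sym (*-^ (K₃ * t₃) y (suc d)))) (^-monoˡ-≤ (suc d) y₂≥)))
      main : N (A Vn flat) ≼ inv κ₁ ⊗ D ⊕ ι cr ⊗ (ι 2 ⊗ G ⊕ ι 2 ⊗ (ι 4 ⊗ inv K₃ ⊗ D))
      main = ≼-trans (≼-reflexive (trans (N-cong (λ z → avg-cong Vn (λ v → cong g (sym (act-+ (h′ v) c z))))) (N-T c (Av Vn h′ g))))
         (≼-trans (r.bound 𝕊 g a x′ y Vn (≤-trans (m≤n+m r.Y W.Y) Yy) Vr (≤-trans x′b (≤-trans (*-monoʳ-≤ c₁ ≤pV) (≤-reflexive (sym (*-assoc c₁ (2 * p) Vn))))))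
         (⊕-mono (⊗-monoˡ (0≼inv κ₁) gN) (⊗-mono (0≼ι cr) (N-nonneg _) (ι-mono (n≤1+n r.κ′)) PMg)))
    partB : N (Av Z h g) ≼ ι 2 ⊗ Inner ⊕ ι 2 ⊗ (ι 4 ⊗ inv K₁ ⊗ D)
    partB = ≼-trans (N-via (A Z w) _) (⊕-mono (⊗-monoˡ (0≼ι 2) (N-A-≼ Z _ Z1 inner)) (⊗-monoˡ (0≼ι 2) smooth))
    result : N (Av Z h f) ≼ inv κ ⊗ D ⊕ ι κ′ ⊗ G
    result = ≼-trans (N-via (Av Z h f) (Av Z h g)) (≼-trans (⊕-mono (⊗-monoˡ (0≼ι 2) partB) (⊗-monoˡ (0≼ι 2) (≼-trans (≼-reflexive (N-cong (λ z → sym (ap-sub OΦ f g z)))) partA))) (≼-reflexive fin))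
      where
      x1 : ι 8 ⊗ inv κ₁ ≡ inv μ
      x1 = ι⊗inv* 8 μ (s≤s z≤n) μ1
      x2 : ι 8 ⊗ ι cW ⊗ inv K ≡ inv μ
      x2 = trans (cong (_⊗ inv K) (sym (ι-* 8 cW))) (ι⊗inv* (8 * cW) μ (1≤m* {8} {cW} (s≤s z≤n) (s≤s z≤n)) μ1)
      x3 : ι 64 ⊗ ι cr ⊗ inv K₃ ≡ inv μ
      x3 = trans (cong (_⊗ inv K₃) (sym (ι-* 64 cr))) (ι⊗inv* (64 * cr) μ (1≤m* {64} {cr} (s≤s z≤n) (s≤s z≤n)) μ1)
      x4 : ι 32 ⊗ inv K₂ ≡ inv μ
      x4 = ι⊗inv* 32 μ (s≤s z≤n) μ1
      x5 : ι 16 ⊗ inv K₁ ≡ inv μ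
      x5 = ι⊗inv* 16 μ (s≤s z≤n) μ1
      x6 : ι 6 ⊗ inv μ ≡ inv κ
      x6 = ι⊗inv* 6 κ (s≤s z≤n) κ1
      fin : ι 2 ⊗ (ι 2 ⊗ Inner ⊕ ι 2 ⊗ (ι 4 ⊗ inv K₁ ⊗ D)) ⊕ ι 2 ⊗ (inv κ₁ ⊗ (ι 4 ⊗ D) ⊕ ι cW ⊗ (ι 4 ⊗ inv K ⊗ D)) ≡ inv κ ⊗ D ⊕ ι κ′ ⊗ G
      fin = begin
        _ ≡⟨ FS.solve 9 (λ d g i1 c i3 i2 ik cw i → con (+ 2) :* (con (+ 2) :* (con (+ 2) :* (i1 :* d :+ c :* (con (+ 2) :* g :+ con (+ 2) :* (con (+ 4) :* i3 :* d))) :+ con (+ 2) :* (con (+ 4) :* i2 :* d)) :+ con (+ 2) :* (con (+ 4) :* ik :* d)) :+ con (+ 2) :* (i1 :* (con (+ 4) :* d) :+ cw :* (con (+ 4) :* i :* d))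
             := (con (+ 8) :* i1 :* d :+ con (+ 8) :* cw :* i :* d :+ con (+ 8) :* i1 :* d :+ con (+ 64) :* c :* i3 :* d :+ con (+ 32) :* i2 :* d :+ con (+ 16) :* ik :* d) :+ con (+ 16) :* c :* g) refl
             D G (inv κ₁) (ι cr) (inv K₃) (inv K₂) (inv K₁) (ι cW) (inv K) ⟩
        (ι 8 ⊗ inv κ₁ ⊗ D ⊕ ι 8 ⊗ ι cW ⊗ inv K ⊗ D ⊕ ι 8 ⊗ inv κ₁ ⊗ D ⊕ ι 64 ⊗ ι cr ⊗ inv K₃ ⊗ D ⊕ ι 32 ⊗ inv K₂ ⊗ D ⊕ ι 16 ⊗ inv K₁ ⊗ D) ⊕ ι 16 ⊗ ι cr ⊗ G
          ≡⟨ cong₂ _⊕_ (cong₂ _⊕_ (cong₂ _⊕_ (cong₂ _⊕_ (cong₂ _⊕_ (cong₂ _⊕_ (cong (_⊗ D) x1) (cong (_⊗ D) x2)) (cong (_⊗ D) x1)) (cong (_⊗ D) x3)) (cong (_⊗ D) x4)) (cong (_⊗ D) x5)) (cong (_⊗ G) (sym (ι-* 16 cr))) ⟩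
        (inv μ ⊗ D ⊕ inv μ ⊗ D ⊕ inv μ ⊗ D ⊕ inv μ ⊗ D ⊕ inv μ ⊗ D ⊕ inv μ ⊗ D) ⊕ ι κ′ ⊗ G
          ≡⟨ cong (_⊕ ι κ′ ⊗ G) (trans (solve 2 (λ i d → i :* d :+ i :* d :+ i :* d :+ i :* d :+ i :* d :+ i :* d := con (+ 6) :* i :* d) refl (inv μ) D) (cong (_⊗ D) x6)) ⟩
        inv κ ⊗ D ⊕ ι κ′ ⊗ G ∎
        where
        open ≡-Reasoning

  prog-suc : Prog (suc d) κ b c₀
  prog-suc = record { κ′ = κ′ ; q = r.q ; e = e ; Y = Y ; t = q″ * r.t ; q≡ = trans r.q≡ (*-assoc b q″ r.t) ; t≥1 = 1≤m* q″1 r.t≥1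
    ; e≥1 = ≤-trans (1≤m* p₂1 (1≤m* K₃1 t₃1)) (m≤n+m _ (2 * p * r.e)) ; Y≥1 = ≤-trans W.Y≥1 (m≤m+n W.Y r.Y) ; bound = result }

abstract
  prog : ∀ d κ b c₀ → 1 ≤ κ → 1 ≤ b → Prog d κ b c₀
  prog zero κ b c₀ κ1 b1 = prog₀ κ b c₀ κ1 b1
  prog (suc d) κ b c₀ κ1 b1 = ProgStep.prog-suc d (prog d) κ b c₀ κ1 b1

-- all that the recurrence argument uses of intersectivity
Rooted : ℕ → (ℕ → ℤ) → Set
Rooted d a = ∀ q → 1 ≤ q → ∃ λ z₀ → 1 ≤ z₀ × ∃ λ k → ev (suc d) a (+ z₀) ≡ a (suc d) ℤ.* + q ℤ.* k

-- The loss in adding `d` errors one after another by ‖u + v‖² <= 2‖u‖² + 2‖v‖².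
CC : ℕ → ℕ
CC zero = 0
CC (suc d) = 2 + 2 * CC d

CC-step : ∀ d ε → ι 2 ⊗ ε ⊕ ι 2 ⊗ (ι (CC d) ⊗ ε) ≡ ι (CC (suc d)) ⊗ ε
CC-step d ε = trans (solve 3 (λ e c t → con (+ 2) :* e :+ con (+ 2) :* (c :* e) := (con (+ 2) :+ con (+ 2) :* c) :* e) refl ε (ι (CC d)) (ι 2))
   (cong (_⊗ ε) (sym (trans (ι-+ 2 (2 * CC d)) (cong (ι 2 ⊕_) (ι-* 2 (CC d))))))

sumF-sub : ∀ {g : ℕ → F} → (∀ i → 0F ≼ g i) → ∀ z q U → 1 ≤ q → sumF U (λ u → g (suc z + q * u)) ≼ sumF (z + q * U) (λ i → g (suc i))
sumF-mono-n : ∀ {g : ℕ → F} → (∀ i → 0F ≼ g i) → ∀ {m n} → m ≤ n → sumF m g ≼ sumF n g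
sumF-mono-n {g} pos {m} {n} p = ≼-trans (≼-add (sumF-nonneg (n ∸ m) (λ i → pos (m + i))) refl) (≼-reflexive (trans (sym (sumF-split m (n ∸ m) g)) (cong (λ z → sumF z g) (m+[n∸m]≡n p))))

sumF-sub pos z q zero q1 = sumF-nonneg (z + q * 0) (λ i → pos (suc i))
sumF-sub {g} pos z q (suc U) q1 = ≼-trans (⊕-mono (sumF-sub pos z q U q1) ≼-refl) (sumF-mono-n (λ i → pos (suc i)) (≤-trans (+-monoˡ-≤ (z + q * U) q1) (≤-reflexive (lem z q U))))
  where lem : ∀ z q U → q + (z + q * U) ≡ z + q * suc U
        lem z q U = ringℕ (z ∷ q ∷ U ∷ []) ($1 ⊹ ($0 ⊹ $1 ⋆ $2)) ($0 ⊹ $1 ⋆ (⟨ 1 ⟩ ⊹ $2)) refl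

module Chain (𝕊 : Sys) where
  open Sys 𝕊 using (S; S-cong; S-add; S-scale; act; act-0; act-+; S-inv)
  open Ops 𝕊 using (V; _⊟_; ⟪_,_⟫; N; T; A; step; M; S-sub; S-zero; S-avg; N-cong; N-T; N-add; N-sub-sym; amgm)
  open Absorption 𝕊 using (Op; Op-M; ap-sub; ap-Av; Abs; abs-post; abs-pre; abs-+; abs-avg; abs-M; inner-Av; ap; ap-cong; ap-add; ap-T; ap-N)
  open Products 𝕊 using (PM; Op-PM; ap-PM)

  abs-0 : ∀ O → Abs O (+ 0) 0F
  abs-0 O f = ≼-reflexive (trans (N-cong {g = λ _ → 0F} (λ x → trans (ap-sub O f (T (+ 0) f) x) (trans (cong (ap O f x ⊝_) (trans (ap-T O (+ 0) f x) (cong (ap O f) (act-0 x)))) (trans (solve 1 (λ a → a :- a := con (+ 0)) refl (ap O f x)) ιℤ-0))))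
     (trans (S-cong (λ _ → ⊗-zeroˡ 0F)) (trans S-zero (sym (⊗-zeroˡ _)))))

  abs-PM : ∀ d a q y (y1 : 1 ≤ y) K j t → 1 ≤ K → 1 ≤ j → j ≤ d → K * ℤ.∣ t ∣ ≤ y ^ j → Abs (Op-PM d a q y y1) (a j ℤ.* + q ℤ.* t) (ι 4 ⊗ inv K)
  abs-PM zero a q y y1 K (suc j) t K1 j1 () Kt
  abs-PM (suc d) a q y y1 K j t K1 j1 j≤d Kt with j ℕ.≟ suc d
  ... | yes refl = abs-post (Op-PM d a q y y1) (Op-M (a (suc d) ℤ.* + q) (y ^ suc d) (1≤^ (suc d) y1)) (abs-M (a (suc d) ℤ.* + q) (y ^ suc d) (1≤^ (suc d) y1) K t K1 Kt)
  ... | no j≢ = abs-pre (Op-PM d a q y y1) (Op-M (a (suc d) ℤ.* + q) (y ^ suc d) (1≤^ (suc d) y1)) (0≼ιinv 4 K) (abs-PM d a q y y1 K j t K1 j1 (≤-pred (≤∧≢⇒< j≤d j≢)) Kt)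

  N-PM : ∀ d a q y → 1 ≤ y → ∀ f → N (PM d a q y f) ≼ N f
  N-PM d a q y y1 f = subst (λ g → N g ≼ N f) (ap-PM d a q y y1 f) (ap-N (Op-PM d a q y y1) f)

  S-PM : ∀ d a q y → 1 ≤ y → ∀ f → S (PM d a q y f) ≡ S f
  S-PM zero a q y y1 f = refl
  S-PM (suc d) a q y y1 f = trans (S-PM d a q y y1 _) (trans (S-avg _ _) (trans (avg-cong _ (λ i → S-inv _ f)) (avg-const _ _ (1≤^ (suc d) y1))))

  -- The factors are inserted one at a time. Each costs `ε`, since `O` absorbs all its shifts, and
  -- the factors already inserted do not increase the norm.
  far-PM : ∀ O d (a : ℕ → ℤ) (q y : ℕ) ε → 1 ≤ y → 0F ≼ ε → (∀ (j l : ℕ) → 1 ≤ j → j ≤ d → l < y ^ j → Abs O (a j ℤ.* + q ℤ.* + l) ε) → ∀ f → N (ap O (f ⊟ PM d a q y f)) ≼ ι (CC d) ⊗ ε ⊗ N f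
  far-PM O zero a q y ε y1 pε ab f = ≼-reflexive (trans (N-cong {g = λ _ → 0F} (λ x → trans (ap-sub O f f x) (trans (solve 1 (λ a → a :- a := con (+ 0)) refl (ap O f x)) ιℤ-0)))
     (trans (S-cong (λ _ → ⊗-zeroˡ 0F)) (trans S-zero (sym (trans (cong (λ z → z ⊗ ε ⊗ N f) ιℤ-0) (trans (cong (_⊗ N f) (⊗-zeroˡ ε)) (⊗-zeroˡ _)))))))
  far-PM O (suc d) a q y ε y1 pε ab f = ≼-trans (≼-reflexive (N-cong (λ x → trans (ap-cong O (λ z → solve 3 (λ a b c → a :- c := (a :- b) :+ (b :- c)) refl (f z) (g z) (PM d a q y g z)) x) (ap-add O (f ⊟ g) (g ⊟ PM d a q y g) x))))
     (≼-trans (N-add _ _) (≼-trans (⊕-mono (⊗-monoˡ (0≼ι 2) (abs-avg O L (step s) L1 (λ l l<L → ab (suc d) l (s≤s z≤n) ≤-refl l<L) f))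
        (⊗-monoˡ (0≼ι 2) (≼-trans (far-PM O d a q y ε y1 pε (λ j l j1 j≤d → ab j l j1 (m≤n⇒m≤1+n j≤d)) g) (⊗-monoˡ (⊗-nonneg (0≼ι (CC d)) pε) (ap-N (Op-M s L L1) f)))))
      (≼-reflexive (trans (solve 3 (λ e c n → con (+ 2) :* (e :* n) :+ con (+ 2) :* (c :* n) := (con (+ 2) :* e :+ con (+ 2) :* c) :* n) refl ε (ι (CC d) ⊗ ε) (N f)) (cong (_⊗ N f) (CC-step d ε))))))
    where
    s = a (suc d) ℤ.* + q
    L = y ^ suc d
    L1 = 1≤^ (suc d) y1
    g = M s L f

  -- reversing all shifts gives the adjoint
  PM* : ℕ → (ℕ → ℤ) → ℕ → ℕ → V → V
  PM* d a = PM d (λ j → ℤ.- a j)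

  inner-congʳ : ∀ f {g g′} → (∀ x → g x ≡ g′ x) → ⟪ f , g ⟫ ≡ ⟪ f , g′ ⟫
  inner-congʳ f p = S-cong (λ x → cong (f x ⊗_) (p x))

  inner-PM : ∀ d a q y → 1 ≤ y → ∀ f g → ⟪ PM d a q y f , g ⟫ ≡ ⟪ f , PM* d a q y g ⟫
  inner-PM zero a q y y1 f g = refl
  inner-PM (suc d) a q y y1 f g = trans (inner-PM d a q y y1 _ g) (trans (inner-Av L (step (a (suc d) ℤ.* + q)) f (PM* d a q y g))
     (inner-congʳ f (λ x → trans (avg-cong L (λ i → cong (λ z → PM* d a q y g (act z x)) (lem (a (suc d)) (+ q) (+ i)))) (sym (trans (cong (λ h → h x) (sym (ap-PM d a⁻ q y y1 (M (a⁻ (suc d) ℤ.* + q) L g)))) (trans (ap-Av (Op-PM d a⁻ q y y1) L (step (a⁻ (suc d) ℤ.* + q)) g x) (avg-cong L (λ i → cong (λ h → h (act _ x)) (ap-PM d a⁻ q y y1 g)))))))))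
    where
    L = y ^ suc d
    a⁻ : ℕ → ℤ
    a⁻ j = ℤ.- a j
    lem : ∀ a q i → ℤ.- (a ℤ.* q ℤ.* i) ≡ (ℤ.- a) ℤ.* q ℤ.* i
    lem a q i = ringℤ (a ∷ q ∷ i ∷ []) (~ ($0 ⋆ $1 ⋆ $2)) ((~ $0) ⋆ $1 ⋆ $2) refl

  abs-neg : ∀ O (a : ℤ) {ε} → Abs O a ε → Abs O (ℤ.- a) ε
  abs-neg O a {ε} p f = ≼-trans (≼-reflexive (trans (sym (N-T a _)) (trans (N-cong e) (trans (N-sub-sym _ _) (sym (N-cong (λ x → trans (ap-sub O f (T a f) x) (cong (ap O f x ⊝_) (ap-T O a f x))))))))) (p f)
    where e : ∀ x → T a (ap O (f ⊟ T (ℤ.- a) f)) x ≡ (T a (ap O f) ⊟ ap O f) x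
          e x = trans (ap-sub O f _ (act a x)) (cong (ap O f (act a x) ⊝_) (trans (ap-T O (ℤ.- a) f (act a x)) (cong (ap O f) (trans (act-+ (ℤ.- a) a x) (trans (cong (λ z → act z x) (ℤP.+-inverseˡ a)) (act-0 x))))))

  far-E : ∀ O d (a : ℕ → ℤ) (q y : ℕ) ε → 1 ≤ y → 0F ≼ ε → (∀ (j l : ℕ) → 1 ≤ j → j ≤ d → l < y ^ j → Abs O (a j ℤ.* + q ℤ.* + l) ε) → ∀ f →
    N (ap O (f ⊟ PM* d a q y (PM d a q y f))) ≼ ι 4 ⊗ (ι (CC d) ⊗ ε) ⊗ N f
  far-E O d a q y ε y1 pε ab f = ≼-trans (≼-reflexive (N-cong (λ x → trans (ap-cong O (λ z → solve 3 (λ a b c → a :- c := (a :- b) :+ (b :- c)) refl (f z) (g z) (PM* d a q y g z)) x) (ap-add O (f ⊟ g) (g ⊟ PM* d a q y g) x))))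
     (≼-trans (N-add _ _) (≼-trans (⊕-mono (⊗-monoˡ (0≼ι 2) (far-PM O d a q y ε y1 pε ab f)) (⊗-monoˡ (0≼ι 2) (≼-trans (far-PM O d (λ j → ℤ.- a j) q y ε y1 pε ab′ g) (⊗-monoˡ (⊗-nonneg (0≼ι (CC d)) pε) (N-PM d a q y y1 f)))))
      (≼-reflexive (solve 2 (λ c n → con (+ 2) :* (c :* n) :+ con (+ 2) :* (c :* n) := con (+ 4) :* c :* n) refl (ι (CC d) ⊗ ε) (N f)))))
    where
    g = PM d a q y f
    lem : ∀ a q i → ℤ.- (a ℤ.* q ℤ.* i) ≡ (ℤ.- a) ℤ.* q ℤ.* i
    lem a q i = ringℤ (a ∷ q ∷ i ∷ []) (~ ($0 ⋆ $1 ⋆ $2)) ((~ $0) ⋆ $1 ⋆ $2) refl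
    ab′ : ∀ j l → 1 ≤ j → j ≤ d → l < y ^ j → Abs O (ℤ.- a j ℤ.* + q ℤ.* + l) ε
    ab′ j l j1 jd ll = subst (λ z → Abs O z ε) (lem (a j) (+ q) (+ l)) (abs-neg O (a j ℤ.* + q ℤ.* + l) (ab j l j1 jd ll))

  -- Expanding the square gives ‖g‖² - 2‖Mg‖² + ‖M*Mg‖², and M* contracts. So a vector losing little
  -- energy under M is nearly fixed by M*M, although M is no projection.
  N-minus-E : ∀ d (a : ℕ → ℤ) (q y : ℕ) → 1 ≤ y → ∀ g → N (g ⊟ PM* d a q y (PM d a q y g)) ≼ N g ⊝ N (PM d a q y g)
  N-minus-E d a q y y1 g = subst (_≼ N g ⊝ N h) (sym expand) (≼-add (≼-diff (N-PM d (λ j → ℤ.- a j) q y y1 h)) (solve 3 (λ n h e → n :- h := n :- con (+ 2) :* h :+ e :+ (h :- e)) refl (N g) (N h) (N (PM* d a q y h))))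
    where
    h = PM d a q y g
    Eg = PM* d a q y h
    expand : N (g ⊟ Eg) ≡ N g ⊝ ι 2 ⊗ N h ⊕ N Eg
    expand = trans (S-cong (λ x → solve 2 (λ a b → (a :- b) :* (a :- b) := (a :* a :+ b :* b) :- con (+ 2) :* (a :* b)) refl (g x) (Eg x)))
       (trans (S-sub _ _) (trans (cong₂ _⊝_ (S-add _ _) (S-scale _ _)) (trans (cong (λ z → N g ⊕ N Eg ⊝ ι 2 ⊗ z) (sym (inner-PM d a q y y1 g h))) (solve 3 (λ n e h → n :+ e :- con (+ 2) :* h := n :- con (+ 2) :* h :+ e) refl (N g) (N Eg) (N h)))))

  N-chain : ∀ a b c d e → N (a ⊟ e) ≼ ι 4 ⊗ (N (a ⊟ b) ⊕ N (b ⊟ c) ⊕ N (c ⊟ d) ⊕ N (d ⊟ e))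
  N-chain a b c d e = ≼-trans (≼-reflexive (N-cong (λ x → solve 3 (λ a c e → a :- e := (a :- c) :+ (c :- e)) refl (a x) (c x) (e x))))
    (≼-trans (N-add (a ⊟ c) (c ⊟ e)) (≼-trans (⊕-mono (⊗-monoˡ (0≼ι 2) (tri a b c)) (⊗-monoˡ (0≼ι 2) (tri c d e)))
     (≼-reflexive (solve 4 (λ a b c d → con (+ 2) :* (con (+ 2) :* a :+ con (+ 2) :* b) :+ con (+ 2) :* (con (+ 2) :* c :+ con (+ 2) :* d) := con (+ 4) :* (a :+ b :+ c :+ d)) refl _ _ _ _))))
    where tri : ∀ a b c → N (a ⊟ c) ≼ ι 2 ⊗ N (a ⊟ b) ⊕ ι 2 ⊗ N (b ⊟ c)
          tri a b c = ≼-trans (≼-reflexive (N-cong (λ x → solve 3 (λ a c e → a :- e := (a :- c) :+ (c :- e)) refl (a x) (b x) (c x)))) (N-add (a ⊟ b) (b ⊟ c))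

  -- The factor `1 + 1 / K`, in place of the 2 in `N-via`, is what allows energies to be compared up
  -- to a small part of the mass.
  N-near : ∀ K f g → 1 ≤ K → N f ≼ N g ⊕ inv K ⊗ N g ⊕ ι (suc K) ⊗ N (f ⊟ g)
  N-near K f g K1 = ≼-trans (≼-reflexive ex) (≼-trans (⊕-mono (⊕-mono ≼-refl (amgm K g (f ⊟ g) K1)) ≼-refl) (≼-reflexive
      (trans (solve 4 (λ n i k r → n :+ (i :* n :+ k :* r) :+ r := n :+ i :* n :+ (con (+ 1) :+ k) :* r) refl (N g) (inv K) (ι K) (N (f ⊟ g))) (cong (λ z → N g ⊕ inv K ⊗ N g ⊕ z ⊗ N (f ⊟ g)) (trans (cong (_⊕ ι K) ιℤ-1) (sym (ι-suc K)))))))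
    where ex : N f ≡ N g ⊕ ι 2 ⊗ ⟪ g , f ⊟ g ⟫ ⊕ N (f ⊟ g)
          ex = trans (S-cong (λ x → solve 2 (λ f g → f :* f := g :* g :+ con (+ 2) :* (g :* (f :- g)) :+ (f :- g) :* (f :- g)) refl (f x) (g x))) (trans (S-add _ _) (cong (_⊕ N (f ⊟ g)) (trans (S-add _ _) (cong (N g ⊕_) (S-scale _ _)))))

  -- By `pow-diff` the term of degree `j` changes by a multiple `t` of `a j * q` with `t` at most
  -- `j u B ^ (j - 1)`, which is the size that the factor of degree `j` in `PM` can absorb.
  abs-ev : ∀ O d (a : ℕ → ℤ) (q z u B : ℕ) ε → 0F ≼ ε → ℤ.∣ + z ∣ + q * u ≤ B → (∀ j t → 1 ≤ j → j ≤ d → ℤ.∣ t ∣ ≤ j * (u * B ^ (j ∸ 1)) → Abs O (a j ℤ.* + q ℤ.* t) ε) →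
    ∃ λ s → ev d a (+ z ℤ.+ + q ℤ.* + u) ≡ ev d a (+ z) ℤ.+ s × Abs O s (ι (CC d) ⊗ ε)
  abs-ev O zero a q z u B ε pε h ab = + 0 , sym (ℤP.+-identityʳ _) , subst (Abs O (+ 0)) (sym (trans (cong (_⊗ ε) ιℤ-0) (⊗-zeroˡ ε))) (abs-0 O)
  abs-ev O (suc d) a q z u B ε pε h ab with abs-ev O d a q z u B ε pε h (λ j t j1 jd → ab j t j1 (m≤n⇒m≤1+n jd)) | pow-diff d (+ z) q u B h
  ... | s , eq , A | j , eq₂ , le = a (suc d) ℤ.* + q ℤ.* j ℤ.+ s ,
      trans (cong₂ (λ u v → u ℤ.+ a (suc d) ℤ.* v) eq eq₂) (lem (ev d a (+ z)) s (a (suc d)) ((+ z) ℤ.^ suc d) (+ q) j) ,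
      subst (Abs O _) (CC-step d ε) (abs-+ O {a = a (suc d) ℤ.* + q ℤ.* j} {b = s} (ab (suc d) j (s≤s z≤n) ≤-refl le) A)
    where lem : ∀ e s a z q j → e ℤ.+ s ℤ.+ a ℤ.* (z ℤ.+ q ℤ.* j) ≡ e ℤ.+ a ℤ.* z ℤ.+ (a ℤ.* q ℤ.* j ℤ.+ s)
          lem e s a z q j = ringℤ (e ∷ s ∷ a ∷ z ∷ q ∷ j ∷ []) ($0 ⊹ $1 ⊹ $2 ⋆ ($3 ⊹ $4 ⋆ $5)) ($0 ⊹ $2 ⋆ $3 ⊹ ($2 ⋆ $4 ⋆ $5 ⊹ $1)) refl

-- Polynomial recurrence by energy increment

-- Three scales below `y`, each a fixed fraction of the one before up to a factor 2: `U` is the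
-- number of polynomial values used, `y₁` the scale in the bound of `Prog`, and `y₂` the finer scale
-- to which `f` is projected.
record Scales (pU e K₀ y : ℕ) : Set where
  field
    U y₁ y₂ : ℕ
    U1 : 1 ≤ U
    y₁1 : 1 ≤ y₁
    y₂1 : 1 ≤ y₂
    pU≤ : pU * U ≤ y
    ≤pU : y ≤ 2 * pU * U
    e≤ : e * y₁ ≤ U
    ≤e : U ≤ 2 * e * y₁
    K≤ : K₀ * y₂ ≤ y₁
    ≤K : y₁ ≤ 2 * K₀ * y₂

scales : ∀ pU e K₀ y → 1 ≤ pU → 1 ≤ e → 1 ≤ K₀ → 2 * pU * (2 * e * (2 * K₀)) ≤ y → Scales pU e K₀ y
scales pU e K₀ y pU1 e≥1 K₀1 h = record { U = U ; y₁ = y₁ ; y₂ = proj₁ c₂ ; U1 = proj₁ (proj₂ a₂) ; y₁1 = proj₁ (proj₂ b₂) ; y₂1 = proj₁ (proj₂ c₂)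
   ; pU≤ = proj₁ (proj₂ (proj₂ a₂)) ; ≤pU = ≤pU ; e≤ = proj₁ (proj₂ (proj₂ b₂)) ; ≤e = ≤e ; K≤ = proj₁ (proj₂ (proj₂ c₂)) ; ≤K = proj₂ (proj₂ (proj₂ c₂)) }
  where
  2pU1 : 1 ≤ 2 * pU
  2pU1 = 1≤m* {2} (s≤s z≤n) pU1
  te1 : 1 ≤ 2 * e
  te1 = 1≤m* {2} (s≤s z≤n) e≥1
  2K1 : 1 ≤ 2 * K₀
  2K1 = 1≤m* {2} (s≤s z≤n) K₀1
  a₂ = quot-scale pU y pU1 (≤-trans (m≤n*m pU {2} (s≤s z≤n)) (≤-trans (m≤m*n (2 * pU) (1≤m* te1 2K1)) h))
  U = proj₁ a₂
  ≤pU = proj₂ (proj₂ (proj₂ a₂))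
  hU : 2 * e * (2 * K₀) ≤ U
  hU = *-cancelˡ-≤ (2 * pU) {{ℕ.>-nonZero 2pU1}} (≤-trans h ≤pU)
  b₂ = quot-scale e U e≥1 (≤-trans (m≤n*m e {2} (s≤s z≤n)) (≤-trans (m≤m*n (2 * e) 2K1) hU))
  y₁ = proj₁ b₂
  ≤e = proj₂ (proj₂ (proj₂ b₂))
  hy₁ : 2 * K₀ ≤ y₁
  hy₁ = *-cancelˡ-≤ (2 * e) {{ℕ.>-nonZero te1}} (≤-trans hU ≤e)
  c₂ = quot-scale K₀ y₁ K₀1 (≤-trans (m≤n*m K₀ {2} (s≤s z≤n)) hy₁)

module Core (d D₀ : ℕ) (D1 : 1 ≤ D₀) where
  H ν μ κ E K CC′ K₄ : ℕ
  -- Let m be the mass. Once ‖E₀f - Φf‖² <= m / `H`, `amgm` with `ν` bounds 2|⟨f, E₀f - Φf⟩| by m /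
  -- `ν` + `ν` m / `H` = m / `D₀`², half of the lower bound for 2⟨f, E₀f⟩.
  ν = 2 * (D₀ * D₀)
  H = ν * (2 * (D₀ * D₀))
  -- Four errors m / `μ`, multiplied by 4 in `N-chain`, amount to m / `H`.
  μ = 16 * H
  κ = 8 * μ
  E = 4 * μ
  K = 4 * μ
  CC′ = suc (CC (suc d))
  K₄ = 8 * CC′ * μ
  DD1 : 1 ≤ D₀ * D₀
  DD1 = 1≤m* D1 D1
  lam1 : 1 ≤ ν
  lam1 = 1≤m* {2} (s≤s z≤n) DD1
  H1 : 1 ≤ H
  H1 = 1≤m* lam1 (1≤m* {2} (s≤s z≤n) DD1)
  μ1 : 1 ≤ μ
  μ1 = 1≤m* {16} (s≤s z≤n) H1
  κ1 : 1 ≤ κ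
  κ1 = 1≤m* {8} (s≤s z≤n) μ1
  K1 : 1 ≤ K
  K1 = 1≤m* {4} (s≤s z≤n) μ1
  K₄1 : 1 ≤ K₄
  K₄1 = 1≤m* {8 * CC′} (1≤m* {8} {CC′} (s≤s z≤n) (s≤s z≤n)) μ1

  record Dense (𝕊 : Sys) (f : Ops.V 𝕊) : Set where
    open Sys 𝕊 using (S)
    field
      f≥0 : ∀ x → 0F ≼ f x
      f≤1 : ∀ x → f x ≼ 1F
      dense : S (λ _ → 1F) ≼ ι D₀ ⊗ S f

  mass : Sys → F
  mass 𝕊 = Sys.S 𝕊 (λ _ → 1F)

  energy : ∀ 𝕊 → (ℕ → ℤ) → ℕ → ℕ → Ops.V 𝕊 → F
  energy 𝕊 a q y f = Ops.N 𝕊 (Products.PM 𝕊 (suc d) a q y f)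

  returns-to : ∀ 𝕊 → (ℕ → ℤ) → Ops.V 𝕊 → ℕ → F
  returns-to 𝕊 a f y = sumF y (λ z → Ops.⟪_,_⟫ 𝕊 f (Ops.T 𝕊 (ev (suc d) a (+ suc z)) f))

  -- Either f returns often along a, or its energy at the finer scale (next, y₂) exceeds the energy at (q, y) by a fixed proportion of the mass.
  record Scale (q : ℕ) : Set₁ where
    field
      next c ratio : ℕ
      next1 : 1 ≤ next
      c1 : 1 ≤ c
      ratio1 : 1 ≤ ratio
      step : ∀ a → Rooted d a → ∃ λ Y → ∀ 𝕊 f → Dense 𝕊 f → ∀ y → Y ≤ y → ∃ λ y₂ → y₂ ≤ y × y ≤ ratio * y₂ × energy 𝕊 a next y₂ f ≼ mass 𝕊 ×
        (energy 𝕊 a next y₂ f ≼ energy 𝕊 a q y f ⊕ inv E ⊗ mass 𝕊 → inv c ⊗ ι y ⊗ mass 𝕊 ≼ returns-to 𝕊 a f y)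

  -- `E₀` is 𝓜*𝓜 at the scale `(q, y)`, `E₂` its analogue at `(q₁, y₂)`, and `Φ` averages over the
  -- values of the polynomial at `z₀ + q u`. As ⟨f, E₀f⟩ = ‖𝓜f‖² is bounded below by the density, it
  -- suffices that `E₀ f` and `Φ f` are close. The path between them runs through `Φ (E₀ f)`,
  -- `Φ (E₀ g)` and `Φ g`, where `g = E₂ f`.
  module Level (q : ℕ) (q1 : 1 ≤ q) where
    module P = Prog (prog (suc d) κ q 1 κ1 q1)
    q₁ cP η⁻ K₀ pU : ℕ
    q₁ = P.q
    cP = suc P.κ′
    η⁻ = 2 * μ * ((4 * μ + 1) * cP)
    K₀ = 16 * CC′ * η⁻
    pU = K₄ * (suc (suc d) * (1 + q)) + P.t
    η1 : 1 ≤ η⁻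
    η1 = 1≤m* {2 * μ} (1≤m* {2} (s≤s z≤n) μ1) (1≤m* {4 * μ + 1} {cP} (m≤n+m 1 (4 * μ)) (s≤s z≤n))
    K₀1 : 1 ≤ K₀
    K₀1 = 1≤m* {16 * CC′} (1≤m* {16} {CC′} (s≤s z≤n) (s≤s z≤n)) η1
    pU1 : 1 ≤ pU
    pU1 = ≤-trans P.t≥1 (m≤n+m P.t _)
    q₁1 : 1 ≤ q₁
    q₁1 = subst (1 ≤_) (sym P.q≡) (1≤m* q1 P.t≥1)
    ratio c : ℕ
    ratio = 2 * pU * (2 * P.e * (2 * K₀))
    c = 2 * pU * (2 * (D₀ * D₀))

    module _ (a : ℕ → ℤ) (z′ : ℕ) (k₀ : ℤ) (root : ev (suc d) a (+ suc z′) ≡ a (suc d) ℤ.* + q ℤ.* k₀) where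
      z₀ Y₀ : ℕ
      z₀ = suc z′
      Y₀ = ratio + (2 * pU * (2 * P.e * P.Y) + (2 * pU * z₀ + K₄ * ℤ.∣ k₀ ∣))

      module _ (𝕊 : Sys) where
       open Sys 𝕊 using (S; S-cong; S-add; S-scale; S-nonneg; act)
       open Ops 𝕊 using (V; _⊟_; ⟪_,_⟫; N; T; Av; S-sub; S-mono; N-cong; N-nonneg; N-sub; N-sub-sym; N-A-≼; amgm)
       open Absorption 𝕊 using (Op; Op-comp; Op-Av; ap-sub; Abs; abs-post; abs-+; abs-≼; inner-avgʳ; ap; ap-T; ap-N)
       open Products 𝕊 using (PM; Op-PM; ap-PM)
       open Chain 𝕊 using (abs-PM; N-PM; S-PM; PM*; inner-PM; far-E; N-minus-E; N-chain; N-near; abs-ev)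

       module _ (f : V) (fd : Dense 𝕊 f) (y : ℕ) (Yy : Y₀ ≤ y) (sc : Scales pU P.e K₀ y) where
        open Scales sc
        open Dense fd
        m : F
        m = S (λ _ → 1F)
        m0 : 0F ≼ m
        m0 = S-nonneg (λ _ → 0≼1)
        y1 : 1 ≤ y
        y1 = ≤-trans (1≤m* pU1 U1) pU≤
        Nf≤m : N f ≼ m
        Nf≤m = S-mono (λ x → ≼-trans (⊗-mono 0≼1 (f≥0 x) (f≤1 x) (f≤1 x)) (≼-reflexive (⊗-idʳ 1F)))
        Y≤y₁ : P.Y ≤ y₁
        Y≤y₁ = *-cancelˡ-≤ (2 * P.e) {{ℕ.>-nonZero (1≤m* {2} (s≤s z≤n) P.e≥1)}} (≤-trans (*-cancelˡ-≤ (2 * pU) {{ℕ.>-nonZero (1≤m* {2} (s≤s z≤n) pU1)}}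
            (≤-trans (≤-trans (m≤m+n _ _) (m≤n+m _ ratio)) (≤-trans Yy ≤pU))) ≤e)
        z₀≤U : z₀ ≤ U
        z₀≤U = *-cancelˡ-≤ (2 * pU) {{ℕ.>-nonZero (1≤m* {2} (s≤s z≤n) pU1)}}
            (≤-trans (≤-trans (m≤m+n _ _) (≤-trans (m≤n+m _ (2 * pU * (2 * P.e * P.Y))) (m≤n+m _ ratio))) (≤-trans Yy ≤pU))
        k₀≤y : K₄ * ℤ.∣ k₀ ∣ ≤ y
        k₀≤y = ≤-trans (≤-trans (m≤n+m _ (2 * pU * z₀)) (≤-trans (m≤n+m _ (2 * pU * (2 * P.e * P.Y))) (m≤n+m _ ratio))) Yy
        𝓜 𝓜₁ 𝓜₂ E₀ E₂ Φ : V → V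
        𝓜 = PM (suc d) a q y
        𝓜₁ = PM (suc d) a q₁ y₁
        𝓜₂ = PM (suc d) a q₁ y₂
        E₀ h = PM* (suc d) a q y (𝓜 h)
        E₂ h = PM* (suc d) a q₁ y₂ (𝓜₂ h)
        R : ℕ → ℤ
        R u = ev (suc d) a (+ z₀ ℤ.+ + q ℤ.* + u)
        Φ = Av U R
        OΦ = Op-Av U U1 R
        O₀ = Op-PM (suc d) a q y y1
        O₀* = Op-PM (suc d) (λ j → ℤ.- a j) q y y1
        O₁ = Op-PM (suc d) a q₁ y₁ y₁1
        OE = Op-comp O₀* O₀
        E₀≡ : ∀ h → ap OE h ≡ E₀ h
        E₀≡ h = trans (ap-PM (suc d) (λ j → ℤ.- a j) q y y1 (ap O₀ h)) (cong (PM* (suc d) a q y) (ap-PM (suc d) a q y y1 h))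
        g : V
        g = E₂ f
        ε : F
        ε = ι 4 ⊗ inv K₀
        ε0 : 0F ≼ ε
        ε0 = 0≼ιinv 4 K₀
        η : F
        η = inv η⁻
        4CCε : ι 4 ⊗ (ι (CC (suc d)) ⊗ ε) ≼ η
        4CCε = ≼-trans (≼-reflexive (solve 2 (λ c i → con (+ 4) :* (c :* (con (+ 4) :* i)) := con (+ 16) :* c :* i) refl (ι (CC (suc d))) (inv K₀)))
           (≼-trans (⊗-monoʳ (0≼inv K₀) (⊗-monoˡ (0≼ι 16) (ι-mono (n≤1+n (CC (suc d))))))
           (≼-reflexive (trans (cong (_⊗ inv K₀) (sym (ι-* 16 CC′))) (ι⊗inv* (16 * CC′) η⁻ (1≤m* {16} {CC′} (s≤s z≤n) (s≤s z≤n)) η1))))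
        tK≤y : P.t * (K₀ * y₂) ≤ y
        tK≤y = ≤-trans (*-monoʳ-≤ P.t (≤-trans K≤ (≤-trans (m≤n*m y₁ P.e≥1) e≤))) (≤-trans (*-monoˡ-≤ U (m≤n+m P.t (K₄ * (suc (suc d) * (1 + q))))) pU≤)
        pow≤ : ∀ C l x j Y → 1 ≤ C → 1 ≤ j → l ≤ x ^ j → C * x ≤ Y → C * l ≤ Y ^ j
        pow≤ C l x j Y C1 j1 lx Cx = ≤-trans (*-mono-≤ (m≤m^ C j j1 C1) lx) (≤-trans (≤-reflexive (sym (*-^ C x j))) (^-monoˡ-≤ j Cx))
        -- The shifts in `E₂` are multiples of `q₁`, hence of `q`, and short against the scale `y`,
        -- so `𝓜` absorbs them.
        small₀ : N (𝓜 f ⊟ 𝓜 g) ≼ η ⊗ m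
        small₀ = ≼-trans (≼-reflexive (N-cong (λ x → trans (sym (cong₂ (λ u v → u x ⊝ v x) (ap-PM (suc d) a q y y1 f) (ap-PM (suc d) a q y y1 g))) (sym (ap-sub O₀ f g x)))))
           (≼-trans (far-E O₀ (suc d) a q₁ y₂ ε y₂1 ε0 near f) (⊗-mono (0≼inv η⁻) (N-nonneg f) 4CCε Nf≤m))
          where
          near : ∀ j l → 1 ≤ j → j ≤ suc d → l < y₂ ^ j → Abs O₀ (a j ℤ.* + q₁ ℤ.* + l) ε
          near j l j1 jd ll = subst (λ z → Abs O₀ z ε) (sym sh) (abs-PM (suc d) a q y y1 K₀ j (+ (P.t * l)) K₀1 j1 jd
              (≤-trans (≤-reflexive (sym (*-assoc K₀ P.t l))) (pow≤ (K₀ * P.t) l y₂ j y (1≤m* K₀1 P.t≥1) j1 (<⇒≤ ll) (≤-trans (≤-reflexive (lem K₀ P.t y₂)) tK≤y))))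
            where
            sh : a j ℤ.* + q₁ ℤ.* + l ≡ a j ℤ.* + q ℤ.* + (P.t * l)
            sh = trans (cong (λ z → a j ℤ.* z ℤ.* + l) (trans (cong +_ P.q≡) (ℤP.pos-* q P.t))) (trans (lem₂ (a j) (+ q) (+ P.t) (+ l)) (cong (λ z → a j ℤ.* + q ℤ.* z) (sym (ℤP.pos-* P.t l))))
              where lem₂ : ∀ a q t l → a ℤ.* (q ℤ.* t) ℤ.* l ≡ a ℤ.* q ℤ.* (t ℤ.* l)
                    lem₂ a q t l = ringℤ (a ∷ q ∷ t ∷ l ∷ []) ($0 ⋆ ($1 ⋆ $2) ⋆ $3) ($0 ⋆ $1 ⋆ ($2 ⋆ $3)) refl
            lem : ∀ K t y → K * t * y ≡ t * (K * y)
            lem K t y = ringℕ (K ∷ t ∷ y ∷ []) ($0 ⋆ $1 ⋆ $2) ($1 ⋆ ($0 ⋆ $2)) refl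
        -- Here the modulus is the same, and `y₁` exceeds `y₂` by the factor `K₀`.
        small₁ : N (𝓜₁ (f ⊟ g)) ≼ η ⊗ m
        small₁ = ≼-trans (≼-reflexive (cong N (sym (ap-PM (suc d) a q₁ y₁ y₁1 (f ⊟ g)))))
           (≼-trans (far-E O₁ (suc d) a q₁ y₂ ε y₂1 ε0 near f) (⊗-mono (0≼inv η⁻) (N-nonneg f) 4CCε Nf≤m))
          where
          near : ∀ j l → 1 ≤ j → j ≤ suc d → l < y₂ ^ j → Abs O₁ (a j ℤ.* + q₁ ℤ.* + l) ε
          near j l j1 jd ll = abs-PM (suc d) a q₁ y₁ y₁1 K₀ j (+ l) K₀1 j1 jd (pow≤ K₀ l y₂ j y₁ K₀1 j1 (<⇒≤ ll) K≤)
        Ng≤ : N g ≼ N (𝓜₂ f)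
        Ng≤ = N-PM (suc d) (λ j → ℤ.- a j) q₁ y₂ y₂1 (𝓜₂ f)
        Ng≤m : N g ≼ m
        Ng≤m = ≼-trans Ng≤ (≼-trans (N-PM (suc d) a q₁ y₂ y₂1 f) Nf≤m)
        iμ : F
        iμ = inv μ
        iμ2 : F
        iμ2 = inv (2 * μ)
        2μ1 : 1 ≤ 2 * μ
        2μ1 = 1≤m* {2} (s≤s z≤n) μ1
        cP1 : 1 ≤ cP
        cP1 = s≤s z≤n
        4μ1 : 1 ≤ 4 * μ + 1
        4μ1 = m≤n+m 1 (4 * μ)
        ηη≤ : ι (4 * μ + 1) ⊗ η ≼ iμ2
        ηη≤ = ι⊗inv≼ (2 * μ) (4 * μ + 1) η⁻ 2μ1 (*-monoʳ-≤ (2 * μ) (m≤m*n (4 * μ + 1) cP1)) η1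
        cη≤ : ι cP ⊗ η ≼ iμ2
        cη≤ = ι⊗inv≼ (2 * μ) cP η⁻ 2μ1 (*-monoʳ-≤ (2 * μ) (m≤n*m cP 4μ1)) η1
        η≤ : η ≼ iμ
        η≤ = inv-mono μ1 (≤-trans (m≤n*m μ {2} (s≤s z≤n)) (m≤m*n (2 * μ) (1≤m* 4μ1 cP1)))
        half+half : iμ2 ⊕ iμ2 ≡ iμ
        half+half = trans (solve 1 (λ i → i :+ i := con (+ 2) :* i) refl iμ2) (ι⊗inv* 2 μ (s≤s z≤n) μ1)
        -- By `Prog`, `Φ` sees little beyond what survives `𝓜₁`, and `𝓜₁` hardly distinguishes `f`
        -- from `g`.
        X₄ : N (Φ g ⊟ Φ f) ≼ iμ ⊗ m
        X₄ = ≼-trans (≼-reflexive (trans (N-sub-sym _ _) (N-cong (λ x → sym (ap-sub OΦ f g x)))))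
          (≼-trans (P.bound 𝕊 (f ⊟ g) a (+ z₀) y₁ U Y≤y₁ e≤ (≤-trans z₀≤U (≤-reflexive (sym (*-identityˡ U)))))
          (≼-trans (⊕-mono (⊗-monoˡ (0≼inv κ) fg4) (⊗-mono (0≼ι cP) (N-nonneg _) (ι-mono (n≤1+n P.κ′)) small₁))
          (≼-trans (⊕-mono (≼-reflexive k4) (≼-trans (≼-reflexive (sym (⊗-assoc _ _ _))) (⊗-monoʳ m0 cη≤))) (≼-reflexive (trans (sym (⊗-distribʳ m iμ2 iμ2)) (cong (_⊗ m) half+half))))))
          where
          fg4 : N (f ⊟ g) ≼ ι 4 ⊗ m
          fg4 = ≼-trans (N-sub f g) (≼-trans (⊕-mono (⊗-monoˡ (0≼ι 2) Nf≤m) (⊗-monoˡ (0≼ι 2) Ng≤m)) (≼-reflexive (solve 1 (λ d → con (+ 2) :* d :+ con (+ 2) :* d := con (+ 4) :* d) refl m)))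
          k4 : inv κ ⊗ (ι 4 ⊗ m) ≡ iμ2 ⊗ m
          k4 = trans (solve 2 (λ i m → i :* (con (+ 4) :* m) := con (+ 4) :* i :* m) refl (inv κ) m) (cong (_⊗ m) (trans (cong (λ z → ι 4 ⊗ inv z) (lem μ)) (ι⊗inv* 4 (2 * μ) (s≤s z≤n) 2μ1)))
            where lem : ∀ μ → 8 * μ ≡ 4 * (2 * μ)
                  lem μ = ringℕ (μ ∷ []) (⟨ 8 ⟩ ⋆ $0) (⟨ 4 ⟩ ⋆ (⟨ 2 ⟩ ⋆ $0)) refl
        X₂ : N (Φ (E₀ f) ⊟ Φ (E₀ g)) ≼ iμ ⊗ m
        X₂ = ≼-trans (≼-reflexive (N-cong (λ x → sym (ap-sub OΦ (E₀ f) (E₀ g) x)))) (≼-trans (ap-N OΦ _) (≼-trans (≼-reflexive (N-cong (λ x → trans (sym (cong₂ (λ u v → u x ⊝ v x) (ap-PM (suc d) (λ j → ℤ.- a j) q y y1 (𝓜 f)) (ap-PM (suc d) (λ j → ℤ.- a j) q y y1 (𝓜 g)))) (sym (ap-sub O₀* (𝓜 f) (𝓜 g) x)))))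
            (≼-trans (ap-N O₀* _) (≼-trans small₀ (⊗-monoʳ m0 η≤)))))
        module _ (flat : N (𝓜₂ f) ≼ N (𝓜 f) ⊕ inv E ⊗ m) where
          -- Flatness of the energy enters here: ‖g - E₀g‖² <= ‖g‖² - ‖𝓜g‖², where ‖g‖² <= ‖𝓜₂f‖²,
          -- and 𝓜g is close to 𝓜f.
          X₃ : N (Φ (E₀ g) ⊟ Φ g) ≼ iμ ⊗ m
          X₃ = ≼-trans (≼-reflexive (N-cong (λ x → sym (ap-sub OΦ (E₀ g) g x)))) (≼-trans (ap-N OΦ _) (≼-trans (≼-reflexive (N-sub-sym (E₀ g) g))
             (≼-trans (N-minus-E (suc d) a q y y1 g) (≼-trans (⊕-mono Ng≤ ≼-refl) (≼-trans (⊕-mono flat ≼-refl) (≼-trans (⊕-mono (⊕-mono Mf≤ ≼-refl) ≼-refl) (≼-trans (≼-reflexive re) fin)))))))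
            where
            Mg = N (𝓜 g)
            Mf≤ : N (𝓜 f) ≼ Mg ⊕ inv K ⊗ m ⊕ ι (suc K) ⊗ (η ⊗ m)
            Mf≤ = ≼-trans (N-near K (𝓜 f) (𝓜 g) K1) (⊕-mono (⊕-mono ≼-refl (⊗-monoˡ (0≼inv K) (≼-trans (N-PM (suc d) a q y y1 g) Ng≤m))) (⊗-monoˡ (0≼ι (suc K)) small₀))
            re : Mg ⊕ inv K ⊗ m ⊕ ι (suc K) ⊗ (η ⊗ m) ⊕ inv E ⊗ m ⊝ Mg ≡ (inv K ⊕ inv E) ⊗ m ⊕ ι (suc K) ⊗ η ⊗ m
            re = solve 6 (λ g k s n e m → g :+ k :* m :+ s :* (n :* m) :+ e :* m :- g := (k :+ e) :* m :+ s :* n :* m) refl Mg (inv K) (ι (suc K)) η (inv E) m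
            fin : (inv K ⊕ inv E) ⊗ m ⊕ ι (suc K) ⊗ η ⊗ m ≼ iμ ⊗ m
            fin = ≼-trans (⊕-mono (≼-reflexive (cong (_⊗ m) (trans (solve 1 (λ i → i :+ i := con (+ 2) :* i) refl (inv K)) (trans (cong (λ z → ι 2 ⊗ inv z) (lem μ)) (ι⊗inv* 2 (2 * μ) (s≤s z≤n) 2μ1)))))
                 (⊗-monoʳ m0 (≼-trans (≼-reflexive (cong (λ z → ι z ⊗ η) (sym (+-comm (4 * μ) 1)))) ηη≤))) (≼-reflexive (trans (sym (⊗-distribʳ m iμ2 iμ2)) (cong (_⊗ m) half+half)))
              where lem : ∀ μ → 4 * μ ≡ 2 * (2 * μ)
                    lem μ = ringℕ (μ ∷ []) (⟨ 4 ⟩ ⋆ $0) (⟨ 2 ⟩ ⋆ (⟨ 2 ⟩ ⋆ $0)) refl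
          ε₄ : F
          ε₄ = ι 4 ⊗ inv K₄
          -- `R u` is the value at the approximate root `z₀`, a multiple of `a (suc d) * q`, plus
          -- the change controlled by `abs-ev`. `𝓜` absorbs both.
          X₁ : N (E₀ f ⊟ Φ (E₀ f)) ≼ iμ ⊗ m
          X₁ = ≼-trans (≼-reflexive (N-cong (λ x → trans (cong (_⊝ Φ (E₀ f) x) (sym (avg-const U (E₀ f x) U1))) (sym (avg-sub U _ _)))))
             (N-A-≼ U (λ u → E₀ f ⊟ T (R u) (E₀ f)) U1 each)
            where
            B : ℕ
            B = (1 + q) * U
            each : ∀ u → u < U → N (E₀ f ⊟ T (R u) (E₀ f)) ≼ iμ ⊗ m
            each u u<U = ≼-trans (≼-reflexive (N-cong (λ x → trans (sym (cong (λ h → h x ⊝ h (act (R u) x)) (E₀≡ f))) (sym (trans (ap-sub OE f (T (R u) f) x) (cong (ap OE f x ⊝_) (ap-T OE (R u) f x)))))))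
                (≼-trans (abs-post O₀* O₀ absR f) (⊗-mono (0≼inv μ) (N-nonneg f) ≼-refl Nf≤m))
              where
              hB : z₀ + q * u ≤ B
              hB = +-mono-≤ z₀≤U (*-monoʳ-≤ q (<⇒≤ u<U))
              KB : K₄ * (suc (suc d) * B) ≤ y
              KB = ≤-trans (≤-reflexive (lem K₄ (suc (suc d)) q U)) (≤-trans (*-monoˡ-≤ U (m≤m+n (K₄ * (suc (suc d) * (1 + q))) P.t)) pU≤)
                where lem : ∀ K s q U → K * (s * ((1 + q) * U)) ≡ K * (s * (1 + q)) * U
                      lem K s q U = ringℕ (K ∷ s ∷ q ∷ U ∷ []) ($0 ⋆ ($1 ⋆ ((⟨ 1 ⟩ ⊹ $2) ⋆ $3))) ($0 ⋆ ($1 ⋆ (⟨ 1 ⟩ ⊹ $2)) ⋆ $3) refl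
              u≤B : u ≤ B
              u≤B = ≤-trans (<⇒≤ u<U) (m≤m+n U _)
              B1 : 1 ≤ B
              B1 = ≤-trans U1 (m≤m+n U _)
              near : ∀ j t → 1 ≤ j → j ≤ suc d → ℤ.∣ t ∣ ≤ j * (u * B ^ (j ∸ 1)) → Abs O₀ (a j ℤ.* + q ℤ.* t) ε₄
              near (suc j) t j1 jd tb = abs-PM (suc d) a q y y1 K₄ (suc j) t K₄1 j1 jd (≤-trans (*-monoʳ-≤ K₄ (≤-trans tb (*-mono-≤ {suc j} {suc (suc d)} (m≤n⇒m≤1+n jd) (*-monoˡ-≤ (B ^ j) u≤B))))
                   (≤-trans (≤-reflexive (sym (*-assoc K₄ (suc (suc d)) (B ^ suc j)))) (pow≤ (K₄ * suc (suc d)) (B ^ suc j) B (suc j) y (1≤m* K₄1 (s≤s z≤n)) j1 ≤-refl (≤-trans (≤-reflexive (*-assoc K₄ (suc (suc d)) B)) KB))))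
              evd = abs-ev O₀ (suc d) a q z₀ u B ε₄ (0≼ιinv 4 K₄) hB near
              abs₀ : Abs O₀ (a (suc d) ℤ.* + q ℤ.* k₀) ε₄
              abs₀ = abs-PM (suc d) a q y y1 K₄ (suc d) k₀ K₄1 (s≤s z≤n) ≤-refl (≤-trans k₀≤y (m≤m^ y (suc d) (s≤s z≤n) y1))
              absR : Abs O₀ (R u) iμ
              absR = subst (λ z → Abs O₀ z iμ) (sym (trans (proj₁ (proj₂ evd)) (cong (λ z → z ℤ.+ proj₁ evd) root)))
                (abs-≼ O₀ εs (abs-+ O₀ {a = a (suc d) ℤ.* + q ℤ.* k₀} {b = proj₁ evd} abs₀ (proj₂ (proj₂ evd))))
                where
                εs : ι 2 ⊗ ε₄ ⊕ ι 2 ⊗ (ι (CC (suc d)) ⊗ ε₄) ≼ iμ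
                εs = ≼-reflexive (trans (solve 2 (λ i c → con (+ 2) :* (con (+ 4) :* i) :+ con (+ 2) :* (c :* (con (+ 4) :* i)) := con (+ 8) :* (con (+ 1) :+ c) :* i) refl (inv K₄) (ι (CC (suc d))))
                   (trans (cong (λ z → ι 8 ⊗ z ⊗ inv K₄) (trans (cong (_⊕ ι (CC (suc d))) ιℤ-1) (sym (ι-suc (CC (suc d)))))) (trans (cong (_⊗ inv K₄) (sym (ι-* 8 CC′))) (ι⊗inv* (8 * CC′) μ (1≤m* {8} {CC′} (s≤s z≤n) (s≤s z≤n)) μ1))))
          total : N (E₀ f ⊟ Φ f) ≼ inv H ⊗ m
          total = ≼-trans (N-chain (E₀ f) (Φ (E₀ f)) (Φ (E₀ g)) (Φ g) (Φ f)) (≼-trans (⊗-monoˡ (0≼ι 4) (⊕-mono (⊕-mono (⊕-mono X₁ X₂) X₃) X₄))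
             (≼-reflexive (trans (solve 2 (λ i m → con (+ 4) :* (i :* m :+ i :* m :+ i :* m :+ i :* m) := con (+ 16) :* i :* m) refl iμ m) (cong (_⊗ m) (ι⊗inv* 16 H (s≤s z≤n) H1)))))
          i₀ : F
          i₀ = inv D₀
          -- Cauchy-Schwarz against a constant, in the form ‖𝓜f - 1 / `D₀`‖² >= 0; `𝓜` preserves the
          -- value of `S`.
          Mf≥ : i₀ ⊗ i₀ ⊗ m ≼ N (𝓜 f)
          Mf≥ = ≼-trans (≼-add (⊗-nonneg (0≼ι 2) (⊗-nonneg (0≼inv D₀) (≼-diff im≤s))) (solve 3 (λ i s m → con (+ 2) :* i :* s :- i :* i :* m := i :* i :* m :+ con (+ 2) :* (i :* (s :- i :* m))) refl i₀ s m)) ≤N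
            where
            s = S f
            im≤s : i₀ ⊗ m ≼ s
            im≤s = ≼-trans (⊗-monoˡ (0≼inv D₀) dense) (≼-reflexive (trans (sym (⊗-assoc _ _ _)) (trans (cong (_⊗ s) (inv-ι D₀ D1)) (⊗-idˡ s))))
            ≤N : ι 2 ⊗ i₀ ⊗ s ⊝ i₀ ⊗ i₀ ⊗ m ≼ N (𝓜 f)
            ≤N = ≼-add (N-nonneg (λ x → 𝓜 f x ⊝ i₀)) (trans (solve 2 (λ n u → n := u :+ (n :- u)) refl (N (𝓜 f)) _) (cong ((ι 2 ⊗ i₀ ⊗ s ⊝ i₀ ⊗ i₀ ⊗ m) ⊕_) (sym ex)))
              where
              ex : N (λ x → 𝓜 f x ⊝ i₀) ≡ N (𝓜 f) ⊝ (ι 2 ⊗ i₀ ⊗ s ⊝ i₀ ⊗ i₀ ⊗ m)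
              ex = trans (S-cong (λ x → trans (solve 2 (λ a i → (a :- i) :* (a :- i) := a :* a :- (con (+ 2) :* i :* a :- i :* i :* con (+ 1))) refl (𝓜 f x) i₀) (cong (λ z → 𝓜 f x ⊗ 𝓜 f x ⊝ (ι 2 ⊗ i₀ ⊗ 𝓜 f x ⊝ i₀ ⊗ i₀ ⊗ z)) ιℤ-1)))
                 (trans (S-sub _ _) (cong (N (𝓜 f) ⊝_) (trans (S-sub _ _) (cong₂ _⊝_ (trans (S-scale _ _) (cong (ι 2 ⊗ i₀ ⊗_) (S-PM (suc d) a q y y1 f))) (S-scale _ _)))))
          corr : ι 2 ⊗ (i₀ ⊗ i₀ ⊗ m) ≼ ι 2 ⊗ ⟪ f , Φ f ⟫ ⊕ i₀ ⊗ i₀ ⊗ m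
          corr = ≼-trans (⊗-monoˡ (0≼ι 2) Mf≥) (≼-trans (≼-reflexive (trans (cong (ι 2 ⊗_) (inner-PM (suc d) a q y y1 f (𝓜 f))) (trans (cong (ι 2 ⊗_) (trans (S-cong (λ x → solve 3 (λ f e p → f :* e := f :* p :+ f :* (e :- p)) refl (f x) (E₀ f x) (Φ f x))) (S-add _ _))) (⊗-distribˡ (ι 2) _ _))))
             (⊕-mono ≼-refl (≼-trans (amgm ν f (E₀ f ⊟ Φ f) lam1) (≼-trans (⊕-mono (⊗-monoˡ (0≼inv ν) Nf≤m) (⊗-monoˡ (0≼ι ν) total)) (≼-reflexive
               (trans (cong (λ z → inv ν ⊗ m ⊕ z) (trans (sym (⊗-assoc _ _ _)) (cong (_⊗ m) (ι⊗inv* ν ν lam1 lam1)))) (trans (solve 2 (λ i m → i :* m :+ i :* m := con (+ 2) :* i :* m) refl (inv ν) m)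
                 (cong (_⊗ m) (trans (ι⊗inv* 2 (D₀ * D₀) (s≤s z≤n) DD1) (inv-* D₀ D₀ D1 D1))))))))))
          corr₂ : inv (2 * (D₀ * D₀)) ⊗ m ≼ ⟪ f , Φ f ⟫
          corr₂ = ≼-trans (≼-reflexive (trans (cong (_⊗ m) (inv-* 2 (D₀ * D₀) (s≤s z≤n) DD1)) (trans (cong (λ z → inv 2 ⊗ z ⊗ m) (inv-* D₀ D₀ D1 D1)) (⊗-assoc _ _ _))))
            (≼-trans (⊗-monoˡ (0≼inv 2) (≼-add (≼-diff corr) (solve 2 (λ r u → r := u :+ (r :+ u :- con (+ 2) :* u)) refl (ι 2 ⊗ ⟪ f , Φ f ⟫) (i₀ ⊗ i₀ ⊗ m)))) (≼-reflexive (trans (sym (⊗-assoc _ _ _)) (trans (cong (_⊗ ⟪ f , Φ f ⟫) (inv-ι 2 (s≤s z≤n))) (⊗-idˡ _)))))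
          G : ℕ → F
          G z = ⟪ f , T (ev (suc d) a (+ z)) f ⟫
          G≥0 : ∀ z → 0F ≼ G z
          G≥0 z = S-nonneg (λ x → ⊗-nonneg (f≥0 x) (f≥0 _))
          ΣG : sumF U (λ u → G (z₀ + q * u)) ≡ ι U ⊗ ⟪ f , Φ f ⟫
          ΣG = trans (sumF-cong U (λ u → cong (λ w → ⟪ f , T (ev (suc d) a w) f ⟫) (trans (ℤP.pos-+ z₀ (q * u)) (cong (λ w → + z₀ ℤ.+ w) (ℤP.pos-* q u)))))
             (trans (sym (trans (cong (_⊗ sumF U (λ u → ⟪ f , T (R u) f ⟫)) (ι-inv U U1)) (⊗-idˡ _))) (trans (⊗-assoc _ _ _) (cong (ι U ⊗_) (sym (inner-avgʳ U _ f)))))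
          zqU≤y : z′ + q * U ≤ y
          zqU≤y = ≤-trans (+-monoˡ-≤ (q * U) (≤-trans (n≤1+n z′) z₀≤U)) (≤-trans (≤-trans (m≤n*m ((1 + q) * U) (1≤m* K₄1 (s≤s {n = suc d} z≤n))) (≤-reflexive (lem K₄ (suc (suc d)) q U))) (≤-trans (*-monoˡ-≤ U (m≤m+n (K₄ * (suc (suc d) * (1 + q))) P.t)) pU≤))
            where lem : ∀ K s q U → K * s * ((1 + q) * U) ≡ K * (s * (1 + q)) * U
                  lem K s q U = ringℕ (K ∷ s ∷ q ∷ U ∷ []) ($0 ⋆ $1 ⋆ ((⟨ 1 ⟩ ⊹ $2) ⋆ $3)) ($0 ⋆ ($1 ⋆ (⟨ 1 ⟩ ⊹ $2)) ⋆ $3) refl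
          -- The arguments `z₀ + q u` with `u < U` lie between 1 and `y`. All other terms of the sum
          -- are non-negative and are dropped.
          conclusion : inv c ⊗ ι y ⊗ m ≼ sumF y (λ z → G (suc z))
          conclusion = ≼-trans (⊗-monoʳ m0 cy) (≼-trans (≼-reflexive (⊗-assoc _ _ _)) (≼-trans (⊗-monoˡ (0≼ι U) corr₂) (≼-trans (≼-reflexive (sym ΣG)) (≼-trans (sumF-sub G≥0 z′ q U q1) (sumF-mono-n (λ i → G≥0 (suc i)) zqU≤y)))))
            where
            2pU1 : 1 ≤ 2 * pU
            2pU1 = 1≤m* {2} (s≤s z≤n) pU1
            cy : inv c ⊗ ι y ≼ ι U ⊗ inv (2 * (D₀ * D₀))
            cy = ≼-trans (⊗-monoˡ (0≼inv c) (≼-trans (ι-mono ≤pU) (≼-reflexive (ι-* (2 * pU) U)))) (≼-reflexive (trans (solve 3 (λ i p u → i :* (p :* u) := u :* (p :* i)) refl (inv c) (ι (2 * pU)) (ι U)) (cong (ι U ⊗_) (ι⊗inv* (2 * pU) (2 * (D₀ * D₀)) 2pU1 (1≤m* {2} (s≤s z≤n) DD1)))))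

    result : Scale q
    result = record { next = q₁ ; c = c ; ratio = ratio ; next1 = q₁1 ; c1 = 1≤m* {2 * pU} (1≤m* {2} (s≤s z≤n) pU1) (1≤m* {2} (s≤s z≤n) DD1)
      ; ratio1 = 1≤m* {2 * pU} (1≤m* {2} (s≤s z≤n) pU1) (1≤m* {2 * P.e} (1≤m* {2} (s≤s z≤n) P.e≥1) (1≤m* {2} (s≤s z≤n) K₀1))
      ; step = λ a rooted → at-root a (proj₁ (rooted q q1)) (proj₁ (proj₂ (rooted q q1))) (proj₁ (proj₂ (proj₂ (rooted q q1)))) (proj₂ (proj₂ (proj₂ (rooted q q1)))) }
      where
      at-root : ∀ a z₀ → 1 ≤ z₀ → ∀ k → ev (suc d) a (+ z₀) ≡ a (suc d) ℤ.* + q ℤ.* k → ∃ λ Y → ∀ 𝕊 f → Dense 𝕊 f → ∀ y → Y ≤ y → ∃ λ y₂ → y₂ ≤ y × y ≤ ratio * y₂ × energy 𝕊 a q₁ y₂ f ≼ mass 𝕊 ×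
        (energy 𝕊 a q₁ y₂ f ≼ energy 𝕊 a q y f ⊕ inv E ⊗ mass 𝕊 → inv c ⊗ ι y ⊗ mass 𝕊 ≼ returns-to 𝕊 a f y)
      at-root a (suc z) _ k root = Y₀ a z k root , λ 𝕊 f fd y Yy → at-scale 𝕊 f fd y Yy (scales pU P.e K₀ y pU1 P.e≥1 K₀1 (≤-trans (m≤m+n ratio _) Yy))
        where
        at-scale : ∀ 𝕊 f → Dense 𝕊 f → ∀ y → Y₀ a z k root ≤ y → Scales pU P.e K₀ y → ∃ λ y₂ → y₂ ≤ y × y ≤ ratio * y₂ × energy 𝕊 a q₁ y₂ f ≼ mass 𝕊 ×
          (energy 𝕊 a q₁ y₂ f ≼ energy 𝕊 a q y f ⊕ inv E ⊗ mass 𝕊 → inv c ⊗ ι y ⊗ mass 𝕊 ≼ returns-to 𝕊 a f y)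
        at-scale 𝕊 f fd y Yy sc = y₂ , ≤-trans (≤-trans (m≤n*m y₂ K₀1) K≤) (≤-trans (≤-trans (m≤n*m y₁ P.e≥1) e≤) (≤-trans (m≤n*m U pU1) pU≤)) ,
          ≤-trans ≤pU (≤-trans (*-monoʳ-≤ (2 * pU) (≤-trans ≤e (≤-trans (*-monoʳ-≤ (2 * P.e) ≤K) (≤-reflexive (sym (*-assoc (2 * P.e) (2 * K₀) y₂)))))) (≤-reflexive (sym (*-assoc (2 * pU) _ y₂)))) ,
          ≼-trans (Chain.N-PM 𝕊 (suc d) a q₁ y₂ y₂1 f) (Nf≤m a z k root 𝕊 f fd y Yy sc) , conclusion a z k root 𝕊 f fd y Yy sc
          where
          open Scales sc

  abstract
    scale : ∀ q → 1 ≤ q → Scale q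
    scale q q1 = Level.result q q1

  -- `n` counts the energy increments still possible: the energy at scale `(q, y)` is within `n / E`
  -- of the mass.
  Recurs : ℕ → ℕ → Set₁
  Recurs n q = ∃ λ c → 1 ≤ c × (∀ a → Rooted d a → ∃ λ Y → ∀ 𝕊 f → Dense 𝕊 f → ∀ y → Y ≤ y →
    mass 𝕊 ≼ energy 𝕊 a q y f ⊕ ι n ⊗ inv E ⊗ mass 𝕊 → inv c ⊗ ι y ⊗ mass 𝕊 ≼ returns-to 𝕊 a f y)

  mass≥0 : ∀ 𝕊 → 0F ≼ mass 𝕊
  mass≥0 𝕊 = Sys.S-nonneg 𝕊 (λ _ → 0≼1)

  returns-mono : ∀ 𝕊 a f → Dense 𝕊 f → ∀ {x y} → x ≤ y → returns-to 𝕊 a f x ≼ returns-to 𝕊 a f y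
  returns-mono 𝕊 a f fd = sumF-mono-n (λ i → Sys.S-nonneg 𝕊 (λ x → ⊗-nonneg (Dense.f≥0 fd x) (Dense.f≥0 fd _)))

  increment-0 : ∀ {m e x} → 0F ≼ m → x ≼ m → m ≼ e ⊕ ι 0 ⊗ inv E ⊗ m → x ≼ e ⊕ inv E ⊗ m
  increment-0 {m} m0 xm h = ≼-trans xm (≼-trans h (⊕-mono ≼-refl (≼-trans (≼-reflexive (trans (cong (λ w → w ⊗ inv E ⊗ m) ιℤ-0) (trans (cong (_⊗ m) (⊗-zeroˡ _)) (⊗-zeroˡ m)))) (⊗-nonneg (0≼inv E) m0))))

  increment-suc : ∀ n {m e x} → m ≼ e ⊕ ι (suc n) ⊗ inv E ⊗ m → e ⊕ inv E ⊗ m ≼ x → m ≼ x ⊕ ι n ⊗ inv E ⊗ m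
  increment-suc n {m} {e} big ge = ≼-trans big (≼-trans (≼-reflexive (trans (cong (λ w → e ⊕ w ⊗ inv E ⊗ m) (trans (ι-suc n) (cong (_⊕ ι n) (sym ιℤ-1)))) (solve 4 (λ a n i m → a :+ (con (+ 1) :+ n) :* i :* m := a :+ con (+ 1) :* i :* m :+ n :* i :* m) refl e (ι n) (inv E) m)))
     (⊕-mono (≼-trans (≼-reflexive (cong (λ w → e ⊕ w ⊗ m) (trans (cong (_⊗ inv E) ιℤ-1) (⊗-idˡ _)))) ge) ≼-refl))

  rescale : ∀ c c′ r {y y₂ m} → 1 ≤ c → 1 ≤ c′ → 1 ≤ r → 0F ≼ m → y ≤ r * y₂ → inv (c * (c′ * r)) ⊗ ι y ⊗ m ≼ inv c′ ⊗ ι y₂ ⊗ m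
  rescale c c′ r {y} {y₂} c1 c′1 r1 m0 y≤ = ⊗-monoʳ m0 (≼-trans (⊗-mono (0≼inv (c′ * r)) (0≼ι y) (inv-mono cr1 (m≤n*m (c′ * r) c1)) (≼-trans (ι-mono y≤) (≼-reflexive (ι-* r y₂))))
     (≼-reflexive (trans (cong (_⊗ (ι r ⊗ ι y₂)) (inv-* c′ r c′1 r1)) (trans (solve 4 (λ c i r y → c :* i :* (r :* y) := (i :* r) :* (c :* y)) refl (inv c′) (inv r) (ι r) (ι y₂)) (trans (cong (_⊗ (inv c′ ⊗ ι y₂)) (inv-ι r r1)) (⊗-idˡ _))))))
    where cr1 : 1 ≤ c′ * r
          cr1 = 1≤m* c′1 r1

  -- If the energy is flat, `step` concludes at once. Otherwise the finer scale has gained the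
  -- proportion `1 / E` of the mass, which uses up one increment. The returns found below `y₂` are
  -- among those below `y`, and `y₂` is a fixed fraction of `y`.
  chain-step : ∀ n q → (σ : Scale q) → Recurs n (Scale.next σ) → Recurs (suc n) q
  chain-step n q σ (c′ , c′1 , rec) = c * (c′ * ratio) , 1≤m* c1 cr1 , λ a rooted → proj₁ (step a rooted) + ratio * proj₁ (rec a rooted) , body a rooted
    where
    open Scale σ
    cr1 : 1 ≤ c′ * ratio
    cr1 = 1≤m* c′1 ratio1
    body : ∀ a (rooted : Rooted d a) 𝕊 f → Dense 𝕊 f → ∀ y → proj₁ (step a rooted) + ratio * proj₁ (rec a rooted) ≤ y →
      mass 𝕊 ≼ energy 𝕊 a q y f ⊕ ι (suc n) ⊗ inv E ⊗ mass 𝕊 → inv (c * (c′ * ratio)) ⊗ ι y ⊗ mass 𝕊 ≼ returns-to 𝕊 a f y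
    body a rooted 𝕊 f fd y Yy big = decide (proj₂ (step a rooted) 𝕊 f fd y (≤-trans (m≤m+n _ _) Yy))
      where
      decide : (∃ λ y₂ → y₂ ≤ y × y ≤ ratio * y₂ × energy 𝕊 a next y₂ f ≼ mass 𝕊 × (energy 𝕊 a next y₂ f ≼ energy 𝕊 a q y f ⊕ inv E ⊗ mass 𝕊 → inv c ⊗ ι y ⊗ mass 𝕊 ≼ returns-to 𝕊 a f y)) →
        inv (c * (c′ * ratio)) ⊗ ι y ⊗ mass 𝕊 ≼ returns-to 𝕊 a f y
      decide (y₂ , y₂≤y , y≤ , _ , flat) with ≼-total (energy 𝕊 a next y₂ f) (energy 𝕊 a q y f ⊕ inv E ⊗ mass 𝕊)
      ... | inj₁ le = ≼-trans (⊗-monoʳ (mass≥0 𝕊) (⊗-monoʳ (0≼ι y) (inv-mono c1 (m≤m*n c cr1)))) (flat le)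
      ... | inj₂ ge = ≼-trans (rescale c c′ ratio c1 c′1 ratio1 (mass≥0 𝕊) y≤) (≼-trans (proj₂ (rec a rooted) 𝕊 f fd y₂ Y′≤ (increment-suc n big ge)) (returns-mono 𝕊 a f fd y₂≤y))
        where
        Y′≤ : proj₁ (rec a rooted) ≤ y₂
        Y′≤ = *-cancelˡ-≤ ratio {{ℕ.>-nonZero ratio1}} (≤-trans (≤-trans (m≤n+m _ (proj₁ (step a rooted))) Yy) y≤)

  chain : ∀ n q → 1 ≤ q → Recurs n q
  -- With no increment left the energy already equals at least the mass, which bounds the energy at
  -- the next scale.
  chain zero q q1 = c , c1 , λ a rooted → proj₁ (step a rooted) , λ 𝕊 f fd y Yy big → let (_ , _ , _ , bounded , flat) = proj₂ (step a rooted) 𝕊 f fd y Yy in flat (increment-0 (mass≥0 𝕊) bounded big)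
    where
    open Scale (scale q q1)
  chain (suc n) q q1 = chain-step n q (scale q q1) (chain n (Scale.next (scale q q1)) (Scale.next1 (scale q q1)))

  -- The constant depends on `d` and `D₀` alone; the polynomial enters only through the threshold.
  -- At modulus 1 the induction starts for free, since energies are non-negative and `E` increments
  -- exhaust the mass.
  sarkozy : ∃ λ c → 1 ≤ c × (∀ a → Rooted d a → ∃ λ Y → ∀ 𝕊 f → Dense 𝕊 f → ∀ y → Y ≤ y → inv c ⊗ ι y ⊗ mass 𝕊 ≼ returns-to 𝕊 a f y)
  sarkozy = proj₁ ch , proj₁ (proj₂ ch) , λ a r → proj₁ (proj₂ (proj₂ ch) a r) , λ 𝕊 f fd y Yy → proj₂ (proj₂ (proj₂ ch) a r) 𝕊 f fd y Yy
     (≼-add (Ops.N-nonneg 𝕊 (Products.PM 𝕊 (suc d) a 1 y f)) (trans (⊕-comm _ _) (cong (_⊕ energy 𝕊 a 1 y f) (trans (cong (_⊗ mass 𝕊) (ι-inv E K1)) (⊗-idˡ _)))))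
    where
    ch : Recurs E 1
    ch = chain E 1 (s≤s z≤n)

-- Counting in ℕ

sumN : ℕ → (ℕ → ℕ) → ℕ
sumN zero g = 0
sumN (suc n) g = sumN n g + g n

𝟙 : Bool → ℕ
𝟙 true = 1
𝟙 false = 0

cnt : ℕ → (ℕ → Bool) → ℕ
cnt n p = sumN n (λ i → 𝟙 (p i))

𝟙≤1 : ∀ b → 𝟙 b ≤ 1
𝟙≤1 true = ≤-refl
𝟙≤1 false = z≤n

sumN-cong< : ∀ n {g h} → (∀ i → i < n → g i ≡ h i) → sumN n g ≡ sumN n h
sumN-cong< zero p = refl
sumN-cong< (suc n) p = cong₂ _+_ (sumN-cong< n (λ i q → p i (m<n⇒m<1+n q))) (p n ≤-refl)

sumN-cong : ∀ n {g h} → (∀ i → g i ≡ h i) → sumN n g ≡ sumN n h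
sumN-cong n p = sumN-cong< n (λ i _ → p i)

sumN-mono : ∀ n {g h} → (∀ i → i < n → g i ≤ h i) → sumN n g ≤ sumN n h
sumN-mono zero p = z≤n
sumN-mono (suc n) p = +-mono-≤ (sumN-mono n (λ i q → p i (m<n⇒m<1+n q))) (p n ≤-refl)

sumN-add : ∀ n g h → sumN n (λ i → g i + h i) ≡ sumN n g + sumN n h
sumN-add zero g h = refl
sumN-add (suc n) g h = trans (cong (_+ (g n + h n)) (sumN-add n g h)) (lem (sumN n g) (sumN n h) (g n) (h n))
  where lem : ∀ a b c d → a + b + (c + d) ≡ a + c + (b + d)
        lem a b c d = ringℕ (a ∷ b ∷ c ∷ d ∷ []) ($0 ⊹ $1 ⊹ ($2 ⊹ $3)) ($0 ⊹ $2 ⊹ ($1 ⊹ $3)) refl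

sumN-scale : ∀ n c g → sumN n (λ i → c * g i) ≡ c * sumN n g
sumN-scale zero c g = sym (*-zeroʳ c)
sumN-scale (suc n) c g = trans (cong (_+ c * g n) (sumN-scale n c g)) (sym (*-distribˡ-+ c _ _))

sumN-const : ∀ n c → sumN n (λ _ → c) ≡ n * c
sumN-const zero c = refl
sumN-const (suc n) c = trans (cong (_+ c) (sumN-const n c)) (+-comm (n * c) c)

sumN-zero : ∀ n → sumN n (λ _ → 0) ≡ 0
sumN-zero n = trans (sumN-const n 0) (*-zeroʳ n)

sumN-swap : ∀ m n (g : ℕ → ℕ → ℕ) → sumN m (λ i → sumN n (g i)) ≡ sumN n (λ j → sumN m (λ i → g i j))
sumN-swap zero n g = sym (sumN-zero n)
sumN-swap (suc m) n g = trans (cong (_+ sumN n (g m)) (sumN-swap m n g)) (sym (sumN-add n _ _))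

sumN-split : ∀ a b g → sumN (a + b) g ≡ sumN a g + sumN b (λ i → g (a + i))
sumN-split a zero g = trans (cong (λ z → sumN z g) (+-identityʳ a)) (sym (+-identityʳ _))
sumN-split a (suc b) g = trans (cong (λ z → sumN z g) (+-suc a b)) (trans (cong (_+ g (a + b)) (sumN-split a b g)) (+-assoc (sumN a g) _ _))

sumN-blocks : ∀ j L g → sumN (j * L) g ≡ sumN j (λ b → sumN L (λ i → g (b * L + i)))
sumN-blocks zero L g = refl
sumN-blocks (suc j) L g = trans (cong (λ z → sumN z g) (+-comm L (j * L))) (trans (sumN-split (j * L) L g) (cong (_+ sumN L (λ i → g (j * L + i))) (sumN-blocks j L g)))

sumN-classes : ∀ s l g → sumN (s * l) g ≡ sumN s (λ c → sumN l (λ i → g (c + s * i)))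
sumN-classes s l g = trans (cong (λ z → sumN z g) (*-comm s l)) (trans (sumN-blocks l s g) (trans (sumN-swap l s _) (sumN-cong s (λ c → sumN-cong l (λ i → cong g (trans (+-comm (i * s) c) (cong (λ ○ → c + ○) (*-comm i s))))))))

sumN-mono-n : ∀ {m n} g → m ≤ n → sumN m g ≤ sumN n g
sumN-mono-n {m} {n} g p = ≤-trans (m≤m+n (sumN m g) _) (≤-reflexive (trans (sym (sumN-split m (n ∸ m) g)) (cong (λ z → sumN z g) (m+[n∸m]≡n p))))

sumN-≤ : ∀ n {g c} → (∀ i → i < n → g i ≤ c) → sumN n g ≤ n * c
sumN-≤ n {c = c} p = ≤-trans (sumN-mono n p) (≤-reflexive (sumN-const n c))

≤-sumN : ∀ n {g c} → (∀ i → i < n → c ≤ g i) → n * c ≤ sumN n g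
≤-sumN n {c = c} p = ≤-trans (≤-reflexive (sym (sumN-const n c))) (sumN-mono n p)

term≤sumN : ∀ n i g → i < n → g i ≤ sumN n g
term≤sumN (suc n) i g i<n with i ℕ.≟ n
... | yes refl = m≤n+m (g n) _
... | no i≢n = ≤-trans (term≤sumN n i g (≤∧≢⇒< (≤-pred i<n) i≢n)) (m≤m+n _ (g n))

sumN-rev : ∀ n g → sumN n g ≡ sumN n (λ i → g (n ∸ suc i))
sumN-rev zero g = refl
sumN-rev (suc n) g = trans (cong (_+ g n) (sumN-rev n g)) (trans (+-comm _ (g n)) (sym (sumN-split 1 n (λ i → g (suc n ∸ suc i)))))

sumN-shift : ∀ n h g → sumN n (λ i → g (h + i)) + sumN h g ≡ sumN (n + h) g
sumN-shift n h g = trans (+-comm _ (sumN h g)) (trans (sym (sumN-split h n g)) (cong (λ z → sumN z g) (+-comm h n)))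

sumN-unique : ∀ n g C → (∀ i → i < n → g i ≤ C) → (∀ i j → i < n → j < n → i ≢ j → g i ≡ 0 ⊎ g j ≡ 0) → sumN n g ≤ C
sumN-unique zero g C p q = z≤n
sumN-unique (suc n) g C p q with g n ℕ.≟ 0
... | yes z = ≤-trans (≤-reflexive (trans (cong (λ ○ → sumN n g + ○) z) (+-identityʳ _))) (sumN-unique n g C (λ i r → p i (m<n⇒m<1+n r)) (λ i j r s → q i j (m<n⇒m<1+n r) (m<n⇒m<1+n s)))
... | no nz = ≤-trans (≤-reflexive (cong (_+ g n) (trans (sumN-cong< n zeros) (sumN-zero n)))) (p n ≤-refl)
  where
  zeros : ∀ i → i < n → g i ≡ 0
  zeros i i<n with q i n (m<n⇒m<1+n i<n) ≤-refl (ℕP.<⇒≢ i<n)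
  ... | inj₁ z = z
  ... | inj₂ z = contradiction z nz

cnt≤ : ∀ n p → cnt n p ≤ n
cnt≤ n p = ≤-trans (sumN-≤ n (λ i _ → 𝟙≤1 (p i))) (≤-reflexive (*-identityʳ n))

cnt-mono : ∀ n {p q} → (∀ i → i < n → p i ≡ true → q i ≡ true) → cnt n p ≤ cnt n q
cnt-mono n {p} {q} h = sumN-mono n (λ i i<n → lem (p i) (q i) (h i i<n))
  where lem : ∀ a b → (a ≡ true → b ≡ true) → 𝟙 a ≤ 𝟙 b
        lem false b _ = z≤n
        lem true b f rewrite f refl = ≤-refl

𝟙-∧ : ∀ a b → 𝟙 (a ∧ b) ≡ 𝟙 a * 𝟙 b
𝟙-∧ true b = sym (+-identityʳ _)
𝟙-∧ false b = refl

𝟙-not : ∀ a → 𝟙 a + 𝟙 (not a) ≡ 1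
𝟙-not true = refl
𝟙-not false = refl

true≢false : ∀ {b} → b ≡ true → b ≡ false → ⊥
true≢false refl ()

∧-intro : ∀ {a b} → a ≡ true → b ≡ true → a ∧ b ≡ true
∧-intro refl refl = refl

∧-elim : ∀ {a b} → a ∧ b ≡ true → a ≡ true × b ≡ true
∧-elim {true} {true} refl = refl , refl

⌊⌋-true : ∀ {p} {P : Set p} (d : Dec P) → P → ⌊ d ⌋ ≡ true
⌊⌋-true (yes _) _ = refl
⌊⌋-true (no ¬p) p = contradiction p ¬p

⌊⌋-elim : ∀ {p} {P : Set p} (d : Dec P) → ⌊ d ⌋ ≡ true → P
⌊⌋-elim (yes p) _ = p

⌊⌋-false : ∀ {p} {P : Set p} (d : Dec P) → ⌊ d ⌋ ≡ false → ¬ P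
⌊⌋-false (no ¬p) _ = ¬p

cnt-pos : ∀ n p → 1 ≤ cnt n p → ∃ λ i → i < n × p i ≡ true
cnt-pos (suc n) p h with p n in eq
... | true = n , ≤-refl , eq
... | false with cnt-pos n p (≤-trans h (≤-reflexive (+-identityʳ _)))
... | i , i<n , q = i , m<n⇒m<1+n i<n , q

find< : ∀ n (p : ℕ → Bool) → (∃ λ i → i < n × p i ≡ true) ⊎ (∀ i → i < n → p i ≡ false)
find< zero p = inj₂ (λ i ())
find< (suc n) p with p n in eq
... | true = inj₁ (n , ≤-refl , eq)
... | false with find< n p
... | inj₁ (i , i<n , q) = inj₁ (i , m<n⇒m<1+n i<n , q)
... | inj₂ none = inj₂ h
  where h : ∀ i → i < suc n → p i ≡ false
        h i i<sn with i ℕ.≟ n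
        ... | yes refl = eq
        ... | no i≢n = none i (≤∧≢⇒< (≤-pred i<sn) i≢n)

sumN-pigeon : ∀ n c g → 1 ≤ n → n * c ≤ sumN n g → ∃ λ i → i < n × c ≤ g i
sumN-pigeon (suc n) c g _ h with find< (suc n) (λ i → ⌊ c ≤? g i ⌋)
... | inj₁ (i , i<n , p) = i , i<n , ⌊⌋-elim (c ≤? g i) p
... | inj₂ none = contradiction (≤-trans (strict n (λ i i<n → ≰⇒> (⌊⌋-false (c ≤? g i) (none i i<n)))) h) (n≮n _)
  where
  strict : ∀ n → (∀ i → i < suc n → g i < c) → sumN (suc n) g < suc n * c
  strict zero p = subst (g 0 <_) (sym (+-identityʳ c)) (p 0 ≤-refl)
  strict (suc n) p = ≤-trans (ℕP.+-mono-< (strict n (λ i q → p i (m<n⇒m<1+n q))) (p (suc n) ≤-refl)) (≤-reflexive (+-comm (suc n * c) c))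

-- Szemerédi's cube lemma.

Cube : List ℕ → (ℕ → Bool) → ℕ → Set
Cube [] G x = G x ≡ true
Cube (e ∷ es) G x = Cube es G x × Cube es G (x + e)

Cube-∧ : ∀ es G e x → Cube es (λ x → G x ∧ G (x + e)) x → Cube es G x × Cube es G (x + e)
Cube-∧ [] G e x p = ∧-elim p
Cube-∧ (e′ ∷ es) G e x (p , q) with Cube-∧ es G e x p | Cube-∧ es G e (x + e′) q
... | p₁ , p₂ | q₁ , q₂ = (p₁ , q₁) , (p₂ , subst (Cube es G) (lem x e e′) q₂)
  where lem : ∀ x e e′ → x + e′ + e ≡ x + e + e′
        lem x e e′ = ringℕ (x ∷ e ∷ e′ ∷ []) ($0 ⊹ $2 ⊹ $1) ($0 ⊹ $1 ⊹ $2) refl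

pigeon₂ : ∀ n a K g → 1 ≤ a → a ≤ K * sumN n g → ∃ λ i → i < n × a ≤ K * n * g i
pigeon₂ zero a K g a1 h = contradiction (≤-trans a1 (≤-trans h (≤-reflexive (*-zeroʳ K)))) (λ ())
pigeon₂ n@(suc _) a K g a1 h = sumN-pigeon n a (λ i → K * n * g i) (s≤s z≤n)
   (≤-trans (*-monoʳ-≤ n h) (≤-reflexive (trans (lem n K (sumN n g)) (sym (sumN-scale n (K * n) g)))))
  where lem : ∀ n K s → n * (K * s) ≡ K * n * s
        lem n K s = ringℕ (n ∷ K ∷ s ∷ []) ($0 ⋆ ($1 ⋆ $2)) ($1 ⋆ $0 ⋆ $2) refl

shift≤ : ∀ n h g → (∀ u → n ≤ u → g u ≡ 0) → sumN n (λ v → g (h + v)) ≤ sumN n g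
shift≤ n h g z = ≤-trans (m≤m+n _ (sumN h g)) (≤-reflexive (trans (sumN-shift n h g) (trans (sumN-split n h g) (trans (cong (λ ○ → sumN n g + ○) (trans (sumN-cong h (λ i → z (n + i) (m≤m+n n i))) (sumN-zero h))) (+-identityʳ _)))))

sum≤shift : ∀ n h g → (∀ i → g i ≤ 1) → sumN n g ≤ sumN n (λ v → g (h + v)) + h
sum≤shift n h g b = ≤-trans (sumN-mono-n g (m≤m+n n h)) (≤-trans (≤-reflexive (sym (sumN-shift n h g))) (+-monoʳ-≤ _ (≤-trans (sumN-≤ h (λ i _ → b i)) (≤-reflexive (*-identityʳ h)))))

-- The `2 D` translates of `G` have total size at least `2 ℓ` up to boundary terms, so their
-- pairwise overlaps add up to at least `ℓ / 2`. Pigeonholing over both indices finds one pair with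
-- a large overlap.
overlapping : ∀ D ℓ G → 1 ≤ D → 1 ≤ ℓ → (∀ x → ℓ ≤ x → G x ≡ false) → ℓ ≤ D * cnt ℓ G → 2 * (2 * D * (2 * D)) ≤ ℓ →
  ∃ λ e → 1 ≤ e × e ≤ ℓ × ℓ ≤ 2 * (2 * D * (2 * D)) * cnt ℓ (λ x → G x ∧ G (x + e))
overlapping D ℓ G D1 ℓ1 supp dens big = e , ℕP.m<n⇒0<n∸m j′<j , ≤-trans (m∸n≤m j j′) (≤-trans (<⇒≤ j<J) J≤ℓ) , fin
  where
  J = 2 * D
  w : ℕ → ℕ → ℕ
  w j j′ = sumN ℓ (λ x → 𝟙 (G (j′ + x) ∧ G (j + x)))
  W = sumN J (λ j → sumN j (w j))
  J1 : 1 ≤ J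
  J1 = 1≤m* {2} (s≤s z≤n) D1
  J≤ℓ : J ≤ ℓ
  J≤ℓ = ≤-trans (≤-trans (m≤m*n J J1) (m≤n*m (J * J) {2} (s≤s z≤n))) big
  -- A point covered by k translates lies in at least k - 1 pairwise intersections.
  pt : ∀ n (b : ℕ → Bool) → sumN n (λ j → 𝟙 (b j)) ≤ 1 + sumN n (λ j → sumN j (λ j′ → 𝟙 (b j′ ∧ b j)))
  pt zero b = z≤n
  pt (suc n) b with b n
  ... | false = ≤-trans (≤-reflexive (+-identityʳ _)) (≤-trans (pt n b) (+-monoʳ-≤ 1 (m≤m+n _ _)))
  ... | true = ≤-trans (≤-reflexive (+-comm _ 1)) (+-monoʳ-≤ 1 (≤-trans (≤-reflexive (sumN-cong n (λ i → cong 𝟙 (sym (lem (b i)))))) (m≤n+m _ _)))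
    where lem : ∀ c → c ∧ true ≡ c
          lem true = refl
          lem false = refl
  C = cnt ℓ G
  low : J * C ≤ sumN J (λ j → sumN ℓ (λ x → 𝟙 (G (j + x)))) + J * J
  low = ≤-trans (≤-sumN J {g = λ j → sumN ℓ (λ x → 𝟙 (G (j + x))) + J} (λ j j<J → ≤-trans (sum≤shift ℓ j (λ x → 𝟙 (G x)) (λ i → 𝟙≤1 _)) (+-monoʳ-≤ _ (<⇒≤ j<J)))) (≤-reflexive (trans (sumN-add J _ _) (cong (λ ○ → sumN J (λ j → sumN ℓ (λ x → 𝟙 (G (j + x)))) + ○) (sumN-const J J))))
  up : sumN J (λ j → sumN ℓ (λ x → 𝟙 (G (j + x)))) ≤ ℓ + W
  up = ≤-trans (≤-reflexive (sumN-swap J ℓ _)) (≤-trans (sumN-mono ℓ (λ x _ → pt J (λ j → G (j + x)))) (≤-reflexive (trans (sumN-add ℓ _ _) (cong₂ _+_ (trans (sumN-const ℓ 1) (*-identityʳ ℓ)) (trans (sumN-swap ℓ J _) (sumN-cong J (λ j → sumN-swap ℓ j _)))))))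
  ℓ≤2W : ℓ ≤ 2 * W
  ℓ≤2W = +-cancelˡ-≤ (ℓ + 2 * (J * J) + 2 * ℓ) ℓ (2 * W) (≤-trans (≤-reflexive (lem₁ ℓ (J * J))) (≤-trans (+-monoˡ-≤ (2 * (J * J)) (*-monoʳ-≤ 2 (≤-trans (*-monoʳ-≤ 2 dens) (≤-trans (≤-reflexive (sym (*-assoc 2 D C))) (≤-trans low (+-monoˡ-≤ (J * J) up))))))
        (≤-trans (≤-reflexive (lem₂ ℓ (J * J) W)) (≤-trans (+-monoˡ-≤ _ big) (≤-reflexive (lem₃ ℓ (J * J) W))))))
    where
    lem₁ : ∀ ℓ q → ℓ + 2 * q + 2 * ℓ + ℓ ≡ 2 * (2 * ℓ) + 2 * q
    lem₁ ℓ q = ringℕ (ℓ ∷ q ∷ []) ($0 ⊹ ⟨ 2 ⟩ ⋆ $1 ⊹ ⟨ 2 ⟩ ⋆ $0 ⊹ $0) (⟨ 2 ⟩ ⋆ (⟨ 2 ⟩ ⋆ $0) ⊹ ⟨ 2 ⟩ ⋆ $1) refl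
    lem₂ : ∀ ℓ q W → 2 * (ℓ + W + q) + 2 * q ≡ 2 * q + (2 * ℓ + 2 * W + 2 * q)
    lem₂ ℓ q W = ringℕ (ℓ ∷ q ∷ W ∷ []) (⟨ 2 ⟩ ⋆ ($0 ⊹ $2 ⊹ $1) ⊹ ⟨ 2 ⟩ ⋆ $1) (⟨ 2 ⟩ ⋆ $1 ⊹ (⟨ 2 ⟩ ⋆ $0 ⊹ ⟨ 2 ⟩ ⋆ $2 ⊹ ⟨ 2 ⟩ ⋆ $1)) refl
    lem₃ : ∀ ℓ q W → ℓ + (2 * ℓ + 2 * W + 2 * q) ≡ ℓ + 2 * q + 2 * ℓ + 2 * W
    lem₃ ℓ q W = ringℕ (ℓ ∷ q ∷ W ∷ []) ($0 ⊹ (⟨ 2 ⟩ ⋆ $0 ⊹ ⟨ 2 ⟩ ⋆ $2 ⊹ ⟨ 2 ⟩ ⋆ $1)) ($0 ⊹ ⟨ 2 ⟩ ⋆ $1 ⊹ ⟨ 2 ⟩ ⋆ $0 ⊹ ⟨ 2 ⟩ ⋆ $2) refl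
  pj = pigeon₂ J ℓ 2 (λ j → sumN j (w j)) ℓ1 ℓ≤2W
  j = proj₁ pj
  j<J = proj₁ (proj₂ pj)
  pj′ = pigeon₂ j ℓ (2 * J) (w j) ℓ1 (proj₂ (proj₂ pj))
  j′ = proj₁ pj′
  j′<j = proj₁ (proj₂ pj′)
  e = j ∸ j′
  h : ℕ → ℕ
  h u = 𝟙 (G u ∧ G (u + e))
  h0 : ∀ u → ℓ ≤ u → h u ≡ 0
  h0 u p = cong (λ b → 𝟙 (b ∧ G (u + e))) (supp u p)
  fin : ℓ ≤ 2 * (J * J) * cnt ℓ (λ x → G x ∧ G (x + e))
  fin = ≤-trans (proj₂ (proj₂ pj′)) (*-mono-≤ (≤-trans (*-monoʳ-≤ (2 * J) (<⇒≤ j<J)) (≤-reflexive (*-assoc 2 J J)))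
      (≤-trans (≤-reflexive (sumN-cong ℓ (λ x → cong (λ z → 𝟙 (G (j′ + x) ∧ G z)) (trans (cong (_+ x) (sym (m+[n∸m]≡n (<⇒≤ j′<j)))) (lem j′ e x))))) (shift≤ ℓ j′ h h0)))
    where lem : ∀ a b c → a + b + c ≡ a + c + b
          lem a b c = ringℕ (a ∷ b ∷ c ∷ []) ($0 ⊹ $1 ⊹ $2) ($0 ⊹ $2 ⊹ $1) refl

-- A cube of dimension `κ` in `G ∩ (G - e)` is a cube of dimension `suc κ` in `G` with the extra
-- side `e`. The density gets worse at each step by an amount fixed in advance.
cube : ∀ κ D → 1 ≤ D → ∃ λ ℓ₀ → ∀ ℓ G → ℓ₀ ≤ ℓ → 1 ≤ ℓ → (∀ x → ℓ ≤ x → G x ≡ false) → ℓ ≤ D * cnt ℓ G →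
  ∃ λ es → length es ≡ κ × All (λ e → 1 ≤ e × e ≤ ℓ) es × ∃ λ x → Cube es G x
cube zero D D1 = 0 , λ ℓ G _ ℓ1 supp dens → [] , refl , [] , let (x , _ , p) = cnt-pos ℓ G (pos ℓ (cnt ℓ G) ℓ1 dens) in x , p
  where pos : ∀ ℓ c → 1 ≤ ℓ → ℓ ≤ D * c → 1 ≤ c
        pos ℓ zero ℓ1 h = contradiction (≤-trans ℓ1 (≤-trans h (≤-reflexive (*-zeroʳ D)))) (λ ())
        pos ℓ (suc c) _ _ = s≤s z≤n
cube (suc κ) D D1 with cube κ (2 * (2 * D * (2 * D))) (1≤m* {2} (s≤s z≤n) (1≤m* (1≤m* {2} (s≤s z≤n) D1) (1≤m* {2} (s≤s z≤n) D1)))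
... | ℓ₀ , rec = ℓ₀ + 2 * (2 * D * (2 * D)) , λ ℓ G big ℓ1 supp dens →
   let (e , e1 , eℓ , dens′) = overlapping D ℓ G D1 ℓ1 supp dens (≤-trans (m≤n+m _ ℓ₀) big)
       (es , len , ok , x , cub) = rec ℓ (λ x → G x ∧ G (x + e)) (≤-trans (m≤m+n ℓ₀ _) big) ℓ1 (λ x p → cong (_∧ G (x + e)) (supp x p)) dens′
   in e ∷ es , cong suc len , (e1 , eℓ) ∷ ok , x , Cube-∧ es G e x cub

-- Roth's theorem for three-point patterns by density increment.

Pat : ℕ → ℕ → ℕ → (ℕ → Bool) → Set
Pat β γ n A = ∃ λ x → ∃ λ w → 1 ≤ w × x + (β + γ) * w < n × A x ≡ true × A (x + β * w) ≡ true × A (x + (β + γ) * w) ≡ true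

sumN-except : ∀ n c g C → c < suc n → (∀ i → i < suc n → g i ≤ C) → sumN (suc n) g ≤ g c + n * C
sumN-except n c g C c≤n p with c ℕ.≟ n
... | yes refl = ≤-trans (+-monoˡ-≤ (g n) (sumN-≤ n (λ i q → p i (m<n⇒m<1+n q)))) (≤-reflexive (+-comm (n * C) (g n)))
sumN-except zero c g C c≤n p | no c≢n = contradiction (n≤0⇒n≡0 (≤-pred c≤n)) c≢n
sumN-except (suc n) c g C c≤n p | no c≢n = ≤-trans (+-mono-≤ (sumN-except n c g C (≤∧≢⇒< (≤-pred c≤n) c≢n) (λ i q → p i (m<n⇒m<1+n q))) (p (suc n) ≤-refl)) (≤-reflexive (lem (g c) n C))
  where lem : ∀ a n C → a + n * C + C ≡ a + suc n * C
        lem a n C = ringℕ (a ∷ n ∷ C ∷ []) ($0 ⊹ $1 ⋆ $2 ⊹ $2) ($0 ⊹ (⟨ 1 ⟩ ⊹ $1) ⋆ $2) refl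

𝟙-escape : ∀ a c c′ x y z → (c ≡ true → c′ ≡ true) → (c ≡ true → x ≡ true → z ≡ true) → 𝟙 a * (𝟙 c * 𝟙 (not y)) ≤ 𝟙 a * (𝟙 c′ * 𝟙 (not x)) + 𝟙 c * 𝟙 (z ∧ not y)
𝟙-escape false c c′ x y z p q = z≤n
𝟙-escape true false c′ x y z p q = z≤n
𝟙-escape true true c′ x true z p q = z≤n
𝟙-escape true true c′ false false z p q rewrite p refl = s≤s z≤n
𝟙-escape true true c′ true false z p q rewrite q refl refl = m≤n+m 1 _

𝟙-inside : ∀ q c y → (q ≡ true → c ≡ true) → (q ≡ true → y ≡ false) → 𝟙 q ≤ 1 * (𝟙 c * 𝟙 (not y))
𝟙-inside false c y f g = z≤n
𝟙-inside true c y f g rewrite f refl | g refl = ≤-refl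

-- Densities are measured in units of `1 / g`. `Good k M` is proved downwards in `k`, from `k > g`,
-- where it is vacuous, to `k₀`, which is the density `1 / D₀`. The choice of `k₀` ensures
-- `4 g (σ + 2) ≤ k²` for all `k ≥ k₀`, the inequality on which each step turns. The parameters are
-- variables tied by equations so that they remain symbols in the computations.
module Increment (β β′ γ γ′ D₀ : ℕ) (β≡ : β ≡ suc β′) (γ≡ : γ ≡ suc γ′) (D1 : 1 ≤ D₀)
    (σ ρ k₀ g : ℕ) (σ≡ : σ ≡ β + γ) (ρ≡ : ρ ≡ β * γ) (k₀≡ : k₀ ≡ 4 * D₀ * (σ + 2)) (g≡ : g ≡ k₀ * D₀) where
  β1 : 1 ≤ β
  β1 = subst (1 ≤_) (sym β≡) (s≤s z≤n)
  γ1 : 1 ≤ γ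
  γ1 = subst (1 ≤_) (sym γ≡) (s≤s z≤n)
  ρ1 : 1 ≤ ρ
  ρ1 = subst (1 ≤_) (sym ρ≡) (1≤m* β1 γ1)
  k₀1 : 1 ≤ k₀
  k₀1 = subst (1 ≤_) (sym k₀≡) (1≤m* {4 * D₀} {σ + 2} (1≤m* {4} (s≤s z≤n) D1) (≤-trans (s≤s z≤n) (m≤n+m 2 σ)))
  g1 : 1 ≤ g
  g1 = subst (1 ≤_) (sym g≡) (1≤m* k₀1 D1)

  Good : ℕ → ℕ → Set
  Good k M = ∀ A → k * M ≤ g * cnt M A → Pat β γ M A

  pat-AP : ∀ n M x₀ s A → 1 ≤ s → x₀ + s * M ≤ n → Pat β γ M (λ i → A (x₀ + s * i)) → Pat β γ n A
  pat-AP n M x₀ s@(suc s′) A s1 h (x , w , w1 , lt , a₁ , a₂ , a₃) = x₀ + s * x , s * w , 1≤m* s1 w1 ,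
     ≤-trans (≤-trans (s≤s (≤-reflexive (lem x₀ s x (β + γ) w))) (+-monoʳ-< x₀ (ℕP.*-monoʳ-< s lt))) h , a₁ , subst (λ z → A z ≡ true) (sym (lem x₀ s x β w)) a₂ , subst (λ z → A z ≡ true) (sym (lem x₀ s x (β + γ) w)) a₃
    where lem : ∀ x₀ s x t w → x₀ + s * x + t * (s * w) ≡ x₀ + s * (x + t * w)
          lem x₀ s x t w = ringℕ (x₀ ∷ s ∷ x ∷ t ∷ w ∷ []) ($0 ⊹ $1 ⋆ $2 ⊹ $3 ⋆ ($1 ⋆ $4)) ($0 ⊹ $1 ⋆ ($2 ⊹ $3 ⋆ $4)) refl

  -- If no progression of length `M` is denser than `(k + 1) / g`, then `A`, of density `k / g`, is
  -- so evenly spread that long progressions cannot be sparse either. The length `(σ + 2) l` leaves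
  -- room for left partners, a central interval of length `l`, and right partners.
  module Step (k : ℕ) (k₀≤k : k₀ ≤ k) (M : ℕ) (M1 : 1 ≤ M) (U κ ℓ Cst l₀ l n : ℕ) (U≡ : U ≡ k + 1)
      (κ≡ : κ ≡ 4 * (g * (g * M))) (ℓ1 : 1 ≤ ℓ)
      (cub : ∀ G → (∀ x → ℓ ≤ x → G x ≡ false) → ℓ ≤ 2 * D₀ * cnt ℓ G → ∃ λ es → length es ≡ κ × All (λ e → 1 ≤ e × e ≤ ℓ) es × ∃ λ x → Cube es G x)
      (Cst≡ : Cst ≡ k + 1 + 2 * (g * (σ * ℓ * M)) + (γ + 1) * (g * M))
      (l₀≡ : l₀ ≡ 4 * ((σ + 2) * (g * M)) + 4 * (g * Cst) + (2 + ρ)) (l≡ : l ≡ l₀ * (ρ * ℓ)) (n≡ : n ≡ (σ + 2) * l) where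
    κ1 : 1 ≤ κ
    κ1 = subst (1 ≤_) (sym κ≡) (1≤m* {4} (s≤s z≤n) (1≤m* g1 (1≤m* g1 M1)))
    ρℓ1 : 1 ≤ ρ * ℓ
    ρℓ1 = 1≤m* ρ1 ℓ1
    l₀≤l : l₀ ≤ l
    l₀≤l = subst (l₀ ≤_) (sym l≡) (m≤m*n l₀ ρℓ1)
    l₀′ : 4 * ((σ + 2) * (g * M)) + 4 * (g * Cst) + (2 + ρ) ≤ l
    l₀′ = subst (_≤ l) l₀≡ l₀≤l
    ρ≤l : 2 + ρ ≤ l
    ρ≤l = ≤-trans (m≤n+m (2 + ρ) _) l₀′
    l2 : 2 ≤ l
    l2 = ≤-trans (m≤m+n 2 ρ) ρ≤l
    l1 : 1 ≤ l
    l1 = ≤-trans (s≤s z≤n) l2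
    l₀1 : 1 ≤ l₀
    l₀1 = subst (1 ≤_) (sym l₀≡) (≤-trans (≤-trans (s≤s z≤n) (m≤m+n 2 ρ)) (m≤n+m (2 + ρ) _))
    lC : 4 * (g * Cst) ≤ l
    lC = ≤-trans (≤-trans (m≤n+m _ (4 * ((σ + 2) * (g * M)))) (m≤m+n _ (2 + ρ))) l₀′
    lM : 4 * ((σ + 2) * (g * M)) ≤ l
    lM = ≤-trans (≤-trans (m≤m+n _ (4 * (g * Cst))) (m≤m+n _ (2 + ρ))) l₀′
    k4 : 4 * (σ + 2) ≤ k
    k4 = ≤-trans (*-monoˡ-≤ (σ + 2) (m≤m*n 4 D1)) (subst (_≤ k) k₀≡ k₀≤k)
    k1 : 1 ≤ k
    k1 = ≤-trans k₀1 k₀≤k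

    module _ (A : ℕ → Bool) (dense : k * n ≤ g * cnt n A) where
      AP : ℕ → ℕ → ℕ → Bool
      AP x₀ s i = A (x₀ + s * i)
      module _ (H : ∀ x₀ s → 1 ≤ s → x₀ + s * M ≤ n → g * cnt M (AP x₀ s) ≤ U * M) where
        long : ∀ j r x₀ s → 1 ≤ s → r ≤ M → x₀ + s * (j * M + r) ≤ n → g * cnt (j * M + r) (AP x₀ s) ≤ U * (j * M + r) + g * M
        long zero r x₀ s s1 rM h = ≤-trans (*-monoʳ-≤ g (≤-trans (cnt≤ r _) rM)) (m≤n+m _ (U * r))
        long (suc j) r x₀ s s1 rM h = ≤-trans (≤-reflexive (trans (cong (λ z → g * z) (trans (cong (λ z → cnt z (AP x₀ s)) (+-assoc M (j * M) r)) (sumN-split M (j * M + r) _))) (*-distribˡ-+ g _ _)))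
           (≤-trans (+-mono-≤ (H x₀ s s1 (≤-trans (+-monoʳ-≤ x₀ (*-monoʳ-≤ s (≤-trans (m≤m+n M (j * M)) (m≤m+n _ r)))) h))
              (≤-trans (≤-reflexive (cong (λ z → g * z) (sumN-cong (j * M + r) (λ i → cong (λ z → 𝟙 (A z)) (lem x₀ s M i))))) (long j r (x₀ + s * M) s s1 rM (≤-trans (≤-reflexive (lem₂ x₀ s M (j * M) r)) h))))
            (≤-reflexive (lem₃ U M (j * M) r (g * M))))
          where
          lem : ∀ x s M i → x + s * (M + i) ≡ x + s * M + s * i
          lem x s M i = ringℕ (x ∷ s ∷ M ∷ i ∷ []) ($0 ⊹ $1 ⋆ ($2 ⊹ $3)) ($0 ⊹ $1 ⋆ $2 ⊹ $1 ⋆ $3) refl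
          lem₂ : ∀ x s M q r → x + s * M + s * (q + r) ≡ x + s * (M + q + r)
          lem₂ x s M q r = ringℕ (x ∷ s ∷ M ∷ q ∷ r ∷ []) ($0 ⊹ $1 ⋆ $2 ⊹ $1 ⋆ ($3 ⊹ $4)) ($0 ⊹ $1 ⋆ ($2 ⊹ $3 ⊹ $4)) refl
          lem₃ : ∀ U M q r G → U * M + (U * (q + r) + G) ≡ U * (M + q + r) + G
          lem₃ U M q r G = ringℕ (U ∷ M ∷ q ∷ r ∷ G ∷ []) ($0 ⋆ $1 ⊹ ($0 ⋆ ($2 ⊹ $3) ⊹ $4)) ($0 ⋆ ($1 ⊹ $2 ⊹ $3) ⊹ $4) refl

        -- The progression is cut into pieces of length `M`, each obeying `H`; the incomplete piece
        -- is counted trivially as `M`.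
        AP≤ : ∀ L x₀ s → 1 ≤ s → x₀ + s * L ≤ n → g * cnt L (AP x₀ s) ≤ U * L + g * M
        AP≤ L x₀ s s1 h = subst (λ L → g * cnt L (AP x₀ s) ≤ U * L + g * M) (sym L=) (long q r x₀ s s1 (<⇒≤ (ℕ-%< )) (subst (λ L → x₀ + s * L ≤ n) L= h))
          where
          instance nz = ℕ.>-nonZero M1
          q = L ℕ./ M
          r = L ℕ.% M
          open ℕDM using (m≡m%n+[m/n]*n; m%n<n)
          ℕ-%< : r < M
          ℕ-%< = m%n<n L M
          L= : L ≡ q * M + r
          L= = trans (m≡m%n+[m/n]*n L M) (+-comm r (q * M))

        -- A lower bound from upper bounds: every other part of the interval holds at most
        -- `(k + 1) / g` of its length, so the rest of `A` must lie in the class of `c`. Since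
        -- `U = k + 1`, each point outside the class costs exactly 1 in the units of `g`.
        classLower : ∀ x₀ s′ c l r → c < suc s′ → x₀ + suc s′ * l + r ≡ n → suc s′ ≤ r →
          k * l ≤ g * cnt l (λ i → A (x₀ + (c + suc s′ * i))) + (x₀ + r) + s′ * l + (s′ + 2) * (g * M)
        classLower x₀ s′ c l r c<s n= s≤r = +-cancelˡ-≤ (k * x₀ + s′ * (k * l) + k * r) _ _
           (≤-trans (≤-reflexive (trans (lem₁ k x₀ s′ l r) (cong (k *_) n=))) (≤-trans dense (≤-trans (≤-reflexive (trans (cong (g *_) parts) (lem₂ g _ _ _)))
             (≤-trans (+-mono-≤ (+-mono-≤ first mid) final) (≤-reflexive (trans (cong (λ U → U * x₀ + g * M + (g * X c + s′ * (U * l + g * M)) + (U * r + g * M)) U≡) (lem₃ k x₀ s′ l r (g * M) (g * X c))))))))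
          where
          s = suc s′
          X : ℕ → ℕ
          X c = cnt l (λ i → A (x₀ + (c + s * i)))
          parts : cnt n A ≡ cnt x₀ A + cnt (s * l) (λ i → A (x₀ + i)) + cnt r (λ i → A (x₀ + s * l + i))
          parts = trans (cong (λ z → cnt z A) (sym n=)) (trans (sumN-split (x₀ + s * l) r _) (cong (_+ cnt r (λ i → A (x₀ + s * l + i))) (sumN-split x₀ (s * l) _)))
          one : ∀ L y → y + L ≤ n → g * cnt L (λ i → A (y + i)) ≤ U * L + g * M
          one L y h = ≤-trans (≤-reflexive (cong (g *_) (sumN-cong L (λ i → cong (λ z → 𝟙 (A (y + z))) (sym (*-identityˡ i)))))) (AP≤ L y 1 (s≤s z≤n) (≤-trans (≤-reflexive (cong (λ ○ → y + ○) (*-identityˡ L))) h))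
          first : g * cnt x₀ A ≤ U * x₀ + g * M
          first = one x₀ 0 (≤-trans (≤-trans (m≤m+n x₀ (s * l)) (m≤m+n _ r)) (≤-reflexive n=))
          final : g * cnt r (λ i → A (x₀ + s * l + i)) ≤ U * r + g * M
          final = one r (x₀ + s * l) (≤-reflexive n=)
          mid : g * cnt (s * l) (λ i → A (x₀ + i)) ≤ g * X c + s′ * (U * l + g * M)
          mid = ≤-trans (≤-reflexive (trans (cong (g *_) (sumN-classes s l _)) (sym (sumN-scale s g X)))) (sumN-except s′ c (λ c → g * X c) (U * l + g * M) c<s (λ c′ c′<s →
             ≤-trans (≤-reflexive (cong (g *_) (sumN-cong l (λ i → cong (λ z → 𝟙 (A z)) (sym (+-assoc x₀ c′ (s * i))))))) (AP≤ l (x₀ + c′) s (s≤s z≤n) (≤-trans (≤-reflexive (lem x₀ c′ (s * l))) (≤-trans (+-monoʳ-≤ (x₀ + s * l) (≤-trans (<⇒≤ c′<s) s≤r)) (≤-reflexive n=))))))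
            where lem : ∀ x c q → x + c + q ≡ x + q + c
                  lem x c q = ringℕ (x ∷ c ∷ q ∷ []) ($0 ⊹ $1 ⊹ $2) ($0 ⊹ $2 ⊹ $1) refl
          lem₁ : ∀ k x s l r → k * x + s * (k * l) + k * r + k * l ≡ k * (x + suc s * l + r)
          lem₁ k x s l r = ringℕ (k ∷ x ∷ s ∷ l ∷ r ∷ []) ($0 ⋆ $1 ⊹ $2 ⋆ ($0 ⋆ $3) ⊹ $0 ⋆ $4 ⊹ $0 ⋆ $3) ($0 ⋆ ($1 ⊹ (⟨ 1 ⟩ ⊹ $2) ⋆ $3 ⊹ $4)) refl
          lem₂ : ∀ g a b c → g * (a + b + c) ≡ g * a + g * b + g * c
          lem₂ g a b c = ringℕ (g ∷ a ∷ b ∷ c ∷ []) ($0 ⋆ ($1 ⊹ $2 ⊹ $3)) ($0 ⋆ $1 ⊹ $0 ⋆ $2 ⊹ $0 ⋆ $3) refl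
          lem₃ : ∀ k x s l r G X → (k + 1) * x + G + (X + s * ((k + 1) * l + G)) + ((k + 1) * r + G) ≡ k * x + s * (k * l) + k * r + (X + (x + r) + s * l + (s + 2) * G)
          lem₃ k x s l r G X = ringℕ (k ∷ x ∷ s ∷ l ∷ r ∷ G ∷ X ∷ []) (($0 ⊹ ⟨ 1 ⟩) ⋆ $1 ⊹ $5 ⊹ ($6 ⊹ $2 ⋆ (($0 ⊹ ⟨ 1 ⟩) ⋆ $3 ⊹ $5)) ⊹ (($0 ⊹ ⟨ 1 ⟩) ⋆ $4 ⊹ $5)) ($0 ⋆ $1 ⊹ $2 ⋆ ($0 ⋆ $3) ⊹ $0 ⋆ $4 ⊹ ($6 ⊹ ($1 ⊹ $4) ⊹ $2 ⋆ $3 ⊹ ($2 ⊹ ⟨ 2 ⟩) ⋆ $5)) refl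

        -- The cost of the outside, at most `(σ + 1) l` with boundary terms of order `g M`, is no
        -- more than half of `k l` because `k ≥ 4 (σ + 2)`.
        half : ∀ a b s′ C → s′ ≤ σ → k * l ≤ C + a + s′ * l + b * (g * M) → a + s′ * l ≤ (σ + 1) * l → b ≤ σ + 2 → k * l ≤ 2 * C
        half a b s′ C _ h ha hb = +-cancelˡ-≤ (k * l) _ _ (≤-trans (≤-reflexive (lem₀ (k * l))) (≤-trans (*-monoʳ-≤ 2 h) (≤-trans (≤-reflexive (lem₁ C a (s′ * l) (b * (g * M)))) (≤-trans (+-monoʳ-≤ (2 * C) (+-mono-≤ (*-monoʳ-≤ 2 ha) (*-monoʳ-≤ 2 (*-monoˡ-≤ (g * M) hb))))
            (≤-trans (+-monoʳ-≤ (2 * C) e≤) (≤-reflexive (+-comm (2 * C) (k * l))))))))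
          where
          lem₀ : ∀ x → x + x ≡ 2 * x
          lem₀ x = ringℕ (x ∷ []) ($0 ⊹ $0) (⟨ 2 ⟩ ⋆ $0) refl
          lem₁ : ∀ C a s b → 2 * (C + a + s + b) ≡ 2 * C + (2 * (a + s) + 2 * b)
          lem₁ C a s b = ringℕ (C ∷ a ∷ s ∷ b ∷ []) (⟨ 2 ⟩ ⋆ ($0 ⊹ $1 ⊹ $2 ⊹ $3)) (⟨ 2 ⟩ ⋆ $0 ⊹ (⟨ 2 ⟩ ⋆ ($1 ⊹ $2) ⊹ ⟨ 2 ⟩ ⋆ $3)) refl
          e≤ : 2 * ((σ + 1) * l) + 2 * ((σ + 2) * (g * M)) ≤ k * l
          e≤ = ≤-trans (+-monoʳ-≤ (2 * ((σ + 1) * l)) (≤-trans (*-monoˡ-≤ ((σ + 2) * (g * M)) {2} {4} (s≤s (s≤s z≤n))) lM)) (≤-trans (≤-trans (≤-reflexive (lem₂ σ l)) (*-monoˡ-≤ l lem₃)) (*-monoˡ-≤ l k4))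
            where
            lem₂ : ∀ s l → 2 * ((s + 1) * l) + l ≡ (2 * s + 3) * l
            lem₂ s l = ringℕ (s ∷ l ∷ []) (⟨ 2 ⟩ ⋆ (($0 ⊹ ⟨ 1 ⟩) ⋆ $1) ⊹ $1) ((⟨ 2 ⟩ ⋆ $0 ⊹ ⟨ 3 ⟩) ⋆ $1) refl
            lem₃ : 2 * σ + 3 ≤ 4 * (σ + 2)
            lem₃ = ≤-trans (m≤m+n _ (2 * σ + 5)) (≤-reflexive (lem₄ σ))
              where lem₄ : ∀ s → 2 * s + 3 + (2 * s + 5) ≡ 4 * (s + 2)
                    lem₄ s = ringℕ (s ∷ []) (⟨ 2 ⟩ ⋆ $0 ⊹ ⟨ 3 ⟩ ⊹ (⟨ 2 ⟩ ⋆ $0 ⊹ ⟨ 5 ⟩)) (⟨ 4 ⟩ ⋆ ($0 ⊹ ⟨ 2 ⟩)) refl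

        central : k * l ≤ 2 * (g * cnt l (λ i → A (β * l + i)))
        central = half (β * l + (γ + 1) * l) 2 0 (g * cnt l (λ i → A (β * l + i))) z≤n
           (subst (λ z → k * l ≤ g * z + (β * l + (γ + 1) * l) + 0 * l + 2 * (g * M)) (sumN-cong l (λ i → cong (λ z → 𝟙 (A (β * l + z))) (*-identityˡ i)))
             (classLower (β * l) 0 0 l ((γ + 1) * l) (s≤s z≤n) (trans (lem₁ β γ l) (sym (trans n≡ (cong (λ σ → (σ + 2) * l) σ≡)))) (1≤m* {γ + 1} (m≤n+m 1 γ) l1)))
           (≤-reflexive (trans (lem₂ β γ l) (cong (λ σ → (σ + 1) * l) (sym σ≡)))) (m≤n+m 2 σ)
          where
          lem₁ : ∀ β γ l → β * l + 1 * l + (γ + 1) * l ≡ (β + γ + 2) * l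
          lem₁ β γ l = ringℕ (β ∷ γ ∷ l ∷ []) ($0 ⋆ $2 ⊹ ⟨ 1 ⟩ ⋆ $2 ⊹ ($1 ⊹ ⟨ 1 ⟩) ⋆ $2) (($0 ⊹ $1 ⊹ ⟨ 2 ⟩) ⋆ $2) refl
          lem₂ : ∀ β γ l → β * l + (γ + 1) * l + 0 * l ≡ (β + γ + 1) * l
          lem₂ β γ l = ringℕ (β ∷ γ ∷ l ∷ []) ($0 ⋆ $2 ⊹ ($1 ⊹ ⟨ 1 ⟩) ⋆ $2 ⊹ ⟨ 0 ⟩ ⋆ $2) (($0 ⊹ $1 ⊹ ⟨ 1 ⟩) ⋆ $2) refl

        k₀-cancel : ∀ L c → k * L ≤ 2 * (g * c) → L ≤ 2 * D₀ * c
        k₀-cancel L c h = *-cancelˡ-≤ k₀ {{ℕ.>-nonZero k₀1}} (≤-trans (*-monoˡ-≤ L k₀≤k) (≤-trans h (≤-reflexive (trans (cong (λ g → 2 * (g * c)) g≡) (lem k₀ D₀ c)))))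
          where lem : ∀ k D c → 2 * (k * D * c) ≡ k * (2 * D * c)
                lem k D c = ringℕ (k ∷ D ∷ c ∷ []) (⟨ 2 ⟩ ⋆ ($0 ⋆ $1 ⋆ $2)) ($0 ⋆ (⟨ 2 ⟩ ⋆ $1 ⋆ $2)) refl

        window : ∃ λ w₀ → w₀ + ρ * ℓ ≤ β * l + l + ρ × β * l ≤ w₀ × ℓ ≤ 2 * D₀ * cnt ℓ (λ i → A (w₀ + ρ * i))
        -- The central interval is cut into `l₀` blocks and each block into the `ρ` residue classes;
        -- one class of one block inherits the density. The difference `ρ = β γ` makes the middle
        -- point of a pattern compatible with both outer ones.
        window = block (sumN-pigeon l₀ (ρ * ℓ) inBlock l₀1
             (≤-trans (subst (_≤ 2 * D₀ * cnt l (λ i → A (β * l + i))) l≡ (k₀-cancel l _ central)) (≤-reflexive (trans (cong (2 * D₀ *_) (trans (cong (λ z → cnt z (λ i → A (β * l + i))) l≡) (sumN-blocks l₀ (ρ * ℓ) _))) (sym (sumN-scale l₀ (2 * D₀) _))))))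
          where
          inBlock : ℕ → ℕ
          inBlock b = 2 * D₀ * sumN (ρ * ℓ) (λ i → 𝟙 (A (β * l + (b * (ρ * ℓ) + i))))
          inClass : ℕ → ℕ → ℕ
          inClass b c = 2 * D₀ * sumN ℓ (λ i → 𝟙 (A (β * l + (b * (ρ * ℓ) + (c + ρ * i)))))
          Window : Set
          Window = ∃ λ w₀ → w₀ + ρ * ℓ ≤ β * l + l + ρ × β * l ≤ w₀ × ℓ ≤ 2 * D₀ * cnt ℓ (λ i → A (w₀ + ρ * i))
          lem : ∀ a b c d → a + (b + (c + d)) ≡ a + (b + c) + d
          lem a b c d = ringℕ (a ∷ b ∷ c ∷ d ∷ []) ($0 ⊹ ($1 ⊹ ($2 ⊹ $3))) ($0 ⊹ ($1 ⊹ $2) ⊹ $3) refl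
          le : ∀ b c → b < l₀ → c < ρ → β * l + (b * (ρ * ℓ) + c) + ρ * ℓ ≤ β * l + l + ρ
          le b c b<l₀ c<ρ = ≤-trans (≤-reflexive (lem₂ (β * l) b (ρ * ℓ) c)) (+-mono-≤ (+-monoʳ-≤ (β * l) (≤-trans (*-monoˡ-≤ (ρ * ℓ) b<l₀) (≤-reflexive (sym l≡)))) (<⇒≤ c<ρ))
            where lem₂ : ∀ a b r c → a + (b * r + c) + r ≡ a + (suc b * r) + c
                  lem₂ a b r c = ringℕ (a ∷ b ∷ r ∷ c ∷ []) ($0 ⊹ ($1 ⋆ $2 ⊹ $3) ⊹ $2) ($0 ⊹ ((⟨ 1 ⟩ ⊹ $1) ⋆ $2) ⊹ $3) refl
          class : ∀ b → b < l₀ → (∃ λ c → c < ρ × ℓ ≤ inClass b c) → Window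
          class b b<l₀ (c , c<ρ , hc) = β * l + (b * (ρ * ℓ) + c) , le b c b<l₀ c<ρ , m≤m+n _ _ , ≤-trans hc (≤-reflexive (cong (2 * D₀ *_) (sumN-cong ℓ (λ i → cong (λ z → 𝟙 (A z)) (lem (β * l) (b * (ρ * ℓ)) c (ρ * i))))))
          block : (∃ λ b → b < l₀ × ρ * ℓ ≤ inBlock b) → Window
          block (b , b<l₀ , hb) = class b b<l₀ (sumN-pigeon ρ ℓ (inClass b) ρ1 (≤-trans hb (≤-reflexive (trans (cong (2 * D₀ *_) (sumN-classes ρ ℓ _)) (sym (sumN-scale ρ (2 * D₀) _))))))

        Cube-base : ∀ es G x → Cube es G x → G x ≡ true
        Cube-base [] G x p = p
        Cube-base (e ∷ es) G x (p , _) = Cube-base es G x p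

        -- `m₀` is the base of the cube, so `m₀ + ρ e` lies in `A` for every subset sum `e` of its
        -- sides. `P` records left points `m₀ - β u` and `Q` right points `m₀ + γ v`. Whenever
        -- `v = u + σ e`, the points `m₀ - β u`, `m₀ + ρ e`, `m₀ + γ v` form a pattern of width
        -- `w = γ e + u`.
        module Located (w₀ : ℕ) (w₀≤ : w₀ + ρ * ℓ ≤ β * l + l + ρ) (βl≤w₀ : β * l ≤ w₀) (x₀ : ℕ) (x₀<ℓ : x₀ < ℓ) where
          G : ℕ → Bool
          G i = ⌊ i <? ℓ ⌋ ∧ A (w₀ + ρ * i)
          m₀ p₀ : ℕ
          m₀ = w₀ + ρ * x₀
          p₀ = m₀ ∸ β * l
          βl≤m₀ : β * l ≤ m₀
          βl≤m₀ = ≤-trans βl≤w₀ (m≤m+n w₀ _)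
          m₀= : p₀ + β * l ≡ m₀
          m₀= = m∸n+n≡m βl≤m₀
          m₀≤ : m₀ ≤ β * l + l
          m₀≤ = +-cancelʳ-≤ ρ m₀ (β * l + l) (≤-trans (≤-reflexive (lem w₀ ρ x₀)) (≤-trans (+-monoʳ-≤ w₀ (*-monoʳ-≤ ρ x₀<ℓ)) w₀≤))
            where lem : ∀ w r x → w + r * x + r ≡ w + r * suc x
                  lem w r x = ringℕ (w ∷ r ∷ x ∷ []) ($0 ⊹ $1 ⋆ $2 ⊹ $1) ($0 ⊹ $1 ⋆ (⟨ 1 ⟩ ⊹ $2)) refl
          n=′ : n ≡ β * l + l + (l + γ * l)
          n=′ = trans n≡ (trans (cong (λ σ → (σ + 2) * l) σ≡) (lem β γ l))
            where lem : ∀ b c l → (b + c + 2) * l ≡ b * l + l + (l + c * l)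
                  lem b c l = ringℕ (b ∷ c ∷ l ∷ []) (($0 ⊹ $1 ⊹ ⟨ 2 ⟩) ⋆ $2) ($0 ⋆ $2 ⊹ $2 ⊹ ($2 ⊹ $1 ⋆ $2)) refl
          P Q : ℕ → Bool
          P v = ⌊ 1 ≤? v ⌋ ∧ (⌊ v ≤? l ⌋ ∧ A (m₀ ∸ β * v))
          Q v = ⌊ 1 ≤? v ⌋ ∧ (⌊ v ≤? l ⌋ ∧ A (m₀ + γ * v))
          drop₂ : ∀ v b → 1 ≤ v → v ≤ l → ⌊ 1 ≤? v ⌋ ∧ (⌊ v ≤? l ⌋ ∧ b) ≡ b
          drop₂ v b p q with 1 ≤? v | v ≤? l
          ... | yes _ | yes _ = refl
          ... | yes _ | no ¬q = contradiction q ¬q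
          ... | no ¬p | _ = contradiction p ¬p
          in₂ : ∀ v b → ⌊ 1 ≤? v ⌋ ∧ (⌊ v ≤? l ⌋ ∧ b) ≡ true → 1 ≤ v × v ≤ l × b ≡ true
          in₂ v b h with ∧-elim {⌊ 1 ≤? v ⌋} h
          ... | h₁ , h₂ with ∧-elim {⌊ v ≤? l ⌋} h₂
          ... | h₃ , h₄ = ⌊⌋-elim (1 ≤? v) h₁ , ⌊⌋-elim (v ≤? l) h₃ , h₄
          in< : ∀ {v b} → l < v → ⌊ 1 ≤? v ⌋ ∧ (⌊ v ≤? l ⌋ ∧ b) ≡ false
          in< {v} {b} h with ⌊ 1 ≤? v ⌋ ∧ (⌊ v ≤? l ⌋ ∧ b) in eq
          ... | false = refl
          ... | true = contradiction (proj₁ (proj₂ (in₂ v b eq))) (<⇒≱ h)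
          p q : ℕ
          p = cnt (suc l) P
          q = cnt (suc l) Q
          β≤l : β ≤ l
          β≤l = ≤-trans (m≤m*n β γ1) (≤-trans (≤-reflexive (sym ρ≡)) (≤-trans (m≤n+m ρ 2) ρ≤l))
          p= : p ≡ cnt l (λ i → A (p₀ + (0 + suc β′ * i)))
          p= = trans (sumN-split 1 l _) (trans (sumN-cong< l (λ i i<l → cong 𝟙 (drop₂ (suc i) (A (m₀ ∸ β * suc i)) (s≤s z≤n) i<l))) (trans (sumN-rev l _) (sumN-cong< l (λ i i<l → cong (λ z → 𝟙 (A z)) (at i i<l)))))
            where
            at : ∀ i → i < l → m₀ ∸ β * suc (l ∸ suc i) ≡ p₀ + suc β′ * i
            at i i<l = trans (cong₂ (λ a b → a ∸ β * b) (sym m₀=) (sym (+-∸-assoc 1 i<l))) (trans (cong (_∸ β * (l ∸ i)) (trans (cong (λ z → p₀ + β * z) (sym (m+[n∸m]≡n (<⇒≤ i<l)))) (lem p₀ β i (l ∸ i)))) (trans (ℕP.m+n∸n≡m (p₀ + β * i) (β * (l ∸ i))) (cong (λ b → p₀ + b * i) β≡)))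
              where lem : ∀ p b i j → p + b * (i + j) ≡ p + b * i + b * j
                    lem p b i j = ringℕ (p ∷ b ∷ i ∷ j ∷ []) ($0 ⊹ $1 ⋆ ($2 ⊹ $3)) ($0 ⊹ $1 ⋆ $2 ⊹ $1 ⋆ $3) refl
          q= : q ≡ cnt l (λ i → A (m₀ + 1 + (γ′ + suc γ′ * i)))
          q= = trans (sumN-split 1 l _) (sumN-cong< l (λ i i<l → cong 𝟙 (trans (drop₂ (suc i) (A (m₀ + γ * suc i)) (s≤s z≤n) i<l) (cong A (trans (cong (λ c → m₀ + c * suc i) γ≡) (lem m₀ γ′ i))))))
            where lem : ∀ m c i → m + suc c * suc i ≡ m + 1 + (c + suc c * i)
                  lem m c i = ringℕ (m ∷ c ∷ i ∷ []) ($0 ⊹ (⟨ 1 ⟩ ⊹ $1) ⋆ (⟨ 1 ⟩ ⊹ $2)) ($0 ⊹ ⟨ 1 ⟩ ⊹ ($1 ⊹ (⟨ 1 ⟩ ⊹ $1) ⋆ $2)) refl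
          F1 : k * l ≤ 2 * (g * p)
          F1 = half (p₀ + r) (β′ + 2) β′ (g * p) (≤-trans (n≤1+n β′) (≤-trans (≤-reflexive (sym β≡)) (≤-trans (m≤m+n β γ) (≤-reflexive (sym σ≡)))))
               (subst (λ z → k * l ≤ g * z + (p₀ + r) + β′ * l + (β′ + 2) * (g * M)) (sym p=) (classLower p₀ β′ 0 l r (s≤s z≤n) (trans (cong (λ b → p₀ + b * l + r) (sym β≡)) (trans (cong (_+ r) m₀=) m₀r)) rβ))
               (≤-reflexive a=) (+-monoˡ-≤ 2 (≤-trans (n≤1+n β′) (≤-trans (≤-reflexive (sym β≡)) (≤-trans (m≤m+n β γ) (≤-reflexive (sym σ≡))))))
            where
            r = n ∸ m₀
            m₀≤n : m₀ ≤ n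
            m₀≤n = ≤-trans m₀≤ (≤-trans (m≤m+n _ _) (≤-reflexive (sym n=′)))
            m₀r : m₀ + r ≡ n
            m₀r = m+[n∸m]≡n m₀≤n
            rβ : suc β′ ≤ r
            rβ = ≤-trans (≤-reflexive (sym β≡)) (≤-trans β≤l (+-cancelˡ-≤ m₀ l r (≤-trans (+-mono-≤ m₀≤ (m≤m+n l (γ * l))) (≤-reflexive (trans (sym n=′) (sym m₀r))))))
            a= : p₀ + r + β′ * l ≡ (σ + 1) * l
            a= = +-cancelʳ-≡ l _ _ (trans (lem₀ p₀ r β′ l) (trans (cong (λ b → p₀ + b * l + r) (sym β≡)) (trans (cong (_+ r) m₀=) (trans m₀r (trans n≡ (lem₁ σ l))))))
              where
              lem₀ : ∀ p r b l → p + r + b * l + l ≡ p + suc b * l + r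
              lem₀ p r b l = ringℕ (p ∷ r ∷ b ∷ l ∷ []) ($0 ⊹ $1 ⊹ $2 ⋆ $3 ⊹ $3) ($0 ⊹ (⟨ 1 ⟩ ⊹ $2) ⋆ $3 ⊹ $1) refl
              lem₁ : ∀ s l → (s + 2) * l ≡ (s + 1) * l + l
              lem₁ s l = ringℕ (s ∷ l ∷ []) (($0 ⊹ ⟨ 2 ⟩) ⋆ $1) (($0 ⊹ ⟨ 1 ⟩) ⋆ $1 ⊹ $1) refl
          F2 : k * l ≤ g * q + (σ + 1) * l + (γ + 1) * (g * M)
          F2 = ≤-trans (subst (λ z → k * l ≤ g * z + (m₀ + 1 + r) + γ′ * l + (γ′ + 2) * (g * M)) (sym q=) (classLower (m₀ + 1) γ′ γ′ l r ≤-refl (trans (cong (λ c → m₀ + 1 + c * l + r) (sym γ≡)) m₀r) rγ))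
               (≤-reflexive (cong₂ (λ u v → u + v * (g * M)) (trans (+-assoc (g * q) _ _) (cong (λ ○ → g * q + ○) a=)) (trans (lem₂ γ′) (cong (_+ 1) (sym γ≡)))))
            where
            r = n ∸ (m₀ + 1 + γ * l)
            e≤n : m₀ + 1 + γ * l + l ≤ n + 1
            e≤n = ≤-trans (≤-reflexive (lem m₀ (γ * l) l)) (+-monoˡ-≤ 1 (≤-trans (+-monoˡ-≤ (l + γ * l) m₀≤) (≤-reflexive (sym n=′))))
              where lem : ∀ m c l → m + 1 + c + l ≡ m + (l + c) + 1
                    lem m c l = ringℕ (m ∷ c ∷ l ∷ []) ($0 ⊹ ⟨ 1 ⟩ ⊹ $1 ⊹ $2) ($0 ⊹ ($2 ⊹ $1) ⊹ ⟨ 1 ⟩) refl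
            e≤n₁ : m₀ + 1 + γ * l ≤ n
            e≤n₁ = +-cancelʳ-≤ 1 _ n (≤-trans (+-monoʳ-≤ _ l1) e≤n)
            m₀r : m₀ + 1 + γ * l + r ≡ n
            m₀r = m+[n∸m]≡n e≤n₁
            rγ : suc γ′ ≤ r
            rγ = ≤-trans (≤-reflexive (sym γ≡)) (+-cancelʳ-≤ 1 γ r (≤-trans γ+1≤l (+-cancelˡ-≤ (m₀ + 1 + γ * l) l (r + 1) (≤-trans e≤n (≤-reflexive (trans (cong (_+ 1) (sym m₀r)) (+-assoc (m₀ + 1 + γ * l) r 1)))))))
              where γ+1≤l : γ + 1 ≤ l
                    γ+1≤l = ≤-trans (≤-reflexive (+-comm γ 1)) (≤-trans (+-mono-≤ (s≤s {n = 1} z≤n) (≤-trans (m≤n*m γ β1) (≤-reflexive (sym ρ≡)))) ρ≤l)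
            a= : m₀ + 1 + r + γ′ * l ≡ (σ + 1) * l
            a= = +-cancelʳ-≡ l _ _ (trans (lem₀ (m₀ + 1) r γ′ l) (trans (cong (λ b → m₀ + 1 + b * l + r) (sym γ≡)) (trans m₀r (trans n≡ (lem₁ σ l)))))
              where
              lem₀ : ∀ p r b l → p + r + b * l + l ≡ p + suc b * l + r
              lem₀ p r b l = ringℕ (p ∷ r ∷ b ∷ l ∷ []) ($0 ⊹ $1 ⊹ $2 ⋆ $3 ⊹ $3) ($0 ⊹ (⟨ 1 ⟩ ⊹ $2) ⋆ $3 ⊹ $1) refl
              lem₁ : ∀ s l → (s + 2) * l ≡ (s + 1) * l + l
              lem₁ s l = ringℕ (s ∷ l ∷ []) (($0 ⊹ ⟨ 2 ⟩) ⋆ $1) (($0 ⊹ ⟨ 1 ⟩) ⋆ $1 ⊹ $1) refl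
            lem₂ : ∀ c → c + 2 ≡ suc c + 1
            lem₂ c = ringℕ (c ∷ []) ($0 ⊹ ⟨ 2 ⟩) ((⟨ 1 ⟩ ⊹ $0) ⊹ ⟨ 1 ⟩) refl

          -- the union of the translates of P by σ times the subset sums of the list
          NN : List ℕ → ℕ → Bool
          NN [] v = P v
          NN (e ∷ es) v = NN es v ∨ (⌊ σ * e ≤? v ⌋ ∧ (⌊ v ≤? l ⌋ ∧ NN es (v ∸ σ * e)))

          ∨-elim : ∀ {a b} → a ∨ b ≡ true → a ≡ true ⊎ b ≡ true
          ∨-elim {true} _ = inj₁ refl
          ∨-elim {false} h = inj₂ h

          NN-sound : ∀ es x v → Cube es G x → NN es v ≡ true → ∃ λ e → G (x + e) ≡ true × σ * e ≤ v × P (v ∸ σ * e) ≡ true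
          NN-sound [] x v c h = 0 , subst (λ z → G z ≡ true) (sym (+-identityʳ x)) c , ≤-trans (≤-reflexive (*-zeroʳ σ)) z≤n , subst (λ z → P (v ∸ z) ≡ true) (sym (*-zeroʳ σ)) h
          NN-sound (e ∷ es) x v (c₁ , c₂) h with ∨-elim {NN es v} h
          ... | inj₁ h₁ = NN-sound es x v c₁ h₁
          ... | inj₂ h₂ with ∧-elim {⌊ σ * e ≤? v ⌋} h₂
          ... | le , h₃ with NN-sound es (x + e) (v ∸ σ * e) c₂ (proj₂ (∧-elim {⌊ v ≤? l ⌋} h₃))
          ... | e′ , gg , le′ , pp = e + e′ , subst (λ z → G z ≡ true) (+-assoc x e e′) gg ,
               ≤-trans (≤-reflexive (*-distribˡ-+ σ e e′)) (≤-trans (+-monoʳ-≤ (σ * e) le′) (≤-reflexive (m+[n∸m]≡n (⌊⌋-elim (σ * e ≤? v) le)))) ,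
               subst (λ z → P z ≡ true) (trans (ℕP.∸-+-assoc v (σ * e) (σ * e′)) (cong (v ∸_) (sym (*-distribˡ-+ σ e e′)))) pp

          found : ∀ es v → Cube es G x₀ → Q v ≡ true → NN es v ≡ true → Pat β γ n A
          found es v c qv nv with NN-sound es x₀ v c nv | in₂ v _ qv
          ... | e , gg , le , pp | v1 , vl , aq with in₂ (v ∸ σ * e) _ pp
          ... | u1 , ul , ap = x , w , ≤-trans u1 (m≤n+m u (γ * e)) , ≤-trans (s≤s (≤-reflexive final=)) lt , ap ,
                subst (λ z → A z ≡ true) (sym mid=) (proj₂ (∧-elim {⌊ x₀ + e <? ℓ ⌋} gg)) , subst (λ z → A z ≡ true) (sym final=) aq
            where
            u = v ∸ σ * e
            w = γ * e + u
            x = m₀ ∸ β * u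
            x+ : x + β * u ≡ m₀
            x+ = m∸n+n≡m (≤-trans (*-monoʳ-≤ β ul) βl≤m₀)
            v= : σ * e + u ≡ v
            v= = m+[n∸m]≡n le
            mid= : x + β * w ≡ w₀ + ρ * (x₀ + e)
            mid= = trans (lem₁ x β γ e u) (trans (cong (_+ β * γ * e) x+) (trans (cong (λ r → m₀ + r * e) (sym ρ≡)) (lem₂ w₀ ρ x₀ e)))
              where
              lem₁ : ∀ x b c e u → x + b * (c * e + u) ≡ x + b * u + b * c * e
              lem₁ x b c e u = ringℕ (x ∷ b ∷ c ∷ e ∷ u ∷ []) ($0 ⊹ $1 ⋆ ($2 ⋆ $3 ⊹ $4)) ($0 ⊹ $1 ⋆ $4 ⊹ $1 ⋆ $2 ⋆ $3) refl
              lem₂ : ∀ w r x e → w + r * x + r * e ≡ w + r * (x + e)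
              lem₂ w r x e = ringℕ (w ∷ r ∷ x ∷ e ∷ []) ($0 ⊹ $1 ⋆ $2 ⊹ $1 ⋆ $3) ($0 ⊹ $1 ⋆ ($2 ⊹ $3)) refl
            final= : x + (β + γ) * w ≡ m₀ + γ * v
            final= = trans (lem₁ x β γ e u) (trans (cong₂ (λ a b → a + γ * (b * e + u)) x+ (sym σ≡)) (cong (λ z → m₀ + γ * z) v=))
              where
              lem₁ : ∀ x b c e u → x + (b + c) * (c * e + u) ≡ x + b * u + c * ((b + c) * e + u)
              lem₁ x b c e u = ringℕ (x ∷ b ∷ c ∷ e ∷ u ∷ []) ($0 ⊹ ($1 ⊹ $2) ⋆ ($2 ⋆ $3 ⊹ $4)) ($0 ⊹ $1 ⋆ $4 ⊹ $2 ⋆ (($1 ⊹ $2) ⋆ $3 ⊹ $4)) refl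
            lt : m₀ + γ * v < n
            lt = ≤-trans (+-mono-<-≤ (≤-trans (s≤s m₀≤) (≤-trans (≤-reflexive (+-comm 1 _)) (+-monoʳ-≤ (β * l + l) l1))) (*-monoʳ-≤ γ vl)) (≤-reflexive (trans (+-assoc (β * l + l) l (γ * l)) (sym n=′)))

          NN-supp : ∀ es v → l < v → NN es v ≡ false
          NN-supp [] v h = in< h
          NN-supp (e ∷ es) v h rewrite NN-supp es v h with ⌊ σ * e ≤? v ⌋ | v ≤? l
          ... | false | _ = refl
          ... | true | no _ = refl
          ... | true | yes v≤l = contradiction v≤l (<⇒≱ h)

          new : ℕ → List ℕ → ℕ
          new e es = sumN (suc l) (λ v → 𝟙 (NN (e ∷ es) v ∧ not (NN es v)))

          NN-count : ∀ e es → cnt (suc l) (NN (e ∷ es)) ≡ cnt (suc l) (NN es) + new e es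
          NN-count e es = trans (sumN-cong (suc l) (λ v → lem (NN es v) _)) (sumN-add (suc l) _ _)
            where lem : ∀ a b → 𝟙 (a ∨ b) ≡ 𝟙 a + 𝟙 ((a ∨ b) ∧ not a)
                  lem true true = refl
                  lem true false = refl
                  lem false true = refl
                  lem false false = refl

          -- The sets `NN` grow inside an interval of `l + 1` points, so among `κ` sides one adds at
          -- most the proportion `1 / κ`. For a list of length `κ` the second alternative
          -- contradicts the size of the interval.
          slow : ∀ es → Cube es G x₀ → All (λ e → 1 ≤ e × e ≤ ℓ) es →
            (∃ λ e → ∃ λ es′ → Cube es′ G x₀ × 1 ≤ e × e ≤ ℓ × κ * new e es′ ≤ l + 1) ⊎ length es * (l + 2) ≤ κ * cnt (suc l) (NN es)
          slow [] c ok = inj₂ z≤n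
          slow (e ∷ es) (c , _) ((e1 , eℓ) ∷ ok) with slow es c ok
          ... | inj₁ r = inj₁ r
          ... | inj₂ h with κ * new e es ≤? l + 1
          ... | yes s = inj₁ (e , es , c , e1 , eℓ , s)
          ... | no s = inj₂ (≤-trans (+-mono-≤ (≤-trans (≤-reflexive (lem l)) (≰⇒> s)) h) (≤-reflexive (trans (+-comm (κ * new e es) _) (trans (sym (*-distribˡ-+ κ _ _)) (cong (κ *_) (sym (NN-count e es)))))))
            where lem : ∀ l → l + 2 ≡ suc (l + 1)
                  lem l = ringℕ (l ∷ []) ($0 ⊹ ⟨ 2 ⟩) ((⟨ 1 ⟩ ⊹ ($0 ⊹ ⟨ 1 ⟩))) refl

          -- `N₀` is almost closed under translation by `s`, so its complement is nearly a union of
          -- long progressions of difference `s`, on which `Q` has density at most `(k + 1) / g`. As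
          -- `N₀` contains `P` it fills a sizeable part of the interval, and `Q`, confined to the
          -- complement, would be too small.
          module Avoid (e : ℕ) (es : List ℕ) (e1 : 1 ≤ e) (eℓ : e ≤ ℓ) (few : κ * new e es ≤ l + 1)
              (avoid : ∀ v → v < suc l → Q v ∧ NN es v ≡ false) where
            s b nn : ℕ
            s = σ * e
            b = new e es
            nn = cnt (suc l) (NN es)
            N₀ N₁ : ℕ → Bool
            N₀ = NN es
            N₁ = NN (e ∷ es)
            s1 : 1 ≤ s
            s1 = 1≤m* (subst (1 ≤_) (sym σ≡) (≤-trans β1 (m≤m+n β γ))) e1
            F4 : p ≤ nn
            F4 = go es
              where
              go : ∀ es → p ≤ cnt (suc l) (NN es)
              go [] = ≤-refl
              go (e ∷ es) = ≤-trans (go es) (≤-trans (m≤m+n _ _) (≤-reflexive (sym (NN-count e es))))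
            E : ℕ → ℕ → ℕ
            E j v = 𝟙 (N₀ v) * (𝟙 (⌊ j * s + v ≤? l ⌋) * 𝟙 (not (N₀ (j * s + v))))
            N₁-intro : ∀ v → s ≤ v → v ≤ l → N₀ (v ∸ s) ≡ true → N₁ v ≡ true
            N₁-intro v p q h with NN es v
            ... | true = refl
            ... | false = ∧-intro (⌊⌋-true (s ≤? v) p) (∧-intro (⌊⌋-true (v ≤? l) q) h)
            -- A point of `N₀` which is outside after `j` steps has at some step crossed into one of
            -- the `b` points of `N₁` not in `N₀`.
            exits : ∀ j → sumN (suc l) (E j) ≤ j * b
            exits zero = ≤-reflexive (trans (sumN-cong (suc l) (λ v → zero-case (N₀ v) (𝟙 ⌊ v ≤? l ⌋))) (sumN-zero (suc l)))
              where zero-case : ∀ a c → 𝟙 a * (c * 𝟙 (not a)) ≡ 0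
                    zero-case true c = trans (+-identityʳ _) (*-zeroʳ c)
                    zero-case false c = refl
            exits (suc j) = ≤-trans (sumN-mono (suc l) (λ v _ → pt v)) (≤-trans (≤-reflexive (sumN-add (suc l) (E j) (λ v → h (j * s + v)))) (≤-trans (+-mono-≤ (exits j) (≤-trans (shift≤ (suc l) (j * s) h h0) h≤b)) (≤-reflexive (+-comm (j * b) b))))
              where
              f h : ℕ → ℕ
              f u = 𝟙 (N₁ u ∧ not (N₀ u))
              h u = 𝟙 (⌊ s + u ≤? l ⌋) * f (s + u)
              h0 : ∀ u → suc l ≤ u → h u ≡ 0
              h0 u lu with s + u ≤? l
              ... | no _ = refl
              ... | yes p = contradiction (≤-trans (m≤n+m u s) p) (<⇒≱ lu)
              h≤b : sumN (suc l) h ≤ b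
              h≤b = ≤-trans (sumN-mono (suc l) (λ u _ → ≤-trans (*-monoˡ-≤ (f (s + u)) (𝟙≤1 (⌊ s + u ≤? l ⌋))) (≤-reflexive (*-identityˡ _)))) (shift≤ (suc l) s f (λ u lu → f0 u lu))
                where f0 : ∀ u → suc l ≤ u → f u ≡ 0
                      f0 u lu rewrite NN-supp (e ∷ es) u lu = refl
              pt : ∀ v → E (suc j) v ≤ E j v + h (j * s + v)
              pt v = subst (λ w → 𝟙 (N₀ v) * (𝟙 (⌊ w ≤? l ⌋) * 𝟙 (not (N₀ w))) ≤ E j v + h (j * s + v)) (sym (+-assoc s (j * s) v))
                 (𝟙-escape (N₀ v) ⌊ s + u ≤? l ⌋ ⌊ u ≤? l ⌋ (N₀ u) (N₀ (s + u)) (N₁ (s + u)) (λ t → ⌊⌋-true (u ≤? l) (≤-trans (m≤n+m u s) (⌊⌋-elim (s + u ≤? l) t)))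
                   (λ t x → N₁-intro (s + u) (m≤m+n s u) (⌊⌋-elim (s + u ≤? l) t) (subst (λ z → N₀ z ≡ true) (sym (ℕP.m+n∸m≡n s u)) x)))
                where
                u = j * s + v
            X : ℕ → ℕ
            X v = sumN M (λ j → 𝟙 (Q (j * s + v)))
            lower : M * q ≤ sumN (suc l) X + M * (M * s)
            lower = ≤-trans (≤-sumN M {g = λ j → sumN (suc l) (λ v → 𝟙 (Q (j * s + v))) + M * s} (λ j j<M → ≤-trans (sum≤shift (suc l) (j * s) (λ v → 𝟙 (Q v)) (λ v → 𝟙≤1 _)) (+-monoʳ-≤ _ (*-monoˡ-≤ s (<⇒≤ j<M)))))
               (≤-reflexive (trans (sumN-add M _ _) (cong₂ _+_ (sumN-swap M (suc l) _) (sumN-const M (M * s)))))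
            tail : ℕ → ℕ
            tail v = 𝟙 (⌊ suc l ≤? M * s + v ⌋)
            -- Three cases: from `v` in `N₀`, `Q` is met only after an exit; near the end of the
            -- interval the trivial bound `M` is used; otherwise `H` applies to the progression of
            -- difference `γ s`.
            point : ∀ v → v < suc l → g * X v ≤ 𝟙 (not (N₀ v)) * (U * M) + tail v * (g * M) + g * sumN M (λ j → E j v)
            point v v<l with N₀ v
            ... | true = ≤-trans (*-monoʳ-≤ g (sumN-mono M (λ j _ → each j))) (m≤n+m _ (tail v * (g * M)))
              where
              each : ∀ j → 𝟙 (Q (j * s + v)) ≤ 1 * (𝟙 (⌊ j * s + v ≤? l ⌋) * 𝟙 (not (N₀ (j * s + v))))
              each j = 𝟙-inside (Q w) ⌊ w ≤? l ⌋ (N₀ w) (λ t → ⌊⌋-true (w ≤? l) (proj₁ (proj₂ (in₂ w _ t)))) (λ t → ¬-not {N₀ w} (λ u → true≢false (∧-intro t u) (avoid w (s≤s (proj₁ (proj₂ (in₂ w _ t)))))))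
                where
                w = j * s + v
            ... | false with suc l ≤? M * s + v
            ... | yes _ = ≤-trans (*-monoʳ-≤ g (≤-trans (sumN-≤ M (λ j _ → 𝟙≤1 _)) (≤-reflexive (*-identityʳ M)))) (≤-trans (≤-trans (≤-reflexive (sym (*-identityˡ (g * M)))) (m≤n+m _ (1 * (U * M)))) (m≤m+n _ _))
            ... | no nl = ≤-trans (≤-trans (*-monoʳ-≤ g (cnt-mono M {λ j → Q (j * s + v)} {AP (m₀ + γ * v) (γ * s)} (λ j _ h → subst (λ z → A z ≡ true) (lem m₀ γ j s v) (proj₂ (proj₂ (in₂ (j * s + v) _ h)))))) (H (m₀ + γ * v) (γ * s) (1≤m* γ1 s1) room))
                 (≤-trans (≤-trans (≤-reflexive (sym (*-identityˡ (U * M)))) (m≤m+n _ _)) (m≤m+n _ _))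
              where
              lem : ∀ m c j s v → m + c * (j * s + v) ≡ m + c * v + c * s * j
              lem m c j s v = ringℕ (m ∷ c ∷ j ∷ s ∷ v ∷ []) ($0 ⊹ $1 ⋆ ($2 ⋆ $3 ⊹ $4)) ($0 ⊹ $1 ⋆ $4 ⊹ $1 ⋆ $3 ⋆ $2) refl
              room : m₀ + γ * v + γ * s * M ≤ n
              room = ≤-trans (≤-reflexive (lem₂ m₀ γ v s M)) (≤-trans (+-mono-≤ m₀≤ (≤-trans (*-monoʳ-≤ γ (≤-pred (≰⇒> nl))) (m≤n+m _ l))) (≤-reflexive (sym n=′)))
                where lem₂ : ∀ m c v s M → m + c * v + c * s * M ≡ m + c * (M * s + v)
                      lem₂ m c v s M = ringℕ (m ∷ c ∷ v ∷ s ∷ M ∷ []) ($0 ⊹ $1 ⋆ $2 ⊹ $1 ⋆ $3 ⋆ $4) ($0 ⊹ $1 ⋆ ($4 ⋆ $3 ⊹ $2)) refl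
            tails : sumN (suc l) tail ≤ M * s
            tails = go (suc l)
              where
              go : ∀ L → sumN L (λ v → 𝟙 (⌊ L ≤? M * s + v ⌋)) ≤ M * s
              go L with M * s ≤? L
              ... | no h = ≤-trans (sumN-≤ L (λ _ _ → 𝟙≤1 _)) (≤-trans (≤-reflexive (*-identityʳ L)) (<⇒≤ (≰⇒> h)))
              ... | yes h = ≤-trans (≤-reflexive (trans (cong (λ z → sumN z f) (sym (m∸n+n≡m h))) (sumN-split (L ∸ M * s) (M * s) f))) (+-mono-≤ {y = 0} (≤-reflexive (trans (sumN-cong< (L ∸ M * s) z) (sumN-zero (L ∸ M * s)))) (≤-trans (sumN-≤ (M * s) (λ _ _ → 𝟙≤1 _)) (≤-reflexive (*-identityʳ _))))
                where
                f : ℕ → ℕ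
                f v = 𝟙 (⌊ L ≤? M * s + v ⌋)
                z : ∀ i → i < L ∸ M * s → f i ≡ 0
                z i lt with L ≤? M * s + i
                ... | no _ = refl
                ... | yes p = contradiction p (<⇒≱ (≤-trans (+-monoʳ-< (M * s) lt) (≤-reflexive (m+[n∸m]≡n h))))
            upper : g * sumN (suc l) X ≤ sumN (suc l) (λ v → 𝟙 (not (N₀ v))) * (U * M) + M * s * (g * M) + g * (M * (M * b))
            upper = ≤-trans (≤-reflexive (sym (sumN-scale (suc l) g X))) (≤-trans (sumN-mono (suc l) point) (≤-trans (≤-reflexive (trans (sumN-add (suc l) _ _) (cong₂ _+_ (trans (sumN-add (suc l) _ _) (cong₂ _+_ (scaleʳ _ _) (scaleʳ _ _))) (trans (sumN-scale (suc l) g _) (cong (g *_) (sumN-swap (suc l) M _))))))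
               (+-mono-≤ (+-monoʳ-≤ _ (*-monoˡ-≤ (g * M) tails)) (*-monoʳ-≤ g (sumN-≤ M (λ j j<M → ≤-trans (exits j) (*-monoˡ-≤ b (<⇒≤ j<M))))))))
              where scaleʳ : ∀ f c → sumN (suc l) (λ v → f v * c) ≡ sumN (suc l) f * c
                    scaleʳ f c = trans (sumN-cong (suc l) (λ v → *-comm (f v) c)) (trans (sumN-scale (suc l) c f) (*-comm c _))
            nots : sumN (suc l) (λ v → 𝟙 (not (N₀ v))) + nn ≡ suc l
            nots = trans (sym (sumN-add (suc l) _ _)) (trans (sumN-cong (suc l) (λ v → trans (+-comm _ (𝟙 (N₀ v))) (𝟙-not (N₀ v)))) (trans (sumN-const (suc l) 1) (*-identityʳ _)))
            F3 : g * q + U * nn ≤ U * suc l + 2 * (g * (s * M)) + g * (M * b)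
            F3 = *-cancelˡ-≤ M {{ℕ.>-nonZero M1}} (≤-trans (≤-reflexive (lem₁ M g q U nn)) (≤-trans (+-monoˡ-≤ (nn * (U * M)) (≤-trans (*-monoʳ-≤ g lower) (≤-trans (≤-reflexive (*-distribˡ-+ g _ _)) (+-monoˡ-≤ _ upper))))
                (≤-reflexive (trans (lem₂ (sumN (suc l) (λ v → 𝟙 (not (N₀ v)))) nn (U * M) M s g b) (trans (cong (λ z → z * (U * M) + M * (2 * (g * (s * M)) + g * (M * b))) nots) (lem₃ (suc l) U M (2 * (g * (s * M))) (g * (M * b))))))))
              where
              lem₁ : ∀ M g q U n → M * (g * q + U * n) ≡ g * (M * q) + n * (U * M)
              lem₁ M g q U n = ringℕ (M ∷ g ∷ q ∷ U ∷ n ∷ []) ($0 ⋆ ($1 ⋆ $2 ⊹ $3 ⋆ $4)) ($1 ⋆ ($0 ⋆ $2) ⊹ $4 ⋆ ($3 ⋆ $0)) refl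
              lem₂ : ∀ a n u M s g b → a * u + M * s * (g * M) + g * (M * (M * b)) + g * (M * (M * s)) + n * u ≡ (a + n) * u + M * (2 * (g * (s * M)) + g * (M * b))
              lem₂ a n u M s g b = ringℕ (a ∷ n ∷ u ∷ M ∷ s ∷ g ∷ b ∷ []) ($0 ⋆ $2 ⊹ $3 ⋆ $4 ⋆ ($5 ⋆ $3) ⊹ $5 ⋆ ($3 ⋆ ($3 ⋆ $6)) ⊹ $5 ⋆ ($3 ⋆ ($3 ⋆ $4)) ⊹ $1 ⋆ $2) (($0 ⊹ $1) ⋆ $2 ⊹ $3 ⋆ (⟨ 2 ⟩ ⋆ ($5 ⋆ ($4 ⋆ $3)) ⊹ $5 ⋆ ($3 ⋆ $6))) refl
              lem₃ : ∀ L U M x y → L * (U * M) + M * (x + y) ≡ M * (U * L + x + y)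
              lem₃ L U M x y = ringℕ (L ∷ U ∷ M ∷ x ∷ y ∷ []) ($0 ⋆ ($1 ⋆ $2) ⊹ $2 ⋆ ($3 ⊹ $4)) ($2 ⋆ ($1 ⋆ $0 ⊹ $3 ⊹ $4)) refl
            -- `F2`, `F3` and `F4` bound `(k + 1) p` by roughly `(σ + 2) l`, while `F1` says
            -- `2 g p ≥ k l`. With `4 g (σ + 2) ≤ k²` the two are compatible only for `l ≤ 1`.
            absurd : ⊥
            absurd = <⇒≱ l2 (+-cancelˡ-≤ (k * k * l + 2 * l) l 1 (≤-trans small (≤-trans two (≤-reflexive (lem₆ (k * k * l) l)))))
              where
              lem₆ : ∀ x l → l + x + (l + 1) ≡ x + 2 * l + 1
              lem₆ x l = ringℕ (x ∷ l ∷ []) ($1 ⊹ $0 ⊹ ($1 ⊹ ⟨ 1 ⟩)) ($0 ⊹ ⟨ 2 ⟩ ⋆ $1 ⊹ ⟨ 1 ⟩) refl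
              one : (k + 1) * p ≤ Cst + (σ + 2) * l + g * (M * b)
              one = +-cancelˡ-≤ (k * l) _ _ (≤-trans (+-mono-≤ F2 (*-monoʳ-≤ (k + 1) F4)) (≤-trans (≤-reflexive (lem₁ (g * q) ((σ + 1) * l) ((γ + 1) * (g * M)) ((k + 1) * nn)))
                 (≤-trans (+-monoˡ-≤ ((σ + 1) * l + (γ + 1) * (g * M)) (subst (λ U → g * q + U * nn ≤ U * suc l + 2 * (g * (s * M)) + g * (M * b)) U≡ F3))
                 (≤-trans (+-monoˡ-≤ ((σ + 1) * l + (γ + 1) * (g * M)) (+-monoˡ-≤ (g * (M * b)) (+-monoʳ-≤ ((k + 1) * suc l) (*-monoʳ-≤ 2 (*-monoʳ-≤ g (*-monoˡ-≤ M (*-monoʳ-≤ σ eℓ)))))))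
                 (≤-reflexive (trans (lem₂ k l (2 * (g * (σ * ℓ * M))) (g * (M * b)) σ ((γ + 1) * (g * M))) (cong (λ c → k * l + (c + (σ + 2) * l + g * (M * b))) (sym Cst≡))))))))
                where
                lem₁ : ∀ a b c d → a + b + c + d ≡ a + d + (b + c)
                lem₁ a b c d = ringℕ (a ∷ b ∷ c ∷ d ∷ []) ($0 ⊹ $1 ⊹ $2 ⊹ $3) ($0 ⊹ $3 ⊹ ($1 ⊹ $2)) refl
                lem₂ : ∀ k l x y s z → (k + 1) * suc l + x + y + ((s + 1) * l + z) ≡ k * l + (k + 1 + x + z + (s + 2) * l + y)
                lem₂ k l x y s z = ringℕ (k ∷ l ∷ x ∷ y ∷ s ∷ z ∷ []) (($0 ⊹ ⟨ 1 ⟩) ⋆ (⟨ 1 ⟩ ⊹ $1) ⊹ $2 ⊹ $3 ⊹ (($4 ⊹ ⟨ 1 ⟩) ⋆ $1 ⊹ $5)) ($0 ⋆ $1 ⊹ ($0 ⊹ ⟨ 1 ⟩ ⊹ $2 ⊹ $5 ⊹ ($4 ⊹ ⟨ 2 ⟩) ⋆ $1 ⊹ $3)) refl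
              kk : 4 * (g * (σ + 2)) ≤ k * k
              kk = ≤-trans (≤-reflexive (trans (cong (λ g → 4 * (g * (σ + 2))) g≡) (trans (lem k₀ D₀ (σ + 2)) (cong (k₀ *_) (sym k₀≡))))) (*-mono-≤ k₀≤k k₀≤k)
                where lem : ∀ k D s → 4 * (k * D * s) ≡ k * (4 * D * s)
                      lem k D s = ringℕ (k ∷ D ∷ s ∷ []) (⟨ 4 ⟩ ⋆ ($0 ⋆ $1 ⋆ $2)) ($0 ⋆ (⟨ 4 ⟩ ⋆ $1 ⋆ $2)) refl
              two : 2 * ((k + 1) * (k * l)) ≤ l + k * k * l + (l + 1)
              two = ≤-trans (*-monoʳ-≤ 2 (*-monoʳ-≤ (k + 1) F1)) (≤-trans (≤-reflexive (lem₁ k g p)) (≤-trans (*-monoʳ-≤ (4 * g) one) (≤-trans (≤-reflexive (lem₂ g Cst (σ + 2) l (M * b)))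
                  (+-mono-≤ (+-mono-≤ lC (*-monoˡ-≤ l kk)) (≤-trans (≤-reflexive (trans (lem₃ g M b) (cong (_* b) (sym κ≡)))) few)))))
                where
                lem₁ : ∀ k g p → 2 * ((k + 1) * (2 * (g * p))) ≡ 4 * g * ((k + 1) * p)
                lem₁ k g p = ringℕ (k ∷ g ∷ p ∷ []) (⟨ 2 ⟩ ⋆ (($0 ⊹ ⟨ 1 ⟩) ⋆ (⟨ 2 ⟩ ⋆ ($1 ⋆ $2)))) (⟨ 4 ⟩ ⋆ $1 ⋆ (($0 ⊹ ⟨ 1 ⟩) ⋆ $2)) refl
                lem₂ : ∀ g C s l x → 4 * g * (C + s * l + g * x) ≡ 4 * (g * C) + 4 * (g * s) * l + 4 * (g * (g * x))
                lem₂ g C s l x = ringℕ (g ∷ C ∷ s ∷ l ∷ x ∷ []) (⟨ 4 ⟩ ⋆ $0 ⋆ ($1 ⊹ $2 ⋆ $3 ⊹ $0 ⋆ $4)) (⟨ 4 ⟩ ⋆ ($0 ⋆ $1) ⊹ ⟨ 4 ⟩ ⋆ ($0 ⋆ $2) ⋆ $3 ⊹ ⟨ 4 ⟩ ⋆ ($0 ⋆ ($0 ⋆ $4))) refl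
                lem₃ : ∀ g M b → 4 * (g * (g * (M * b))) ≡ 4 * (g * (g * M)) * b
                lem₃ g M b = ringℕ (g ∷ M ∷ b ∷ []) (⟨ 4 ⟩ ⋆ ($0 ⋆ ($0 ⋆ ($1 ⋆ $2)))) (⟨ 4 ⟩ ⋆ ($0 ⋆ ($0 ⋆ $1)) ⋆ $2) refl
              small : k * k * l + 2 * l + l ≤ 2 * ((k + 1) * (k * l))
              small = ≤-trans (≤-reflexive (lem₄ (k * k * l) l)) (≤-trans (+-monoʳ-≤ (k * k * l) (+-mono-≤ (≤-trans (m≤n*m l (1≤m* k1 k1)) ≤-refl) (*-monoʳ-≤ 2 (m≤n*m l k1)))) (≤-reflexive (lem₅ k l)))
                where
                lem₄ : ∀ x l → x + 2 * l + l ≡ x + (l + 2 * l)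
                lem₄ x l = ringℕ (x ∷ l ∷ []) ($0 ⊹ ⟨ 2 ⟩ ⋆ $1 ⊹ $1) ($0 ⊹ ($1 ⊹ ⟨ 2 ⟩ ⋆ $1)) refl
                lem₅ : ∀ k l → k * k * l + (k * k * l + 2 * (k * l)) ≡ 2 * ((k + 1) * (k * l))
                lem₅ k l = ringℕ (k ∷ l ∷ []) ($0 ⋆ $0 ⋆ $1 ⊹ ($0 ⋆ $0 ⋆ $1 ⊹ ⟨ 2 ⟩ ⋆ ($0 ⋆ $1))) (⟨ 2 ⟩ ⋆ (($0 ⊹ ⟨ 1 ⟩) ⋆ ($0 ⋆ $1))) refl

        pattern-in-A : Pat β γ n A
        pattern-in-A = go window
          where
          go : _ → Pat β γ n A
          go (w₀ , w₀≤ , βl≤w₀ , dens) = go₂ (cub G supp (≤-trans dens (≤-reflexive (cong (2 * D₀ *_) (sumN-cong< ℓ (λ i i<ℓ → cong (λ z → 𝟙 (z ∧ A (w₀ + ρ * i))) (sym (⌊⌋-true (i <? ℓ) i<ℓ))))))))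
            where
            G : ℕ → Bool
            G i = ⌊ i <? ℓ ⌋ ∧ A (w₀ + ρ * i)
            supp : ∀ x → ℓ ≤ x → G x ≡ false
            supp x h with x <? ℓ
            ... | no _ = refl
            ... | yes p = contradiction h (<⇒≱ p)
            go₂ : _ → Pat β γ n A
            go₂ (es , len , ok , x₀ , c) = go₃ (L.slow es c ok)
              where
              module L = Located w₀ w₀≤ βl≤w₀ x₀ (⌊⌋-elim (x₀ <? ℓ) (proj₁ (∧-elim {⌊ x₀ <? ℓ ⌋} (Cube-base es G x₀ c)))) using (slow; NN; Q; found; module Avoid)
              go₃ : _ → Pat β γ n A
              go₃ (inj₂ h) = contradiction (*-cancelˡ-≤ κ {{ℕ.>-nonZero κ1}} (≤-trans (≤-reflexive (cong (_* (l + 2)) (sym len))) (≤-trans h (*-monoʳ-≤ κ (cnt≤ (suc l) (L.NN es)))))) (<⇒≱ (≤-reflexive (+-comm 2 l)))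
              go₃ (inj₁ (e , es′ , c′ , e1 , eℓ , few)) with find< (suc l) (λ v → L.Q v ∧ L.NN es′ v)
              ... | inj₁ (v , _ , h) = L.found es′ v c′ (proj₁ (∧-elim {L.Q v} h)) (proj₂ (∧-elim {L.Q v} h))
              ... | inj₂ none = ⊥-elim (L.Avoid.absurd e es′ e1 eℓ few none)

  find₂ : ∀ m n (p : ℕ → ℕ → Bool) → (∃ λ i → ∃ λ j → p i j ≡ true) ⊎ (∀ i j → i < m → j < n → p i j ≡ false)
  find₂ zero n p = inj₂ (λ i j ())
  find₂ (suc m) n p with find< n (p m) | find₂ m n p
  ... | inj₁ (j , _ , h) | _ = inj₁ (m , j , h)
  ... | inj₂ _ | inj₁ r = inj₁ r
  ... | inj₂ a | inj₂ b = inj₂ h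
    where h : ∀ i j → i < suc m → j < n → p i j ≡ false
          h i j i<sm j<n with i ℕ.≟ m
          ... | yes refl = a j j<n
          ... | no i≢m = b i j (≤∧≢⇒< (≤-pred i<sm) i≢m) j<n

  -- A bounded search decides whether some progression of length `M` has density at least
  -- `(k + 1) / g`. If so, the hypothesis supplies a pattern inside it; if not, `Step` does.
  good-step : ∀ k → k₀ ≤ k → ∀ M → 1 ≤ M → Good (suc k) M → ∃ λ n → 1 ≤ n × Good k n
  good-step k k₀≤k M M1 good = go _ refl
    where
    go : ∀ (κ : ℕ) → κ ≡ 4 * (g * (g * M)) → ∃ λ n → 1 ≤ n × Good k n
    go κ κ≡ = go₂ (suc (proj₁ (cube κ (2 * D₀) (1≤m* {2} (s≤s z≤n) D1)))) _ _ _ _ refl refl refl refl refl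
      where
      go₂ : ∀ (ℓ Cst l₀ l n : ℕ) → ℓ ≡ suc (proj₁ (cube κ (2 * D₀) (1≤m* {2} (s≤s z≤n) D1))) → Cst ≡ k + 1 + 2 * (g * (σ * ℓ * M)) + (γ + 1) * (g * M) →
        l₀ ≡ 4 * ((σ + 2) * (g * M)) + 4 * (g * Cst) + (2 + ρ) → l ≡ l₀ * (ρ * ℓ) → n ≡ (σ + 2) * l → ∃ λ n → 1 ≤ n × Good k n
      go₂ ℓ Cst l₀ l n ℓ≡ Cst≡ l₀≡ l≡ n≡ = n , n1 , λ A dense → decide A dense (find₂ (suc n) (suc n) (bad A))
        where
        ℓ1 : 1 ≤ ℓ
        ℓ1 = subst (1 ≤_) (sym ℓ≡) (s≤s z≤n)
        cub : ∀ G → (∀ x → ℓ ≤ x → G x ≡ false) → ℓ ≤ 2 * D₀ * cnt ℓ G → ∃ λ es → length es ≡ κ × All (λ e → 1 ≤ e × e ≤ ℓ) es × ∃ λ x → Cube es G x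
        cub G = proj₂ (cube κ (2 * D₀) (1≤m* {2} (s≤s z≤n) D1)) ℓ G (≤-trans (n≤1+n _) (≤-reflexive (sym ℓ≡))) ℓ1
        module St = Step k k₀≤k M M1 (suc k) κ ℓ Cst l₀ l n (+-comm 1 k) κ≡ ℓ1 cub Cst≡ l₀≡ l≡ n≡ using (l1; pattern-in-A)
        n1 : 1 ≤ n
        n1 = subst (1 ≤_) (sym n≡) (1≤m* (≤-trans (s≤s z≤n) (m≤n+m 2 σ)) St.l1)
        bad : (ℕ → Bool) → ℕ → ℕ → Bool
        bad A x₀ s = ⌊ 1 ≤? s ⌋ ∧ (⌊ x₀ + s * M ≤? n ⌋ ∧ ⌊ suc k * M ≤? g * cnt M (λ i → A (x₀ + s * i)) ⌋)
        decide : ∀ A → k * n ≤ g * cnt n A → _ → Pat β γ n A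
        decide A dense (inj₁ (x₀ , s , h)) with ∧-elim {⌊ 1 ≤? s ⌋} h
        ... | h₁ , h₂ with ∧-elim {⌊ x₀ + s * M ≤? n ⌋} h₂
        ... | h₃ , h₄ = pat-AP n M x₀ s A (⌊⌋-elim (1 ≤? s) h₁) (⌊⌋-elim (x₀ + s * M ≤? n) h₃) (good (λ i → A (x₀ + s * i)) (⌊⌋-elim (suc k * M ≤? g * cnt M (λ i → A (x₀ + s * i))) h₄))
        decide A dense (inj₂ none) = St.pattern-in-A A dense (λ x₀ s s1 le → H x₀ s s1 le)
          where
          H : ∀ x₀ s → 1 ≤ s → x₀ + s * M ≤ n → g * cnt M (λ i → A (x₀ + s * i)) ≤ suc k * M
          H x₀ s s1 le with suc k * M ≤? g * cnt M (λ i → A (x₀ + s * i))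
          ... | no ¬p = <⇒≤ (≰⇒> ¬p)
          ... | yes p = ⊥-elim (true≢false (∧-intro (⌊⌋-true (1 ≤? s) s1) (∧-intro (⌊⌋-true (x₀ + s * M ≤? n) le) (⌊⌋-true (suc k * M ≤? g * cnt M (λ i → A (x₀ + s * i))) p)))
              (none x₀ s (s≤s (≤-trans (m≤m+n x₀ _) le)) (s≤s (≤-trans (m≤m*n s M1) (≤-trans (m≤n+m _ x₀) le)))))

  good-all : ∀ j k → k₀ ≤ k → g + 1 ≤ k + j → ∃ λ M → 1 ≤ M × Good k M
  good-all zero k k₀≤k h = 1 , s≤s z≤n , λ A dense → contradiction (≤-trans h (≤-trans (≤-reflexive (trans (+-identityʳ k) (sym (*-identityʳ k)))) (≤-trans dense (≤-trans (*-monoʳ-≤ g (cnt≤ 1 A)) (≤-reflexive (*-identityʳ g))))))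
      (<⇒≱ (≤-reflexive (+-comm 1 g)))
  good-all (suc j) k k₀≤k h with good-all j (suc k) (m≤n⇒m≤1+n k₀≤k) (≤-trans h (≤-reflexive (+-suc k j)))
  ... | M , M1 , good = good-step k k₀≤k M M1 good

abstract
  roth-pattern : ∀ β γ D₀ → 1 ≤ β → 1 ≤ γ → 1 ≤ D₀ → ∃ λ M → 1 ≤ M × (∀ A → M ≤ D₀ * cnt M A → Pat β γ M A)
  roth-pattern (suc β′) (suc γ′) D₀ _ _ D1 = go _ _ _ _ refl refl refl refl
    where
    β γ : ℕ
    β = suc β′
    γ = suc γ′
    go : ∀ (σ ρ k₀ g : ℕ) → σ ≡ β + γ → ρ ≡ β * γ → k₀ ≡ 4 * D₀ * (σ + 2) → g ≡ k₀ * D₀ → ∃ λ M → 1 ≤ M × (∀ A → M ≤ D₀ * cnt M A → Pat β γ M A)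
    go σ ρ k₀ g σ≡ ρ≡ k₀≡ g≡ with I.good-all (g + 1) k₀ ≤-refl (m≤n+m (g + 1) k₀)
      where
      module I = Increment β β′ γ γ′ D₀ refl refl D1 σ ρ k₀ g σ≡ ρ≡ k₀≡ g≡ using (good-all)
    ... | M , M1 , good = M , M1 , λ A dense → good A (≤-trans (*-monoʳ-≤ k₀ dense) (≤-reflexive (trans (sym (*-assoc k₀ D₀ _)) (cong (_* cnt M A) (sym g≡)))))

-- Varnavides' theorem and linear equations with coefficient sum zero

Supp : ℕ → (ℕ → Bool) → Set
Supp N C = ∀ i → N ≤ i → C i ≡ false

sumN-beyond : ∀ m n g → (∀ u → n ≤ u → g u ≡ 0) → sumN m g ≤ sumN n g
sumN-beyond m n g z with ≤-total m n
... | inj₁ p = sumN-mono-n g p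
... | inj₂ p = ≤-reflexive (trans (cong (λ w → sumN w g) (sym (m+[n∸m]≡n p))) (trans (sumN-split n (m ∸ n) g) (trans (cong (λ ○ → sumN n g + ○) (trans (sumN-cong (m ∸ n) (λ i → z (n + i) (m≤m+n n i))) (sumN-zero (m ∸ n)))) (+-identityʳ _))))

sumN-dilate : ∀ n N x β h → 1 ≤ β → (∀ u → N ≤ u → h u ≡ 0) → sumN n (λ w → h (x + β * w)) ≤ sumN N h
sumN-dilate n N x β h β1 z = ≤-trans (go n) (sumN-beyond (x + β * n) N h z)
  where
  go : ∀ n → sumN n (λ w → h (x + β * w)) ≤ sumN (x + β * n) h
  go zero = z≤n
  go (suc n) = ≤-trans (+-monoˡ-≤ (h (x + β * n)) (go n)) (sumN-mono-n h (≤-trans (≤-reflexive (+-comm 1 (x + β * n))) (≤-trans (+-monoʳ-≤ (x + β * n) β1) (≤-reflexive (lem x β n)))))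
    where lem : ∀ x b n → x + b * n + b ≡ x + b * suc n
          lem x b n = ringℕ (x ∷ b ∷ n ∷ []) ($0 ⊹ $1 ⋆ $2 ⊹ $1) ($0 ⊹ $1 ⋆ (⟨ 1 ⟩ ⊹ $2)) refl

false-∧ : ∀ {a} b → a ≡ false → a ∧ b ≡ false
false-∧ b refl = refl

triple : ℕ → ℕ → (ℕ → Bool) → ℕ → ℕ → ℕ
triple β γ C x w = 𝟙 (C x ∧ (C (x + β * w) ∧ C (x + (β + γ) * w)))

-- For every difference `y ≤ Y`, at least `N / (4 D)` starting points give a progression of length
-- `M` dense enough for `roth-pattern`. For a fixed position `(x′, w′)` inside the progression the
-- pattern found determines `x` and `y`, so no pattern is counted more than `M²` times.
varnavides : ∀ β γ D → 1 ≤ β → 1 ≤ γ → 1 ≤ D → ∃ λ c → 1 ≤ c × (∀ N C → Supp N C → N ≤ D * cnt N C → N * N ≤ c * sumN N (λ x → sumN N (triple β γ C x)))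
varnavides β γ D β1 γ1 D1 with roth-pattern β γ (4 * D) β1 γ1 (1≤m* {4} (s≤s z≤n) D1)
... | M , M1 , pat = D * t + 2 * t * (4 * D * (M * M)) , ≤-trans (1≤m* D1 t1) (m≤m+n _ _) , main
  where
  t : ℕ
  t = 2 * D * M
  t1 : 1 ≤ t
  t1 = 1≤m* (1≤m* {2} (s≤s z≤n) D1) M1
  main : ∀ N C → Supp N C → N ≤ D * cnt N C → N * N ≤ (D * t + 2 * t * (4 * D * (M * M))) * sumN N (λ x → sumN N (triple β γ C x))
  main N C supp dens with t ≤? N
  -- For `N` below `t` the trivial patterns with `w = 0` suffice.
  ... | no N<t = ≤-trans (*-mono-≤ dens (<⇒≤ (≰⇒> N<t))) (≤-trans (≤-reflexive (lem D (cnt N C) t)) (*-mono-≤ (m≤m+n (D * t) _) (sumN-mono N (λ x x<N → ≤-trans (diag x) (term≤sumN N 0 (triple β γ C x) (≤-trans (s≤s z≤n) x<N))))))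
    where
    lem : ∀ D c t → D * c * t ≡ D * t * c
    lem D c t = ringℕ (D ∷ c ∷ t ∷ []) ($0 ⋆ $1 ⋆ $2) ($0 ⋆ $2 ⋆ $1) refl
    diag : ∀ x → 𝟙 (C x) ≤ triple β γ C x 0
    diag x rewrite *-zeroʳ β | *-zeroʳ (β + γ) | +-identityʳ x with C x
    ... | true = ≤-refl
    ... | false = z≤n
  ... | yes t≤N with quot-scale t N t1 t≤N
  ... | Y , Y1 , tY≤N , N≤2tY = ≤-trans (*-monoˡ-≤ N N≤2tY) (≤-trans (≤-reflexive (*-assoc (2 * t) Y N)) (≤-trans (*-monoʳ-≤ (2 * t) YN) (≤-trans (≤-reflexive (sym (*-assoc (2 * t) _ Σ₀))) (*-monoˡ-≤ Σ₀ (m≤n+m _ (D * t))))))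
    where
    Fn : ℕ → ℕ → ℕ
    Fn = triple β γ C
    Σ₀ : ℕ
    Σ₀ = sumN N (λ x → sumN N (Fn x))
    AP : ℕ → ℕ → ℕ → Bool
    AP y x i = C (x + y * i)
    good : ℕ → ℕ → Bool
    good y x = ⌊ M ≤? 4 * D * cnt M (AP y x) ⌋
    many : ∀ y → y ≤ Y → N ≤ 4 * D * sumN N (λ x → 𝟙 (good y x))
    many y yY = *-cancelˡ-≤ M {{ℕ.>-nonZero M1}} (+-cancelˡ-≤ (3 * (M * N)) _ _ (≤-trans (≤-reflexive (lem₀ (M * N))) (≤-trans (*-monoʳ-≤ 4 (≤-trans (*-monoʳ-≤ M dens) (≤-trans (≤-reflexive (lem₁ M D (cnt N C))) (*-monoʳ-≤ D total))))
          (≤-trans (≤-reflexive (lem₂ D S₁ M Y)) (≤-trans (+-mono-≤ S₁≤ (*-monoʳ-≤ (2 * M) tY≤N)) (≤-reflexive (lem₃ (4 * D) M Gy N)))))))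
      where
      Gy S₁ : ℕ
      Gy = sumN N (λ x → 𝟙 (good y x))
      S₁ = sumN N (λ x → cnt M (AP y x))
      total : M * cnt N C ≤ S₁ + M * (M * Y)
      total = ≤-trans (≤-sumN M {g = λ i → sumN N (λ x → 𝟙 (C (x + y * i))) + M * Y} (λ i i<M → ≤-trans (sum≤shift N (y * i) (λ x → 𝟙 (C x)) (λ x → 𝟙≤1 (C x)))
          (+-mono-≤ (≤-reflexive (sumN-cong N (λ x → cong (λ z → 𝟙 (C z)) (+-comm (y * i) x)))) (≤-trans (*-mono-≤ yY (<⇒≤ i<M)) (≤-reflexive (*-comm Y M))))))
          (≤-reflexive (trans (sumN-add M _ _) (cong₂ _+_ (sumN-swap M N _) (sumN-const M (M * Y)))))
      S₁≤ : 4 * D * S₁ ≤ 4 * D * M * Gy + N * M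
      S₁≤ = ≤-trans (≤-reflexive (sym (sumN-scale N (4 * D) _))) (≤-trans (sumN-mono N (λ x _ → pt x)) (≤-reflexive (trans (sumN-add N _ _) (cong₂ _+_ (sumN-scale N (4 * D * M) _) (sumN-const N M)))))
        where
        pt : ∀ x → 4 * D * cnt M (AP y x) ≤ 4 * D * M * 𝟙 (good y x) + M
        pt x with M ≤? 4 * D * cnt M (AP y x)
        ... | yes _ = ≤-trans (*-monoʳ-≤ (4 * D) (cnt≤ M _)) (≤-trans (≤-reflexive (sym (*-identityʳ _))) (m≤m+n _ M))
        ... | no h = ≤-trans (<⇒≤ (≰⇒> h)) (m≤n+m M _)
      lem₀ : ∀ x → 3 * x + x ≡ 4 * x
      lem₀ x = ringℕ (x ∷ []) (⟨ 3 ⟩ ⋆ $0 ⊹ $0) (⟨ 4 ⟩ ⋆ $0) refl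
      lem₁ : ∀ M D c → M * (D * c) ≡ D * (M * c)
      lem₁ M D c = ringℕ (M ∷ D ∷ c ∷ []) ($0 ⋆ ($1 ⋆ $2)) ($1 ⋆ ($0 ⋆ $2)) refl
      lem₂ : ∀ D S M Y → 4 * (D * (S + M * (M * Y))) ≡ 4 * D * S + 2 * M * (2 * D * M * Y)
      lem₂ D S M Y = ringℕ (D ∷ S ∷ M ∷ Y ∷ []) (⟨ 4 ⟩ ⋆ ($0 ⋆ ($1 ⊹ $2 ⋆ ($2 ⋆ $3)))) (⟨ 4 ⟩ ⋆ $0 ⋆ $1 ⊹ ⟨ 2 ⟩ ⋆ $2 ⋆ (⟨ 2 ⟩ ⋆ $0 ⋆ $2 ⋆ $3)) refl
      lem₃ : ∀ d M G N → d * M * G + N * M + 2 * M * N ≡ 3 * (M * N) + M * (d * G)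
      lem₃ d M G N = ringℕ (d ∷ M ∷ G ∷ N ∷ []) ($0 ⋆ $1 ⋆ $2 ⊹ $3 ⋆ $1 ⊹ ⟨ 2 ⟩ ⋆ $1 ⋆ $3) (⟨ 3 ⟩ ⋆ ($1 ⋆ $3) ⊹ $1 ⋆ ($0 ⋆ $2)) refl
    -- Excludes `w′ = 0`, for which the width `y w′` would no longer determine `y`.
    pos : ℕ → ℕ
    pos w = 𝟙 ⌊ 1 ≤? w ⌋
    spread : ∀ y x → 𝟙 (good y x) ≤ sumN M (λ x′ → sumN M (λ w′ → pos w′ * Fn (x + y * x′) (y * w′)))
    spread y x with M ≤? 4 * D * cnt M (AP y x)
    ... | no _ = z≤n
    ... | yes h with pat (AP y x) h
    ... | x′ , w′ , w1 , lt , a₁ , a₂ , a₃ = ≤-trans (≤-reflexive (sym val)) (≤-trans (term≤sumN M w′ (λ w′ → pos w′ * Fn (x + y * x′) (y * w′)) w<M) (term≤sumN M x′ (λ x′ → sumN M (λ w′ → pos w′ * Fn (x + y * x′) (y * w′))) x<M))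
      where
      x<M : x′ < M
      x<M = ≤-trans (s≤s (m≤m+n x′ _)) lt
      w<M : w′ < M
      w<M = ≤-trans (s≤s (≤-trans (m≤n*m w′ (≤-trans β1 (m≤m+n β γ))) (m≤n+m _ x′))) lt
      lem : ∀ x y x′ b w → x + y * (x′ + b * w) ≡ x + y * x′ + b * (y * w)
      lem x y x′ b w = ringℕ (x ∷ y ∷ x′ ∷ b ∷ w ∷ []) ($0 ⊹ $1 ⋆ ($2 ⊹ $3 ⋆ $4)) ($0 ⊹ $1 ⋆ $2 ⊹ $3 ⋆ ($1 ⋆ $4)) refl
      val : pos w′ * Fn (x + y * x′) (y * w′) ≡ 1
      val = cong₂ _*_ (cong 𝟙 (⌊⌋-true (1 ≤? w′) w1)) (cong 𝟙 (∧-intro a₁ (∧-intro (subst (λ z → C z ≡ true) (lem x y x′ β w′) a₂) (subst (λ z → C z ≡ true) (lem x y x′ (β + γ) w′) a₃))))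
    F-zero : ∀ x w → N ≤ x → Fn x w ≡ 0
    F-zero x w h rewrite supp x h = refl
    ∧-false : ∀ a b → a ∧ (b ∧ false) ≡ false
    ∧-false true true = refl
    ∧-false true false = refl
    ∧-false false b = refl
    F-zero₂ : ∀ x w → N ≤ w → Fn x w ≡ 0
    F-zero₂ x w h rewrite supp (x + (β + γ) * w) (≤-trans h (≤-trans (m≤n*m w (≤-trans β1 (m≤m+n β γ))) (m≤n+m _ x))) | ∧-false (C x) (C (x + β * w)) = refl
    YN : Y * N ≤ 4 * D * (M * M) * Σ₀
    YN = ≤-trans (≤-sumN Y (λ y′ y<Y → many (suc y′) y<Y)) (≤-trans (≤-reflexive (sumN-scale Y (4 * D) _)) (≤-trans (*-monoʳ-≤ (4 * D)
         (≤-trans (sumN-mono Y (λ y′ _ → sumN-mono N (λ x _ → spread (suc y′) x))) (≤-trans (≤-reflexive reorder) (≤-trans (sumN-≤ M (λ x′ _ → sumN-≤ M (λ w′ _ → each x′ w′))) (≤-reflexive (sym (*-assoc M M Σ₀)))))))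
         (≤-reflexive (sym (*-assoc (4 * D) (M * M) Σ₀)))))
      where
      reorder : sumN Y (λ y′ → sumN N (λ x → sumN M (λ x′ → sumN M (λ w′ → pos w′ * Fn (x + suc y′ * x′) (suc y′ * w′))))) ≡
                sumN M (λ x′ → sumN M (λ w′ → sumN Y (λ y′ → sumN N (λ x → pos w′ * Fn (x + suc y′ * x′) (suc y′ * w′)))))
      reorder = trans (sumN-cong Y (λ y′ → trans (sumN-swap N M _) (sumN-cong M (λ x′ → sumN-swap N M _)))) (trans (sumN-swap Y M _) (sumN-cong M (λ x′ → sumN-swap Y M _)))
      each : ∀ x′ w′ → sumN Y (λ y′ → sumN N (λ x → pos w′ * Fn (x + suc y′ * x′) (suc y′ * w′))) ≤ Σ₀
      each x′ zero = ≤-trans (≤-reflexive (trans (sumN-cong Y (λ y′ → sumN-zero N)) (sumN-zero Y))) z≤n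
      each x′ w′@(suc _) = ≤-trans (sumN-mono Y (λ y′ _ → ≤-trans (≤-reflexive (sumN-cong N (λ x → trans (*-identityˡ _) (cong (λ z → Fn z (suc y′ * w′)) (+-comm x (suc y′ * x′)))))) (shift≤ N (suc y′ * x′) (λ x → Fn x (suc y′ * w′)) (λ u h → F-zero u _ h))))
          (≤-trans (≤-reflexive (sumN-cong Y (λ y′ → cong H (lem w′ y′)))) (≤-trans (sumN-dilate Y N w′ w′ H (s≤s z≤n) (λ W h → trans (sumN-cong N (λ x → F-zero₂ x W h)) (sumN-zero N))) (≤-reflexive (sumN-swap N N _))))
        where
        H : ℕ → ℕ
        H W = sumN N (λ x → Fn x W)
        lem : ∀ w y → suc y * w ≡ w + w * y
        lem w y = ringℕ (w ∷ y ∷ []) ((⟨ 1 ⟩ ⊹ $1) ⋆ $0) ($0 ⊹ $0 ⋆ $1) refl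

-- the number of solutions of b · n = h with all n - 1 in C and below N
Rep : ∀ {s} → Vec ℤ s → (ℕ → Bool) → ℕ → ℤ → ℕ
Rep [] C N h = 𝟙 ⌊ h ℤ.≟ + 0 ⌋
Rep (b ∷ bs) C N h = sumN N (λ i → 𝟙 (C i) * Rep bs C N (h ℤ.- b ℤ.* + suc i))

Rep-cong : ∀ {s} (b : Vec ℤ s) C N {h h′} → h ≡ h′ → Rep b C N h ≡ Rep b C N h′
Rep-cong b C N refl = refl

Rep-swap : ∀ {s} b c (bs : Vec ℤ s) C N h → Rep (b ∷ c ∷ bs) C N h ≡ Rep (c ∷ b ∷ bs) C N h
Rep-swap b c bs C N h = trans (sumN-cong N (λ i → sym (sumN-scale N (𝟙 (C i)) _))) (trans (sumN-swap N N _) (sumN-cong N (λ j → trans (sumN-cong N (λ i → trans (lem (𝟙 (C i)) (𝟙 (C j)) _) (cong (λ z → 𝟙 (C j) * (𝟙 (C i) * Rep bs C N z)) (lem₂ h (b ℤ.* + suc i) (c ℤ.* + suc j))))) (sumN-scale N (𝟙 (C j)) _))))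
  where
  lem : ∀ a b c → a * (b * c) ≡ b * (a * c)
  lem a b c = ringℕ (a ∷ b ∷ c ∷ []) ($0 ⋆ ($1 ⋆ $2)) ($1 ⋆ ($0 ⋆ $2)) refl
  lem₂ : ∀ h x y → h ℤ.- x ℤ.- y ≡ h ℤ.- y ℤ.- x
  lem₂ h x y = ringℤ (h ∷ x ∷ y ∷ []) ($0 ⊹ ~ $1 ⊹ ~ $2) ($0 ⊹ ~ $2 ⊹ ~ $1) refl

Rep-tail : ∀ {s} b (bs cs : Vec ℤ s) C N → (∀ h → Rep bs C N h ≡ Rep cs C N h) → ∀ h → Rep (b ∷ bs) C N h ≡ Rep (b ∷ cs) C N h
Rep-tail b bs cs C N p h = sumN-cong N (λ i → cong (𝟙 (C i) *_) (p _))

Rep-mono : ∀ {s} (b : Vec ℤ s) C C′ N → (∀ i → C i ≡ true → C′ i ≡ true) → ∀ h → Rep b C N h ≤ Rep b C′ N h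
Rep-mono [] C C′ N p h = ≤-refl
Rep-mono (b ∷ bs) C C′ N p h = sumN-mono N (λ i _ → *-mono-≤ (lem (C i) (C′ i) (p i)) (Rep-mono bs C C′ N p _))
  where lem : ∀ a b → (a ≡ true → b ≡ true) → 𝟙 a ≤ 𝟙 b
        lem false b _ = z≤n
        lem true b f rewrite f refl = ≤-refl

NZ : ∀ {s} → Vec ℤ s → Set
NZ [] = ⊤
NZ (b ∷ bs) = b ≢ + 0 × NZ bs

sumV : ∀ {s} → Vec ℤ s → ℤ
sumV [] = + 0
sumV (b ∷ bs) = b ℤ.+ sumV bs

-- The exponent is one less than the number of variables, the order of magnitude of all solutions
-- below `N`.
Roth : ∀ {s} → Vec ℤ (suc s) → Set
Roth {s} b = ∀ D → 1 ≤ D → ∃ λ c → 1 ≤ c × (∀ N C → Supp N C → N ≤ D * cnt N C → N ^ s ≤ c * Rep b C N (+ 0))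

𝟙-yes : ∀ {h : ℤ} → h ≡ + 0 → 𝟙 ⌊ h ℤ.≟ + 0 ⌋ ≡ 1
𝟙-yes {h} e = cong 𝟙 (⌊⌋-true (h ℤ.≟ + 0) e)

-- b₁ and b₃ of equal sign: the middle variable is a weighted mean of the others
roth-mid : ∀ b₁ b₂ b₃ β γ → 1 ≤ β → 1 ≤ γ → b₁ ℤ.+ (b₂ ℤ.+ (b₃ ℤ.+ + 0)) ≡ + 0 → b₁ ℤ.* + β ≡ b₃ ℤ.* + γ → Roth (b₁ ∷ b₂ ∷ b₃ ∷ [])
roth-mid b₁ b₂ b₃ β γ β1 γ1 Σ0 prop D D1 with varnavides β γ D β1 γ1 D1
... | c , c1 , triples = c , c1 , λ N C supp dens → ≤-trans (≤-reflexive (cong (N *_) (*-identityʳ N))) (≤-trans (triples N C supp dens) (*-monoʳ-≤ c (sumN-mono N (λ x _ → row N C supp x))))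
  where
  module _ (N : ℕ) (C : ℕ → Bool) (supp : Supp N C) where
    row : ∀ x → sumN N (triple β γ C x) ≤ 𝟙 (C x) * Rep (b₂ ∷ b₃ ∷ []) C N (+ 0 ℤ.- b₁ ℤ.* + suc x)
    row x = ≤-trans (≤-trans (sumN-mono N (λ w _ → pt w)) (≤-reflexive (sumN-scale N (𝟙 (C x)) (λ w → G (x + β * w))))) (*-monoʳ-≤ (𝟙 (C x)) (sumN-dilate N N x β G β1 G0))
      where
      h : ℕ → ℤ
      h i = + 0 ℤ.- b₁ ℤ.* + suc x ℤ.- b₂ ℤ.* + suc i
      G : ℕ → ℕ
      G i = 𝟙 (C i) * Rep (b₃ ∷ []) C N (h i)
      G0 : ∀ u → N ≤ u → G u ≡ 0
      G0 u p rewrite supp u p = refl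
      pt : ∀ w → triple β γ C x w ≤ 𝟙 (C x) * G (x + β * w)
      pt w = ≤-trans (≤-reflexive (trans (𝟙-∧ (C x) _) (cong (𝟙 (C x) *_) (𝟙-∧ (C (x + β * w)) _)))) (*-monoʳ-≤ (𝟙 (C x)) (*-monoʳ-≤ (𝟙 (C (x + β * w))) final))
        where
        z : ℕ
        z = x + (β + γ) * w
        eq : h (x + β * w) ℤ.- b₃ ℤ.* + suc z ≡ + 0
        eq = trans (cong₂ (λ u v → + 0 ℤ.- b₁ ℤ.* + suc x ℤ.- b₂ ℤ.* u ℤ.- b₃ ℤ.* v) (trans (ℤP.pos-+ (suc x) (β * w)) (cong (λ t → + suc x ℤ.+ t) (ℤP.pos-* β w)))
               (trans (ℤP.pos-+ (suc x) ((β + γ) * w)) (cong (λ t → + suc x ℤ.+ t) (trans (ℤP.pos-* (β + γ) w) (cong (ℤ._* + w) (ℤP.pos-+ β γ))))))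
             (trans (lem₁ b₁ b₂ b₃ (+ suc x) (+ β) (+ γ) (+ w)) (trans (cong₂ (λ s p → (ℤ.- (+ suc x ℤ.+ + β ℤ.* + w)) ℤ.* s ℤ.+ + w ℤ.* (p ℤ.- b₃ ℤ.* + γ)) Σ0 prop) (lem₂ (ℤ.- (+ suc x ℤ.+ + β ℤ.* + w)) (+ w) (b₃ ℤ.* + γ))))
          where
          lem₁ : ∀ b₁ b₂ b₃ x β γ w → + 0 ℤ.- b₁ ℤ.* x ℤ.- b₂ ℤ.* (x ℤ.+ β ℤ.* w) ℤ.- b₃ ℤ.* (x ℤ.+ (β ℤ.+ γ) ℤ.* w) ≡ (ℤ.- (x ℤ.+ β ℤ.* w)) ℤ.* (b₁ ℤ.+ (b₂ ℤ.+ (b₃ ℤ.+ + 0))) ℤ.+ w ℤ.* (b₁ ℤ.* β ℤ.- b₃ ℤ.* γ)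
          lem₁ b₁ b₂ b₃ x β γ w = ringℤ (b₁ ∷ b₂ ∷ b₃ ∷ x ∷ β ∷ γ ∷ w ∷ []) (⟨ 0 ⟩ ⊹ ~ ($0 ⋆ $3) ⊹ ~ ($1 ⋆ ($3 ⊹ $4 ⋆ $6)) ⊹ ~ ($2 ⋆ ($3 ⊹ ($4 ⊹ $5) ⋆ $6))) ((~ ($3 ⊹ $4 ⋆ $6)) ⋆ ($0 ⊹ ($1 ⊹ ($2 ⊹ ⟨ 0 ⟩))) ⊹ $6 ⋆ ($0 ⋆ $4 ⊹ ~ ($2 ⋆ $5))) refl
          lem₂ : ∀ a w p → a ℤ.* + 0 ℤ.+ w ℤ.* (p ℤ.- p) ≡ + 0
          lem₂ a w p = ringℤ (a ∷ w ∷ p ∷ []) ($0 ⋆ ⟨ 0 ⟩ ⊹ $1 ⋆ ($2 ⊹ ~ $2)) (⟨ 0 ⟩) refl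
        final : 𝟙 (C z) ≤ Rep (b₃ ∷ []) C N (h (x + β * w))
        final with C z in eqC
        ... | false = z≤n
        ... | true = ≤-trans (≤-reflexive (sym (trans (cong₂ (λ a b → 𝟙 a * b) eqC (𝟙-yes eq)) refl))) (term≤sumN N z (λ i → 𝟙 (C i) * 𝟙 ⌊ h (x + β * w) ℤ.- b₃ ℤ.* + suc i ℤ.≟ + 0 ⌋) (≰⇒> (λ N≤z → true≢false eqC (supp z N≤z))))

Roth-≡ : ∀ {s} (b b′ : Vec ℤ (suc s)) → (∀ C N h → Rep b C N h ≡ Rep b′ C N h) → Roth b → Roth b′
Roth-≡ b b′ e R D D1 with R D D1
... | c , c1 , f = c , c1 , λ N C supp dens → ≤-trans (f N C supp dens) (≤-reflexive (cong (c *_) (e C N (+ 0))))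

data SameSign : ℤ → ℤ → Set where
  both-pos : ∀ a b → SameSign (+ suc a) (+ suc b)
  mm : ∀ a b → SameSign -[1+ a ] -[1+ b ]

roth-same : ∀ b₁ b₂ b₃ → SameSign b₁ b₃ → b₁ ℤ.+ (b₂ ℤ.+ (b₃ ℤ.+ + 0)) ≡ + 0 → Roth (b₁ ∷ b₂ ∷ b₃ ∷ [])
roth-same b₁ b₂ b₃ (both-pos a b) Σ0 = roth-mid b₁ b₂ b₃ (suc b) (suc a) (s≤s z≤n) (s≤s z≤n) Σ0 (ℤP.*-comm (+ suc a) (+ suc b))
roth-same b₁ b₂ b₃ (mm a b) Σ0 = roth-mid b₁ b₂ b₃ (suc b) (suc a) (s≤s z≤n) (s≤s z≤n) Σ0 (lem (+ suc a) (+ suc b))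
  where lem : ∀ x y → (ℤ.- x) ℤ.* y ≡ (ℤ.- y) ℤ.* x
        lem x y = ringℤ (x ∷ y ∷ []) ((~ $0) ⋆ $1) ((~ $1) ⋆ $0) refl

two-same : ∀ a b c → a ≢ + 0 → b ≢ + 0 → c ≢ + 0 → SameSign a c ⊎ SameSign a b ⊎ SameSign b c
two-same (+ zero) b c p q r = contradiction refl p
two-same (+ suc a) (+ zero) c p q r = contradiction refl q
two-same (+ suc a) (+ suc b) c p q r = inj₂ (inj₁ (both-pos a b))
two-same (+ suc a) -[1+ b ] (+ zero) p q r = contradiction refl r
two-same (+ suc a) -[1+ b ] (+ suc c) p q r = inj₁ (both-pos a c)
two-same (+ suc a) -[1+ b ] -[1+ c ] p q r = inj₂ (inj₂ (mm b c))
two-same -[1+ a ] (+ zero) c p q r = contradiction refl q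
two-same -[1+ a ] -[1+ b ] c p q r = inj₂ (inj₁ (mm a b))
two-same -[1+ a ] (+ suc b) (+ zero) p q r = contradiction refl r
two-same -[1+ a ] (+ suc b) (+ suc c) p q r = inj₂ (inj₂ (both-pos b c))
two-same -[1+ a ] (+ suc b) -[1+ c ] p q r = inj₁ (mm a c)

-- Two of three non-zero integers have equal sign; a permutation of the variables brings these to
-- the outer places required by `roth-mid`.
roth₃ : ∀ b₁ b₂ b₃ → b₁ ≢ + 0 → b₂ ≢ + 0 → b₃ ≢ + 0 → b₁ ℤ.+ (b₂ ℤ.+ (b₃ ℤ.+ + 0)) ≡ + 0 → Roth (b₁ ∷ b₂ ∷ b₃ ∷ [])
roth₃ b₁ b₂ b₃ p q r Σ0 with two-same b₁ b₂ b₃ p q r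
... | inj₁ ss = roth-same b₁ b₂ b₃ ss Σ0
... | inj₂ (inj₁ ss) = Roth-≡ (b₁ ∷ b₃ ∷ b₂ ∷ []) (b₁ ∷ b₂ ∷ b₃ ∷ []) (λ C N h → Rep-tail b₁ (b₃ ∷ b₂ ∷ []) (b₂ ∷ b₃ ∷ []) C N (Rep-swap b₃ b₂ [] C N) h) (roth-same b₁ b₃ b₂ ss (trans (lem b₁ b₂ b₃) Σ0))
  where lem : ∀ a b c → a ℤ.+ (c ℤ.+ (b ℤ.+ + 0)) ≡ a ℤ.+ (b ℤ.+ (c ℤ.+ + 0))
        lem a b c = ringℤ (a ∷ b ∷ c ∷ []) ($0 ⊹ ($2 ⊹ ($1 ⊹ ⟨ 0 ⟩))) ($0 ⊹ ($1 ⊹ ($2 ⊹ ⟨ 0 ⟩))) refl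
... | inj₂ (inj₂ ss) = Roth-≡ (b₂ ∷ b₁ ∷ b₃ ∷ []) (b₁ ∷ b₂ ∷ b₃ ∷ []) (λ C N h → Rep-swap b₂ b₁ (b₃ ∷ []) C N h) (roth-same b₂ b₁ b₃ ss (trans (lem b₁ b₂ b₃) Σ0))
  where lem : ∀ a b c → b ℤ.+ (a ℤ.+ (c ℤ.+ + 0)) ≡ a ℤ.+ (b ℤ.+ (c ℤ.+ + 0))
        lem a b c = ringℤ (a ∷ b ∷ c ∷ []) ($1 ⊹ ($0 ⊹ ($2 ⊹ ⟨ 0 ⟩))) ($0 ⊹ ($1 ⊹ ($2 ⊹ ⟨ 0 ⟩))) refl

roth₂ : ∀ b₁ b₂ → b₁ ℤ.+ (b₂ ℤ.+ + 0) ≡ + 0 → Roth (b₁ ∷ b₂ ∷ [])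
roth₂ b₁ b₂ Σ0 D D1 = D , D1 , λ N C supp dens → ≤-trans (≤-reflexive (*-identityʳ N)) (≤-trans dens (*-monoʳ-≤ D (sumN-mono N (λ i i<N → row N C i i<N))))
  where
  row : ∀ N C i → i < N → 𝟙 (C i) ≤ 𝟙 (C i) * Rep (b₂ ∷ []) C N (+ 0 ℤ.- b₁ ℤ.* + suc i)
  row N C i i<N with C i in eqC
  ... | false = z≤n
  ... | true = ≤-trans (≤-trans (≤-reflexive (sym (cong₂ (λ a b → 𝟙 a * b) eqC (𝟙-yes eq)))) (term≤sumN N i (λ j → 𝟙 (C j) * 𝟙 ⌊ + 0 ℤ.- b₁ ℤ.* + suc i ℤ.- b₂ ℤ.* + suc j ℤ.≟ + 0 ⌋) i<N)) (≤-reflexive (sym (+-identityʳ _)))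
    where eq : + 0 ℤ.- b₁ ℤ.* + suc i ℤ.- b₂ ℤ.* + suc i ≡ + 0
          eq = trans (lem b₁ b₂ (+ suc i)) (trans (cong (λ s → (ℤ.- + suc i) ℤ.* s) Σ0) (ℤP.*-zeroʳ (ℤ.- + suc i)))
            where lem : ∀ a b x → + 0 ℤ.- a ℤ.* x ℤ.- b ℤ.* x ≡ (ℤ.- x) ℤ.* (a ℤ.+ (b ℤ.+ + 0))
                  lem a b x = ringℤ (a ∷ b ∷ x ∷ []) (⟨ 0 ⟩ ⊹ ~ ($0 ⋆ $2) ⊹ ~ ($1 ⋆ $2)) ((~ $2) ⋆ ($0 ⊹ ($1 ⊹ ⟨ 0 ⟩))) refl

-- all but few elements of a dense set are the first coordinate of many solutions
poor-few : ∀ {s} b (bs : Vec ℤ s) → Roth (b ∷ bs) → ∀ D → 1 ≤ D → ∃ λ c → 1 ≤ c × (∀ N C → 1 ≤ N → Supp N C →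
  D * cnt N (λ i → C i ∧ not ⌊ N ^ (s ∸ 1) ≤? c * Rep bs C N (+ 0 ℤ.- b ℤ.* + suc i) ⌋) ≤ N)
poor-few {zero} b [] R D D1 with R D D1
... | c , c1 , f = c , c1 , λ N C N1 supp → body N C N1 supp
  where
  body : ∀ N C → 1 ≤ N → Supp N C → D * cnt N (λ i → C i ∧ not ⌊ 1 ≤? c * Rep [] C N (+ 0 ℤ.- b ℤ.* + suc i) ⌋) ≤ N
  body N C N1 supp with D * cnt N (λ i → C i ∧ not ⌊ 1 ≤? c * Rep [] C N (+ 0 ℤ.- b ℤ.* + suc i) ⌋) ≤? N
  ... | yes p = p
  ... | no ¬p = contradiction (f N P (λ i h → false-∧ _ (supp i h)) (<⇒≤ (≰⇒> ¬p))) (<⇒≱ (s≤s (≤-trans (≤-reflexive (sym (sumN-scale N c _))) (≤-trans (≤-reflexive (trans (sumN-cong N pt) (sumN-zero N))) z≤n))))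
    where
    P : ℕ → Bool
    P i = C i ∧ not ⌊ 1 ≤? c * Rep [] C N (+ 0 ℤ.- b ℤ.* + suc i) ⌋
    pt : ∀ i → c * (𝟙 (P i) * Rep [] P N (+ 0 ℤ.- b ℤ.* + suc i)) ≡ 0
    pt i with C i | 1 ≤? c * 𝟙 ⌊ + 0 ℤ.- b ℤ.* + suc i ℤ.≟ + 0 ⌋
    ... | false | _ = *-zeroʳ c
    ... | true | yes _ = *-zeroʳ c
    ... | true | no n = trans (cong (c *_) (+-identityʳ _)) (n≤0⇒n≡0 (≤-pred (≰⇒> n)))
poor-few {suc s} b bs R D D1 with R D D1
... | c , c1 , f = c , c1 , λ N C N1 supp → body N C N1 supp
  where
  body : ∀ N C → 1 ≤ N → Supp N C → D * cnt N (λ i → C i ∧ not ⌊ N ^ s ≤? c * Rep bs C N (+ 0 ℤ.- b ℤ.* + suc i) ⌋) ≤ N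
  -- If the poor elements were dense, `R` applied to the set `P` of poor elements would yield many
  -- solutions inside `P`, yet each element of `P` begins too few solutions even inside `C`.
  body N C N1 supp with D * cnt N (λ i → C i ∧ not ⌊ N ^ s ≤? c * Rep bs C N (+ 0 ℤ.- b ℤ.* + suc i) ⌋) ≤? N
  ... | yes p = p
  ... | no ¬p = contradiction (≤-trans (+-monoˡ-≤ (cnt N P) (f N P (λ i h → false-∧ _ (supp i h)) (<⇒≤ (≰⇒> ¬p)))) bound) (<⇒≱ (≤-trans (≤-reflexive (+-comm 1 (N ^ suc s))) (+-monoʳ-≤ (N ^ suc s) P1)))
    where
    P : ℕ → Bool
    P i = C i ∧ not ⌊ N ^ s ≤? c * Rep bs C N (+ 0 ℤ.- b ℤ.* + suc i) ⌋
    P1 : 1 ≤ cnt N P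
    P1 = go (cnt N P) ¬p
      where go : ∀ k → ¬ (D * k ≤ N) → 1 ≤ k
            go zero h = contradiction (≤-trans (≤-reflexive (*-zeroʳ D)) z≤n) h
            go (suc k) _ = s≤s z≤n
    P⊂C : ∀ i → P i ≡ true → C i ≡ true
    P⊂C i h = proj₁ (∧-elim {C i} h)
    bound : c * Rep (b ∷ bs) P N (+ 0) + cnt N P ≤ N ^ suc s
    bound = ≤-trans (≤-reflexive (trans (cong (_+ cnt N P) (sym (sumN-scale N c _))) (sym (sumN-add N _ _)))) (sumN-≤ N (λ i _ → ≤-trans (+-monoˡ-≤ (𝟙 (P i)) (*-monoʳ-≤ c (*-monoʳ-≤ (𝟙 (P i)) (Rep-mono bs P C N P⊂C _)))) (pt i)))
      where
      pt : ∀ i → c * (𝟙 (P i) * Rep bs C N (+ 0 ℤ.- b ℤ.* + suc i)) + 𝟙 (P i) ≤ N ^ s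
      pt i with C i | N ^ s ≤? c * Rep bs C N (+ 0 ℤ.- b ℤ.* + suc i)
      ... | false | _ = ≤-trans (≤-reflexive (trans (+-identityʳ _) (*-zeroʳ c))) z≤n
      ... | true | yes _ = ≤-trans (≤-reflexive (trans (+-identityʳ _) (*-zeroʳ c))) z≤n
      ... | true | no n = ≤-trans (≤-reflexive (trans (+-comm _ 1) (cong (λ z → suc (c * z)) (+-identityʳ _)))) (≰⇒> n)

-- Put `e = b₁ + b₂`. By `poor-few` a positive proportion of `C` consists of `i` that occur both in
-- many solutions of `e i = b₁ x + b₂ y` and in many of `e i + bs · n = 0`. Joining such solutions
-- eliminates `i`; as `e` is not zero, `i` is recovered from `x` and `y`, so nothing is counted
-- twice.
roth-merge : ∀ {s} b₁ b₂ (bs : Vec ℤ (suc s)) → Roth (ℤ.- (b₁ ℤ.+ b₂) ∷ b₁ ∷ b₂ ∷ []) → Roth ((b₁ ℤ.+ b₂) ∷ bs) → b₁ ℤ.+ b₂ ≢ + 0 → Roth (b₁ ∷ b₂ ∷ bs)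
roth-merge {s} b₁ b₂ bs RA RB nz D D1 with poor-few (ℤ.- (b₁ ℤ.+ b₂)) (b₁ ∷ b₂ ∷ []) RA (4 * D) (1≤m* {4} (s≤s z≤n) D1) | poor-few (b₁ ℤ.+ b₂) bs RB (4 * D) (1≤m* {4} (s≤s z≤n) D1)
... | cA , cA1 , fA | cB , cB1 , fB = 2 * D * (cA * cB) , 1≤m* (1≤m* {2} (s≤s z≤n) D1) (1≤m* cA1 cB1) , main
  where
  e : ℤ
  e = b₁ ℤ.+ b₂
  main : ∀ N C → Supp N C → N ≤ D * cnt N C → N ^ suc (suc s) ≤ 2 * D * (cA * cB) * Rep (b₁ ∷ b₂ ∷ bs) C N (+ 0)
  main zero C supp dens = z≤n
  main N@(suc N′) C supp dens = ≤-trans (*-monoˡ-≤ (N ^ suc s) rich-many) (≤-trans (≤-reflexive (lem₀ (2 * D) (cnt N rich) (N ^ suc s))) (≤-trans (*-monoʳ-≤ (2 * D) prod) (≤-trans (*-monoʳ-≤ (2 * D) (*-monoʳ-≤ (cA * cB) counted)) (≤-reflexive (sym (*-assoc (2 * D) (cA * cB) _))))))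
    where
    RAi RBi : ℕ → ℕ
    RAi i = Rep (b₁ ∷ b₂ ∷ []) C N (+ 0 ℤ.- (ℤ.- e) ℤ.* + suc i)
    RBi i = Rep bs C N (+ 0 ℤ.- e ℤ.* + suc i)
    okA okB rich : ℕ → Bool
    okA i = ⌊ N ^ 1 ≤? cA * RAi i ⌋
    okB i = ⌊ N ^ s ≤? cB * RBi i ⌋
    rich i = C i ∧ (okA i ∧ okB i)
    pA = cnt N (λ i → C i ∧ not (okA i))
    pB = cnt N (λ i → C i ∧ not (okB i))
    rich-many : N ≤ 2 * D * cnt N rich
    rich-many = *-cancelˡ-≤ 2 (+-cancelʳ-≤ (N + N) (2 * N) _ (≤-trans (≤-reflexive (lem₁ N)) (≤-trans (*-monoʳ-≤ 4 (≤-trans dens (*-monoʳ-≤ D split))) (≤-trans (≤-reflexive (lem₂ D (cnt N rich) pA pB)) (+-monoʳ-≤ (2 * (2 * D * cnt N rich)) (+-mono-≤ (fA N C (s≤s z≤n) supp) (fB N C (s≤s z≤n) supp)))))))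
      where
      split : cnt N C ≤ cnt N rich + (pA + pB)
      split = ≤-trans (sumN-mono N (λ i _ → lem (C i) (okA i) (okB i))) (≤-reflexive (trans (sumN-add N _ _) (cong (λ ○ → cnt N rich + ○) (sumN-add N _ _))))
        where lem : ∀ c a b → 𝟙 c ≤ 𝟙 (c ∧ (a ∧ b)) + (𝟙 (c ∧ not a) + 𝟙 (c ∧ not b))
              lem false a b = z≤n
              lem true true true = s≤s z≤n
              lem true true false = s≤s z≤n
              lem true false b = s≤s z≤n
      lem₁ : ∀ N → 2 * N + (N + N) ≡ 4 * N
      lem₁ N = ringℕ (N ∷ []) (⟨ 2 ⟩ ⋆ $0 ⊹ ($0 ⊹ $0)) (⟨ 4 ⟩ ⋆ $0) refl
      lem₂ : ∀ D r a b → 4 * (D * (r + (a + b))) ≡ 2 * (2 * D * r) + (4 * D * a + 4 * D * b)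
      lem₂ D r a b = ringℕ (D ∷ r ∷ a ∷ b ∷ []) (⟨ 4 ⟩ ⋆ ($0 ⋆ ($1 ⊹ ($2 ⊹ $3)))) (⟨ 2 ⟩ ⋆ (⟨ 2 ⟩ ⋆ $0 ⋆ $1) ⊹ (⟨ 4 ⟩ ⋆ $0 ⋆ $2 ⊹ ⟨ 4 ⟩ ⋆ $0 ⋆ $3)) refl
    lem₀ : ∀ d r x → d * r * x ≡ d * (r * x)
    lem₀ d r x = ringℕ (d ∷ r ∷ x ∷ []) ($0 ⋆ $1 ⋆ $2) ($0 ⋆ ($1 ⋆ $2)) refl
    W : ℕ
    W = sumN N (λ i → 𝟙 (rich i) * (RAi i * RBi i))
    prod : cnt N rich * N ^ suc s ≤ cA * cB * W
    prod = ≤-trans (≤-reflexive (trans (*-comm _ (N ^ suc s)) (sym (sumN-scale N (N ^ suc s) _)))) (≤-trans (sumN-mono N (λ i _ → pt i)) (≤-reflexive (sumN-scale N (cA * cB) _)))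
      where
      pt : ∀ i → N ^ suc s * 𝟙 (rich i) ≤ cA * cB * (𝟙 (rich i) * (RAi i * RBi i))
      pt i with rich i in eq
      ... | false = ≤-trans (≤-reflexive (*-zeroʳ (N ^ suc s))) z≤n
      ... | true = ≤-trans (≤-reflexive (trans (*-identityʳ _) (cong (_* N ^ s) (sym (*-identityʳ N))))) (≤-trans (*-mono-≤ (⌊⌋-elim (N ^ 1 ≤? cA * RAi i) (proj₁ both)) (⌊⌋-elim (N ^ s ≤? cB * RBi i) (proj₂ both))) (≤-reflexive (lem cA (RAi i) cB (RBi i))))
        where
        both = ∧-elim {okA i} (proj₂ (∧-elim {C i} eq))
        lem : ∀ a x b y → a * x * (b * y) ≡ a * b * (1 * (x * y))
        lem a x b y = ringℕ (a ∷ x ∷ b ∷ y ∷ []) ($0 ⋆ $1 ⋆ ($2 ⋆ $3)) ($0 ⋆ $2 ⋆ (⟨ 1 ⟩ ⋆ ($1 ⋆ $3))) refl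
    counted : W ≤ Rep (b₁ ∷ b₂ ∷ bs) C N (+ 0)
    counted = ≤-trans (≤-reflexive reorder) (sumN-mono N (λ x _ → *-monoʳ-≤ (𝟙 (C x)) (sumN-mono N (λ y _ → *-monoʳ-≤ (𝟙 (C y)) (inner x y)))))
      where
      δ : ℕ → ℕ → ℕ → ℕ
      δ x y i = 𝟙 ⌊ + 0 ℤ.- (ℤ.- e) ℤ.* + suc i ℤ.- b₁ ℤ.* + suc x ℤ.- b₂ ℤ.* + suc y ℤ.≟ + 0 ⌋
      reorder : W ≡ sumN N (λ x → 𝟙 (C x) * sumN N (λ y → 𝟙 (C y) * sumN N (λ i → 𝟙 (rich i) * (δ x y i * RBi i))))
      reorder = trans (sumN-cong N (λ i → trans (lem₁ (𝟙 (rich i)) (RAi i) (RBi i)) (trans (sym (sumN-scale N (𝟙 (rich i) * RBi i) _)) (sumN-cong N (λ x → trans (lem₂ (𝟙 (rich i) * RBi i) (𝟙 (C x)) _) (cong (𝟙 (C x) *_) (trans (sym (sumN-scale N (𝟙 (rich i) * RBi i) _)) (sumN-cong N (λ y → lem₃ (𝟙 (rich i)) (RBi i) (𝟙 (C y)) (δ x y i))))))))))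
         (trans (sumN-swap N N _) (sumN-cong N (λ x → trans (sumN-scale N (𝟙 (C x)) _) (cong (𝟙 (C x) *_) (trans (sumN-swap N N _) (sumN-cong N (λ y → sumN-scale N (𝟙 (C y)) _)))))))
        where
        lem₁ : ∀ r a b → r * (a * b) ≡ r * b * a
        lem₁ r a b = ringℕ (r ∷ a ∷ b ∷ []) ($0 ⋆ ($1 ⋆ $2)) ($0 ⋆ $2 ⋆ $1) refl
        lem₂ : ∀ k c z → k * (c * z) ≡ c * (k * z)
        lem₂ k c z = ringℕ (k ∷ c ∷ z ∷ []) ($0 ⋆ ($1 ⋆ $2)) ($1 ⋆ ($0 ⋆ $2)) refl
        lem₃ : ∀ r b c d → r * b * (c * d) ≡ c * (r * (d * b))
        lem₃ r b c d = ringℕ (r ∷ b ∷ c ∷ d ∷ []) ($0 ⋆ $1 ⋆ ($2 ⋆ $3)) ($2 ⋆ ($0 ⋆ ($3 ⋆ $1))) refl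
      inner : ∀ x y → sumN N (λ i → 𝟙 (rich i) * (δ x y i * RBi i)) ≤ Rep bs C N (+ 0 ℤ.- b₁ ℤ.* + suc x ℤ.- b₂ ℤ.* + suc y)
      inner x y = sumN-unique N _ _ (λ i _ → each i) uniq
        where
        R₀ = Rep bs C N (+ 0 ℤ.- b₁ ℤ.* + suc x ℤ.- b₂ ℤ.* + suc y)
        lem : ∀ e i u v → + 0 ℤ.- (ℤ.- e) ℤ.* i ℤ.- u ℤ.- v ≡ + 0 ℤ.- u ℤ.- v ℤ.- (+ 0 ℤ.- e ℤ.* i)
        lem e i u v = ringℤ (e ∷ i ∷ u ∷ v ∷ []) (⟨ 0 ⟩ ⊹ ~ ((~ $0) ⋆ $1) ⊹ ~ $2 ⊹ ~ $3) (⟨ 0 ⟩ ⊹ ~ $2 ⊹ ~ $3 ⊹ ~ (⟨ 0 ⟩ ⊹ ~ ($0 ⋆ $1))) refl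
        same : ∀ i → + 0 ℤ.- (ℤ.- e) ℤ.* + suc i ℤ.- b₁ ℤ.* + suc x ℤ.- b₂ ℤ.* + suc y ≡ + 0 → + 0 ℤ.- b₁ ℤ.* + suc x ℤ.- b₂ ℤ.* + suc y ≡ + 0 ℤ.- e ℤ.* + suc i
        same i z = ℤP.i-j≡0⇒i≡j _ _ (trans (sym (lem e (+ suc i) (b₁ ℤ.* + suc x) (b₂ ℤ.* + suc y))) z)
        each : ∀ i → 𝟙 (rich i) * (δ x y i * RBi i) ≤ R₀
        each i with + 0 ℤ.- (ℤ.- e) ℤ.* + suc i ℤ.- b₁ ℤ.* + suc x ℤ.- b₂ ℤ.* + suc y ℤ.≟ + 0
        ... | no _ = ≤-trans (≤-reflexive (*-zeroʳ (𝟙 (rich i)))) z≤n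
        ... | yes z = ≤-trans (*-monoˡ-≤ (1 * RBi i) (𝟙≤1 (rich i))) (≤-reflexive (trans (trans (*-identityˡ _) (*-identityˡ _)) (Rep-cong bs C N (sym (same i z)))))
        uniq : ∀ i j → i < N → j < N → i ≢ j → 𝟙 (rich i) * (δ x y i * RBi i) ≡ 0 ⊎ 𝟙 (rich j) * (δ x y j * RBi j) ≡ 0
        uniq i j _ _ i≢j with + 0 ℤ.- (ℤ.- e) ℤ.* + suc i ℤ.- b₁ ℤ.* + suc x ℤ.- b₂ ℤ.* + suc y ℤ.≟ + 0 | + 0 ℤ.- (ℤ.- e) ℤ.* + suc j ℤ.- b₁ ℤ.* + suc x ℤ.- b₂ ℤ.* + suc y ℤ.≟ + 0
        ... | no _ | _ = inj₁ (*-zeroʳ (𝟙 (rich i)))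
        ... | yes _ | no _ = inj₂ (*-zeroʳ (𝟙 (rich j)))
        ... | yes z | yes z′ = contradiction (ℕP.suc-injective (ℤP.+-injective (ℤP.*-cancelˡ-≡ e (+ suc i) (+ suc j) {{ℤ.≢-nonZero nz}} (ℤP.neg-injective (trans (sym (ℤP.+-identityˡ _)) (trans (trans (sym (same i z)) (same j z′)) (ℤP.+-identityˡ _))))))) i≢j

-- Merging needs two coefficients with non-zero sum. Among the first three such a pair exists, since
-- `b₁ + b₂ = b₁ + b₃ = 0` gives `b₂ + b₃ = - 2 b₁`.
roth-step : ∀ {s} → (∀ (b : Vec ℤ (suc (suc (suc s)))) → NZ b → sumV b ≡ + 0 → Roth b) → ∀ b₁ b₂ b₃ (bs : Vec ℤ (suc s)) →
  b₁ ≢ + 0 → b₂ ≢ + 0 → b₃ ≢ + 0 → NZ bs → b₁ ℤ.+ (b₂ ℤ.+ (b₃ ℤ.+ sumV bs)) ≡ + 0 → Roth (b₁ ∷ b₂ ∷ b₃ ∷ bs)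
roth-step rec b₁ b₂ b₃ bs p q r ns Σ0 = go
  where
  core : ∀ a b c → a ≢ + 0 → b ≢ + 0 → c ≢ + 0 → a ℤ.+ b ≢ + 0 → a ℤ.+ (b ℤ.+ (c ℤ.+ sumV bs)) ≡ + 0 → Roth (a ∷ b ∷ c ∷ bs)
  core a b c pa pb pc nz Σ = roth-merge a b (c ∷ bs)
     (roth₃ (ℤ.- (a ℤ.+ b)) a b (λ z → nz (ℤP.neg-injective z)) pa pb (lem₁ a b))
     (rec ((a ℤ.+ b) ∷ c ∷ bs) (nz , pc , ns) (trans (ℤP.+-assoc a b _) Σ)) nz
    where lem₁ : ∀ a b → (ℤ.- (a ℤ.+ b)) ℤ.+ (a ℤ.+ (b ℤ.+ + 0)) ≡ + 0
          lem₁ a b = ringℤ (a ∷ b ∷ []) ((~ ($0 ⊹ $1)) ⊹ ($0 ⊹ ($1 ⊹ ⟨ 0 ⟩))) (⟨ 0 ⟩) refl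
  lem₂ : ∀ a b c d → a ℤ.+ (c ℤ.+ (b ℤ.+ d)) ≡ a ℤ.+ (b ℤ.+ (c ℤ.+ d))
  lem₂ a b c d = ringℤ (a ∷ b ∷ c ∷ d ∷ []) ($0 ⊹ ($2 ⊹ ($1 ⊹ $3))) ($0 ⊹ ($1 ⊹ ($2 ⊹ $3))) refl
  lem₃ : ∀ a b c d → b ℤ.+ (c ℤ.+ (a ℤ.+ d)) ≡ a ℤ.+ (b ℤ.+ (c ℤ.+ d))
  lem₃ a b c d = ringℤ (a ∷ b ∷ c ∷ d ∷ []) ($1 ⊹ ($2 ⊹ ($0 ⊹ $3))) ($0 ⊹ ($1 ⊹ ($2 ⊹ $3))) refl
  go : Roth (b₁ ∷ b₂ ∷ b₃ ∷ bs)
  go with b₁ ℤ.+ b₂ ℤ.≟ + 0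
  ... | no nz = core b₁ b₂ b₃ p q r nz Σ0
  ... | yes z with b₁ ℤ.+ b₃ ℤ.≟ + 0
  ... | no nz = Roth-≡ (b₁ ∷ b₃ ∷ b₂ ∷ bs) (b₁ ∷ b₂ ∷ b₃ ∷ bs) (λ C N h → Rep-tail b₁ (b₃ ∷ b₂ ∷ bs) (b₂ ∷ b₃ ∷ bs) C N (Rep-swap b₃ b₂ bs C N) h) (core b₁ b₃ b₂ p r q nz (trans (lem₂ b₁ b₂ b₃ (sumV bs)) Σ0))
  ... | yes z′ = Roth-≡ (b₂ ∷ b₃ ∷ b₁ ∷ bs) (b₁ ∷ b₂ ∷ b₃ ∷ bs) (λ C N h → trans (Rep-tail b₂ (b₃ ∷ b₁ ∷ bs) (b₁ ∷ b₃ ∷ bs) C N (Rep-swap b₃ b₁ bs C N) h) (Rep-swap b₂ b₁ (b₃ ∷ bs) C N h)) (core b₂ b₃ b₁ q r p nz (trans (lem₃ b₁ b₂ b₃ (sumV bs)) Σ0))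
    where
    dbl : ∀ b → b ≢ + 0 → b ℤ.+ b ≢ + 0
    dbl (+ zero) h _ = h refl
    dbl (+ suc n) h ()
    dbl -[1+ n ] h ()
    lem₄ : ∀ a b c → a ℤ.+ a ≡ (a ℤ.+ b) ℤ.+ (a ℤ.+ c) ℤ.- (b ℤ.+ c)
    lem₄ a b c = ringℤ (a ∷ b ∷ c ∷ []) ($0 ⊹ $0) (($0 ⊹ $1) ⊹ ($0 ⊹ $2) ⊹ ~ ($1 ⊹ $2)) refl
    nz : b₂ ℤ.+ b₃ ≢ + 0
    nz w = dbl b₁ p (trans (lem₄ b₁ b₂ b₃) (trans (cong₂ (λ u v → u ℤ.- v) (cong₂ ℤ._+_ z z′) w) refl))

roth : ∀ s (b : Vec ℤ (suc (suc s))) → NZ b → sumV b ≡ + 0 → Roth b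
roth zero (b₁ ∷ b₂ ∷ []) _ Σ0 = roth₂ b₁ b₂ Σ0
roth (suc zero) (b₁ ∷ b₂ ∷ b₃ ∷ []) (p , q , r , _) Σ0 = roth₃ b₁ b₂ b₃ p q r Σ0
roth (suc (suc s)) (b₁ ∷ b₂ ∷ b₃ ∷ bs) (p , q , r , ns) Σ0 = roth-step (roth (suc s)) b₁ b₂ b₃ bs p q r ns Σ0

-- Taylor shifts of coefficient vectors.

-- coefficients of c + (x + a) S(x)
addS : ∀ {n} → ℤ → ℤ → Vec ℤ n → Vec ℤ (suc n)
addS c a [] = c ∷ []
addS c a (s ∷ S) = (c ℤ.+ a ℤ.* s) ∷ addS s a S

-- coefficients of P(x + a)
sh : ∀ {n} → ℤ → Vec ℤ n → Vec ℤ n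
sh a [] = []
sh a (c ∷ cs) = addS c a (sh a cs)

eval-addS : ∀ {n} c a (S : Vec ℤ n) x → evalℤ (addS c a S) x ≡ c ℤ.+ (x ℤ.+ a) ℤ.* evalℤ S x
eval-addS c a [] x = lem c x a
  where lem : ∀ c x a → c ℤ.+ x ℤ.* + 0 ≡ c ℤ.+ (x ℤ.+ a) ℤ.* + 0
        lem c x a = ringℤ (c ∷ x ∷ a ∷ []) ($0 ⊹ $1 ⋆ ⟨ 0 ⟩) ($0 ⊹ ($1 ⊹ $2) ⋆ ⟨ 0 ⟩) refl
eval-addS c a (s ∷ S) x = trans (cong (λ z → c ℤ.+ a ℤ.* s ℤ.+ x ℤ.* z) (eval-addS s a S x)) (lem c a s x (evalℤ S x))
  where lem : ∀ c a s x e → c ℤ.+ a ℤ.* s ℤ.+ x ℤ.* (s ℤ.+ (x ℤ.+ a) ℤ.* e) ≡ c ℤ.+ (x ℤ.+ a) ℤ.* (s ℤ.+ x ℤ.* e)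
        lem c a s x e = ringℤ (c ∷ a ∷ s ∷ x ∷ e ∷ []) ($0 ⊹ $1 ⋆ $2 ⊹ $3 ⋆ ($2 ⊹ ($3 ⊹ $1) ⋆ $4)) ($0 ⊹ ($3 ⊹ $1) ⋆ ($2 ⊹ $3 ⋆ $4)) refl

eval-sh : ∀ {n} a (P : Vec ℤ n) x → evalℤ (sh a P) x ≡ evalℤ P (x ℤ.+ a)
eval-sh a [] x = refl
eval-sh a (c ∷ cs) x = trans (eval-addS c a (sh a cs) x) (cong (λ z → c ℤ.+ (x ℤ.+ a) ℤ.* z) (eval-sh a cs x))

addS-addS : ∀ {n} c s a b (V : Vec ℤ n) → addS (c ℤ.+ a ℤ.* s) b (addS s (a ℤ.+ b) V) ≡ addS c (a ℤ.+ b) (addS s b V)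
addS-addS c s a b [] = cong (_∷ (s ∷ [])) (lem c s a b)
  where lem : ∀ c s a b → c ℤ.+ a ℤ.* s ℤ.+ b ℤ.* s ≡ c ℤ.+ (a ℤ.+ b) ℤ.* s
        lem c s a b = ringℤ (c ∷ s ∷ a ∷ b ∷ []) ($0 ⊹ $2 ⋆ $1 ⊹ $3 ⋆ $1) ($0 ⊹ ($2 ⊹ $3) ⋆ $1) refl
addS-addS c s a b (v ∷ V) = cong₂ _∷_ (lem c s a b v) (trans (cong (λ z → addS z b (addS v (a ℤ.+ b) V)) (lem₂ s a b v)) (addS-addS (s ℤ.+ b ℤ.* v) v a b V))
  where
  lem : ∀ c s a b v → c ℤ.+ a ℤ.* s ℤ.+ b ℤ.* (s ℤ.+ (a ℤ.+ b) ℤ.* v) ≡ c ℤ.+ (a ℤ.+ b) ℤ.* (s ℤ.+ b ℤ.* v)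
  lem c s a b v = ringℤ (c ∷ s ∷ a ∷ b ∷ v ∷ []) ($0 ⊹ $2 ⋆ $1 ⊹ $3 ⋆ ($1 ⊹ ($2 ⊹ $3) ⋆ $4)) ($0 ⊹ ($2 ⊹ $3) ⋆ ($1 ⊹ $3 ⋆ $4)) refl
  lem₂ : ∀ s a b v → s ℤ.+ (a ℤ.+ b) ℤ.* v ≡ s ℤ.+ b ℤ.* v ℤ.+ a ℤ.* v
  lem₂ s a b v = ringℤ (s ∷ a ∷ b ∷ v ∷ []) ($0 ⊹ ($1 ⊹ $2) ⋆ $3) ($0 ⊹ $2 ⋆ $3 ⊹ $1 ⋆ $3) refl

sh-addS : ∀ {n} a b c (S : Vec ℤ n) → sh b (addS c a S) ≡ addS c (a ℤ.+ b) (sh b S)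
sh-addS a b c [] = refl
sh-addS a b c (s ∷ S) = trans (cong (addS (c ℤ.+ a ℤ.* s) b) (sh-addS a b s S)) (addS-addS c s a b (sh b S))

sh-sh : ∀ {n} a b (P : Vec ℤ n) → sh b (sh a P) ≡ sh (a ℤ.+ b) P
sh-sh a b [] = refl
sh-sh a b (c ∷ cs) = trans (sh-addS a b c (sh a cs)) (cong (addS c (a ℤ.+ b)) (sh-sh a b cs))

nth : ∀ {n} → Vec ℤ n → ℕ → ℤ
nth [] j = + 0
nth (c ∷ cs) zero = c
nth (c ∷ cs) (suc j) = nth cs j

nth-addS-0 : ∀ {n} c a (S : Vec ℤ n) → nth (addS c a S) 0 ≡ c ℤ.+ a ℤ.* nth S 0
nth-addS-0 c a [] = lem c a
  where lem : ∀ c a → c ≡ c ℤ.+ a ℤ.* + 0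
        lem c a = ringℤ (c ∷ a ∷ []) ($0) ($0 ⊹ $1 ⋆ ⟨ 0 ⟩) refl
nth-addS-0 c a (s ∷ S) = refl

nth-addS-suc : ∀ {n} c a (S : Vec ℤ n) j → nth (addS c a S) (suc j) ≡ nth S j ℤ.+ a ℤ.* nth S (suc j)
nth-addS-suc c a [] j = sym (trans (ℤP.+-identityˡ _) (ℤP.*-zeroʳ a))
nth-addS-suc c a (s ∷ S) zero = nth-addS-0 s a S
nth-addS-suc c a (s ∷ S) (suc j) = nth-addS-suc s a S j

taylorFrom-0 : ∀ {n} i (cs : Vec ℤ n) a → taylorFrom (suc i) cs 0 a ≡ a ℤ.* taylorFrom i cs 0 a
taylorFrom-0 i [] a = sym (ℤP.*-zeroʳ a)
taylorFrom-0 i (c ∷ cs) a = trans (cong (λ z → + (suc i ℕC.C 0) ℤ.* c ℤ.* (a ℤ.* a ℤ.^ i) ℤ.+ z) (taylorFrom-0 (suc i) cs a)) (lem c a (a ℤ.^ i) (taylorFrom (suc i) cs 0 a))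
  where lem : ∀ c a p t → + 1 ℤ.* c ℤ.* (a ℤ.* p) ℤ.+ a ℤ.* t ≡ a ℤ.* (+ 1 ℤ.* c ℤ.* p ℤ.+ t)
        lem c a p t = ringℤ (c ∷ a ∷ p ∷ t ∷ []) (⟨ 1 ⟩ ⋆ $0 ⋆ ($1 ⋆ $2) ⊹ $1 ⋆ $3) ($1 ⋆ (⟨ 1 ⟩ ⋆ $0 ⋆ $2 ⊹ $3)) refl

taylorFrom-suc : ∀ {n} i (cs : Vec ℤ n) j a → taylorFrom (suc i) cs (suc j) a ≡ taylorFrom i cs j a ℤ.+ a ℤ.* taylorFrom i cs (suc j) a
taylorFrom-suc i [] j a = sym (trans (ℤP.+-identityˡ _) (ℤP.*-zeroʳ a))
taylorFrom-suc i (c ∷ cs) j a = trans (cong₂ ℤ._+_ term (taylorFrom-suc (suc i) cs j a)) (lem (+ (i ℕC.C j)) c (a ℤ.^ (i ∸ j)) (taylorFrom (suc i) cs j a) a (+ (i ℕC.C suc j)) (a ℤ.^ (i ∸ suc j)) (taylorFrom (suc i) cs (suc j) a))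
  where
  lem : ∀ x c p t a y q u → x ℤ.* c ℤ.* p ℤ.+ a ℤ.* (y ℤ.* c ℤ.* q) ℤ.+ (t ℤ.+ a ℤ.* u) ≡ x ℤ.* c ℤ.* p ℤ.+ t ℤ.+ a ℤ.* (y ℤ.* c ℤ.* q ℤ.+ u)
  lem x c p t a y q u = ringℤ (x ∷ c ∷ p ∷ t ∷ a ∷ y ∷ q ∷ u ∷ []) ($0 ⋆ $1 ⋆ $2 ⊹ $4 ⋆ ($5 ⋆ $1 ⋆ $6) ⊹ ($3 ⊹ $4 ⋆ $7)) ($0 ⋆ $1 ⋆ $2 ⊹ $3 ⊹ $4 ⋆ ($5 ⋆ $1 ⋆ $6 ⊹ $7)) refl
  pow : (+ (i ℕC.C suc j)) ℤ.* a ℤ.^ (i ∸ j) ≡ (+ (i ℕC.C suc j)) ℤ.* (a ℤ.* a ℤ.^ (i ∸ suc j))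
  pow with suc j ≤? i
  ... | yes p = cong (λ z → + (i ℕC.C suc j) ℤ.* a ℤ.^ z) (sym (trans (sym (+-∸-assoc 1 p)) refl))
  ... | no ¬p = trans (cong (λ z → + z ℤ.* a ℤ.^ (i ∸ j)) (k>n⇒nCk≡0 (≰⇒> ¬p))) (sym (cong (λ z → + z ℤ.* (a ℤ.* a ℤ.^ (i ∸ suc j))) (k>n⇒nCk≡0 (≰⇒> ¬p))))
  term : + (suc i ℕC.C suc j) ℤ.* c ℤ.* a ℤ.^ (i ∸ j) ≡ + (i ℕC.C j) ℤ.* c ℤ.* a ℤ.^ (i ∸ j) ℤ.+ a ℤ.* (+ (i ℕC.C suc j) ℤ.* c ℤ.* a ℤ.^ (i ∸ suc j))
  term = trans (cong (λ z → z ℤ.* c ℤ.* a ℤ.^ (i ∸ j)) (trans (cong +_ (sym (nCk+nC[k+1]≡[n+1]C[k+1] i j))) (ℤP.pos-+ (i ℕC.C j) (i ℕC.C suc j))))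
     (trans (lem₁ (+ (i ℕC.C j)) (+ (i ℕC.C suc j)) c (a ℤ.^ (i ∸ j))) (trans (cong (λ z → + (i ℕC.C j) ℤ.* c ℤ.* a ℤ.^ (i ∸ j) ℤ.+ c ℤ.* z) pow) (lem₂ (+ (i ℕC.C j) ℤ.* c ℤ.* a ℤ.^ (i ∸ j)) c (+ (i ℕC.C suc j)) a (a ℤ.^ (i ∸ suc j)))))
    where
    lem₁ : ∀ x y c p → (x ℤ.+ y) ℤ.* c ℤ.* p ≡ x ℤ.* c ℤ.* p ℤ.+ c ℤ.* (y ℤ.* p)
    lem₁ x y c p = ringℤ (x ∷ y ∷ c ∷ p ∷ []) (($0 ⊹ $1) ⋆ $2 ⋆ $3) ($0 ⋆ $2 ⋆ $3 ⊹ $2 ⋆ ($1 ⋆ $3)) refl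
    lem₂ : ∀ X c y a q → X ℤ.+ c ℤ.* (y ℤ.* (a ℤ.* q)) ≡ X ℤ.+ a ℤ.* (y ℤ.* c ℤ.* q)
    lem₂ X c y a q = ringℤ (X ∷ c ∷ y ∷ a ∷ q ∷ []) ($0 ⊹ $1 ⋆ ($2 ⋆ ($3 ⋆ $4))) ($0 ⊹ $3 ⋆ ($2 ⋆ $1 ⋆ $4)) refl

-- Connects Horner's scheme with the binomial formula behind the multiplicity of a zero; the
-- recursion of the latter is Pascal's rule in `taylorFrom-suc`.
nth-sh : ∀ {n} (P : Vec ℤ n) j a → nth (sh a P) j ≡ taylorFrom 0 P j a
nth-sh [] j a = refl
nth-sh (c ∷ cs) zero a = trans (nth-addS-0 c a (sh a cs)) (trans (cong (λ z → c ℤ.+ a ℤ.* z) (nth-sh cs 0 a)) (cong₂ ℤ._+_ (lem c) (sym (taylorFrom-0 0 cs a))))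
  where lem : ∀ c → c ≡ + 1 ℤ.* c ℤ.* + 1
        lem c = ringℤ (c ∷ []) ($0) (⟨ 1 ⟩ ⋆ $0 ⋆ ⟨ 1 ⟩) refl
nth-sh (c ∷ cs) (suc j) a = trans (nth-addS-suc c a (sh a cs) j) (trans (cong₂ (λ u v → u ℤ.+ a ℤ.* v) (nth-sh cs j a) (nth-sh cs (suc j) a)) (trans (sym (taylorFrom-suc 0 cs j a)) (sym (trans (cong (λ z → z ℤ.* c ℤ.* + 1 ℤ.+ taylorFrom 1 cs (suc j) a) (cong +_ (k>n⇒nCk≡0 {0} {suc j} (s≤s z≤n)))) (lem c (taylorFrom 1 cs (suc j) a))))))
  where lem : ∀ c t → + 0 ℤ.* c ℤ.* + 1 ℤ.+ t ≡ t
        lem c t = ringℤ (c ∷ t ∷ []) (⟨ 0 ⟩ ⋆ $0 ⋆ ⟨ 1 ⟩ ⊹ $1) ($1) refl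

-- Says that `t` divides every coefficient of s Q(πx). In this form a shift of Q by a multiple π v
-- is a shift of x by the integer v, which is why `WD-sh` holds.
WD : ∀ {n} → ℤ → ℤ → ℤ → Vec ℤ n → Set
WD t s π [] = ⊤
WD t s π (q ∷ Q) = t ∣ s ℤ.* q × WD t (s ℤ.* π) π Q

WD-addS : ∀ {n} t s π v c (S : Vec ℤ n) → t ∣ s ℤ.* c → WD t (s ℤ.* π) π S → WD t s π (addS c (π ℤ.* v) S)
WD-addS t s π v c [] d _ = d , tt
WD-addS t s π v c (s₀ ∷ S) d (d₀ , w) = subst (t ∣_) (lem s c v π s₀) (∣m∣n⇒∣m+n d (∣n⇒∣m*n v d₀)) , WD-addS t (s ℤ.* π) π v s₀ S d₀ w
  where lem : ∀ s c v π x → s ℤ.* c ℤ.+ v ℤ.* (s ℤ.* π ℤ.* x) ≡ s ℤ.* (c ℤ.+ π ℤ.* v ℤ.* x)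
        lem s c v π x = ringℤ (s ∷ c ∷ v ∷ π ∷ x ∷ []) ($0 ⋆ $1 ⊹ $2 ⋆ ($0 ⋆ $3 ⋆ $4)) ($0 ⋆ ($1 ⊹ $3 ⋆ $2 ⋆ $4)) refl

WD-sh : ∀ {n} t s π v (Q : Vec ℤ n) → WD t s π Q → WD t s π (sh (π ℤ.* v) Q)
WD-sh t s π v [] _ = tt
WD-sh t s π v (c ∷ cs) (d , w) = WD-addS t s π v c (sh (π ℤ.* v) cs) d (WD-sh t (s ℤ.* π) π v cs w)

WD-nth : ∀ {n} t s π (Q : Vec ℤ n) → (∀ i → t ∣ s ℤ.* π ℤ.^ i ℤ.* nth Q i) → WD t s π Q
WD-nth t s π [] f = tt
WD-nth t s π (q ∷ Q) f = subst (t ∣_) (cong (ℤ._* q) (ℤP.*-identityʳ s)) (f 0) , WD-nth t (s ℤ.* π) π Q (λ i → subst (t ∣_) (cong (ℤ._* nth Q i) (sym (ℤP.*-assoc s π (π ℤ.^ i)))) (f (suc i)))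

nth-WD : ∀ {n} t s π (Q : Vec ℤ n) → WD t s π Q → ∀ i → t ∣ s ℤ.* π ℤ.^ i ℤ.* nth Q i
nth-WD t s π [] w i = subst (t ∣_) (sym (ℤP.*-zeroʳ (s ℤ.* π ℤ.^ i))) (divides (+ 0) refl)
nth-WD t s π (q ∷ Q) (d , w) zero = subst (t ∣_) (cong (ℤ._* q) (sym (ℤP.*-identityʳ s))) d
nth-WD t s π (q ∷ Q) (d , w) (suc i) = subst (t ∣_) (cong (ℤ._* nth Q i) (ℤP.*-assoc s π (π ℤ.^ i))) (nth-WD t (s ℤ.* π) π Q w i)

eval-cong : ∀ {n} (P : Vec ℤ n) t x y → t ∣ x ℤ.- y → t ∣ evalℤ P x ℤ.- evalℤ P y
eval-cong [] t x y d = divides (+ 0) refl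
eval-cong (c ∷ cs) t x y d = subst (t ∣_) (lem c x y (evalℤ cs x) (evalℤ cs y)) (∣m∣n⇒∣m+n (∣n⇒∣m*n x (eval-cong cs t x y d)) (∣m⇒∣m*n (evalℤ cs y) d))
  where lem : ∀ c x y e f → x ℤ.* (e ℤ.- f) ℤ.+ (x ℤ.- y) ℤ.* f ≡ (c ℤ.+ x ℤ.* e) ℤ.- (c ℤ.+ y ℤ.* f)
        lem c x y e f = ringℤ (c ∷ x ∷ y ∷ e ∷ f ∷ []) ($1 ⋆ ($3 ⊹ ~ $4) ⊹ ($1 ⊹ ~ $2) ⋆ $4) (($0 ⊹ $1 ⋆ $3) ⊹ ~ ($0 ⊹ $2 ⋆ $4)) refl

-- Prime powers, λ(D) and zeros modulo n.

fromᵤ : ∀ k i → (+ k) ℤDv.∣ i → + k ∣ i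
fromᵤ k i = Sg.∣ᵤ⇒∣ {+ k} {i}

1∣ : ∀ Y → + 1 ∣ Y
1∣ Y = divides Y (sym (ℤP.*-identityʳ Y))

ℕ∣⇒ : ∀ {a b} → a ℕD.∣ b → + a ∣ + b
ℕ∣⇒ {a} {b} (ℕD.divides q eq) = divides (+ q) (trans (cong +_ eq) (ℤP.pos-* q a))

prime≥2 : ∀ {p} → Prime p → 2 ≤ p
prime≥2 pr = ℕ.nonTrivial⇒n>1 _ {{prime⇒nonTrivial pr}}

ordFuel-divides : ∀ f p n → p ^ ordFuel f p n ℕD.∣ n
ordFuel-divides zero p n = ℕD.1∣ n
ordFuel-divides (suc f) zero n = ℕD.1∣ n
ordFuel-divides (suc f) (suc q) n with suc q ℕD.∣? n
... | no _ = ℕD.1∣ n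
... | yes d with 1 ≤? q
... | no _ = ℕD.1∣ n
... | yes _ with 1 ≤? n
... | no _ = ℕD.1∣ n
... | yes _ = subst (suc q ^ suc (ordFuel f (suc q) (n ℕ./ suc q)) ℕD.∣_) (ℕDM.m*[n/m]≡n d) (ℕD.*-monoʳ-∣ (suc q) (ordFuel-divides f (suc q) (n ℕ./ suc q)))

ordFuel-max : ∀ f p n k → 2 ≤ p → 1 ≤ n → n ≤ f → p ^ k ℕD.∣ n → k ≤ ordFuel f p n
ordFuel-max f p n zero _ _ _ _ = z≤n
ordFuel-max zero p n (suc k) p2 n1 nf d = contradiction (≤-trans n1 nf) (λ ())
ordFuel-max (suc f) (suc q) n (suc k) p2 n1 nf d with suc q ℕD.∣? n
... | no ¬d = contradiction (ℕD.∣-trans (ℕD.m∣m*n (suc q ^ k)) d) ¬d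
... | yes d′ with 1 ≤? q
... | no h = contradiction (≤-pred p2) h
... | yes _ with 1 ≤? n
... | no h = contradiction n1 h
... | yes _ = s≤s (ordFuel-max f (suc q) (n ℕ./ suc q) k p2 m1 (≤-pred (≤-trans m<n nf)) dk)
  where
  m = n ℕ./ suc q
  m= : suc q * m ≡ n
  m= = ℕDM.m*[n/m]≡n d′
  m1 : 1 ≤ m
  m1 = go m m=
    where go : ∀ m → suc q * m ≡ n → 1 ≤ m
          go zero e = contradiction (≤-trans n1 (≤-reflexive (trans (sym e) (*-zeroʳ (suc q))))) (λ ())
          go (suc m) _ = s≤s z≤n
  m<n : m < n
  m<n = ≤-trans (≤-trans (+-monoˡ-≤ m m1) (≤-trans (≤-reflexive (cong (λ z → m + z) (sym (+-identityʳ m)))) (*-monoˡ-≤ m p2))) (≤-reflexive m=)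
  dk : suc q ^ k ℕD.∣ m
  dk = ℕD.*-cancelˡ-∣ (suc q) (subst (suc q * suc q ^ k ℕD.∣_) (sym m=) d)

ord-divides : ∀ p n → p ^ ord p n ℕD.∣ n
ord-divides p n = ordFuel-divides n p n

ord-max : ∀ p n k → 2 ≤ p → 1 ≤ n → p ^ k ℕD.∣ n → k ≤ ord p n
ord-max p n k p2 n1 d = ordFuel-max n p n k p2 n1 ≤-refl d

coprime-* : ∀ {a b c} → Coprime a b → Coprime a c → Coprime a (b * c)
coprime-* {a} {b} {c} ab ac {d} (da , dbc) = ac (da , Cop.coprime-divisor {d} {b} {c} (λ {e} (ed , eb) → ab (ℕD.∣-trans ed da , eb)) dbc)

coprime-^ : ∀ {a b} n → Coprime a b → Coprime a (b ^ n)
coprime-^ zero ab {d} (_ , d1) = ℕD.∣1⇒≡1 d1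
coprime-^ (suc n) ab = coprime-* ab (coprime-^ n ab)

primes-coprime : ∀ {p q} → Prime p → Prime q → p ≢ q → Coprime p q
primes-coprime {p} {q} pp pq p≢q {d} (dp , dq) with prime⇒irreducible pp dp | prime⇒irreducible pq dq
... | inj₁ e | _ = e
... | inj₂ _ | inj₁ e = e
... | inj₂ e | inj₂ e′ = contradiction (trans (sym e) e′) p≢q

primepowers-coprime : ∀ {p q} a b → Prime p → Prime q → p ≢ q → Coprime (p ^ a) (q ^ b)
primepowers-coprime a b pp pq ne = Cop.sym (coprime-^ a (Cop.sym (coprime-^ b (primes-coprime pp pq ne))))

coprime-∣ : ∀ {a b} {Y : ℤ} → Coprime a b → + a ∣ Y → + b ∣ Y → + (a * b) ∣ Y
coprime-∣ {a} {b} {Y} ab da db with Sg.∣⇒∣ᵤ da | Sg.∣⇒∣ᵤ db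
... | ℕD.divides k eq | d = Sg.∣ᵤ⇒∣ (subst (a * b ℕD.∣_) (trans (*-comm a k) (sym eq)) (ℕD.*-monoʳ-∣ a (Cop.coprime-divisor {b} {a} {k} (Cop.sym ab) (subst (b ℕD.∣_) (trans eq (*-comm k a)) d))))

lamFactor : (ℕ → ℕ) → ℕ → ℕ → ℕ
lamFactor m D p = if ⌊ prime? p ⌋ then p ^ (m p * ord p D) else 1

lamFactors-coprime : ∀ m D p q → p ≢ q → Coprime (lamFactor m D p) (lamFactor m D q)
lamFactors-coprime m D p q ne with prime? p | prime? q
... | yes pp | yes pq = primepowers-coprime (m p * ord p D) (m q * ord q D) pp pq ne
... | no _ | _ = λ (d1 , _) → ℕD.∣1⇒≡1 d1
... | yes _ | no _ = λ (_ , d1) → ℕD.∣1⇒≡1 d1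

-- The factors of λ(D) belong to distinct primes and are pairwise coprime, so divisibility can be
-- tested at one prime at a time.
lam-∣ : ∀ m D (Y : ℤ) → (∀ p → Prime p → + (p ^ (m p * ord p D)) ∣ Y) → + lam m D ∣ Y
lam-∣ m D Y f = go (upTo (suc D)) (upTo⁺ (suc D))
  where
  one : ∀ p → + lamFactor m D p ∣ Y
  one p with prime? p
  ... | yes pp = f p pp
  ... | no _ = 1∣ Y
  cop : ∀ p ps → All (p ≢_) ps → Coprime (lamFactor m D p) (prodℕ (List.map (lamFactor m D) ps))
  cop p [] [] (_ , d1) = ℕD.∣1⇒≡1 d1
  cop p (q ∷ ps) (ne ∷ nes) = coprime-* (lamFactors-coprime m D p q ne) (cop p ps nes)
  go : ∀ ps → Unique ps → + prodℕ (List.map (lamFactor m D) ps) ∣ Y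
  go [] _ = 1∣ Y
  go (p ∷ ps) (ne ∷ u) = coprime-∣ (cop p ps ne) (one p) (go ps u)

lam≥1 : ∀ m D → 1 ≤ lam m D
lam≥1 m D = go (upTo (suc D))
  where
  one : ∀ p → 1 ≤ lamFactor m D p
  one p with prime? p
  ... | yes pp = 1≤^ (m p * ord p D) (≤-trans (s≤s z≤n) (prime≥2 pp))
  ... | no _ = s≤s z≤n
  go : ∀ ps → 1 ≤ prodℕ (List.map (lamFactor m D) ps)
  go [] = s≤s z≤n
  go (p ∷ ps) = 1≤m* (one p) (go ps)

-- Splits off the full power of one prime, so that induction on `n` can use the Chinese remainder
-- theorem with coprime moduli `p ^ e` and `n′`.
record Peel (n : ℕ) : Set where
  field
    p e n′ : ℕ
    isPrime : Prime p
    n≡ : n ≡ p ^ e * n′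
    p∤ : ¬ p ℕD.∣ n′
    n′<n : n′ < n
    n′≥1 : 1 ≤ n′

abstract
  peel : ∀ n → 2 ≤ n → Peel n
  peel n n2 = go (PrimeFactorisation.factors pf) (PrimeFactorisation.isFactorisation pf) (PrimeFactorisation.factorsPrime pf)
    where
    n1 : 1 ≤ n
    n1 = ≤-trans (s≤s z≤n) n2
    pf : PrimeFactorisation n
    pf = factorise n {{ℕ.>-nonZero n1}}
    go : ∀ ps → n ≡ product ps → All Prime ps → Peel n
    go [] eq _ = contradiction (≤-trans n2 (≤-reflexive eq)) (λ { (s≤s ()) })
    go (p ∷ ps) eq (pp ∷ _) with ord-divides p n
    ... | ℕD.divides n′ e= = record { p = p ; e = e ; n′ = n′ ; isPrime = pp ; n≡ = trans e= (*-comm n′ (p ^ e)) ; p∤ = ¬d ; n′<n = lt ; n′≥1 = pos }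
      where
      e : ℕ
      e = ord p n
      p2 : 2 ≤ p
      p2 = prime≥2 pp
      e1 : 1 ≤ e
      e1 = ord-max p n 1 p2 n1 (subst (ℕD._∣ n) (sym (*-identityʳ p)) (subst (p ℕD.∣_) (sym eq) (ℕD.m∣m*n (product ps))))
      pos : 1 ≤ n′
      pos = h n′ e=
        where h : ∀ k → n ≡ k * p ^ e → 1 ≤ k
              h zero z = contradiction (≤-trans n1 (≤-reflexive z)) (λ ())
              h (suc k) _ = s≤s z≤n
      ¬d : ¬ p ℕD.∣ n′
      ¬d (ℕD.divides k k=) = contradiction (ord-max p n (suc e) p2 n1 (ℕD.divides k (trans e= (trans (cong (_* p ^ e) k=) (*-assoc k p (p ^ e)))))) (<⇒≱ ≤-refl)
      lt : n′ < n
      lt = ≤-trans (≤-trans (+-monoˡ-≤ n′ pos) (≤-trans (≤-reflexive (lem n′)) (*-monoʳ-≤ n′ (≤-trans p2 (m≤m^ p e e1 (≤-trans (s≤s z≤n) p2)))))) (≤-reflexive (sym e=))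
        where lem : ∀ n → n + n ≡ n * 2
              lem n = ringℕ (n ∷ []) ($0 ⊹ $0) ($0 ⋆ ⟨ 2 ⟩) refl

peel-coprime : ∀ {n} (P : Peel n) → Coprime (Peel.p P ^ Peel.e P) (Peel.n′ P)
peel-coprime P = Cop.sym (coprime-^ e (λ {d} (dn , dp) → h d dn dp))
  where
  open Peel P
  h : ∀ d → d ℕD.∣ n′ → d ℕD.∣ p → d ≡ 1
  h d dn dp with prime⇒irreducible isPrime dp
  ... | inj₁ x = x
  ... | inj₂ refl = contradiction dn p∤

primepower-∣ : ∀ n (Y : ℤ) → 1 ≤ n → (∀ p k → Prime p → p ^ k ℕD.∣ n → + (p ^ k) ∣ Y) → + n ∣ Y
primepower-∣ = <-rec _ step
  where
  step : ∀ n → (∀ {m} → m < n → ∀ Y → 1 ≤ m → (∀ p k → Prime p → p ^ k ℕD.∣ m → + (p ^ k) ∣ Y) → + m ∣ Y) → ∀ Y → 1 ≤ n → (∀ p k → Prime p → p ^ k ℕD.∣ n → + (p ^ k) ∣ Y) → + n ∣ Y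
  step (suc zero) rec Y n1 f = 1∣ Y
  step n@(suc (suc _)) rec Y n1 f = subst (λ z → + z ∣ Y) (sym n≡) (coprime-∣ (peel-coprime P) (f p e isPrime (subst (p ^ e ℕD.∣_) (sym n≡) (ℕD.m∣m*n n′)))
      (rec n′<n Y n′≥1 (λ q k pq d → f q k pq (subst (q ^ k ℕD.∣_) (sym n≡) (ℕD.∣-trans d (ℕD.n∣m*n (p ^ e)))))))
    where
    P = peel n (s≤s (s≤s z≤n))
    open Peel P

bezoutℤ : ∀ {a b} → Coprime a b → ∃ λ u → ∃ λ v → u ℤ.* + a ℤ.+ v ℤ.* + b ≡ + 1
bezoutℤ {a} {b} ab with Cop.coprime-Bézout ab
... | Bézout.+- x y eq = + x , ℤ.- + y , trans (cong (λ z → z ℤ.+ (ℤ.- + y) ℤ.* + b) (trans (sym (ℤP.pos-* x a)) (trans (cong +_ (sym eq)) (trans (ℤP.pos-+ 1 (y * b)) (cong (λ z → + 1 ℤ.+ z) (ℤP.pos-* y b)))))) (lem (+ y) (+ b))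
  where lem : ∀ y b → + 1 ℤ.+ y ℤ.* b ℤ.+ (ℤ.- y) ℤ.* b ≡ + 1
        lem y b = ringℤ (y ∷ b ∷ []) (⟨ 1 ⟩ ⊹ $0 ⋆ $1 ⊹ (~ $0) ⋆ $1) (⟨ 1 ⟩) refl
... | Bézout.-+ x y eq = ℤ.- + x , + y , trans (cong (λ z → (ℤ.- + x) ℤ.* + a ℤ.+ z) (trans (sym (ℤP.pos-* y b)) (trans (cong +_ (sym eq)) (trans (ℤP.pos-+ 1 (x * a)) (cong (λ z → + 1 ℤ.+ z) (ℤP.pos-* x a)))))) (lem (+ x) (+ a))
  where lem : ∀ x a → (ℤ.- x) ℤ.* a ℤ.+ (+ 1 ℤ.+ x ℤ.* a) ≡ + 1
        lem x a = ringℤ (x ∷ a ∷ []) ((~ $0) ⋆ $1 ⊹ (⟨ 1 ⟩ ⊹ $0 ⋆ $1)) (⟨ 1 ⟩) refl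

module Roots {d} (P : Poly d) (ζ : PAdicZeros P) where
  open PAdicZeros ζ

  -- y agrees with every z_p to the precision visible modulo n
  Approx : ℕ → ℤ → Set
  Approx n y = ∀ p k → Prime p → p ^ k ℕD.∣ n → + (p ^ k) ∣ y ℤ.- zs p k

  coherent-≤ : ∀ p k j → Prime p → + (p ^ k) ∣ zs p (j + k) ℤ.- zs p k
  coherent-≤ p k zero pp = divides (+ 0) (ℤP.+-inverseʳ (zs p k))
  coherent-≤ p k (suc j) pp = subst (+ (p ^ k) ∣_) (lem (zs p (suc (j + k))) (zs p (j + k)) (zs p k)) (∣m∣n⇒∣m+n (Sg.∣-trans (ℕ∣⇒ (pow-∣ k j)) (fromᵤ (p ^ (j + k)) (zs p (suc (j + k)) ℤ.- zs p (j + k)) (coherent p pp (j + k)))) (coherent-≤ p k j pp))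
    where
    lem : ∀ a b c → (a ℤ.- b) ℤ.+ (b ℤ.- c) ≡ a ℤ.- c
    lem a b c = ringℤ (a ∷ b ∷ c ∷ []) (($0 ⊹ ~ $1) ⊹ ($1 ⊹ ~ $2)) ($0 ⊹ ~ $2) refl
    pow-∣ : ∀ k j → p ^ k ℕD.∣ p ^ (j + k)
    pow-∣ k j = subst (p ^ k ℕD.∣_) (sym (^-distribˡ-+-* p j k)) (ℕD.n∣m*n (p ^ j))

  coherent-le : ∀ p k K → Prime p → k ≤ K → + (p ^ k) ∣ zs p K ℤ.- zs p k
  coherent-le p k K pp k≤K = subst (λ z → + (p ^ k) ∣ zs p z ℤ.- zs p k) (m∸n+n≡m k≤K) (coherent-≤ p k (K ∸ k) pp)

  approx-unique : ∀ n y y′ → 1 ≤ n → Approx n y → Approx n y′ → + n ∣ y ℤ.- y′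
  approx-unique n y y′ n1 a a′ = primepower-∣ n (y ℤ.- y′) n1 (λ p k pp dv → subst (+ (p ^ k) ∣_) (lem y y′ (zs p k)) (∣m∣n⇒∣m-n (a p k pp dv) (a′ p k pp dv)))
    where lem : ∀ y y′ z → (y ℤ.- z) ℤ.- (y′ ℤ.- z) ≡ y ℤ.- y′
          lem y y′ z = ringℤ (y ∷ y′ ∷ z ∷ []) (($0 ⊹ ~ $2) ⊹ ~ ($1 ⊹ ~ $2)) ($0 ⊹ ~ $1) refl

  approx-shift : ∀ n y y′ → + n ∣ y′ ℤ.- y → Approx n y → Approx n y′
  approx-shift n y y′ dv a p k pp dn = subst (+ (p ^ k) ∣_) (lem y′ y (zs p k)) (∣m∣n⇒∣m+n (Sg.∣-trans (ℕ∣⇒ dn) dv) (a p k pp dn))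
    where lem : ∀ a b c → (a ℤ.- b) ℤ.+ (b ℤ.- c) ≡ a ℤ.- c
          lem a b c = ringℤ (a ∷ b ∷ c ∷ []) (($0 ⊹ ~ $1) ⊹ ($1 ⊹ ~ $2)) ($0 ⊹ ~ $2) refl

  approx-∣ : ∀ m n y → m ℕD.∣ n → Approx n y → Approx m y
  approx-∣ m n y mn a p k pp dv = a p k pp (ℕD.∣-trans dv mn)

  -- The Chinese remainder theorem glues the approximations `zs p e`. Keeping `Approx` besides the
  -- divisibility is essential: it forces the zero found to agree with r_D modulo D.
  approx-root : ∀ n → 1 ≤ n → ∃ λ y → Approx n y × + n ∣ evalℤ P y
  approx-root = <-rec _ step
    where
    step : ∀ n → (∀ {m} → m < n → 1 ≤ m → ∃ λ y → Approx m y × + m ∣ evalℤ P y) → 1 ≤ n → ∃ λ y → Approx n y × + n ∣ evalℤ P y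
    step (suc zero) rec n1 = + 0 , (λ p k pp dv → subst (λ z → + z ∣ + 0 ℤ.- zs p k) (sym (ℕD.∣1⇒≡1 dv)) (1∣ (+ 0 ℤ.- zs p k))) , 1∣ (evalℤ P (+ 0))
    step n@(suc (suc _)) rec n1 = y , appr , subst (λ z → + z ∣ evalℤ P y) (sym n≡) (coprime-∣ (peel-coprime pl)
         (subst (+ (p ^ e) ∣_) (lem₀ (evalℤ P y) (evalℤ P z₀)) (∣m∣n⇒∣m+n (eval-cong P (+ (p ^ e)) y z₀ y≡z₀) (fromᵤ (p ^ e) (evalℤ P z₀) (isZero p isPrime e))))
         (subst (+ n′ ∣_) (lem₀ (evalℤ P y) (evalℤ P y′)) (∣m∣n⇒∣m+n (eval-cong P (+ n′) y y′ y≡y′) (proj₂ (proj₂ sub)))))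
      where
      pl = peel n (s≤s (s≤s z≤n))
      open Peel pl
      sub = rec n′<n n′≥1
      y′ z₀ : ℤ
      y′ = proj₁ sub
      z₀ = zs p e
      bz = bezoutℤ (peel-coprime pl)
      u v : ℤ
      u = proj₁ bz
      v = proj₁ (proj₂ bz)
      q : ℤ
      q = + (p ^ e)
      y : ℤ
      y = z₀ ℤ.* (v ℤ.* + n′) ℤ.+ y′ ℤ.* (u ℤ.* q)
      lem₀ : ∀ a b → (a ℤ.- b) ℤ.+ b ≡ a
      lem₀ a b = ringℤ (a ∷ b ∷ []) (($0 ⊹ ~ $1) ⊹ $1) ($0) refl
      y≡z₀ : q ∣ y ℤ.- z₀
      y≡z₀ = divides ((y′ ℤ.- z₀) ℤ.* u) (trans (cong (λ w → y ℤ.- w) (trans (sym (ℤP.*-identityʳ z₀)) (cong (λ o → z₀ ℤ.* o) (sym (proj₂ (proj₂ bz)))))) (lem z₀ (v ℤ.* + n′) y′ u q))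
        where
        lem : ∀ z w y u q → z ℤ.* w ℤ.+ y ℤ.* (u ℤ.* q) ℤ.- z ℤ.* (u ℤ.* q ℤ.+ w) ≡ (y ℤ.- z) ℤ.* u ℤ.* q
        lem z w y u q = ringℤ (z ∷ w ∷ y ∷ u ∷ q ∷ []) ($0 ⋆ $1 ⊹ $2 ⋆ ($3 ⋆ $4) ⊹ ~ ($0 ⋆ ($3 ⋆ $4 ⊹ $1))) (($2 ⊹ ~ $0) ⋆ $3 ⋆ $4) refl
      y≡y′ : + n′ ∣ y ℤ.- y′
      y≡y′ = divides ((z₀ ℤ.- y′) ℤ.* v) (trans (cong (λ w → y ℤ.- w) (trans (sym (ℤP.*-identityʳ y′)) (cong (λ o → y′ ℤ.* o) (sym (proj₂ (proj₂ bz)))))) (lem z₀ v (+ n′) y′ (u ℤ.* q)))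
        where
        lem : ∀ z v n y w → z ℤ.* (v ℤ.* n) ℤ.+ y ℤ.* w ℤ.- y ℤ.* (w ℤ.+ v ℤ.* n) ≡ (z ℤ.- y) ℤ.* v ℤ.* n
        lem z v n y w = ringℤ (z ∷ v ∷ n ∷ y ∷ w ∷ []) ($0 ⋆ ($1 ⋆ $2) ⊹ $3 ⋆ $4 ⊹ ~ ($3 ⋆ ($4 ⊹ $1 ⋆ $2))) (($0 ⊹ ~ $3) ⋆ $1 ⋆ $2) refl
      appr : Approx n y
      appr p′ k pp dv with p′ ℕ.≟ p
      ... | yes refl = subst (+ (p ^ k) ∣_) (lem y z₀ (zs p k)) (∣m∣n⇒∣m+n (Sg.∣-trans (ℕ∣⇒ (pow-le k≤e)) y≡z₀) (coherent-le p k e isPrime k≤e))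
        where
        lem : ∀ a b c → (a ℤ.- b) ℤ.+ (b ℤ.- c) ≡ a ℤ.- c
        lem a b c = ringℤ (a ∷ b ∷ c ∷ []) (($0 ⊹ ~ $1) ⊹ ($1 ⊹ ~ $2)) ($0 ⊹ ~ $2) refl
        pow-le : ∀ {k} → k ≤ e → p ^ k ℕD.∣ p ^ e
        pow-le {k} le = subst (λ z → p ^ k ℕD.∣ p ^ z) (m∸n+n≡m le) (subst (p ^ k ℕD.∣_) (sym (^-distribˡ-+-* p (e ∸ k) k)) (ℕD.n∣m*n (p ^ (e ∸ k))))
        k≤e : k ≤ e
        k≤e with k ≤? e
        ... | yes h = h
        ... | no h = contradiction (ℕD.*-cancelˡ-∣ (p ^ e) {{ℕ.>-nonZero (1≤^ e (≤-trans (s≤s z≤n) (prime≥2 isPrime)))}} (subst₂ ℕD._∣_ (trans (cong (p *_) refl) (*-comm p (p ^ e))) n≡ (ℕD.∣-trans (subst (λ z → p ^ suc e ℕD.∣ p ^ z) (m∸n+n≡m (≰⇒> h)) (subst (p ^ suc e ℕD.∣_) (sym (^-distribˡ-+-* p (k ∸ suc e) (suc e))) (ℕD.n∣m*n (p ^ (k ∸ suc e))))) dv))) p∤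
      ... | no ne = subst (+ (p′ ^ k) ∣_) (lem y y′ (zs p′ k)) (∣m∣n⇒∣m+n (Sg.∣-trans (ℕ∣⇒ dn′) y≡y′) (proj₁ (proj₂ sub) p′ k pp dn′))
        where
        lem : ∀ a b c → (a ℤ.- b) ℤ.+ (b ℤ.- c) ≡ a ℤ.- c
        lem a b c = ringℤ (a ∷ b ∷ c ∷ []) (($0 ⊹ ~ $1) ⊹ ($1 ⊹ ~ $2)) ($0 ⊹ ~ $2) refl
        dn′ : p′ ^ k ℕD.∣ n′
        dn′ = Cop.coprime-divisor {p′ ^ k} {p ^ e} {n′} (primepowers-coprime k e pp isPrime ne) (subst (p′ ^ k ℕD.∣_) n≡ dv)

  module Scaled (D : ℕ) (D1 : 1 ≤ D) (rD : ℤ) (isRD : IsRD zs D rD) where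
    approx-rD : Approx D rD
    approx-rD p k pp dv = subst (+ (p ^ k) ∣_) (lem rD (zs p o) (zs p k)) (∣m∣n⇒∣m+n (Sg.∣-trans (ℕ∣⇒ (subst (λ z → p ^ k ℕD.∣ p ^ z) (m∸n+n≡m k≤o) (subst (p ^ k ℕD.∣_) (sym (^-distribˡ-+-* p (o ∸ k) k)) (ℕD.n∣m*n (p ^ (o ∸ k))))))
         (fromᵤ (p ^ o) (rD ℤ.- zs p o) (proj₂ (proj₂ isRD) p pp))) (coherent-le p k o pp k≤o))
      where
      o = ord p D
      k≤o : k ≤ o
      k≤o = ord-max p D k (prime≥2 pp) D1 dv
      lem : ∀ a b c → (a ℤ.- b) ℤ.+ (b ℤ.- c) ≡ a ℤ.- c
      lem a b c = ringℤ (a ∷ b ∷ c ∷ []) (($0 ⊹ ~ $1) ⊹ ($1 ⊹ ~ $2)) ($0 ⊹ ~ $2) refl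

    -- This is the integrality of P_D. At a prime p, with π the power of p in D, expand P at an
    -- approximation ζ₀ of z_p: the coefficients below the multiplicity m vanish to high order, and
    -- those from m on come with π^m. Since r_D is congruent to ζ₀ modulo π, `WD-sh` carries the
    -- divisibility from ζ₀ to r_D.
    lam-∣-coeff : ∀ i → + lam mult D ∣ (+ D) ℤ.^ i ℤ.* nth (sh rD P) i
    lam-∣-coeff i = lam-∣ mult D _ each
      where
      each : ∀ p → Prime p → + (p ^ (mult p * ord p D)) ∣ (+ D) ℤ.^ i ℤ.* nth (sh rD P) i
      each p pp = go (ord-divides p D)
        where
        o m K : ℕ
        o = ord p D
        m = mult p
        -- The precision must reach `o` for the congruence with `rD`, also when `m` is 0, and
        -- `m * o` for the lower Taylor coefficients.
        K = m * o + o
        π t ζ₀ : ℤ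
        π = + (p ^ o)
        t = + (p ^ (m * o))
        ζ₀ = zs p K
        rζ : π ∣ rD ℤ.- ζ₀
        rζ = subst (π ∣_) (lem rD (zs p o) ζ₀) (∣m∣n⇒∣m-n (fromᵤ (p ^ o) (rD ℤ.- zs p o) (proj₂ (proj₂ isRD) p pp)) (coherent-≤ p o (m * o) pp))
          where lem : ∀ a b c → (a ℤ.- b) ℤ.- (c ℤ.- b) ≡ a ℤ.- c
                lem a b c = ringℤ (a ∷ b ∷ c ∷ []) (($0 ⊹ ~ $1) ⊹ ~ ($2 ⊹ ~ $1)) ($0 ⊹ ~ $2) refl
        v : ℤ
        v = Sg.quotient rζ
        t=π^m : t ≡ π ℤ.^ m
        t=π^m = trans (cong +_ (trans (cong (p ^_) (*-comm m o)) (sym (ℕP.^-*-assoc p o m)))) (pos-^ (p ^ o) m)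
          where pos-^ : ∀ a n → + (a ^ n) ≡ (+ a) ℤ.^ n
                pos-^ a zero = refl
                pos-^ a (suc n) = trans (ℤP.pos-* a (a ^ n)) (cong (+ a ℤ.*_) (pos-^ a n))
        base : ∀ j → t ∣ + 1 ℤ.* π ℤ.^ j ℤ.* nth (sh ζ₀ P) j
        base j with j <? m
        ... | yes j<m = ∣n⇒∣m*n (+ 1 ℤ.* π ℤ.^ j) (Sg.∣-trans (ℕ∣⇒ (subst (p ^ (m * o) ℕD.∣_) (sym (^-distribˡ-+-* p (m * o) o)) (ℕD.m∣m*n (p ^ o)))) (subst (+ (p ^ K) ∣_) (sym (nth-sh P j ζ₀)) (fromᵤ (p ^ K) (taylor P j ζ₀) (proj₁ (isMult p pp) j j<m K))))
        ... | no h = ∣m⇒∣m*n (nth (sh ζ₀ P) j) (∣n⇒∣m*n (+ 1) (subst (_∣ π ℤ.^ j) (sym t=π^m) (divides (π ℤ.^ (j ∸ m)) (trans (cong (π ℤ.^_) (sym (m∸n+n≡m (ℕP.≮⇒≥ h)))) (ℤP.^-distribˡ-+-* π (j ∸ m) m)))))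
        wd : WD t (+ 1) π (sh rD P)
        wd = subst (WD t (+ 1) π) (trans (sh-sh ζ₀ (π ℤ.* v) P) (cong (λ z → sh z P) (trans (cong (λ z → ζ₀ ℤ.+ z) (trans (ℤP.*-comm π v) (sym (Sg._∣_.equality rζ)))) (lem ζ₀ rD)))) (WD-sh t (+ 1) π v (sh ζ₀ P) (WD-nth t (+ 1) π (sh ζ₀ P) base))
          where lem : ∀ z r → z ℤ.+ (r ℤ.- z) ≡ r
                lem z r = ringℤ (z ∷ r ∷ []) ($0 ⊹ ($1 ⊹ ~ $0)) ($1) refl
        go : p ^ o ℕD.∣ D → t ∣ (+ D) ℤ.^ i ℤ.* nth (sh rD P) i
        go (ℕD.divides D′ D=) = subst (t ∣_) (sym (trans (cong (λ z → z ℤ.^ i ℤ.* nth (sh rD P) i) (trans (cong +_ D=) (ℤP.pos-* D′ (p ^ o)))) (trans (cong (ℤ._* nth (sh rD P) i) (*-^ℤ (+ D′) π i)) (lem ((+ D′) ℤ.^ i) (π ℤ.^ i) (nth (sh rD P) i))))) (∣n⇒∣m*n ((+ D′) ℤ.^ i) (nth-WD t (+ 1) π (sh rD P) wd i))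
          where
          lem : ∀ d q c → d ℤ.* q ℤ.* c ≡ d ℤ.* (+ 1 ℤ.* q ℤ.* c)
          lem d q c = ringℤ (d ∷ q ∷ c ∷ []) ($0 ⋆ $1 ⋆ $2) ($0 ⋆ (⟨ 1 ⟩ ⋆ $1 ⋆ $2)) refl
          *-^ℤ : ∀ a b n → (a ℤ.* b) ℤ.^ n ≡ a ℤ.^ n ℤ.* b ℤ.^ n
          *-^ℤ a b zero = refl
          *-^ℤ a b (suc n) = trans (cong (a ℤ.* b ℤ.*_) (*-^ℤ a b n)) (lem₂ a b (a ℤ.^ n) (b ℤ.^ n))
            where lem₂ : ∀ a b c d → a ℤ.* b ℤ.* (c ℤ.* d) ≡ a ℤ.* c ℤ.* (b ℤ.* d)
                  lem₂ a b c d = ringℤ (a ∷ b ∷ c ∷ d ∷ []) ($0 ⋆ $1 ⋆ ($2 ⋆ $3)) ($0 ⋆ $2 ⋆ ($1 ⋆ $3)) refl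

-- The auxiliary polynomial on a progression.

toVec : ∀ n → (ℕ → ℤ) → Vec ℤ n
toVec zero a = []
toVec (suc n) a = a 0 ∷ toVec n (λ i → a (suc i))

ev-cong : ∀ d {a b : ℕ → ℤ} x → (∀ i → a i ≡ b i) → ev d a x ≡ ev d b x
ev-cong zero x p = p 0
ev-cong (suc d) x p = cong₂ (λ u v → u ℤ.+ v ℤ.* x ℤ.^ suc d) (ev-cong d x p) (p (suc d))

ev-horner : ∀ d a x → ev (suc d) a x ≡ a 0 ℤ.+ x ℤ.* ev d (λ i → a (suc i)) x
ev-horner zero a x = lem (a 0) (a 1) x
  where lem : ∀ a b x → a ℤ.+ b ℤ.* (x ℤ.* + 1) ≡ a ℤ.+ x ℤ.* b
        lem a b x = ringℤ (a ∷ b ∷ x ∷ []) ($0 ⊹ $1 ⋆ ($2 ⋆ ⟨ 1 ⟩)) ($0 ⊹ $2 ⋆ $1) refl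
ev-horner (suc d) a x = trans (cong (λ z → z ℤ.+ a (suc (suc d)) ℤ.* x ℤ.^ suc (suc d)) (ev-horner d a x)) (lem (a 0) x (ev d (λ i → a (suc i)) x) (a (suc (suc d))) (x ℤ.^ suc d))
  where lem : ∀ a x e b p → a ℤ.+ x ℤ.* e ℤ.+ b ℤ.* (x ℤ.* p) ≡ a ℤ.+ x ℤ.* (e ℤ.+ b ℤ.* p)
        lem a x e b p = ringℤ (a ∷ x ∷ e ∷ b ∷ p ∷ []) ($0 ⊹ $1 ⋆ $2 ⊹ $3 ⋆ ($1 ⋆ $4)) ($0 ⊹ $1 ⋆ ($2 ⊹ $3 ⋆ $4)) refl

eval-toVec : ∀ d a x → evalℤ (toVec (suc d) a) x ≡ ev d a x
eval-toVec zero a x = trans (cong (λ z → a 0 ℤ.+ z) (ℤP.*-zeroʳ x)) (ℤP.+-identityʳ (a 0))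
eval-toVec (suc d) a x = trans (cong (λ z → a 0 ℤ.+ x ℤ.* z) (eval-toVec d (λ i → a (suc i)) x)) (sym (ev-horner d a x))

eval-nth : ∀ {d} (Q : Vec ℤ (suc d)) x → evalℤ Q x ≡ ev d (nth Q) x
eval-nth {zero} (q ∷ []) x = trans (cong (λ z → q ℤ.+ z) (ℤP.*-zeroʳ x)) (ℤP.+-identityʳ q)
eval-nth {suc d} (q ∷ Q) x = trans (cong (λ z → q ℤ.+ x ℤ.* z) (eval-nth Q x)) (sym (ev-horner d (nth (q ∷ Q)) x))

ev-scale : ∀ d c a x → c ℤ.* ev d a x ≡ ev d (λ i → c ℤ.* a i) x
ev-scale zero c a x = refl
ev-scale (suc d) c a x = trans (ℤP.*-distribˡ-+ c (ev d a x) _) (cong₂ ℤ._+_ (ev-scale d c a x) (sym (ℤP.*-assoc c (a (suc d)) (x ℤ.^ suc d))))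

*-^ℤ : ∀ a b n → (a ℤ.* b) ℤ.^ n ≡ a ℤ.^ n ℤ.* b ℤ.^ n
*-^ℤ a b zero = refl
*-^ℤ a b (suc n) = trans (cong (λ z → a ℤ.* b ℤ.* z) (*-^ℤ a b n)) (lem a b (a ℤ.^ n) (b ℤ.^ n))
  where lem : ∀ a b c d → a ℤ.* b ℤ.* (c ℤ.* d) ≡ a ℤ.* c ℤ.* (b ℤ.* d)
        lem a b c d = ringℤ (a ∷ b ∷ c ∷ d ∷ []) ($0 ⋆ $1 ⋆ ($2 ⋆ $3)) ($0 ⋆ $2 ⋆ ($1 ⋆ $3)) refl

ev-dilate : ∀ d c a x → ev d (λ i → c ℤ.^ i ℤ.* a i) x ≡ ev d a (c ℤ.* x)
ev-dilate zero c a x = ℤP.*-identityˡ (a 0)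
ev-dilate (suc d) c a x = cong₂ ℤ._+_ (ev-dilate d c a x) (trans (lem (c ℤ.^ suc d) (a (suc d)) (x ℤ.^ suc d)) (cong (λ z → a (suc d) ℤ.* z) (sym (*-^ℤ c x (suc d)))))
  where lem : ∀ c a x → c ℤ.* a ℤ.* x ≡ a ℤ.* (c ℤ.* x)
        lem c a x = ringℤ (c ∷ a ∷ x ∷ []) ($0 ⋆ $1 ⋆ $2) ($1 ⋆ ($0 ⋆ $2)) refl

nth-beyond : ∀ {n} (Q : Vec ℤ n) i → n ≤ i → nth Q i ≡ + 0
nth-beyond [] i h = refl
nth-beyond (q ∷ Q) (suc i) (s≤s h) = nth-beyond Q i h

nth-last : ∀ {n} (P : Vec ℤ (suc n)) → nth P n ≡ last P
nth-last {zero} (x ∷ []) = refl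
nth-last {suc n} (x ∷ y ∷ P) = nth-last (y ∷ P)

nth-sh-lead : ∀ {n} a (P : Vec ℤ (suc n)) → nth (sh a P) n ≡ nth P n
nth-sh-lead {zero} a (c ∷ []) = refl
nth-sh-lead {suc n} a (c ∷ cs) = trans (nth-addS-suc c a (sh a cs) n) (trans (cong₂ (λ u v → u ℤ.+ a ℤ.* v) (nth-sh-lead a cs) (nth-beyond (sh a cs) (suc n) ≤-refl)) (lem (nth cs n) a))
  where lem : ∀ x a → x ℤ.+ a ℤ.* + 0 ≡ x
        lem x a = ringℤ (x ∷ a ∷ []) ($0 ⊹ $1 ⋆ ⟨ 0 ⟩) ($0) refl

nth-toVec : ∀ n a i → i < n → nth (toVec n a) i ≡ a i
nth-toVec (suc n) a zero _ = refl
nth-toVec (suc n) a (suc i) (s≤s h) = nth-toVec n (λ i → a (suc i)) i h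

divℕ-exact : ∀ a n → 1 ≤ n → divℕ (a ℤ.* + n) n ≡ a
divℕ-exact a (suc n) _ = ℤP.i-j≡0⇒i≡j q a (ℤP.∣i∣≡0⇒i≡0 (small ℤ.∣ q ℤ.- a ∣ bound))
  where
  x q : ℤ
  x = a ℤ.* + suc n
  q = x ℤ./ℕ suc n
  r : ℕ
  r = x ℤ.%ℕ suc n
  eq : (q ℤ.- a) ℤ.* + suc n ≡ ℤ.- + r
  eq = trans (lem₁ q a (+ suc n) (+ r)) (trans (cong (λ z → z ℤ.- x ℤ.- + r) (sym (ℤDM.a≡a%ℕn+[a/ℕn]*n x (suc n)))) (lem₂ x (+ r)))
    where
    lem₁ : ∀ q a n r → (q ℤ.- a) ℤ.* n ≡ (r ℤ.+ q ℤ.* n) ℤ.- a ℤ.* n ℤ.- r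
    lem₁ q a n r = ringℤ (q ∷ a ∷ n ∷ r ∷ []) (($0 ⊹ ~ $1) ⋆ $2) (($3 ⊹ $0 ⋆ $2) ⊹ ~ ($1 ⋆ $2) ⊹ ~ $3) refl
    lem₂ : ∀ x r → x ℤ.- x ℤ.- r ≡ ℤ.- r
    lem₂ x r = ringℤ (x ∷ r ∷ []) ($0 ⊹ ~ $0 ⊹ ~ $1) (~ $1) refl
  bound : ℤ.∣ q ℤ.- a ∣ * suc n < suc n
  bound = ≤-trans (s≤s (≤-reflexive (trans (sym (ℤP.abs-* (q ℤ.- a) (+ suc n))) (trans (cong ℤ.∣_∣ eq) (ℤP.∣-i∣≡∣i∣ (+ r)))))) (ℤDM.n%ℕd<d x (suc n))
  small : ∀ k → k * suc n < suc n → k ≡ 0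
  small zero _ = refl
  small (suc k) h = contradiction h (ℕP.≤⇒≯ (m≤m+n (suc n) (k * suc n)))

nonneg : ∀ (x : ℤ) k → 1 ≤ k → ∃ λ n → x ℤ.+ + (k * ℤ.∣ x ∣) ≡ + n
nonneg (+ m) k k1 = m + k * m , sym (ℤP.pos-+ m (k * m))
nonneg -[1+ m ] k k1 with m∸n+n≡m (m≤n*m (suc m) k1)
... | e = k * suc m ∸ suc m , trans (cong (λ z → -[1+ m ] ℤ.+ z) (trans (cong +_ (sym e)) (ℤP.pos-+ (k * suc m ∸ suc m) (suc m)))) (lem (+ suc m) (+ (k * suc m ∸ suc m)))
  where lem : ∀ s t → (ℤ.- s) ℤ.+ (t ℤ.+ s) ≡ t
        lem s t = ringℤ (s ∷ t ∷ []) ((~ $0) ⊹ ($1 ⊹ $0)) ($1) refl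

1≤∣∣ : ∀ {x : ℤ} → x ≢ + 0 → 1 ≤ ℤ.∣ x ∣
1≤∣∣ nz = n≢0⇒n>0 (λ z → nz (ℤP.∣i∣≡0⇒i≡0 z))

signed : ∀ (x : ℤ) → ∃ λ s → + ℤ.∣ x ∣ ≡ x ℤ.* s
signed (+ n) = + 1 , sym (ℤP.*-identityʳ (+ n))
signed -[1+ n ] = ℤ.- + 1 , lem (+ suc n)
  where lem : ∀ s → s ≡ (ℤ.- s) ℤ.* (ℤ.- + 1)
        lem s = ringℤ (s ∷ []) ($0) ((~ $0) ⋆ (~ ⟨ 1 ⟩)) refl

*-nonzero : ∀ {x y : ℤ} → x ≢ + 0 → y ≢ + 0 → x ℤ.* y ≢ + 0
*-nonzero {x} {y} p q e with ℤP.i*j≡0⇒i≡0∨j≡0 x e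
... | inj₁ z = p z
... | inj₂ z = q z

^-nonzero : ∀ {x : ℤ} n → x ≢ + 0 → x ℤ.^ n ≢ + 0
^-nonzero zero p ()
^-nonzero (suc n) p = *-nonzero p (^-nonzero n p)

pos≢0 : ∀ {n} → 1 ≤ n → + n ≢ + 0
pos≢0 (s≤s _) ()

-- the auxiliary polynomial restricted to a progression on which it is divisible by b
record Auxiliary {d} (P : Poly (suc d)) (ζ : PAdicZeros P) (D : ℕ) (rD : ℤ) (b : ℕ) : Set where
  field
    A Â : ℕ → ℤ
    z₁ : ℕ
    PD≡ : ∀ x → PD P (PAdicZeros.mult ζ) D rD x ≡ ev (suc d) A x
    lead : A (suc d) ≢ + 0
    factor : ∀ w → ev (suc d) A (+ z₁ ℤ.+ + b ℤ.* w) ≡ + b ℤ.* ev (suc d) Â w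
    rooted : Rooted d Â

-- A zero of P modulo a large number, chosen along the p-adic zeros, lies on the progression r_D + D
-- x and so gives an argument at which P_D is divisible by `b`. Dividing out `b` keeps the root
-- property, because zeros to still higher moduli agree with the chosen one modulo D b and so lie on
-- the refined progression.
auxiliary : ∀ {d} (P : Poly (suc d)) → HasDegree P → (ζ : PAdicZeros P) → ∀ D → 1 ≤ D → ∀ rD → IsRD (PAdicZeros.zs ζ) D rD → ∀ b → 1 ≤ b → Auxiliary P ζ D rD b
auxiliary {d} P deg ζ D D1 rD isRD b b1 = record { A = A ; Â = Â ; z₁ = z₁ ; PD≡ = PD≡ ; lead = lead ; factor = factor ; rooted = rooted }
  where
  open PAdicZeros ζ
  open Roots P ζ
  open Scaled D D1 rD isRD
  Λ : ℕ
  Λ = lam mult D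
  Λ1 : 1 ≤ Λ
  Λ1 = lam≥1 mult D
  A : ℕ → ℤ
  A i = Sg.quotient (lam-∣-coeff i)
  A≡ : ∀ i → (+ D) ℤ.^ i ℤ.* nth (sh rD P) i ≡ A i ℤ.* + Λ
  A≡ i = Sg._∣_.equality (lam-∣-coeff i)
  R : ℤ → ℤ
  R = ev (suc d) A
  PR : ∀ x → evalℤ P (rD ℤ.+ + D ℤ.* x) ≡ R x ℤ.* + Λ
  PR x = trans (trans (cong (evalℤ P) (ℤP.+-comm rD (+ D ℤ.* x))) (trans (sym (eval-sh rD P (+ D ℤ.* x))) (trans (eval-nth (sh rD P) (+ D ℤ.* x)) (trans (sym (ev-dilate (suc d) (+ D) (nth (sh rD P)) x)) (ev-cong (suc d) x (λ i → trans (A≡ i) (ℤP.*-comm (A i) (+ Λ))))))))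
     (trans (sym (ev-scale (suc d) (+ Λ) A x)) (ℤP.*-comm (+ Λ) (R x)))
  PD≡ : ∀ x → PD P mult D rD x ≡ R x
  PD≡ x = trans (cong (λ z → divℕ z Λ) (PR x)) (divℕ-exact (R x) Λ Λ1)
  lead : A (suc d) ≢ + 0
  lead z = *-nonzero {(+ D) ℤ.^ suc d} {nth (sh rD P) (suc d)} (^-nonzero (suc d) (pos≢0 D1)) (λ e → deg (trans (sym (nth-last P)) (trans (sym (nth-sh-lead rD P)) e))) (trans (A≡ (suc d)) (cong (ℤ._* + Λ) z))
  n₁ : ℕ
  -- `Λ * b` makes `R (+ z₁)` divisible by `b` after division by `Λ`. The factor `D * b` puts the
  -- zero on the progression of `rD` and preserves `Approx (D * b)` for use in `rooted`.
  n₁ = Λ * b * (D * b)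
  n₁1 : 1 ≤ n₁
  n₁1 = 1≤m* (1≤m* Λ1 b1) (1≤m* D1 b1)
  root₁ = approx-root n₁ n₁1
  y₁ : ℤ
  y₁ = proj₁ root₁
  D∣ : + D ∣ y₁ ℤ.- rD
  D∣ = approx-unique D y₁ rD D1 (approx-∣ D n₁ y₁ (ℕD.∣-trans (ℕD.m∣m*n b) (ℕD.n∣m*n (Λ * b))) (proj₁ (proj₂ root₁))) approx-rD
  x₁ : ℤ
  x₁ = Sg.quotient D∣
  kk : ℕ
  kk = Λ * b * b
  -- Passes to a non-negative argument: `D * kk` is `n₁`, so nothing changes modulo `n₁`.
  nn = nonneg x₁ kk (1≤m* (1≤m* Λ1 b1) b1)
  z₁ : ℕ
  z₁ = proj₁ nn
  r′ : ℤ
  r′ = rD ℤ.+ + D ℤ.* + z₁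
  r′≡ : r′ ≡ y₁ ℤ.+ + n₁ ℤ.* + ℤ.∣ x₁ ∣
  r′≡ = trans (cong (λ z → rD ℤ.+ + D ℤ.* z) (trans (sym (proj₂ nn)) (cong (λ z → x₁ ℤ.+ z) (ℤP.pos-* kk ℤ.∣ x₁ ∣)))) (trans (lem₁ rD (+ D) x₁ (+ kk) (+ ℤ.∣ x₁ ∣)) (cong₂ (λ u v → rD ℤ.+ u ℤ.+ v ℤ.* + ℤ.∣ x₁ ∣) (sym (Sg._∣_.equality D∣)) (trans (sym (ℤP.pos-* D kk)) (cong +_ (lem₂ Λ b D)))) ⟨≡⟩ lem₃ rD y₁ (+ n₁ ℤ.* + ℤ.∣ x₁ ∣))
    where
    infixl 4 _⟨≡⟩_
    _⟨≡⟩_ : ∀ {a b c : ℤ} → a ≡ b → b ≡ c → a ≡ c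
    _⟨≡⟩_ = trans
    lem₁ : ∀ r D x k a → r ℤ.+ D ℤ.* (x ℤ.+ k ℤ.* a) ≡ r ℤ.+ x ℤ.* D ℤ.+ D ℤ.* k ℤ.* a
    lem₁ r D x k a = ringℤ (r ∷ D ∷ x ∷ k ∷ a ∷ []) ($0 ⊹ $1 ⋆ ($2 ⊹ $3 ⋆ $4)) ($0 ⊹ $2 ⋆ $1 ⊹ $1 ⋆ $3 ⋆ $4) refl
    lem₂ : ∀ Λ b D → D * (Λ * b * b) ≡ Λ * b * (D * b)
    lem₂ Λ b D = ringℕ (Λ ∷ b ∷ D ∷ []) ($2 ⋆ ($0 ⋆ $1 ⋆ $1)) ($0 ⋆ $1 ⋆ ($2 ⋆ $1)) refl
    lem₃ : ∀ r y u → r ℤ.+ (y ℤ.- r) ℤ.+ u ≡ y ℤ.+ u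
    lem₃ r y u = ringℤ (r ∷ y ∷ u ∷ []) ($0 ⊹ ($1 ⊹ ~ $0) ⊹ $2) ($1 ⊹ $2) refl
  n₁∣ : + n₁ ∣ r′ ℤ.- y₁
  n₁∣ = divides (+ ℤ.∣ x₁ ∣) (trans (cong (ℤ._- y₁) r′≡) (lem y₁ (+ n₁) (+ ℤ.∣ x₁ ∣)))
    where lem : ∀ y n a → y ℤ.+ n ℤ.* a ℤ.- y ≡ a ℤ.* n
          lem y n a = ringℤ (y ∷ n ∷ a ∷ []) ($0 ⊹ $1 ⋆ $2 ⊹ ~ $0) ($2 ⋆ $1) refl
  n₁∣P : + n₁ ∣ evalℤ P r′
  n₁∣P = subst (+ n₁ ∣_) (lem (evalℤ P r′) (evalℤ P y₁)) (∣m∣n⇒∣m+n (eval-cong P (+ n₁) r′ y₁ n₁∣) (proj₂ (proj₂ root₁)))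
    where lem : ∀ a b → (a ℤ.- b) ℤ.+ b ≡ a
          lem a b = ringℤ (a ∷ b ∷ []) (($0 ⊹ ~ $1) ⊹ $1) ($0) refl
  approx-r′ : Approx (D * b) r′
  approx-r′ = approx-∣ (D * b) n₁ r′ (ℕD.n∣m*n (Λ * b)) (approx-shift n₁ y₁ r′ n₁∣ (proj₁ (proj₂ root₁)))
  ρ₀ : ℤ
  ρ₀ = Sg.quotient n₁∣P ℤ.* + (D * b)
  Rz₁ : R (+ z₁) ≡ + b ℤ.* ρ₀
  Rz₁ = ℤP.*-cancelʳ-≡ (R (+ z₁)) (+ b ℤ.* ρ₀) (+ Λ) {{ℤ.≢-nonZero (pos≢0 Λ1)}} (trans (sym (PR (+ z₁))) (trans (Sg._∣_.equality n₁∣P) (trans (cong (λ z → Sg.quotient n₁∣P ℤ.* z) (trans (ℤP.pos-* (Λ * b) (D * b)) (cong (ℤ._* + (D * b)) (ℤP.pos-* Λ b)))) (lem (Sg.quotient n₁∣P) (+ Λ) (+ b) (+ (D * b))))))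
    where lem : ∀ q Λ b x → q ℤ.* (Λ ℤ.* b ℤ.* x) ≡ b ℤ.* (q ℤ.* x) ℤ.* Λ
          lem q Λ b x = ringℤ (q ∷ Λ ∷ b ∷ x ∷ []) ($0 ⋆ ($1 ⋆ $2 ⋆ $3)) ($2 ⋆ ($0 ⋆ $3) ⋆ $1) refl
  B : Vec ℤ (suc (suc d))
  B = sh (+ z₁) (toVec (suc (suc d)) A)
  Â : ℕ → ℤ
  Â zero = ρ₀
  Â (suc i) = nth B (suc i) ℤ.* (+ b) ℤ.^ i
  B≡ : ∀ x → ev (suc d) (nth B) x ≡ R (x ℤ.+ + z₁)
  B≡ x = trans (sym (eval-nth B x)) (trans (eval-sh (+ z₁) (toVec (suc (suc d)) A) x) (eval-toVec (suc d) A (x ℤ.+ + z₁)))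
  B₀ : nth B 0 ≡ + b ℤ.* ρ₀
  B₀ = trans (sym (trans (ev-horner d (nth B) (+ 0)) (ℤP.+-identityʳ (nth B 0)))) (trans (B≡ (+ 0)) (trans (cong R (ℤP.+-identityˡ (+ z₁))) Rz₁))
  factor : ∀ w → R (+ z₁ ℤ.+ + b ℤ.* w) ≡ + b ℤ.* ev (suc d) Â w
  factor w = trans (cong R (ℤP.+-comm (+ z₁) (+ b ℤ.* w))) (trans (sym (B≡ (+ b ℤ.* w))) (trans (sym (ev-dilate (suc d) (+ b) (nth B) w)) (trans (ev-cong (suc d) w coeff) (sym (ev-scale (suc d) (+ b) Â w)))))
    where
    coeff : ∀ i → (+ b) ℤ.^ i ℤ.* nth B i ≡ + b ℤ.* Â i
    coeff zero = trans (ℤP.*-identityˡ (nth B 0)) B₀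
    coeff (suc i) = lem (+ b) ((+ b) ℤ.^ i) (nth B (suc i))
      where lem : ∀ b p n → b ℤ.* p ℤ.* n ≡ b ℤ.* (n ℤ.* p)
            lem b p n = ringℤ (b ∷ p ∷ n ∷ []) ($0 ⋆ $1 ⋆ $2) ($0 ⋆ ($2 ⋆ $1)) refl
  â : ℤ
  â = Â (suc d)
  â≢0 : â ≢ + 0
  â≢0 = *-nonzero {nth B (suc d)} (λ e → lead (trans (sym (trans (nth-sh-lead (+ z₁) (toVec (suc (suc d)) A)) (nth-toVec (suc (suc d)) A (suc d) ≤-refl))) e)) (^-nonzero d (pos≢0 b1))
  rooted : Rooted d Â
  rooted q q1 = w₀ , w₀1 , kq , final
    where
    Q n : ℕ
    Q = q * ℤ.∣ â ∣
    -- After cancelling `Λ * b` the value at `w₀` is a multiple of `Q`, which is `q` times the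
    -- absolute value of the leading coefficient, as `Rooted` demands.
    n = Λ * b * Q * (D * b)
    Q1 : 1 ≤ Q
    Q1 = 1≤m* q1 (1≤∣∣ â≢0)
    n1 : 1 ≤ n
    n1 = 1≤m* (1≤m* (1≤m* Λ1 b1) Q1) (1≤m* D1 b1)
    root = approx-root n n1
    y : ℤ
    y = proj₁ root
    Db∣ : + (D * b) ∣ y ℤ.- r′
    Db∣ = approx-unique (D * b) y r′ (1≤m* D1 b1) (approx-∣ (D * b) n y (ℕD.n∣m*n (Λ * b * Q)) (proj₁ (proj₂ root))) approx-r′
    x : ℤ
    x = Sg.quotient Db∣
    k₂ : ℕ
    k₂ = Λ * b * Q
    k₂1 : 1 ≤ k₂
    k₂1 = 1≤m* (1≤m* Λ1 b1) Q1
    nn₂ = nonneg x k₂ k₂1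
    w₀ : ℕ
    -- Adding `k₂` makes `w₀` positive; `k₂ * (D * b)` is `n`, so the residue modulo `n` is kept.
    w₀ = proj₁ nn₂ + k₂
    w₀1 : 1 ≤ w₀
    w₀1 = ≤-trans k₂1 (m≤n+m k₂ (proj₁ nn₂))
    w₀≡ : + w₀ ≡ x ℤ.+ + k₂ ℤ.* (+ ℤ.∣ x ∣ ℤ.+ + 1)
    w₀≡ = trans (ℤP.pos-+ (proj₁ nn₂) k₂) (trans (cong (ℤ._+ + k₂) (trans (sym (proj₂ nn₂)) (cong (λ z → x ℤ.+ z) (ℤP.pos-* k₂ ℤ.∣ x ∣)))) (lem x (+ k₂) (+ ℤ.∣ x ∣)))
      where lem : ∀ x k a → x ℤ.+ k ℤ.* a ℤ.+ k ≡ x ℤ.+ k ℤ.* (a ℤ.+ + 1)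
            lem x k a = ringℤ (x ∷ k ∷ a ∷ []) ($0 ⊹ $1 ⋆ $2 ⊹ $1) ($0 ⊹ $1 ⋆ ($2 ⊹ ⟨ 1 ⟩)) refl
    Y : ℤ
    Y = rD ℤ.+ + D ℤ.* (+ z₁ ℤ.+ + b ℤ.* + w₀)
    n∣Y : + n ∣ Y ℤ.- y
    n∣Y = divides (+ ℤ.∣ x ∣ ℤ.+ + 1) (trans (cong (λ w → rD ℤ.+ + D ℤ.* (+ z₁ ℤ.+ + b ℤ.* w) ℤ.- y) w₀≡) (trans (lem₁ rD (+ D) (+ z₁) (+ b) x (+ k₂) (+ ℤ.∣ x ∣ ℤ.+ + 1) y) (trans (cong₂ (λ u v → r′ ℤ.+ x ℤ.* u ℤ.- y ℤ.+ v) (sym (ℤP.pos-* D b)) (cong (λ z → (+ ℤ.∣ x ∣ ℤ.+ + 1) ℤ.* (+ k₂ ℤ.* z)) (sym (ℤP.pos-* D b))))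
         (trans (cong (λ u → r′ ℤ.+ u ℤ.- y ℤ.+ (+ ℤ.∣ x ∣ ℤ.+ + 1) ℤ.* (+ k₂ ℤ.* + (D * b))) (sym (Sg._∣_.equality Db∣))) (trans (lem₂ r′ y ((+ ℤ.∣ x ∣ ℤ.+ + 1) ℤ.* (+ k₂ ℤ.* + (D * b)))) (cong (λ z → (+ ℤ.∣ x ∣ ℤ.+ + 1) ℤ.* z) (sym (ℤP.pos-* k₂ (D * b)))))))))
      where
      lem₁ : ∀ r D z b x k a y → r ℤ.+ D ℤ.* (z ℤ.+ b ℤ.* (x ℤ.+ k ℤ.* a)) ℤ.- y ≡ r ℤ.+ D ℤ.* z ℤ.+ x ℤ.* (D ℤ.* b) ℤ.- y ℤ.+ a ℤ.* (k ℤ.* (D ℤ.* b))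
      lem₁ r D z b x k a y = ringℤ (r ∷ D ∷ z ∷ b ∷ x ∷ k ∷ a ∷ y ∷ []) ($0 ⊹ $1 ⋆ ($2 ⊹ $3 ⋆ ($4 ⊹ $5 ⋆ $6)) ⊹ ~ $7) ($0 ⊹ $1 ⋆ $2 ⊹ $4 ⋆ ($1 ⋆ $3) ⊹ ~ $7 ⊹ $6 ⋆ ($5 ⋆ ($1 ⋆ $3))) refl
      lem₂ : ∀ r y u → r ℤ.+ (y ℤ.- r) ℤ.- y ℤ.+ u ≡ u
      lem₂ r y u = ringℤ (r ∷ y ∷ u ∷ []) ($0 ⊹ ($1 ⊹ ~ $0) ⊹ ~ $1 ⊹ $2) ($2) refl
    n∣P : + n ∣ evalℤ P Y
    n∣P = subst (+ n ∣_) (lem (evalℤ P Y) (evalℤ P y)) (∣m∣n⇒∣m+n (eval-cong P (+ n) Y y n∣Y) (proj₂ (proj₂ root)))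
      where lem : ∀ a b → (a ℤ.- b) ℤ.+ b ≡ a
            lem a b = ringℤ (a ∷ b ∷ []) (($0 ⊹ ~ $1) ⊹ $1) ($0) refl
    u kq : ℤ
    u = Sg.quotient n∣P ℤ.* + (D * b)
    kq = proj₁ (signed â) ℤ.* u
    final : ev (suc d) Â (+ w₀) ≡ â ℤ.* + q ℤ.* kq
    final = trans (ℤP.*-cancelˡ-≡ (+ (Λ * b)) (ev (suc d) Â (+ w₀)) (+ Q ℤ.* u) {{ℤ.≢-nonZero (pos≢0 (1≤m* Λ1 b1))}}
       (trans (cong (ℤ._* ev (suc d) Â (+ w₀)) (ℤP.pos-* Λ b)) (trans (lem₁ (+ Λ) (+ b) (ev (suc d) Â (+ w₀))) (trans (cong (ℤ._* + Λ) (sym (factor (+ w₀)))) (trans (sym (PR (+ z₁ ℤ.+ + b ℤ.* + w₀))) (trans (Sg._∣_.equality n∣P) (trans (cong (λ z → Sg.quotient n∣P ℤ.* z) (trans (ℤP.pos-* k₂ (D * b)) (cong (ℤ._* + (D * b)) (ℤP.pos-* (Λ * b) Q)))) (lem₂ (Sg.quotient n∣P) (+ (Λ * b)) (+ Q) (+ (D * b))))))))))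
       (trans (cong (ℤ._* u) (trans (ℤP.pos-* q ℤ.∣ â ∣) (cong (λ z → + q ℤ.* z) (proj₂ (signed â))))) (lem₃ (+ q) â (proj₁ (signed â)) u))
      where
      lem₁ : ∀ Λ b e → Λ ℤ.* b ℤ.* e ≡ b ℤ.* e ℤ.* Λ
      lem₁ Λ b e = ringℤ (Λ ∷ b ∷ e ∷ []) ($0 ⋆ $1 ⋆ $2) ($1 ⋆ $2 ⋆ $0) refl
      lem₂ : ∀ p L Q x → p ℤ.* (L ℤ.* Q ℤ.* x) ≡ L ℤ.* (Q ℤ.* (p ℤ.* x))
      lem₂ p L Q x = ringℤ (p ∷ L ∷ Q ∷ x ∷ []) ($0 ⋆ ($1 ⋆ $2 ⋆ $3)) ($1 ⋆ ($2 ⋆ ($0 ⋆ $3))) refl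
      lem₃ : ∀ q a s u → q ℤ.* (a ℤ.* s) ℤ.* u ≡ a ℤ.* q ℤ.* (s ℤ.* u)
      lem₃ q a s u = ringℤ (q ∷ a ∷ s ∷ u ∷ []) ($0 ⋆ ($1 ⋆ $2) ⋆ $3) ($1 ⋆ $0 ⋆ ($2 ⋆ $3)) refl

absSum : ℕ → (ℕ → ℤ) → ℕ
absSum zero a = ℤ.∣ a 0 ∣
absSum (suc d) a = absSum d a + ℤ.∣ a (suc d) ∣

abs-^ : ∀ z n → ℤ.∣ (+ z) ℤ.^ n ∣ ≡ z ^ n
abs-^ z zero = refl
abs-^ z (suc n) = trans (ℤP.abs-* (+ z) ((+ z) ℤ.^ n)) (cong (z *_) (abs-^ z n))

ev-bound : ∀ d a z → 1 ≤ z → ℤ.∣ ev d a (+ z) ∣ ≤ absSum d a * z ^ d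
ev-bound zero a z _ = ≤-reflexive (sym (*-identityʳ _))
ev-bound (suc d) a z z1 = ≤-trans (ℤP.∣i+j∣≤∣i∣+∣j∣ (ev d a (+ z)) _) (≤-trans (+-mono-≤ (≤-trans (ev-bound d a z z1) (*-monoʳ-≤ (absSum d a) (m≤n*m (z ^ d) z1)))
    (≤-reflexive (trans (ℤP.abs-* (a (suc d)) ((+ z) ℤ.^ suc d)) (cong (ℤ.∣ a (suc d) ∣ *_) (abs-^ z (suc d)))))) (≤-reflexive (sym (*-distribʳ-+ (z ^ suc d) (absSum d a) ℤ.∣ a (suc d) ∣))))

-- Past the threshold the lower terms are less than half of `Z ^ suc d`, so the leading term is at
-- most `2 N` in absolute value; a negative leading coefficient would contradict the value being a
-- natural number. For `κ z ≤ Z` the lower terms of `κ` times the value at `z` are again at most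
-- `Z ^ suc d`, whence `4 N`.
growth : ∀ d A κ → 1 ≤ κ → A (suc d) ≢ + 0 → ∃ λ Z₀ → 1 ≤ Z₀ × (∀ Z N → Z₀ ≤ Z → ev (suc d) A (+ Z) ≡ + N →
  Z ≤ 2 * N × (∀ z → 1 ≤ z → κ * z ≤ Z → κ * ℤ.∣ ev (suc d) A (+ z) ∣ ≤ 4 * N))
growth d A κ κ1 nz = suc (κ * S + 2 * S) , s≤s z≤n , main
  where
  S : ℕ
  S = absSum d A
  main : ∀ Z N → suc (κ * S + 2 * S) ≤ Z → ev (suc d) A (+ Z) ≡ + N → Z ≤ 2 * N × (∀ z → 1 ≤ z → κ * z ≤ Z → κ * ℤ.∣ ev (suc d) A (+ z) ∣ ≤ 4 * N)
  main Z N big eq = ≤-trans (≤-trans (m≤m*n Z (1≤^ d Z1)) (m≤n*m (Z ^ suc d) (1≤∣∣ nz))) aZ≤2N , bound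
    where
    Z1 : 1 ≤ Z
    Z1 = ≤-trans (s≤s z≤n) big
    κS≤Z : κ * S ≤ Z
    κS≤Z = ≤-trans (≤-trans (m≤m+n (κ * S) (2 * S)) (n≤1+n _)) big
    2S<Z : 2 * S < Z
    2S<Z = ≤-trans (s≤s (m≤n+m (2 * S) (κ * S))) big
    α : ℤ
    α = A (suc d)
    E : ℤ
    E = ev d A (+ Z)
    |E| : ℤ.∣ E ∣ ≤ S * Z ^ d
    |E| = ev-bound d A Z Z1
    E<P : 2 * ℤ.∣ E ∣ < Z ^ suc d
    E<P = ≤-trans (s≤s (≤-trans (*-monoʳ-≤ 2 |E|) (≤-reflexive (sym (*-assoc 2 S (Z ^ d)))))) (ℕP.*-monoˡ-< (Z ^ d) {{ℕ.>-nonZero (1≤^ d Z1)}} 2S<Z)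
    pos-^ : ∀ a n → (+ a) ℤ.^ n ≡ + (a ^ n)
    pos-^ a zero = refl
    pos-^ a (suc n) = trans (cong (λ z → + a ℤ.* z) (pos-^ a n)) (sym (ℤP.pos-* a (a ^ n)))
    aZ≤2N : ℤ.∣ α ∣ * Z ^ suc d ≤ 2 * N
    aZ≤2N = go α refl nz
      where
      go : ∀ x → α ≡ x → x ≢ + 0 → ℤ.∣ x ∣ * Z ^ suc d ≤ 2 * N
      go (+ zero) _ h = contradiction refl h
      go (+ suc a) e _ = +-cancelʳ-≤ (suc a * Z ^ suc d) _ _ (≤-trans (≤-reflexive (lem₀ (suc a * Z ^ suc d))) (≤-trans (*-monoʳ-≤ 2 key) (≤-trans (≤-reflexive (*-distribˡ-+ 2 N ℤ.∣ E ∣)) (+-monoʳ-≤ (2 * N) (≤-trans (<⇒≤ E<P) (m≤n*m (Z ^ suc d) {suc a} (s≤s z≤n)))))))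
        where
        lem₀ : ∀ x → x + x ≡ 2 * x
        lem₀ x = ringℕ (x ∷ []) ($0 ⊹ $0) (⟨ 2 ⟩ ⋆ $0) refl
        key : suc a * Z ^ suc d ≤ N + ℤ.∣ E ∣
        key = ≤-trans (≤-reflexive (sym (trans (cong ℤ.∣_∣ ne) refl))) (ℤP.∣i-j∣≤∣i∣+∣j∣ (+ N) E)
          where
          ne : + N ℤ.- E ≡ + (suc a * Z ^ suc d)
          ne = trans (cong (ℤ._- E) (sym eq)) (trans (cong (λ x → E ℤ.+ x ℤ.* (+ Z) ℤ.^ suc d ℤ.- E) e) (trans (lem E (+ suc a ℤ.* (+ Z) ℤ.^ suc d)) (trans (cong (λ z → + suc a ℤ.* z) (pos-^ Z (suc d))) (sym (ℤP.pos-* (suc a) (Z ^ suc d))))))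
            where lem : ∀ e x → e ℤ.+ x ℤ.- e ≡ x
                  lem e x = ringℤ (e ∷ x ∷ []) ($0 ⊹ $1 ⊹ ~ $0) ($1) refl
      go -[1+ a ] e _ = contradiction (≤-trans (≤-trans (m≤n*m (Z ^ suc d) {suc a} (s≤s z≤n)) key) (m≤m+n ℤ.∣ E ∣ _)) (<⇒≱ E<P)
        where
        key : suc a * Z ^ suc d ≤ ℤ.∣ E ∣
        key = ≤-trans (m≤n+m _ N) (≤-reflexive (cong ℤ.∣_∣ (sym ne)))
          where
          ne : E ≡ + (N + suc a * Z ^ suc d)
          ne = trans (lem E (+ suc a) ((+ Z) ℤ.^ suc d)) (trans (cong₂ (λ u v → u ℤ.+ v) (trans (cong (λ x → E ℤ.+ x ℤ.* (+ Z) ℤ.^ suc d) (sym e)) eq) (trans (cong (λ z → + suc a ℤ.* z) (pos-^ Z (suc d))) (sym (ℤP.pos-* (suc a) (Z ^ suc d))))) (sym (ℤP.pos-+ N (suc a * Z ^ suc d))))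
            where
            lem : ∀ e s p → e ≡ e ℤ.+ (ℤ.- s) ℤ.* p ℤ.+ s ℤ.* p
            lem e s p = ringℤ (e ∷ s ∷ p ∷ []) ($0) ($0 ⊹ (~ $1) ⋆ $2 ⊹ $1 ⋆ $2) refl
    bound : ∀ z → 1 ≤ z → κ * z ≤ Z → κ * ℤ.∣ ev (suc d) A (+ z) ∣ ≤ 4 * N
    bound z z1 κz = ≤-trans (*-monoʳ-≤ κ (ev-bound-lead)) (≤-trans (≤-reflexive (lem κ S (z ^ d) ℤ.∣ α ∣ z)) (≤-trans (+-mono-≤ (*-mono-≤ κS≤Z zd) (*-monoʳ-≤ ℤ.∣ α ∣ (*-mono-≤ κz zd)))
        (≤-trans (+-monoˡ-≤ _ (m≤n*m (Z ^ suc d) (1≤∣∣ nz))) (≤-trans (≤-reflexive (lem₂ (ℤ.∣ α ∣ * Z ^ suc d))) (≤-trans (*-monoʳ-≤ 2 aZ≤2N) (≤-reflexive (lem₃ N)))))))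
      where
      zd : z ^ d ≤ Z ^ d
      zd = ^-monoˡ-≤ d (≤-trans (m≤n*m z κ1) κz)
      ev-bound-lead : ℤ.∣ ev (suc d) A (+ z) ∣ ≤ S * z ^ d + ℤ.∣ α ∣ * z ^ suc d
      ev-bound-lead = ≤-trans (ℤP.∣i+j∣≤∣i∣+∣j∣ (ev d A (+ z)) _) (+-mono-≤ (ev-bound d A z z1) (≤-reflexive (trans (ℤP.abs-* α ((+ z) ℤ.^ suc d)) (cong (ℤ.∣ α ∣ *_) (abs-^ z (suc d))))))
      lem : ∀ k S p a z → k * (S * p + a * (z * p)) ≡ k * S * p + a * (k * z * p)
      lem k S p a z = ringℕ (k ∷ S ∷ p ∷ a ∷ z ∷ []) ($0 ⋆ ($1 ⋆ $2 ⊹ $3 ⋆ ($4 ⋆ $2))) ($0 ⋆ $1 ⋆ $2 ⊹ $3 ⋆ ($0 ⋆ $4 ⋆ $2)) refl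
      lem₂ : ∀ x → x + x ≡ 2 * x
      lem₂ x = ringℕ (x ∷ []) ($0 ⊹ $0) (⟨ 2 ⟩ ⋆ $0) refl
      lem₃ : ∀ N → 2 * (2 * N) ≡ 4 * N
      lem₃ N = ringℕ (N ∷ []) (⟨ 2 ⟩ ⋆ (⟨ 2 ⟩ ⋆ $0)) (⟨ 4 ⟩ ⋆ $0) refl

-- Recurrence in products of cyclic systems

residue-unique : ∀ n u v z → u < n → v < n → + u ≡ + v ℤ.+ z ℤ.* + n → u ≡ v
residue-unique n u v z u<n v<n e = go z e
  where
  pos : ∀ u v k → u < n → + u ≡ + v ℤ.+ + suc k ℤ.* + n → ⊥
  pos u v k u<n e = <⇒≱ u<n (≤-trans (m≤m+n n (k * n)) (≤-trans (m≤n+m _ v) (≤-reflexive (sym (ℤP.+-injective (trans e (trans (cong (λ w → + v ℤ.+ w) (sym (ℤP.pos-* (suc k) n))) (sym (ℤP.pos-+ v (suc k * n))))))))))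
  go : ∀ z → + u ≡ + v ℤ.+ z ℤ.* + n → u ≡ v
  go (+ zero) e = ℤP.+-injective (trans e (ℤP.+-identityʳ (+ v)))
  go (+ suc k) e = ⊥-elim (pos u v k u<n e)
  go -[1+ k ] e = ⊥-elim (pos v u k v<n (trans (lem (+ v) (+ suc k) (+ n)) (cong (ℤ._+ + suc k ℤ.* + n) (sym e))))
    where lem : ∀ v k n → v ≡ v ℤ.+ (ℤ.- k) ℤ.* n ℤ.+ k ℤ.* n
          lem v k n = ringℤ (v ∷ k ∷ n ∷ []) ($0) ($0 ⊹ (~ $1) ⋆ $2 ⊹ $1 ⋆ $2) refl

-- translation modulo n on {0, ..., n-1}; larger numbers are fixed
module Cyclic (n′ : ℕ) where
  n : ℕ
  n = suc n′

  rot : ℤ → ℕ → ℕ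
  rot a x with x <? n
  ... | yes _ = (+ x ℤ.+ a) ℤ.%ℕ n
  ... | no _ = x

  rot-in : ∀ a x → x < n → rot a x < n × ∃ λ z → + rot a x ≡ + x ℤ.+ a ℤ.+ z ℤ.* + n
  rot-in a x x<n with x <? n
  ... | no h = contradiction x<n h
  ... | yes _ = ℤDM.n%ℕd<d (+ x ℤ.+ a) n , ℤ.- ((+ x ℤ.+ a) ℤ./ℕ n) , trans (lem (+ ((+ x ℤ.+ a) ℤ.%ℕ n)) ((+ x ℤ.+ a) ℤ./ℕ n) (+ n)) (cong (ℤ._+ (ℤ.- ((+ x ℤ.+ a) ℤ./ℕ n)) ℤ.* + n) (sym (ℤDM.a≡a%ℕn+[a/ℕn]*n (+ x ℤ.+ a) n)))
    where lem : ∀ r q n → r ≡ r ℤ.+ q ℤ.* n ℤ.+ (ℤ.- q) ℤ.* n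
          lem r q n = ringℤ (r ∷ q ∷ n ∷ []) ($0) ($0 ⊹ $1 ⋆ $2 ⊹ (~ $1) ⋆ $2) refl

  rot-out : ∀ a x → ¬ x < n → rot a x ≡ x
  rot-out a x h with x <? n
  ... | yes p = contradiction p h
  ... | no _ = refl

  rot-unique : ∀ a x y z → x < n → y < n → + y ≡ + x ℤ.+ a ℤ.+ z ℤ.* + n → rot a x ≡ y
  rot-unique a x y z x<n y<n e with rot-in a x x<n
  ... | w<n , z′ , e′ = residue-unique n (rot a x) y (z′ ℤ.- z) w<n y<n (trans e′ (trans (lem (+ x ℤ.+ a) z z′ (+ n)) (cong (ℤ._+ (z′ ℤ.- z) ℤ.* + n) (sym e))))
    where lem : ∀ u z z′ n → u ℤ.+ z′ ℤ.* n ≡ u ℤ.+ z ℤ.* n ℤ.+ (z′ ℤ.- z) ℤ.* n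
          lem u z z′ n = ringℤ (u ∷ z ∷ z′ ∷ n ∷ []) ($0 ⊹ $2 ⋆ $3) ($0 ⊹ $1 ⋆ $3 ⊹ ($2 ⊹ ~ $1) ⋆ $3) refl

  rot-0 : ∀ x → rot (+ 0) x ≡ x
  rot-0 x with x <? n in eq
  ... | no _ = refl
  ... | yes p = trans (sym (cong-rot eq)) (rot-unique (+ 0) x x (+ 0) p p (lem (+ x) (+ n)))
    where
    lem : ∀ x n → x ≡ x ℤ.+ + 0 ℤ.+ + 0 ℤ.* n
    lem x n = ringℤ (x ∷ n ∷ []) ($0) ($0 ⊹ ⟨ 0 ⟩ ⊹ ⟨ 0 ⟩ ⋆ $1) refl
    cong-rot : (x <? n) ≡ yes p → rot (+ 0) x ≡ (+ x ℤ.+ + 0) ℤ.%ℕ n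
    cong-rot e rewrite e = refl

  rot-+ : ∀ a b x → rot a (rot b x) ≡ rot (a ℤ.+ b) x
  rot-+ a b x = go (x <? n)
    where
    go : Dec (x < n) → rot a (rot b x) ≡ rot (a ℤ.+ b) x
    go (no h) = trans (cong (rot a) (rot-out b x h)) (trans (rot-out a x h) (sym (rot-out (a ℤ.+ b) x h)))
    go (yes p) with rot-in b x p
    ... | w<n , z , e with rot-in a (rot b x) w<n
    ... | v<n , z′ , e′ = sym (rot-unique (a ℤ.+ b) x (rot a (rot b x)) (z ℤ.+ z′) p v<n (trans e′ (trans (cong (λ t → t ℤ.+ a ℤ.+ z′ ℤ.* + n) e) (lem (+ x) a b z z′ (+ n)))))
      where lem : ∀ x a b z z′ n → x ℤ.+ b ℤ.+ z ℤ.* n ℤ.+ a ℤ.+ z′ ℤ.* n ≡ x ℤ.+ (a ℤ.+ b) ℤ.+ (z ℤ.+ z′) ℤ.* n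
            lem x a b z z′ n = ringℤ (x ∷ a ∷ b ∷ z ∷ z′ ∷ n ∷ []) ($0 ⊹ $2 ⊹ $3 ⋆ $5 ⊹ $1 ⊹ $4 ⋆ $5) ($0 ⊹ ($1 ⊹ $2) ⊹ ($3 ⊹ $4) ⋆ $5) refl

  rot-sum : ∀ a (f : ℕ → F) → sumF n (λ x → f (rot a x)) ≡ sumF n f
  rot-sum a f = trans (cong (λ w → sumF w (λ x → f (rot a x))) (sym nk)) (trans (sumF-split (n ∸ k) k _) (trans (cong₂ _⊕_ (sumF-cong< (n ∸ k) low) (sumF-cong< k high)) (trans (⊕-comm _ _) (trans (sym (sumF-split k (n ∸ k) f)) (cong (λ w → sumF w f) (m+[n∸m]≡n (<⇒≤ k<n)))))))
    where
    k : ℕ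
    k = a ℤ.%ℕ n
    q : ℤ
    q = a ℤ./ℕ n
    k<n : k < n
    k<n = ℤDM.n%ℕd<d a n
    a= : a ≡ + k ℤ.+ q ℤ.* + n
    a= = ℤDM.a≡a%ℕn+[a/ℕn]*n a n
    nk : n ∸ k + k ≡ n
    nk = m∸n+n≡m (<⇒≤ k<n)
    low : ∀ i → i < n ∸ k → f (rot a i) ≡ f (k + i)
    low i h = cong f (rot-unique a i (k + i) (ℤ.- q) (≤-trans h (m∸n≤m n k)) (≤-trans (+-monoʳ-< k h) (≤-reflexive (m+[n∸m]≡n (<⇒≤ k<n)))) (trans (ℤP.pos-+ k i) (trans (lem (+ k) (+ i) q (+ n)) (cong (λ t → + i ℤ.+ t ℤ.+ (ℤ.- q) ℤ.* + n) (sym a=)))))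
      where lem : ∀ k i q n → k ℤ.+ i ≡ i ℤ.+ (k ℤ.+ q ℤ.* n) ℤ.+ (ℤ.- q) ℤ.* n
            lem k i q n = ringℤ (k ∷ i ∷ q ∷ n ∷ []) ($0 ⊹ $1) ($1 ⊹ ($0 ⊹ $2 ⋆ $3) ⊹ (~ $2) ⋆ $3) refl
    high : ∀ i → i < k → f (rot a (n ∸ k + i)) ≡ f i
    high i h = cong f (rot-unique a (n ∸ k + i) i (ℤ.- q ℤ.- + 1) (≤-trans (+-monoʳ-< (n ∸ k) h) (≤-reflexive nk)) (ℕP.<-trans h k<n) (trans (lem (+ i) (+ (n ∸ k)) (+ k) q)
      (trans (cong (λ w → + (n ∸ k) ℤ.+ + i ℤ.+ (+ k ℤ.+ q ℤ.* w) ℤ.+ (ℤ.- q ℤ.- + 1) ℤ.* w) (trans (sym (ℤP.pos-+ (n ∸ k) k)) (cong +_ nk)))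
      (cong₂ (λ s t → s ℤ.+ t ℤ.+ (ℤ.- q ℤ.- + 1) ℤ.* + n) (sym (ℤP.pos-+ (n ∸ k) i)) (sym a=)))))
      where
      lem : ∀ i m k q → i ≡ (m ℤ.+ i) ℤ.+ (k ℤ.+ q ℤ.* (m ℤ.+ k)) ℤ.+ (ℤ.- q ℤ.- + 1) ℤ.* (m ℤ.+ k)
      lem i m k q = ringℤ (i ∷ m ∷ k ∷ q ∷ []) ($0) (($1 ⊹ $0) ⊹ ($2 ⊹ $3 ⋆ ($1 ⊹ $2)) ⊹ (~ $3 ⊹ ~ ⟨ 1 ⟩) ⋆ ($1 ⊹ $2)) refl

  cyclic : Sys
  cyclic = record
    { X = ℕ ; S = sumF n ; S-cong = λ p → sumF-cong n p ; S-add = sumF-add n ; S-scale = λ c f → sumF-scale n c f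
    ; S-nonneg = λ p → sumF-nonneg n p ; act = rot ; act-0 = rot-0 ; act-+ = rot-+ ; S-inv = rot-sum }

Sys-unit : Sys
Sys-unit = record { X = ⊤ ; S = λ f → f tt ; S-cong = λ p → p tt ; S-add = λ _ _ → refl ; S-scale = λ _ _ → refl ; S-nonneg = λ p → p tt
  ; act = λ _ x → x ; act-0 = λ _ → refl ; act-+ = λ _ _ _ → refl ; S-inv = λ _ _ → refl }

Sys-speed : ℤ → Sys → Sys
Sys-speed c 𝕊 = record { X = X ; S = S ; S-cong = S-cong ; S-add = S-add ; S-scale = S-scale ; S-nonneg = S-nonneg ; act = λ a → act (c ℤ.* a)
  ; act-0 = λ x → trans (cong (λ z → act z x) (ℤP.*-zeroʳ c)) (act-0 x)
  ; act-+ = λ a b x → trans (act-+ (c ℤ.* a) (c ℤ.* b) x) (cong (λ z → act z x) (sym (ℤP.*-distribˡ-+ c a b)))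
  ; S-inv = λ a f → S-inv (c ℤ.* a) f }
  where
  open Sys 𝕊

Sys-prod : Sys → Sys → Sys
Sys-prod 𝕊 𝕋 = record { X = 𝕊.X × 𝕋.X ; S = λ f → 𝕊.S (λ x → 𝕋.S (λ y → f (x , y)))
  ; S-cong = λ p → 𝕊.S-cong (λ x → 𝕋.S-cong (λ y → p (x , y)))
  ; S-add = λ f g → trans (𝕊.S-cong (λ x → 𝕋.S-add _ _)) (𝕊.S-add _ _)
  ; S-scale = λ c f → trans (𝕊.S-cong (λ x → 𝕋.S-scale c _)) (𝕊.S-scale c _)
  ; S-nonneg = λ p → 𝕊.S-nonneg (λ x → 𝕋.S-nonneg (λ y → p (x , y)))
  ; act = λ a (x , y) → 𝕊.act a x , 𝕋.act a y
  ; act-0 = λ (x , y) → cong₂ _,_ (𝕊.act-0 x) (𝕋.act-0 y)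
  ; act-+ = λ a b (x , y) → cong₂ _,_ (𝕊.act-+ a b x) (𝕋.act-+ a b y)
  ; S-inv = λ a f → trans (𝕊.S-cong (λ x → 𝕋.S-inv a (λ y → f (𝕊.act a x , y)))) (𝕊.S-inv a (λ x → 𝕋.S (λ y → f (x , y)))) }
  where
  module 𝕊 = Sys 𝕊
  module 𝕋 = Sys 𝕋

ι𝟙 : (ℕ → Bool) → ℕ → F
ι𝟙 B x = ι (𝟙 (B x))

sumF-ι : ∀ n g → sumF n (λ x → ι (g x)) ≡ ι (sumN n g)
sumF-ι zero g = sym ιℤ-0
sumF-ι (suc n) g = trans (cong (_⊕ ι (g n)) (sumF-ι n g)) (sym (ι-+ (sumN n g) (g n)))

prodFin : ∀ {J} → (Fin J → ℕ) → ℕ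
prodFin {zero} g = 1
prodFin {suc J} g = g zero * prodFin (λ j → g (suc j))

prodFin-≤ : ∀ {J} (g : Fin J → ℕ) n → (∀ j → g j ≤ n) → prodFin g ≤ n ^ J
prodFin-≤ {zero} g n p = ≤-refl
prodFin-≤ {suc J} g n p = *-mono-≤ (p zero) (prodFin-≤ (λ j → g (suc j)) n (λ j → p (suc j)))

-- The remaining factors are at most `n` each, so a product comparable with `n ^ J` forces every
-- single factor to be comparable with `n`.
prodFin-factor : ∀ {J} (g : Fin J → ℕ) n C → 1 ≤ n → (∀ j → g j ≤ n) → n ^ J ≤ C * prodFin g → ∀ j → n ≤ C * g j
prodFin-factor {suc J} g n C n1 p h zero = *-cancelʳ-≤ n (C * g zero) (n ^ J) {{ℕ.>-nonZero (1≤^ J n1)}} (≤-trans h (≤-trans (*-monoʳ-≤ C (*-monoʳ-≤ (g zero) (prodFin-≤ _ n (λ j → p (suc j))))) (≤-reflexive (sym (*-assoc C (g zero) (n ^ J))))))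
prodFin-factor {suc J} g n C n1 p h (suc j) = prodFin-factor (λ j → g (suc j)) n C n1 (λ j → p (suc j)) (*-cancelˡ-≤ n {{ℕ.>-nonZero n1}} (≤-trans h (≤-trans (*-monoʳ-≤ C (*-monoˡ-≤ _ (p zero))) (≤-reflexive (lem C n (prodFin (λ j → g (suc j)))))))) j
  where lem : ∀ C n x → C * (n * x) ≡ n * (C * x)
        lem C n x = ringℕ (C ∷ n ∷ x ∷ []) ($0 ⋆ ($1 ⋆ $2)) ($1 ⋆ ($0 ⋆ $2)) refl

module Family (n′ : ℕ) where
  open Cyclic n′

  PS : ∀ {J} → (Fin J → ℤ) → Sys
  PS {zero} c = Sys-unit
  PS {suc J} c = Sys-prod (Sys-speed (c zero) cyclic) (PS (λ j → c (suc j)))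

  PF : ∀ {J} (c : Fin J → ℤ) → (Fin J → ℕ → Bool) → Sys.X (PS c) → F
  PF {zero} c B _ = 1F
  PF {suc J} c B (x , y) = ι𝟙 (B zero) x ⊗ PF (λ j → c (suc j)) (λ j → B (suc j)) y

  PF≥0 : ∀ {J} (c : Fin J → ℤ) B x → 0F ≼ PF c B x
  PF≥0 {zero} c B _ = 0≼1
  PF≥0 {suc J} c B (x , y) = ⊗-nonneg (0≼ι _) (PF≥0 (λ j → c (suc j)) (λ j → B (suc j)) y)

  PF≤1 : ∀ {J} (c : Fin J → ℤ) B x → PF c B x ≼ 1F
  PF≤1 {zero} c B _ = ≼-refl
  PF≤1 {suc J} c B (x , y) = ≼-trans (⊗-mono 0≼1 (PF≥0 (λ j → c (suc j)) (λ j → B (suc j)) y) (≼-trans (ι-mono (𝟙≤1 (B zero x))) (≼-reflexive ιℤ-1)) (PF≤1 (λ j → c (suc j)) (λ j → B (suc j)) y)) (≼-reflexive (⊗-idʳ 1F))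

  S-ι : ∀ (g : ℕ → ℕ) → Sys.S cyclic (λ x → ι (g x)) ≡ ι (sumN n g)
  S-ι g = sumF-ι n g

  mass : ∀ {J} (c : Fin J → ℤ) → Sys.S (PS c) (λ _ → 1F) ≡ ι (n ^ J)
  mass {zero} c = sym ιℤ-1
  mass {suc J} c = trans (sumF-cong n (λ x → mass (λ j → c (suc j)))) (trans (sumF-const n (ι (n ^ J))) (sym (ι-* n (n ^ J))))

  S-PF : ∀ {J} (c : Fin J → ℤ) B → Sys.S (PS c) (PF c B) ≡ ι (prodFin (λ j → cnt n (B j)))
  S-PF {zero} c B = sym ιℤ-1
  S-PF {suc J} c B = trans (sumF-cong n (λ x → trans (Sys.S-scale (PS (λ j → c (suc j))) (ι𝟙 (B zero) x) _) (trans (cong (ι𝟙 (B zero) x ⊗_) (S-PF (λ j → c (suc j)) (λ j → B (suc j)))) (⊗-comm _ _))))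
    (trans (sumF-scale n _ _) (trans (cong (ι (prodFin (λ j → cnt n (B (suc j)))) ⊗_) (S-ι (λ x → 𝟙 (B zero x)))) (trans (⊗-comm _ _) (sym (ι-* _ _)))))

  corr : (ℕ → Bool) → ℤ → ℕ
  corr B h = cnt n (λ x → B x ∧ B (rot h x))

  corr≤ : ∀ B h → corr B h ≤ n
  corr≤ B h = cnt≤ n _

  inner-PF : ∀ {J} (c : Fin J → ℤ) B h → Sys.S (PS c) (λ x → PF c B x ⊗ PF c B (Sys.act (PS c) h x)) ≡ ι (prodFin (λ j → corr (B j) (c j ℤ.* h)))
  inner-PF {zero} c B h = trans (⊗-idʳ 1F) (sym ιℤ-1)
  inner-PF {suc J} c B h = trans (sumF-cong n (λ x → trans (Sys.S-cong (PS (λ j → c (suc j))) (λ y → solve 4 (λ a b c d → a :* b :* (c :* d) := (a :* c) :* (b :* d)) refl _ _ _ _))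
      (trans (Sys.S-scale (PS (λ j → c (suc j))) _ _) (trans (cong₂ _⊗_ (trans (sym (ι-* (𝟙 (B zero x)) _)) (cong ι (sym (𝟙-∧ (B zero x) (B zero (rot (c zero ℤ.* h) x)))))) (inner-PF (λ j → c (suc j)) (λ j → B (suc j)) h)) (⊗-comm _ _)))))
    (trans (sumF-scale n _ _) (trans (cong (ι (prodFin (λ j → corr (B (suc j)) (c (suc j) ℤ.* h))) ⊗_) (S-ι (λ x → 𝟙 (B zero x ∧ B zero (rot (c zero ℤ.* h) x))))) (trans (⊗-comm _ _) (sym (ι-* _ _)))))

  dense-prod : ∀ {J} D (B : Fin J → ℕ → Bool) → (∀ j → n ≤ D * cnt n (B j)) → n ^ J ≤ D ^ J * prodFin (λ j → cnt n (B j))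
  dense-prod {zero} D B p = s≤s z≤n
  dense-prod {suc J} D B p = ≤-trans (*-mono-≤ (p zero) (dense-prod D (λ j → B (suc j)) (λ j → p (suc j)))) (≤-reflexive (lem D (cnt n (B zero)) (D ^ J) (prodFin (λ j → cnt n (B (suc j))))))
    where lem : ∀ d c e p → d * c * (e * p) ≡ d * e * (c * p)
          lem d c e p = ringℕ (d ∷ c ∷ e ∷ p ∷ []) ($0 ⋆ $1 ⋆ ($2 ⋆ $3)) ($0 ⋆ $2 ⋆ ($1 ⋆ $3)) refl

allFin : ∀ {J} → (Fin J → Bool) → Bool
allFin {zero} p = true
allFin {suc J} p = p zero ∧ allFin (λ j → p (suc j))

allFin-elim : ∀ {J} (p : Fin J → Bool) → allFin p ≡ true → ∀ j → p j ≡ true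
allFin-elim {suc J} p h zero = proj₁ (∧-elim {p zero} h)
allFin-elim {suc J} p h (suc j) = allFin-elim (λ j → p (suc j)) (proj₂ (∧-elim {p zero} h)) j

allFin-intro : ∀ {J} (p : Fin J → Bool) → (∀ j → p j ≡ true) → allFin p ≡ true
allFin-intro {zero} p h = refl
allFin-intro {suc J} p h = ∧-intro (h zero) (allFin-intro (λ j → p (suc j)) (λ j → h (suc j)))

-- Simultaneous recurrence of `J` sets is recurrence of one product set in the product of `J` cyclic
-- systems, the `j`-th moving at speed `c j`. The density becomes `D ^ J`, and `C` depends neither
-- on the modulus nor on the speeds, the sets or the polynomial.
recurrence : ∀ d J D → 1 ≤ D → ∃ λ C → 1 ≤ C × (∀ a → Rooted d a → ∃ λ Y → ∀ n′ (c : Fin J → ℤ) (B : Fin J → ℕ → Bool) → (∀ j → suc n′ ≤ D * cnt (suc n′) (B j)) →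
  ∀ W → Y ≤ W → W ≤ C * cnt W (λ w → allFin (λ j → ⌊ suc n′ ≤? C * Family.corr n′ (B j) (c j ℤ.* ev (suc d) a (+ suc w)) ⌋)))
recurrence d J D D1 with Core.sarkozy d (D ^ J) (1≤^ J D1)
... | c₀ , c₀1 , rest = 2 * c₀ , 1≤m* {2} (s≤s z≤n) c₀1 , λ a rooted → proj₁ (rest a rooted) , body a rooted
  where
  body : ∀ a (rooted : Rooted d a) n′ (c : Fin J → ℤ) (B : Fin J → ℕ → Bool) → (∀ j → suc n′ ≤ D * cnt (suc n′) (B j)) →
    ∀ W → proj₁ (rest a rooted) ≤ W → W ≤ 2 * c₀ * cnt W (λ w → allFin (λ j → ⌊ suc n′ ≤? 2 * c₀ * Family.corr n′ (B j) (c j ℤ.* ev (suc d) a (+ suc w)) ⌋))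
  body a rooted n′ c B dens W YW = ≤-trans many (*-monoʳ-≤ (2 * c₀) (cnt-mono W {big} (λ w _ h → allFin-intro _ (λ j → ⌊⌋-true (n ≤? _) (prodFin-factor (κ w) n (2 * c₀) (s≤s z≤n) (λ j → corr≤ (B j) _) (⌊⌋-elim (n ^ J ≤? 2 * c₀ * prodFin (κ w)) h) j)))))
    where
    open Cyclic n′ using (n)
    open Family n′
    κ : ℕ → Fin J → ℕ
    κ w j = corr (B j) (c j ℤ.* ev (suc d) a (+ suc w))
    big : ℕ → Bool
    big w = ⌊ n ^ J ≤? 2 * c₀ * prodFin (κ w) ⌋
    fd : Core.Dense d (D ^ J) (1≤^ J D1) (PS c) (PF c B)
    fd = record { f≥0 = PF≥0 c B ; f≤1 = PF≤1 c B ; dense = ≼-trans (≼-reflexive (mass c)) (≼-trans (ι-mono (dense-prod D B dens)) (≼-reflexive (trans (ι-* (D ^ J) _) (cong (ι (D ^ J) ⊗_) (sym (S-PF c B)))))) }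
    raw : W * n ^ J ≤ c₀ * sumN W (λ w → prodFin (κ w))
    raw = ι-cancel (≼-trans (≼-reflexive (trans (ι-* W (n ^ J)) (trans (sym (trans (cong (_⊗ (ι W ⊗ ι (n ^ J))) (ι-inv c₀ c₀1)) (⊗-idˡ _))) (trans (solve 4 (λ c i w m → c :* i :* (w :* m) := c :* (i :* w :* m)) refl (ι c₀) (inv c₀) (ι W) (ι (n ^ J))) (cong (λ z → ι c₀ ⊗ (inv c₀ ⊗ ι W ⊗ z)) (sym (mass c)))))))
      (≼-trans (⊗-monoˡ (0≼ι c₀) (proj₂ (rest a rooted) (PS c) (PF c B) fd W YW)) (≼-reflexive (trans (cong (ι c₀ ⊗_) (trans (sumF-cong W (λ w → inner-PF c B (ev (suc d) a (+ suc w)))) (sumF-ι W (λ w → prodFin (κ w))))) (sym (ι-* c₀ _))))))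
    -- The `w` that are not `big` account for at most half of the total in `raw`.
    many : W ≤ 2 * c₀ * cnt W big
    many = *-cancelʳ-≤ W (2 * c₀ * cnt W big) (n ^ J) {{ℕ.>-nonZero (1≤^ J (s≤s z≤n))}} (+-cancelʳ-≤ (W * n ^ J) _ _ (≤-trans (≤-reflexive (lem₀ (W * n ^ J))) (≤-trans (*-monoʳ-≤ 2 raw)
       (≤-trans (≤-reflexive (trans (sym (*-assoc 2 c₀ _)) (sym (sumN-scale W (2 * c₀) _)))) (≤-trans (sumN-mono W (λ w _ → pt w)) (≤-reflexive (trans (sumN-add W _ _) (cong₂ _+_ (trans (sumN-scale W (2 * c₀ * n ^ J) _) (lem₁ (2 * c₀) (n ^ J) (cnt W big))) (sumN-const W (n ^ J))))))))))
      where
      lem₀ : ∀ x → x + x ≡ 2 * x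
      lem₀ x = ringℕ (x ∷ []) ($0 ⊹ $0) (⟨ 2 ⟩ ⋆ $0) refl
      lem₁ : ∀ c m g → c * m * g ≡ c * g * m
      lem₁ c m g = ringℕ (c ∷ m ∷ g ∷ []) ($0 ⋆ $1 ⋆ $2) ($0 ⋆ $2 ⋆ $1) refl
      pt : ∀ w → 2 * c₀ * prodFin (κ w) ≤ 2 * c₀ * n ^ J * 𝟙 (big w) + n ^ J
      pt w with n ^ J ≤? 2 * c₀ * prodFin (κ w)
      ... | yes _ = ≤-trans (≤-trans (*-monoʳ-≤ (2 * c₀) (prodFin-≤ (κ w) n (λ j → corr≤ (B j) _))) (≤-reflexive (sym (*-identityʳ _)))) (m≤m+n _ (n ^ J))
      ... | no h = ≤-trans (<⇒≤ (≰⇒> h)) (m≤n+m (n ^ J) _)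

-- Recursion over the colours

sumFin : ∀ {r} → (Fin r → ℕ) → ℕ
sumFin {zero} g = 0
sumFin {suc r} g = g zero + sumFin (λ k → g (suc k))

term≤sumFin : ∀ {r} (g : Fin r → ℕ) k → g k ≤ sumFin g
term≤sumFin g zero = m≤m+n (g zero) _
term≤sumFin g (suc k) = ≤-trans (term≤sumFin (λ j → g (suc j)) k) (m≤n+m _ (g zero))

sumFin-mono : ∀ {r} {g h : Fin r → ℕ} → (∀ k → g k ≤ h k) → sumFin g ≤ sumFin h
sumFin-mono {zero} p = z≤n
sumFin-mono {suc r} p = +-mono-≤ (p zero) (sumFin-mono (λ k → p (suc k)))

sumFin-mono-< : ∀ {r} {g h : Fin r → ℕ} → (∀ k → g k ≤ h k) → ∀ k → g k < h k → sumFin g < sumFin h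
sumFin-mono-< p zero q = +-mono-<-≤ q (sumFin-mono (λ k → p (suc k)))
sumFin-mono-< p (suc k) q = ℕP.+-mono-≤-< (p zero) (sumFin-mono-< (λ k → p (suc k)) k q)

sumFin-add : ∀ {r} (g h : Fin r → ℕ) → sumFin g + sumFin h ≡ sumFin (λ k → g k + h k)
sumFin-add {zero} g h = refl
sumFin-add {suc r} g h = trans (lem (g zero) (sumFin (λ k → g (suc k))) (h zero) (sumFin (λ k → h (suc k)))) (cong (λ ○ → g zero + h zero + ○) (sumFin-add (λ k → g (suc k)) (λ k → h (suc k))))
  where lem : ∀ a b c d → a + b + (c + d) ≡ a + c + (b + d)
        lem a b c d = ringℕ (a ∷ b ∷ c ∷ d ∷ []) ($0 ⊹ $1 ⊹ ($2 ⊹ $3)) ($0 ⊹ $2 ⊹ ($1 ⊹ $3)) refl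

sumFin-pigeon : ∀ {r} → 1 ≤ r → (g : Fin r → ℕ) → ∃ λ k → sumFin g ≤ r * g k
sumFin-pigeon {suc zero} _ g = zero , ≤-refl
sumFin-pigeon {suc (suc r)} _ g with sumFin-pigeon (s≤s z≤n) (λ k → g (suc k))
... | k , p with ≤-total (g zero) (g (suc k))
... | inj₁ q = suc k , +-mono-≤ q p
... | inj₂ q = zero , +-monoʳ-≤ (g zero) (≤-trans p (*-monoʳ-≤ (suc r) q))

colour-pigeon : ∀ {r} → 1 ≤ r → ∀ W (good : ℕ → Bool) (col : Fin r → ℕ → Bool) → (∀ w → w < W → ∃ λ k → col k w ≡ true) →
  ∃ λ k → cnt W good ≤ r * cnt W (λ w → good w ∧ col k w)
colour-pigeon r1 W good col cover with sumFin-pigeon r1 (λ k → cnt W (λ w → good w ∧ col k w))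
... | k , p = k , ≤-trans (split W cover) p
  where
  split : ∀ W → (∀ w → w < W → ∃ λ k → col k w ≡ true) → cnt W good ≤ sumFin (λ k → cnt W (λ w → good w ∧ col k w))
  split zero cov = z≤n
  split (suc W) cov = ≤-trans (+-mono-≤ (split W (λ w q → cov w (m<n⇒m<1+n q))) final) (≤-reflexive (sumFin-add (λ k → cnt W (λ w → good w ∧ col k w)) (λ k → 𝟙 (good W ∧ col k W))))
    where
    final : 𝟙 (good W) ≤ sumFin (λ k → 𝟙 (good W ∧ col k W))
    final with good W | cov W ≤-refl
    ... | false | _ = z≤n
    ... | true | j , e = ≤-trans (≤-reflexive (cong 𝟙 (sym e))) (term≤sumFin (λ k → 𝟙 (col k W)) j)

𝟙-∧-mono : ∀ a b {x y} → (a ∧ b ≡ true → x ≤ y) → 𝟙 (a ∧ b) * x ≤ 𝟙 b * y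
𝟙-∧-mono false b h = z≤n
𝟙-∧-mono true false h = z≤n
𝟙-∧-mono true true h = *-monoʳ-≤ 1 (h refl)

updateAt-intro : ∀ {r} {A : Set} (Q : Fin r → A → Set) {f : A → A} k (σ : Fin r → A) → Q k (f (σ k)) → (∀ j → Q j (σ j)) → ∀ j → Q j (updateAt σ k f j)
updateAt-intro Q k σ p q j with j Fin.≟ k
... | yes refl = subst (Q k) (sym (updateAt-updates k σ)) p
... | no h = subst (Q j) (sym (updateAt-minimal j k σ h)) (q j)

updateAt-elim : ∀ {r} {A : Set} (Q : Fin r → A → Set) {f : A → A} k (σ : Fin r → A) j → Q j (updateAt σ k f j) → Q k (f (σ k)) ⊎ Q j (σ j)
updateAt-elim Q k σ j p with j Fin.≟ k
... | yes refl = inj₁ (subst (Q k) (updateAt-updates k σ) p)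
... | no h = inj₂ (subst (Q j) (updateAt-minimal j k σ h) p)

Ext : (W : ℕ) (val : ℕ → ℤ) (P : ℤ → Bool) (cl : ℕ → Bool) → List ℤ → ℤ → ℕ
Ext W val P cl [] h = 𝟙 (P h)
Ext W val P cl (b ∷ bs) h = sumN W (λ w → 𝟙 (cl w) * Ext W val P cl bs (h ℤ.+ b ℤ.* val w))

module Colours (r : ℕ) (r1 : 1 ≤ r) where

  -- The accepted values of `h`: every `A i` meets its translate by `h` in at least the proportion
  -- `1 / C`, so that Roth's theorem will apply to all intersections.
  returns : ∀ n′ → (Fin r → ℕ → Bool) → ℕ → ℤ → Bool
  returns n′ A C h = allFin (λ i → ⌊ suc n′ ≤? C * Family.corr n′ (A i) h ⌋)

  -- a partial choice of the variables of one colour: coefficients still to come, value of the form so far, surviving parts of the A i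
  record State : Set where
    constructor state
    field
      rem : List ℤ
      val : ℤ
      part : Fin r → ℕ → Bool
  open State

  record Valid n′ (A : Fin r → ℕ → Bool) (D : ℕ) (σ : State) : Set where
    constructor valid
    open Cyclic n′
    field
      inA : ∀ i x → part σ i x ≡ true → A i x ≡ true
      inA+ : ∀ i x → part σ i x ≡ true → A i (rot (val σ) x) ≡ true
      dense : ∀ i → n ≤ D * cnt n (part σ i)
  open Valid

  size : (Fin r → State) → ℕ
  size σ = sumFin (λ k → length (rem (σ k)))

  Recurrent : ℕ → ℕ → ℕ → Set
  Recurrent d D C = ∀ a → Rooted d a → ∃ λ Y → ∀ n′ (c : Fin (r * r) → ℤ) (B : Fin (r * r) → ℕ → Bool) → (∀ j → suc n′ ≤ D * cnt (suc n′) (B j)) →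
    ∀ W → Y ≤ W → W ≤ C * cnt W (λ w → allFin (λ j → ⌊ suc n′ ≤? C * Family.corr n′ (B j) (c j ℤ.* ev (suc d) a (+ suc w)) ⌋))

  -- For some colour a fixed proportion of all completions within that colour ends at an accepted
  -- value. `m` bounds the missing variables of all colours together. `c` and `C₀` are fixed before
  -- the polynomial, which affects only the threshold.
  Claim : ℕ → ℕ → ℕ → Set
  Claim d m D = ∃ λ c → ∃ λ C₀ → 1 ≤ c × 1 ≤ C₀ × (∀ a → Rooted d a → ∃ λ Y → ∀ n′ A C → C₀ ≤ C → ∀ (col : Fin r → ℕ → Bool) W → Y ≤ W →
    (∀ w → w < W → ∃ λ k → col k w ≡ true) → ∀ (σ : Fin r → State) → (∀ k → Valid n′ A D (σ k)) → size σ ≤ m →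
    ∃ λ k → W ^ length (rem (σ k)) ≤ c * Ext W (λ w → ev (suc d) a (+ suc w)) (returns n′ A C) (col k) (rem (σ k)) (val (σ k)))

  returns-valid : ∀ n′ A D C σ → D ≤ C → Valid n′ A D σ → returns n′ A C (val σ) ≡ true
  returns-valid n′ A D C σ DC v = allFin-intro _ (λ i → ⌊⌋-true (suc n′ ≤? _) (≤-trans (dense v i) (*-mono-≤ DC (cnt-mono (suc n′) (λ x _ h → ∧-intro (inA v i x h) (inA+ v i x h))))))

  finished : ∀ n′ A D C W f cl σ → D ≤ C → Valid n′ A D σ → rem σ ≡ [] → W ^ length (rem σ) ≤ Ext W f (returns n′ A C) cl (rem σ) (val σ)
  finished n′ A D C W f cl σ DC v e rewrite e | returns-valid n′ A D C σ DC v = ≤-refl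

  empty? : (bs : List ℤ) → Dec (bs ≡ [])
  empty? [] = yes refl
  empty? (b ∷ bs) = no (λ ())

  -- The default 0 lets one recurrence statement cover all colours, including those with no variable
  -- left.
  headL : List ℤ → ℤ
  headL [] = + 0
  headL (b ∷ bs) = b

  tailL : List ℤ → List ℤ
  tailL [] = []
  tailL (b ∷ bs) = bs

  cons : (bs : List ℤ) → bs ≢ [] → bs ≡ headL bs ∷ tailL bs
  cons [] h = contradiction refl h
  cons (b ∷ bs) h = refl

  advance : ∀ n′ → ℤ → State → State
  advance n′ v σ = state (tailL (rem σ)) (val σ ℤ.+ headL (rem σ) ℤ.* v) (λ i x → part σ i x ∧ part σ i (Cyclic.rot n′ (headL (rem σ) ℤ.* v) x))

  advance-valid : ∀ n′ A D D′ v σ → Valid n′ A D σ → (∀ i → suc n′ ≤ D′ * Family.corr n′ (part σ i) (headL (rem σ) ℤ.* v)) → Valid n′ A D′ (advance n′ v σ)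
  advance-valid n′ A D D′ v σ V h = valid (λ i x p → inA V i x (proj₁ (∧-elim {part σ i x} p)))
    (λ i x p → trans (cong (A i) (sym (rot-+ (val σ) (headL (rem σ) ℤ.* v) x))) (inA+ V i _ (proj₂ (∧-elim {part σ i x} p)))) h
    where
    open Cyclic n′

  weaken : ∀ n′ A {D D′ σ} → D ≤ D′ → Valid n′ A D σ → Valid n′ A D′ σ
  weaken n′ A DD′ V = valid (inA V) (inA+ V) (λ i → ≤-trans (dense V i) (*-monoˡ-≤ _ DD′))

  -- Recurrence for all `r * r` parts gives many `w` good for every colour, and pigeonholing gives a
  -- colour `k` containing many of these. For each such `w` only the state of `k` advances, and the
  -- induction names a colour. Had it named another colour, whose state is unchanged, that colour
  -- would satisfy the conclusion from the start, a case settled beforehand in `decide`. So `k` is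
  -- named for every such `w`, and summing over `w` adds the variable.
  advance-claim : ∀ d m D → 1 ≤ D → ∀ C₁ → 1 ≤ C₁ → Recurrent d D C₁ → Claim d m (D * C₁) → Claim d (suc m) D
  advance-claim d m D D1 C₁ C₁1 rec (c′ , C₂ , c′1 , C₂1 , next) = r * C₁ * c′ , D * C₂ , c1 , 1≤m* {D} D1 C₂1 , λ a rooted → proj₁ (rec a rooted) ℕ.⊔ proj₁ (next a rooted) , body a rooted
    where
    c1 : 1 ≤ r * C₁ * c′
    c1 = 1≤m* {r * C₁} (1≤m* r1 C₁1) c′1
    body : ∀ a (rooted : Rooted d a) n′ A C → D * C₂ ≤ C → ∀ (col : Fin r → ℕ → Bool) W → proj₁ (rec a rooted) ℕ.⊔ proj₁ (next a rooted) ≤ W →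
      (∀ w → w < W → ∃ λ k → col k w ≡ true) → ∀ (σ : Fin r → State) → (∀ k → Valid n′ A D (σ k)) → size σ ≤ suc m →
      ∃ λ k → W ^ length (rem (σ k)) ≤ r * C₁ * c′ * Ext W (λ w → ev (suc d) a (+ suc w)) (returns n′ A C) (col k) (rem (σ k)) (val (σ k))
    body a rooted n′ A C DC col W YW cover σ V sz = decide (FinP.any? (λ k → empty? (rem (σ k)))) (FinP.any? (λ k → W ^ length (rem (σ k)) ≤? c′ * E k (rem (σ k)) (val (σ k))))
      where
      f : ℕ → ℤ
      f w = ev (suc d) a (+ suc w)
      E : Fin r → List ℤ → ℤ → ℕ
      E k = Ext W f (returns n′ A C) (col k)
      Goal : Set
      Goal = ∃ λ k → W ^ length (rem (σ k)) ≤ r * C₁ * c′ * E k (rem (σ k)) (val (σ k))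
      hd : Fin r → ℤ
      hd k = headL (rem (σ k))
      cs : Fin (r * r) → ℤ
      cs j = hd (proj₁ (Fin.remQuot r j))
      Bs : Fin (r * r) → ℕ → Bool
      Bs j = part (σ (proj₁ (Fin.remQuot {r} r j))) (proj₂ (Fin.remQuot {r} r j))
      good : ℕ → Bool
      good w = allFin (λ j → ⌊ suc n′ ≤? C₁ * Family.corr n′ (Bs j) (cs j ℤ.* f w) ⌋)
      many : W ≤ C₁ * cnt W good
      many = proj₂ (rec a rooted) n′ cs Bs (λ j → dense (V (proj₁ (Fin.remQuot {r} r j))) (proj₂ (Fin.remQuot {r} r j))) W (≤-trans (ℕP.m≤m⊔n _ _) YW)
      good-at : ∀ w → good w ≡ true → ∀ k i → suc n′ ≤ C₁ * Family.corr n′ (part (σ k) i) (hd k ℤ.* f w)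
      good-at w g k i = subst (λ p → suc n′ ≤ C₁ * Family.corr n′ (part (σ (proj₁ p)) (proj₂ p)) (hd (proj₁ p) ℤ.* f w)) (FinP.remQuot-combine {r} {r} k i) (⌊⌋-elim (suc n′ ≤? _) (allFin-elim _ g (Fin.combine k i)))
      decide : Dec (∃ λ k → rem (σ k) ≡ []) → Dec (∃ λ k → W ^ length (rem (σ k)) ≤ c′ * E k (rem (σ k)) (val (σ k))) → Goal
      decide (yes (k , e)) _ = k , ≤-trans (finished n′ A D C W f (col k) (σ k) (≤-trans (m≤m*n D C₂1) DC) (V k) e) (m≤n*m _ c1)
      decide (no _) (yes (k , p)) = k , ≤-trans p (*-monoˡ-≤ _ (m≤n*m _ (1≤m* r1 C₁1)))
      decide (no ne) (no none) with colour-pigeon r1 W good col cover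
      ... | k , p = k , subst (λ bs → W ^ length bs ≤ r * C₁ * c′ * E k bs (val (σ k))) (sym (cons (rem (σ k)) (λ e → ne (k , e)))) result
        where
        bs : List ℤ
        bs = tailL (rem (σ k))
        shorter : length bs < length (rem (σ k))
        shorter = ≤-reflexive (cong length (sym (cons (rem (σ k)) (λ e → ne (k , e)))))
        g : ℕ → Bool
        g w = good w ∧ col k w
        ext : ∀ w → g w ≡ true → W ^ length bs ≤ c′ * E k bs (val (σ k) ℤ.+ hd k ℤ.* f w)
        ext w gw = returned (proj₂ (next a rooted) n′ A C (≤-trans (m≤n*m _ D1) DC) col W (≤-trans (ℕP.m≤n⊔m _ _) YW) cover (updateAt σ k step)
            (updateAt-intro (λ _ → Valid n′ A (D * C₁)) k σ (weaken n′ A (m≤n*m _ D1) (advance-valid n′ A D C₁ (f w) (σ k) (V k) (good-at w (proj₁ (∧-elim {good w} gw)) k))) (λ j → weaken n′ A (m≤m*n D C₁1) (V j)))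
            (≤-pred (≤-trans (sumFin-mono-< (updateAt-intro (λ j τ → length (rem τ) ≤ length (rem (σ j))) k σ (<⇒≤ shorter) (λ j → ≤-refl)) k (subst (λ τ → length (rem τ) < length (rem (σ k))) (sym (updateAt-updates k σ)) shorter)) sz)))
          where
          step : State → State
          step = advance n′ (f w)
          Done : Fin r → State → Set
          Done j τ = W ^ length (rem τ) ≤ c′ * E j (rem τ) (val τ)
          returned : (∃ λ j → Done j (updateAt σ k step j)) → Done k (step (σ k))
          returned (j , q) = [ (λ p → p) , (λ p → contradiction (j , p) none) ]′ (updateAt-elim Done k σ j q)
        pt : ∀ w → 𝟙 (g w) * W ^ length bs ≤ c′ * (𝟙 (col k w) * E k bs (val (σ k) ℤ.+ hd k ℤ.* f w))
        pt w = ≤-trans (𝟙-∧-mono (good w) (col k w) (ext w)) (≤-reflexive (lem (𝟙 (col k w)) c′ _))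
          where lem : ∀ a b c → a * (b * c) ≡ b * (a * c)
                lem a b c = ringℕ (a ∷ b ∷ c ∷ []) ($0 ⋆ ($1 ⋆ $2)) ($1 ⋆ ($0 ⋆ $2)) refl
        result : W * W ^ length bs ≤ r * C₁ * c′ * E k (hd k ∷ bs) (val (σ k))
        result = ≤-trans (*-monoˡ-≤ (W ^ length bs) (≤-trans many (*-monoʳ-≤ C₁ p)))
          (≤-trans (≤-reflexive (trans (lem C₁ r (cnt W g) (W ^ length bs)) (cong (r * C₁ *_) (trans (sym (sumN-scale W (W ^ length bs) _)) (sumN-cong W (λ w → *-comm (W ^ length bs) (𝟙 (g w))))))))
          (≤-trans (*-monoʳ-≤ (r * C₁) (sumN-mono W (λ w _ → pt w))) (≤-reflexive (trans (cong (r * C₁ *_) (sumN-scale W c′ _)) (sym (*-assoc (r * C₁) c′ _))))))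
          where lem : ∀ c r g x → c * (r * g) * x ≡ r * c * (x * g)
                lem c r g x = ringℕ (c ∷ r ∷ g ∷ x ∷ []) ($0 ⋆ ($1 ⋆ $2) ⋆ $3) ($1 ⋆ $0 ⋆ ($3 ⋆ $2)) refl

  claim : ∀ d m D → 1 ≤ D → Claim d m D
  -- No variable is missing in any colour, so the first one serves; its value is accepted because
  -- its parts are still dense.
  claim d zero D D1 = 1 , D , ≤-refl , D1 , λ a rooted → 0 , λ n′ A C DC col W _ _ σ V sz → o , ≤-trans (finished n′ A D C W _ (col o) (σ o) DC (V o) (len0 (rem (σ o)) (≤-trans (term≤sumFin (λ k → length (rem (σ k))) o) sz))) (≤-reflexive (sym (*-identityˡ _)))
    where o : Fin r
          o = Fin.fromℕ< r1
          len0 : ∀ (bs : List ℤ) → length bs ≤ 0 → bs ≡ []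
          len0 [] _ = refl
  claim d (suc m) D D1 = advance-claim d m D D1 (proj₁ R) (proj₁ (proj₂ R)) (proj₂ (proj₂ R)) (claim d m (D * proj₁ R) (1≤m* {D} D1 (proj₁ (proj₂ R))))
    where R = recurrence d (r * r) D D1

-- Counting solutions

sumL : {A : Set} → List A → (A → ℕ) → ℕ
sumL [] g = 0
sumL (x ∷ xs) g = g x + sumL xs g

count≡sumL : {A : Set} (p : A → Bool) (xs : List A) → count p xs ≡ sumL xs (λ x → 𝟙 (p x))
count≡sumL p [] = refl
count≡sumL p (x ∷ xs) = cong₂ _+_ (if-𝟙 (p x)) (count≡sumL p xs)
  where if-𝟙 : ∀ b → (if b then 1 else 0) ≡ 𝟙 b
        if-𝟙 true = refl
        if-𝟙 false = refl

sumL-cong : {A : Set} (xs : List A) {g h : A → ℕ} → (∀ x → g x ≡ h x) → sumL xs g ≡ sumL xs h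
sumL-cong [] p = refl
sumL-cong (x ∷ xs) p = cong₂ _+_ (p x) (sumL-cong xs p)

sumL-++ : {A : Set} (xs ys : List A) (g : A → ℕ) → sumL (xs ++ ys) g ≡ sumL xs g + sumL ys g
sumL-++ [] ys g = refl
sumL-++ (x ∷ xs) ys g = trans (cong (λ n → g x + n) (sumL-++ xs ys g)) (sym (+-assoc (g x) _ _))

sumL-map : {A B : Set} (f : A → B) (xs : List A) (g : B → ℕ) → sumL (List.map f xs) g ≡ sumL xs (λ x → g (f x))
sumL-map f [] g = refl
sumL-map f (x ∷ xs) g = cong (λ n → g (f x) + n) (sumL-map f xs g)

sumL-concatMap : {A B : Set} (f : A → List B) (xs : List A) (g : B → ℕ) → sumL (concatMap f xs) g ≡ sumL xs (λ x → sumL (f x) g)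
sumL-concatMap f [] g = refl
sumL-concatMap f (x ∷ xs) g = trans (sumL-++ (f x) (concatMap f xs) g) (cong (λ n → sumL (f x) g + n) (sumL-concatMap f xs g))

sumL-scale : {A : Set} (xs : List A) (c : ℕ) (g : A → ℕ) → sumL xs (λ x → c * g x) ≡ c * sumL xs g
sumL-scale [] c g = sym (*-zeroʳ c)
sumL-scale (x ∷ xs) c g = trans (cong (λ n → c * g x + n) (sumL-scale xs c g)) (sym (*-distribˡ-+ c (g x) _))

sumL-add : {A : Set} (xs : List A) (g h : A → ℕ) → sumL xs (λ x → g x + h x) ≡ sumL xs g + sumL xs h
sumL-add [] g h = refl
sumL-add (x ∷ xs) g h = trans (cong (λ n → g x + h x + n) (sumL-add xs g h)) (lem (g x) (h x) (sumL xs g) (sumL xs h))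
  where lem : ∀ a b c d → a + b + (c + d) ≡ a + c + (b + d)
        lem a b c d = ringℕ (a ∷ b ∷ c ∷ d ∷ []) ($0 ⊹ $1 ⊹ ($2 ⊹ $3)) ($0 ⊹ $2 ⊹ ($1 ⊹ $3)) refl

sumL-swap : {A B : Set} (xs : List A) (ys : List B) (g : A → B → ℕ) → sumL xs (λ x → sumL ys (g x)) ≡ sumL ys (λ y → sumL xs (λ x → g x y))
sumL-swap [] ys g = sym (zeros ys)
  where zeros : ∀ {B : Set} (ys : List B) → sumL ys (λ _ → 0) ≡ 0
        zeros [] = refl
        zeros (y ∷ ys) = zeros ys
sumL-swap (x ∷ xs) ys g = trans (cong (λ n → sumL ys (g x) + n) (sumL-swap xs ys g)) (sym (sumL-add ys (g x) _))

sumL-applyUpTo : ∀ (f : ℕ → ℕ) M g → sumL (applyUpTo f M) g ≡ sumN M (λ i → g (f i))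
sumL-applyUpTo f zero g = refl
sumL-applyUpTo f (suc M) g = trans (cong (λ n → g (f 0) + n) (sumL-applyUpTo (λ i → f (suc i)) M g)) (sym (sumN-split 1 M (λ i → g (f i))))

sumL-range : ∀ M g → sumL (List.map suc (upTo M)) g ≡ sumN M (λ i → g (suc i))
sumL-range M g = trans (sumL-map suc (upTo M) g) (sumL-applyUpTo (λ i → i) M (λ i → g (suc i)))

sumL-tuples : ∀ k M (g : Vec ℕ (suc k) → ℕ) → sumL (tuples (suc k) M) g ≡ sumN M (λ i → sumL (tuples k M) (λ v → g (suc i ∷ v)))
sumL-tuples k M g = trans (sumL-concatMap (λ x → List.map (x ∷_) (tuples k M)) (List.map suc (upTo M)) g)
  (trans (sumL-range M _) (sumN-cong M (λ i → sumL-map (suc i ∷_) (tuples k M) g)))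

card≡cnt : ∀ A M → card A M ≡ cnt M (λ i → A (suc i))
card≡cnt A M = trans (count≡sumL A (range M)) (sumL-range M _)

⌊⌋-iff : {P Q : Set} (p : Dec P) (q : Dec Q) → (P → Q) → (Q → P) → ⌊ p ⌋ ≡ ⌊ q ⌋
⌊⌋-iff (yes _) (yes _) f g = refl
⌊⌋-iff (yes p) (no h) f g = contradiction (f p) h
⌊⌋-iff (no h) (yes q) f g = contradiction (g q) h
⌊⌋-iff (no _) (no _) f g = refl

Rep-tuples : ∀ {s} (b : Vec ℤ s) A N g → sumL (tuples s N) (λ n → 𝟙 (allV A n) * 𝟙 ⌊ linear b (V.map +_ n) ℤ.≟ g ⌋) ≡ Rep b (λ i → A (suc i)) N g
Rep-tuples [] A N g = trans (+-identityʳ _) (trans (+-identityʳ _) (cong 𝟙 (⌊⌋-iff (+ 0 ℤ.≟ g) (g ℤ.≟ + 0) sym sym)))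
Rep-tuples {suc s} (b ∷ bs) A N g = trans (sumL-tuples s N _) (sumN-cong N (λ i → trans (sumL-cong (tuples s N) (λ v → trans (cong₂ _*_ (𝟙-∧ (A (suc i)) (allV A v)) (cong 𝟙 (⌊⌋-iff (b ℤ.* + suc i ℤ.+ linear bs (V.map +_ v) ℤ.≟ g) (linear bs (V.map +_ v) ℤ.≟ g ℤ.- b ℤ.* + suc i)
    (λ e → trans (lem₁ (b ℤ.* + suc i) (linear bs (V.map +_ v))) (cong (λ z → z ℤ.- b ℤ.* + suc i) e)) (λ e → trans (cong (λ z → b ℤ.* + suc i ℤ.+ z) e) (lem₂ (b ℤ.* + suc i) g)))))
    (*-assoc (𝟙 (A (suc i))) (𝟙 (allV A v)) _))) (trans (sumL-scale (tuples s N) (𝟙 (A (suc i))) _) (cong (λ n → 𝟙 (A (suc i)) * n) (Rep-tuples bs A N _)))))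
  where
  lem₁ : ∀ x l → l ≡ x ℤ.+ l ℤ.- x
  lem₁ x l = ringℤ (x ∷ l ∷ []) ($1) ($0 ⊹ $1 ⊹ ~ $0) refl
  lem₂ : ∀ x g → x ℤ.+ (g ℤ.- x) ≡ g
  lem₂ x g = ringℤ (x ∷ g ∷ []) ($0 ⊹ ($1 ⊹ ~ $0)) ($1) refl

Nest : ∀ {t} → (ℕ → ℤ) → ℕ → (ℕ → Bool) → (ℤ → ℕ) → Vec ℤ t → ℤ → ℕ
Nest f Z C G [] g = G g
Nest f Z C G (l ∷ ls) g = sumN Z (λ i → 𝟙 (C (suc i)) * Nest f Z C G ls (g ℤ.+ l ℤ.* f (suc i)))

Nest-tuples : ∀ {t} f Z C G (ls : Vec ℤ t) g → sumL (tuples t Z) (λ z → 𝟙 (allV C z) * G (g ℤ.+ linear ls (V.map f z))) ≡ Nest f Z C G ls g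
Nest-tuples f Z C G [] g = trans (+-identityʳ _) (trans (+-identityʳ _) (cong G (ℤP.+-identityʳ g)))
Nest-tuples {suc t} f Z C G (l ∷ ls) g = trans (sumL-tuples t Z _) (sumN-cong Z (λ i → trans (sumL-cong (tuples t Z) (λ v → trans (cong₂ _*_ (𝟙-∧ (C (suc i)) (allV C v)) (cong G (sym (ℤP.+-assoc g (l ℤ.* f (suc i)) _)))) (*-assoc (𝟙 (C (suc i))) (𝟙 (allV C v)) _)))
  (trans (sumL-scale (tuples t Z) (𝟙 (C (suc i))) _) (cong (λ n → 𝟙 (C (suc i)) * n) (Nest-tuples f Z C G ls _)))))

solCount≡Nest : ∀ {s t} (L₁ : Vec ℤ s) (L₂ : Vec ℤ t) f 𝒜 𝒞 N Z → solCount L₁ L₂ f 𝒜 𝒞 N Z ≡ Nest f Z 𝒞 (Rep L₁ (λ i → 𝒜 (suc i)) N) L₂ (+ 0)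
solCount≡Nest {s} {t} L₁ L₂ f 𝒜 𝒞 N Z = trans (count≡sumL p (concatMap (λ n → List.map (λ z → n , z) (tuples t Z)) (tuples s N))) (trans (sumL-concatMap (λ n → List.map (λ z → n , z) (tuples t Z)) (tuples s N) (λ nz → 𝟙 (p nz))) (trans (sumL-cong (tuples s N) (λ n → sumL-map (λ z → n , z) (tuples t Z) _)) (trans (sumL-swap (tuples s N) (tuples t Z) _)
  (trans (sumL-cong (tuples t Z) (λ z → trans (sumL-cong (tuples s N) (λ n → term n z)) (trans (sumL-scale (tuples s N) (𝟙 (allV 𝒞 z)) _) (cong (λ m → 𝟙 (allV 𝒞 z) * m) (trans (Rep-tuples L₁ 𝒜 N _) (cong (Rep L₁ (λ i → 𝒜 (suc i)) N) (sym (ℤP.+-identityˡ _))))))))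
  (Nest-tuples f Z 𝒞 (Rep L₁ (λ i → 𝒜 (suc i)) N) L₂ (+ 0))))))
  where
  p : Vec ℕ s × Vec ℕ t → Bool
  p (n , z) = allV 𝒜 n ∧ allV 𝒞 z ∧ ⌊ linear L₁ (V.map +_ n) ℤ.≟ linear L₂ (V.map f z) ⌋
  term : ∀ n z → 𝟙 (allV 𝒜 n ∧ allV 𝒞 z ∧ ⌊ linear L₁ (V.map +_ n) ℤ.≟ linear L₂ (V.map f z) ⌋) ≡ 𝟙 (allV 𝒞 z) * (𝟙 (allV 𝒜 n) * 𝟙 ⌊ linear L₁ (V.map +_ n) ℤ.≟ linear L₂ (V.map f z) ⌋)
  term n z = trans (𝟙-∧ (allV 𝒜 n) _) (trans (cong (λ m → 𝟙 (allV 𝒜 n) * m) (𝟙-∧ (allV 𝒞 z) _)) (lem (𝟙 (allV 𝒜 n)) (𝟙 (allV 𝒞 z)) _))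
    where lem : ∀ a b c → a * (b * c) ≡ b * (a * c)
          lem a b c = ringℕ (a ∷ b ∷ c ∷ []) ($0 ⋆ ($1 ⋆ $2)) ($1 ⋆ ($0 ⋆ $2)) refl

absV : ∀ {t} → Vec ℤ t → ℕ
absV [] = 0
absV (l ∷ ls) = ℤ.∣ l ∣ + absV ls

-- the budget K |h| + |ls| N ≤ K N keeps every value reached at most N
Ext≤Nest : ∀ b₁ u val f W Z N K x₀ β E c P C G → 1 ≤ β → ℤ.∣ u ∣ ≡ 1 → 1 ≤ K →
  (∀ h → ℤ.∣ h ∣ ≤ N → P h ≡ true → E ≤ c * G (b₁ ℤ.* h)) → (∀ w → w < W → K * ℤ.∣ val w ∣ ≤ N) →
  (∀ w → f (suc (x₀ + β * w)) ≡ b₁ ℤ.* (u ℤ.* val w)) → (∀ i → Z ≤ i → C (suc i) ≡ false) →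
  ∀ {t} (ls : Vec ℤ t) h → K * ℤ.∣ h ∣ + absV ls * N ≤ K * N →
  E * Ext W val P (λ w → C (suc (x₀ + β * w))) (toList (V.map (λ l → u ℤ.* l) ls)) h ≤ c * Nest f Z C G ls (b₁ ℤ.* h)
Ext≤Nest b₁ u val f W Z N K x₀ β E c P C G β1 u1 K1 leaf small fval supp = go
  where
  go : ∀ {t} (ls : Vec ℤ t) h → K * ℤ.∣ h ∣ + absV ls * N ≤ K * N →
    E * Ext W val P (λ w → C (suc (x₀ + β * w))) (toList (V.map (λ l → u ℤ.* l) ls)) h ≤ c * Nest f Z C G ls (b₁ ℤ.* h)
  go [] h bud = at (P h) refl
    where
    at : ∀ p → P h ≡ p → E * 𝟙 p ≤ c * G (b₁ ℤ.* h)
    at false _ = ≤-trans (≤-reflexive (*-zeroʳ E)) z≤n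
    at true e = ≤-trans (≤-reflexive (*-identityʳ E)) (leaf h (*-cancelˡ-≤ K {{ℕ.>-nonZero K1}} (≤-trans (≤-reflexive (sym (+-identityʳ _))) bud)) e)
  go (l ∷ ls) h bud = ≤-trans (≤-reflexive (sym (sumN-scale W E _))) (≤-trans (sumN-mono W step) (≤-trans (≤-reflexive (sumN-scale W c (λ w → X (x₀ + β * w)))) (*-monoʳ-≤ c (sumN-dilate W Z x₀ β X β1 beyond))))
    where
    X : ℕ → ℕ
    X i = 𝟙 (C (suc i)) * Nest f Z C G ls (b₁ ℤ.* h ℤ.+ l ℤ.* f (suc i))
    beyond : ∀ i → Z ≤ i → X i ≡ 0
    beyond i p rewrite supp i p = refl
    step : ∀ w → w < W → E * (𝟙 (C (suc (x₀ + β * w))) * Ext W val P (λ w → C (suc (x₀ + β * w))) (toList (V.map (λ l → u ℤ.* l) ls)) (h ℤ.+ u ℤ.* l ℤ.* val w)) ≤ c * X (x₀ + β * w)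
    step w w<W = ≤-trans (≤-reflexive (lem₁ E (𝟙 (C (suc (x₀ + β * w)))) _)) (≤-trans (*-monoʳ-≤ (𝟙 (C (suc (x₀ + β * w)))) (go ls (h ℤ.+ u ℤ.* l ℤ.* val w) bud′))
       (≤-reflexive (trans (lem₁ (𝟙 (C (suc (x₀ + β * w)))) c _) (cong (λ z → c * (𝟙 (C (suc (x₀ + β * w))) * Nest f Z C G ls z)) (trans (lem₂ b₁ h u l (val w)) (cong (λ z → b₁ ℤ.* h ℤ.+ l ℤ.* z) (sym (fval w))))))))
      where
      lem₁ : ∀ a b c → a * (b * c) ≡ b * (a * c)
      lem₁ a b c = ringℕ (a ∷ b ∷ c ∷ []) ($0 ⋆ ($1 ⋆ $2)) ($1 ⋆ ($0 ⋆ $2)) refl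
      lem₂ : ∀ b h u l v → b ℤ.* (h ℤ.+ u ℤ.* l ℤ.* v) ≡ b ℤ.* h ℤ.+ l ℤ.* (b ℤ.* (u ℤ.* v))
      lem₂ b h u l v = ringℤ (b ∷ h ∷ u ∷ l ∷ v ∷ []) ($0 ⋆ ($1 ⊹ $2 ⋆ $3 ⋆ $4)) ($0 ⋆ $1 ⊹ $3 ⋆ ($0 ⋆ ($2 ⋆ $4))) refl
      bud′ : K * ℤ.∣ h ℤ.+ u ℤ.* l ℤ.* val w ∣ + absV ls * N ≤ K * N
      bud′ = ≤-trans (+-monoˡ-≤ (absV ls * N) (≤-trans (*-monoʳ-≤ K (ℤP.∣i+j∣≤∣i∣+∣j∣ h _)) (≤-trans (≤-reflexive (trans (cong (λ a → K * (ℤ.∣ h ∣ + a)) abs≡) (lem₃ K ℤ.∣ h ∣ ℤ.∣ l ∣ ℤ.∣ val w ∣)))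
        (+-monoʳ-≤ (K * ℤ.∣ h ∣) (*-monoʳ-≤ ℤ.∣ l ∣ (small w w<W)))))) (≤-trans (≤-reflexive (lem₄ (K * ℤ.∣ h ∣) ℤ.∣ l ∣ (absV ls) N)) bud)
        where
        abs≡ : ℤ.∣ u ℤ.* l ℤ.* val w ∣ ≡ ℤ.∣ l ∣ * ℤ.∣ val w ∣
        abs≡ = trans (ℤP.abs-* (u ℤ.* l) (val w)) (cong (λ a → a * ℤ.∣ val w ∣) (trans (ℤP.abs-* u l) (trans (cong (λ a → a * ℤ.∣ l ∣) u1) (*-identityˡ _))))
        lem₃ : ∀ K h l v → K * (h + l * v) ≡ K * h + l * (K * v)
        lem₃ K h l v = ringℕ (K ∷ h ∷ l ∷ v ∷ []) ($0 ⋆ ($1 ⊹ $2 ⋆ $3)) ($0 ⋆ $1 ⊹ $2 ⋆ ($0 ⋆ $3)) refl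
        lem₄ : ∀ a l s N → a + l * N + s * N ≡ a + (l + s) * N
        lem₄ a l s N = ringℕ (a ∷ l ∷ s ∷ N ∷ []) ($0 ⊹ $1 ⋆ $3 ⊹ $2 ⋆ $3) ($0 ⊹ ($1 ⊹ $2) ⋆ $3) refl

module _ (N : ℕ) where
  open Cyclic (2 * N)

  -- The modulus `2 N + 1` exceeds `N + N`, so translating a point up to `N` by at most `N` does not
  -- wrap round.
  rot-forward : ∀ a x → a ≤ N → x ≤ N → rot (+ a) x ≡ x + a
  rot-forward a x aN xN = rot-unique (+ a) x (x + a) (+ 0) (x<n x xN) (s≤s (≤-trans (+-mono-≤ xN aN) (≤-reflexive (lem₁ N)))) (trans (ℤP.pos-+ x a) (lem₂ (+ x ℤ.+ + a) (+ n)))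
    where
    x<n : ∀ x → x ≤ N → x < n
    x<n x p = s≤s (≤-trans p (m≤m+n N _))
    lem₁ : ∀ N → N + N ≡ 2 * N
    lem₁ N = ringℕ (N ∷ []) ($0 ⊹ $0) (⟨ 2 ⟩ ⋆ $0) refl
    lem₂ : ∀ a n → a ≡ a ℤ.+ + 0 ℤ.* n
    lem₂ a n = ringℤ (a ∷ n ∷ []) ($0) ($0 ⊹ ⟨ 0 ⟩ ⋆ $1) refl

  rot-backward : ∀ a x → a ≤ N → x ≤ N → rot (ℤ.- + a) x ≤ N → x ≡ rot (ℤ.- + a) x + a
  rot-backward a x aN xN yN = sym (trans (sym (rot-forward a (rot (ℤ.- + a) x) aN yN)) (trans (rot-+ (+ a) (ℤ.- + a) x) (trans (cong (λ z → rot z x) (ℤP.+-inverseʳ (+ a))) (rot-0 x))))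

  -- moving the first variable by h turns solutions of b · n = 0 in A ∩ (A - h) into solutions of b · n = b₁ h in A
  Rep-shift : ∀ {s} b₁ (bs : Vec ℤ s) (A : ℕ → Bool) → (∀ x → A x ≡ true → 1 ≤ x × x ≤ N) → ∀ h → ℤ.∣ h ∣ ≤ N →
    Rep (b₁ ∷ bs) (λ i → A (suc i) ∧ A (rot h (suc i))) N (+ 0) ≤ Rep (b₁ ∷ bs) (λ i → A (suc i)) N (b₁ ℤ.* h)
  Rep-shift b₁ bs A inN = cases
    where
    B : ℤ → ℕ → Bool
    B h i = A (suc i) ∧ A (rot h (suc i))
    Fh : ℤ → ℕ → ℕ
    Fh h i = 𝟙 (B h i) * Rep bs (B h) N (+ 0 ℤ.- b₁ ℤ.* + suc i)
    Hh : ℤ → ℕ → ℕ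
    Hh h i = 𝟙 (A (suc i)) * Rep bs (λ i → A (suc i)) N (b₁ ℤ.* h ℤ.- b₁ ℤ.* + suc i)
    compare : ∀ h i j → (A (suc i) ≡ true → A (rot h (suc i)) ≡ true → A (suc j) ≡ true) → + suc j ≡ + suc i ℤ.+ h → Fh h i ≤ Hh h j
    compare h i j imp e = *-mono-≤ (𝟙-mono (λ p → imp (proj₁ (∧-elim {A (suc i)} p)) (proj₂ (∧-elim {A (suc i)} p))))
      (≤-trans (Rep-mono bs (B h) (λ i → A (suc i)) N (λ i p → proj₁ (∧-elim p)) _) (≤-reflexive (Rep-cong bs _ N (trans (lem b₁ (+ suc i) h) (cong (λ z → b₁ ℤ.* h ℤ.- b₁ ℤ.* z) (sym e))))))
      where
      𝟙-mono : ∀ {a b} → (a ≡ true → b ≡ true) → 𝟙 a ≤ 𝟙 b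
      𝟙-mono {false} f = z≤n
      𝟙-mono {true} f = ≤-reflexive (cong 𝟙 (sym (f refl)))
      lem : ∀ b i h → + 0 ℤ.- b ℤ.* i ≡ b ℤ.* h ℤ.- b ℤ.* (i ℤ.+ h)
      lem b i h = ringℤ (b ∷ i ∷ h ∷ []) (⟨ 0 ⟩ ⊹ ~ ($0 ⋆ $1)) ($0 ⋆ $2 ⊹ ~ ($0 ⋆ ($1 ⊹ $2))) refl
    beyond : ∀ h i → N ≤ i → Hh h i ≡ 0
    beyond h i p = cong (λ b → b * Rep bs (λ i → A (suc i)) N (b₁ ℤ.* h ℤ.- b₁ ℤ.* + suc i)) (out (A (suc i)) refl)
      where
      out : ∀ b → A (suc i) ≡ b → 𝟙 b ≡ 0
      out false e = refl
      out true e = contradiction (≤-trans (proj₂ (inN (suc i) e)) p) (n≮n i)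
    empty : ∀ h i → (A (suc i) ≡ true → A (rot h (suc i)) ≡ true → ⊥) → Fh h i ≡ 0
    empty h i never = cong (λ b → b * Rep bs (B h) N (+ 0 ℤ.- b₁ ℤ.* + suc i)) (𝟙-empty (A (suc i)) (A (rot h (suc i))) never)
      where
      𝟙-empty : ∀ a b → (a ≡ true → b ≡ true → ⊥) → 𝟙 (a ∧ b) ≡ 0
      𝟙-empty false b f = refl
      𝟙-empty true false f = refl
      𝟙-empty true true f = ⊥-elim (f refl refl)
    forward : ∀ a → a ≤ N → sumN N (Fh (+ a)) ≤ sumN N (Hh (+ a))
    forward a aN = ≤-trans (sumN-mono N pt) (sumN-dilate N N a 1 (Hh (+ a)) ≤-refl (beyond (+ a)))
      where
      pt : ∀ i → i < N → Fh (+ a) i ≤ Hh (+ a) (a + 1 * i)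
      pt i i<N = compare (+ a) i (a + 1 * i) (λ _ q → trans (cong A (trans (lem a i) (sym (rot-forward a (suc i) aN i<N)))) q) (trans (cong +_ (lem a i)) (ℤP.pos-+ (suc i) a))
        where lem : ∀ a i → suc (a + 1 * i) ≡ suc i + a
              lem a i = ringℕ (a ∷ i ∷ []) ((⟨ 1 ⟩ ⊹ ($0 ⊹ ⟨ 1 ⟩ ⋆ $1))) ((⟨ 1 ⟩ ⊹ $1) ⊹ $0) refl
    backward : ∀ a → a ≤ N → sumN N (Fh (ℤ.- + a)) ≤ sumN N (Hh (ℤ.- + a))
    backward a aN = ≤-trans (sumN-mono-n (Fh (ℤ.- + a)) (m≤n+m N a)) (≤-trans (≤-reflexive (trans (sumN-split a N _) (cong (λ z → z + sumN N (λ i → Fh (ℤ.- + a) (a + i))) (trans (sumN-cong< a start) (sumN-zero a))))) (sumN-mono N (λ i _ → pt i)))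
      where
      meet : ∀ i → A (suc i) ≡ true → A (rot (ℤ.- + a) (suc i)) ≡ true → suc i ≡ rot (ℤ.- + a) (suc i) + a
      meet i p q = rot-backward a (suc i) aN (proj₂ (inN (suc i) p)) (proj₂ (inN _ q))
      -- A point of `A` whose translate back by `a` is again in `A` exceeds `a`, so the first `a`
      -- terms vanish.
      start : ∀ i → i < a → Fh (ℤ.- + a) i ≡ 0
      start i i<a = empty (ℤ.- + a) i (λ p q → <⇒≱ (s≤s i<a) (≤-trans (+-monoˡ-≤ a (proj₁ (inN _ q))) (≤-reflexive (sym (meet i p q)))))
      pt : ∀ i → Fh (ℤ.- + a) (a + i) ≤ Hh (ℤ.- + a) i
      pt i = compare (ℤ.- + a) (a + i) i (λ p q → trans (cong A (+-cancelʳ-≡ a (suc i) (rot (ℤ.- + a) (suc (a + i))) (trans (lem i a) (meet (a + i) p q)))) q) (trans (lem₂ (+ suc i) (+ a)) (cong (λ z → z ℤ.- + a) (trans (sym (ℤP.pos-+ (suc i) a)) (cong +_ (lem i a)))))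
        where
        lem : ∀ i a → suc i + a ≡ suc (a + i)
        lem i a = ringℕ (i ∷ a ∷ []) ((⟨ 1 ⟩ ⊹ $0) ⊹ $1) ((⟨ 1 ⟩ ⊹ ($1 ⊹ $0))) refl
        lem₂ : ∀ i a → i ≡ i ℤ.+ a ℤ.- a
        lem₂ i a = ringℤ (i ∷ a ∷ []) ($0) ($0 ⊹ $1 ⊹ ~ $1) refl
    cases : ∀ h → ℤ.∣ h ∣ ≤ N → sumN N (Fh h) ≤ sumN N (Hh h)
    cases (+ a) p = forward a p
    cases -[1+ a ] p = backward (suc a) p

-- Assembly of the theorem.

NonDegenerate⇒NZ : ∀ {k} (b : Vec ℤ k) → NonDegenerate b → NZ b
NonDegenerate⇒NZ [] nd = tt
NonDegenerate⇒NZ (b ∷ bs) nd = nd zero , NonDegenerate⇒NZ bs (λ i → nd (suc i))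

linear-ones : ∀ {k} (b : Vec ℤ k) → linear b (ones k) ≡ sumV b
linear-ones [] = refl
linear-ones (b ∷ bs) = cong₂ ℤ._+_ (ℤP.*-identityʳ b) (linear-ones bs)

sumFin-≤ : ∀ {r} {g : Fin r → ℕ} {c} → (∀ k → g k ≤ c) → sumFin g ≤ r * c
sumFin-≤ {zero} p = z≤n
sumFin-≤ {suc r} p = +-mono-≤ (p zero) (sumFin-≤ (λ k → p (suc k)))

cnt-suc≤ : ∀ N Q → Q 0 ≡ false → Supp N (λ i → Q (suc i)) → cnt (suc (2 * N)) Q ≤ cnt N (λ i → Q (suc i))
cnt-suc≤ N Q q0 supp = ≤-trans (≤-reflexive (trans (sumN-split 1 (2 * N) (λ i → 𝟙 (Q i))) (cong (λ b → 𝟙 b + sumN (2 * N) (λ i → 𝟙 (Q (suc i)))) q0))) (sumN-beyond (2 * N) N _ (λ i p → cong 𝟙 (supp i p)))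

≤cnt-suc : ∀ N Q → cnt N (λ i → Q (suc i)) ≤ cnt (suc (2 * N)) Q
≤cnt-suc N Q = ≤-trans (sumN-mono-n _ (m≤m+n N (N + 0))) (≤-trans (m≤n+m _ (𝟙 (Q 0))) (≤-reflexive (sym (sumN-split 1 (2 * N) (λ i → 𝟙 (Q i))))))

-- Embedding in the cyclic group costs a factor 3, as `2 N + 1 ≤ 3 N`.
dense-cyclic : ∀ δn δd N → 1 ≤ δn → 1 ≤ N → ∀ A → δn * N ≤ δd * card A N → suc (2 * N) ≤ 3 * δd * cnt (suc (2 * N)) A
dense-cyclic δn δd N δn1 N1 A h = ≤-trans (+-monoˡ-≤ (2 * N) N1) (≤-trans (*-monoʳ-≤ 3 (≤-trans (m≤n*m N δn1) (≤-trans h (*-monoʳ-≤ δd (≤-trans (≤-reflexive (card≡cnt A N)) (≤cnt-suc N A))))))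
  (≤-reflexive (sym (*-assoc 3 δd _))))

module Counting {s} (b₁ : ℤ) (bs : Vec ℤ (suc s)) (C cR : ℕ) (roth-C : ∀ N Q → Supp N Q → N ≤ C * cnt N Q → N ^ suc s ≤ cR * Rep (b₁ ∷ bs) Q N (+ 0)) where

  -- An accepted `h` becomes solutions: Roth's theorem is applied inside A ∩ (A - h), and
  -- `Rep-shift` moves the first variable by `h`.
  leaf : ∀ N (A : ℕ → Bool) → (∀ x → A x ≡ true → 1 ≤ x × x ≤ N) → ∀ h → ℤ.∣ h ∣ ≤ N → suc (2 * N) ≤ C * Family.corr (2 * N) A h →
    N ^ suc s ≤ cR * Rep (b₁ ∷ bs) (λ i → A (suc i)) N (b₁ ℤ.* h)
  leaf N A inN h hN dens = ≤-trans (roth-C N (λ i → Q (suc i)) supp (≤-trans (≤-trans (m≤m+n N (N + 0)) (n≤1+n _)) (≤-trans dens (*-monoʳ-≤ C (cnt-suc≤ N Q (¬-not (λ e → ℕP.1+n≰n (proj₁ (inN 0 (proj₁ (∧-elim e)))))) supp)))))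
    (*-monoʳ-≤ cR (Rep-shift N b₁ bs A inN h hN))
    where
    Q : ℕ → Bool
    Q x = A x ∧ A (Cyclic.rot (2 * N) h x)
    supp : Supp N (λ i → Q (suc i))
    supp i p = ¬-not (λ e → <⇒≱ (s≤s p) (proj₂ (inN (suc i) (proj₁ (∧-elim e)))))

module Main {d r s t} (r1 : 1 ≤ r) (δn δd : ℕ) (δn1 : 1 ≤ δn) (P : Poly (suc d)) (deg : HasDegree P) (ζ : PAdicZeros P)
  (b₁ u : ℤ) (b′ : ℕ) (u1 : ℤ.∣ u ∣ ≡ 1) (b₁u : + suc b′ ≡ b₁ ℤ.* u) (bs : Vec ℤ (suc s)) (L₂ : Vec ℤ t)
  (c C₀ : ℕ) (cR : ℕ)
  (roth-C : ∀ N Q → Supp N Q → N ≤ C₀ * cnt N Q → N ^ suc s ≤ cR * Rep (b₁ ∷ bs) Q N (+ 0)) where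

  open Colours r r1
  open State
  open Counting b₁ bs C₀ cR roth-C

  b K κ p : ℕ
  b = suc b′
  -- Each polynomial value will be at most `N / K`, so the values of the form stay below `N` in
  -- absolute value.
  K = suc (absV L₂)
  -- `growth` bounds `κ` times a value by `4 N`; cancelling 4 leaves `K`.
  κ = 4 * K
  -- One half of `Z` is reserved for the offset `z₁`, the other for `W` steps of length `b`.
  p = 2 * κ * b

  p1 : 1 ≤ p
  p1 = s≤s z≤n

  coeffs : List ℤ
  coeffs = toList (V.map (λ l → u ℤ.* l) L₂)

  length-coeffs : length coeffs ≡ t
  length-coeffs = length-toList (V.map (λ l → u ℤ.* l) L₂)

  init : (Fin r → ℕ → Bool) → Fin r → State
  init A k = state coeffs (+ 0) A

  Search : (ℕ → ℤ) → ℕ → Set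
  Search Â Y = ∀ n′ A C → C₀ ≤ C → ∀ (col : Fin r → ℕ → Bool) W → Y ≤ W →
    (∀ w → w < W → ∃ λ k → col k w ≡ true) → ∀ (σ : Fin r → State) → (∀ k → Valid n′ A (3 * δd) (σ k)) → size σ ≤ r * t →
    ∃ λ k → W ^ length (rem (σ k)) ≤ c * Ext W (λ w → ev (suc d) Â (+ suc w)) (returns n′ A C) (col k) (rem (σ k)) (val (σ k))

  module Fixed (D : ℕ) (rD : ℤ) (aux : Auxiliary P ζ D rD b) (Y : ℕ) (search : Search (Auxiliary.Â aux) Y) where
    open Auxiliary aux

    f : ℕ → ℤ
    f z = PD P (PAdicZeros.mult ζ) D rD (+ z)

    v : ℕ → ℤ
    v w = ev (suc d) Â (+ suc w)

    x₀ : ℕ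
    -- The shift by one in both counts: `suc (x₀ + b * w)` is `z₁ + b * suc w`.
    x₀ = z₁ + b′

    f-factor : ∀ w → f (suc (x₀ + b * w)) ≡ + b ℤ.* v w
    f-factor w = trans (PD≡ _) (trans (cong (ev (suc d) A) (trans (cong +_ (lem z₁ b′ w)) (trans (ℤP.pos-+ z₁ (b * suc w)) (cong (λ x → + z₁ ℤ.+ x) (ℤP.pos-* b (suc w)))))) (factor (+ suc w)))
      where lem : ∀ z b w → suc (z + b + suc b * w) ≡ z + suc b * suc w
            lem z b w = ringℕ (z ∷ b ∷ w ∷ []) ((⟨ 1 ⟩ ⊹ ($0 ⊹ $1 ⊹ (⟨ 1 ⟩ ⊹ $1) ⋆ $2))) ($0 ⊹ (⟨ 1 ⟩ ⊹ $1) ⋆ (⟨ 1 ⟩ ⊹ $2)) refl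

    v≤f : ∀ w → ℤ.∣ v w ∣ ≤ ℤ.∣ f (suc (x₀ + b * w)) ∣
    v≤f w = ≤-trans (m≤n*m ℤ.∣ v w ∣ {b} (s≤s z≤n)) (≤-reflexive (sym (trans (cong ℤ.∣_∣ (f-factor w)) (ℤP.abs-* (+ b) (v w)))))

    bound : ∀ Z W w → 2 * κ * z₁ ≤ Z → p * W ≤ Z → w < W → κ * suc (x₀ + b * w) ≤ Z
    bound Z W w z₁Z WZ w<W = *-cancelˡ-≤ 2 (≤-trans (≤-reflexive (lem κ z₁ b′ w)) (≤-trans (+-mono-≤ z₁Z (≤-trans (*-monoʳ-≤ p w<W) WZ)) (≤-reflexive (cong (λ x → Z + x) (sym (+-identityʳ Z))))))
      where lem : ∀ κ z b w → 2 * (κ * suc (z + b + suc b * w)) ≡ 2 * κ * z + 2 * κ * suc b * suc w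
            lem κ z b w = ringℕ (κ ∷ z ∷ b ∷ w ∷ []) (⟨ 2 ⟩ ⋆ ($0 ⋆ (⟨ 1 ⟩ ⊹ ($1 ⊹ $2 ⊹ (⟨ 1 ⟩ ⊹ $2) ⋆ $3)))) (⟨ 2 ⟩ ⋆ $0 ⋆ $1 ⊹ ⟨ 2 ⟩ ⋆ $0 ⋆ (⟨ 1 ⟩ ⊹ $2) ⋆ (⟨ 1 ⟩ ⊹ $3)) refl

    Grows : ℕ → ℕ → Set
    Grows Z N = Z ≤ 2 * N × (∀ z → 1 ≤ z → κ * z ≤ Z → κ * ℤ.∣ ev (suc d) A (+ z) ∣ ≤ 4 * N)

    module Sized (Z N W : ℕ) (Z1 : 1 ≤ Z) (z₁Z : 2 * κ * z₁ ≤ Z) (grows : Grows Z N) (WZ : p * W ≤ Z) (ZW : Z ≤ 2 * p * W) (YW : Y ≤ W)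
      (𝒜 : Fin r → ℕ → Bool) (inN : ∀ i n → 𝒜 i n ≡ true → 1 ≤ n × n ≤ N) (dens : ∀ i → δn * N ≤ δd * card (𝒜 i) N)
      (𝒞 : Fin r → ℕ → Bool) (inZ : ∀ k z → 𝒞 k z ≡ true → 1 ≤ z × z ≤ Z) (cover : ∀ z → 1 ≤ z → z ≤ Z → ∃ λ k → 𝒞 k z ≡ true) where

      N1 : 1 ≤ N
      N1 = half N (≤-trans Z1 (proj₁ grows))
        where half : ∀ N → 1 ≤ 2 * N → 1 ≤ N
              half (suc N) _ = s≤s z≤n

      small : ∀ w → w < W → K * ℤ.∣ v w ∣ ≤ N
      small w w<W = *-cancelˡ-≤ 4 (≤-trans (≤-reflexive (sym (*-assoc 4 K _))) (≤-trans (*-monoʳ-≤ κ (≤-trans (v≤f w) (≤-reflexive (cong ℤ.∣_∣ (PD≡ _))))) (proj₂ grows (suc (x₀ + b * w)) (s≤s z≤n) (bound Z W w z₁Z WZ w<W))))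

      col : Fin r → ℕ → Bool
      col k w = 𝒞 k (suc (x₀ + b * w))

      col-cover : ∀ w → w < W → ∃ λ k → col k w ≡ true
      col-cover w w<W = cover _ (s≤s z≤n) (≤-trans (m≤n*m _ {κ} (s≤s z≤n)) (bound Z W w z₁Z WZ w<W))

      init-valid : ∀ k → Valid (2 * N) 𝒜 (3 * δd) (init 𝒜 k)
      init-valid k = valid (λ i x e → e) (λ i x e → trans (cong (𝒜 i) (Cyclic.rot-0 (2 * N) x)) e) (λ i → dense-cyclic δn δd N δn1 N1 (𝒜 i) (dens i))

      found : ∃ λ k → W ^ length coeffs ≤ c * Ext W v (returns (2 * N) 𝒜 C₀) (col k) coeffs (+ 0)
      found = search (2 * N) 𝒜 C₀ ≤-refl col W YW col-cover (init 𝒜) init-valid (sumFin-≤ {r} (λ k → ≤-reflexive length-coeffs))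

      transfer : ∀ k i → N ^ suc s * Ext W v (returns (2 * N) 𝒜 C₀) (col k) coeffs (+ 0) ≤ cR * solCount (b₁ ∷ bs) L₂ f (𝒜 i) (𝒞 k) N Z
      transfer k i = ≤-trans (Ext≤Nest b₁ u v f W Z N K x₀ b (N ^ suc s) cR (returns (2 * N) 𝒜 C₀) (𝒞 k) (Rep (b₁ ∷ bs) (λ i′ → 𝒜 i (suc i′)) N) (s≤s z≤n) u1 (s≤s z≤n)
          (λ h hN e → leaf N (𝒜 i) (inN i) h hN (⌊⌋-elim (suc (2 * N) ≤? _) (allFin-elim _ e i)))
          small
          (λ w → trans (f-factor w) (trans (cong (λ x → x ℤ.* v w) b₁u) (ℤP.*-assoc b₁ u (v w))))
          (λ j Zj → ¬-not (λ e → <⇒≱ (s≤s Zj) (proj₂ (inZ k _ e))))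
          L₂ (+ 0) (≤-trans (≤-reflexive (cong (λ x → x + absV L₂ * N) (*-zeroʳ K))) (*-monoˡ-≤ N (n≤1+n (absV L₂)))))
        (≤-reflexive (cong (λ x → cR * x) (trans (cong (Nest f Z (𝒞 k) _ L₂) (ℤP.*-zeroʳ b₁)) (sym (solCount≡Nest (b₁ ∷ bs) L₂ f (𝒜 i) (𝒞 k) N Z)))))

      conclusion : ∃ λ k → ∀ i → 1 * (N ^ suc s * Z ^ t) ≤ (2 * p) ^ t * (c * cR) * solCount (b₁ ∷ bs) L₂ f (𝒜 i) (𝒞 k) N Z
      conclusion = proj₁ found , λ i → ≤-trans (≤-reflexive (*-identityˡ _))
        (≤-trans (*-monoʳ-≤ (N ^ suc s) (≤-trans (^-monoˡ-≤ t ZW) (≤-trans (≤-reflexive (trans (*-^ (2 * p) W t) (cong (λ e → (2 * p) ^ t * W ^ e) (sym length-coeffs)))) (*-monoʳ-≤ ((2 * p) ^ t) (proj₂ found)))))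
        (≤-trans (≤-reflexive (lem₁ (N ^ suc s) ((2 * p) ^ t) c _)) (≤-trans (*-monoʳ-≤ ((2 * p) ^ t * c) (transfer (proj₁ found) i)) (≤-reflexive (lem₂ ((2 * p) ^ t) c cR _)))))
        where
        lem₁ : ∀ n q c e → n * (q * (c * e)) ≡ q * c * (n * e)
        lem₁ n q c e = ringℕ (n ∷ q ∷ c ∷ e ∷ []) ($0 ⋆ ($1 ⋆ ($2 ⋆ $3))) ($1 ⋆ $2 ⋆ ($0 ⋆ $3)) refl
        lem₂ : ∀ q c r x → q * c * (r * x) ≡ q * (c * r) * x
        lem₂ q c r x = ringℕ (q ∷ c ∷ r ∷ x ∷ []) ($0 ⋆ $1 ⋆ ($2 ⋆ $3)) ($0 ⋆ ($1 ⋆ $2) ⋆ $3) refl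

-- `u` is the sign of the first coefficient, so `b₁ * u` is its absolute value and both signs are
-- treated together.
theorem-normalised : ∀ {d r s t} → 1 ≤ r → ∀ δn δd → 1 ≤ δn → δn < δd → (P : Poly (suc d)) → HasDegree P → (ζ : PAdicZeros P) →
  ∀ b₁ u b′ → ℤ.∣ u ∣ ≡ 1 → + suc b′ ≡ b₁ ℤ.* u → (bs : Vec ℤ (suc s)) → NZ (b₁ ∷ bs) → sumV (b₁ ∷ bs) ≡ + 0 → (L₂ : Vec ℤ t) →
  ∃ λ cd → 1 ≤ cd × (∀ D → 1 ≤ D → ∀ rD → IsRD (PAdicZeros.zs ζ) D rD → ∃ λ Z₀ → ∀ Z → Z₀ ≤ Z → ∀ N → PD P (PAdicZeros.mult ζ) D rD (+ Z) ≡ + N →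
    (𝒜 : Fin r → ℕ → Bool) → (∀ i n → 𝒜 i n ≡ true → 1 ≤ n × n ≤ N) → (∀ i → δn * N ≤ δd * card (𝒜 i) N) →
    (𝒞 : Fin r → ℕ → Bool) → (∀ k z → 𝒞 k z ≡ true → 1 ≤ z × z ≤ Z) → (∀ z → 1 ≤ z → z ≤ Z → ∃ λ k → 𝒞 k z ≡ true) →
    ∃ λ k → ∀ i → 1 * (N ^ suc s * Z ^ t) ≤ cd * solCount (b₁ ∷ bs) L₂ (λ z → PD P (PAdicZeros.mult ζ) D rD (+ z)) (𝒜 i) (𝒞 k) N Z)
theorem-normalised {d} {r} {s} {t} r1 δn δd δn1 δnd P deg ζ b₁ u b′ u1 b₁u bs nz sum0 L₂ =
  (2 * p) ^ t * (c * cR) , 1≤m* (1≤^ t (1≤m* {2} (s≤s z≤n) p1)) (1≤m* c1 cR1) , λ D D1 rD isRD → threshold D rD (auxiliary P deg ζ D D1 rD isRD (suc b′) (s≤s z≤n))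
  where
  open Colours r r1 using (Claim; claim)
  cl : Claim d (r * t) (3 * δd)
  cl = claim d (r * t) (3 * δd) (1≤m* {3} (s≤s z≤n) (≤-trans (s≤s z≤n) δnd))
  c C₀ : ℕ
  c = proj₁ cl
  C₀ = proj₁ (proj₂ cl)
  c1 : 1 ≤ c
  c1 = proj₁ (proj₂ (proj₂ cl))
  C₀1 : 1 ≤ C₀
  C₀1 = proj₁ (proj₂ (proj₂ (proj₂ cl)))
  ro = roth s (b₁ ∷ bs) nz sum0 C₀ C₀1
  cR : ℕ
  cR = proj₁ ro
  cR1 : 1 ≤ cR
  cR1 = proj₁ (proj₂ ro)
  open Main {t = t} r1 δn δd δn1 P deg ζ b₁ u b′ u1 b₁u bs L₂ c C₀ cR (proj₂ (proj₂ ro)) using (p; p1; κ; module Fixed)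
  threshold : ∀ D rD (aux : Auxiliary P ζ D rD (suc b′)) → ∃ λ Z₀ → ∀ Z → Z₀ ≤ Z → ∀ N → PD P (PAdicZeros.mult ζ) D rD (+ Z) ≡ + N →
    (𝒜 : Fin r → ℕ → Bool) → (∀ i n → 𝒜 i n ≡ true → 1 ≤ n × n ≤ N) → (∀ i → δn * N ≤ δd * card (𝒜 i) N) →
    (𝒞 : Fin r → ℕ → Bool) → (∀ k z → 𝒞 k z ≡ true → 1 ≤ z × z ≤ Z) → (∀ z → 1 ≤ z → z ≤ Z → ∃ λ k → 𝒞 k z ≡ true) →
    ∃ λ k → ∀ i → 1 * (N ^ suc s * Z ^ t) ≤ (2 * p) ^ t * (c * cR) * solCount (b₁ ∷ bs) L₂ (λ z → PD P (PAdicZeros.mult ζ) D rD (+ z)) (𝒜 i) (𝒞 k) N Z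
  -- `p` makes `W` positive, `Zg` lets the leading term dominate, `2 * p * Y` gives `Y ≤ W`, and
  -- `2 * κ * z₁` makes the offset negligible.
  threshold D rD aux = p + (Zg + (2 * p * Y + 2 * κ * z₁)) , large
    where
    open Auxiliary aux
    gr = growth d A κ (s≤s z≤n) lead
    Zg : ℕ
    Zg = proj₁ gr
    sr = proj₂ (proj₂ (proj₂ (proj₂ cl))) Â rooted
    Y : ℕ
    Y = proj₁ sr
    open Fixed D rD aux Y (proj₂ sr) using (module Sized)
    large : ∀ Z → p + (Zg + (2 * p * Y + 2 * κ * z₁)) ≤ Z → ∀ N → PD P (PAdicZeros.mult ζ) D rD (+ Z) ≡ + N →
      (𝒜 : Fin r → ℕ → Bool) → (∀ i n → 𝒜 i n ≡ true → 1 ≤ n × n ≤ N) → (∀ i → δn * N ≤ δd * card (𝒜 i) N) →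
      (𝒞 : Fin r → ℕ → Bool) → (∀ k z → 𝒞 k z ≡ true → 1 ≤ z × z ≤ Z) → (∀ z → 1 ≤ z → z ≤ Z → ∃ λ k → 𝒞 k z ≡ true) →
      ∃ λ k → ∀ i → 1 * (N ^ suc s * Z ^ t) ≤ (2 * p) ^ t * (c * cR) * solCount (b₁ ∷ bs) L₂ (λ z → PD P (PAdicZeros.mult ζ) D rD (+ z)) (𝒜 i) (𝒞 k) N Z
    large Z big N eq = Sized.conclusion Z N W (≤-trans p1 pZ) (≤-trans (m≤n+m _ (2 * p * Y)) rest₂)
      (proj₂ (proj₂ gr) Z N (≤-trans (m≤m+n Zg _) rest₁) (trans (sym (PD≡ (+ Z))) eq)) (proj₁ (proj₂ (proj₂ qs))) (proj₂ (proj₂ (proj₂ qs)))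
      (*-cancelˡ-≤ (2 * p) {{ℕ.>-nonZero (1≤m* {2} (s≤s z≤n) p1)}} (≤-trans (≤-trans (m≤m+n (2 * p * Y) _) rest₂) (proj₂ (proj₂ (proj₂ qs)))))
      where
      pZ : p ≤ Z
      pZ = ≤-trans (m≤m+n p _) big
      rest₁ : Zg + (2 * p * Y + 2 * κ * z₁) ≤ Z
      rest₁ = ≤-trans (m≤n+m _ p) big
      rest₂ : 2 * p * Y + 2 * κ * z₁ ≤ Z
      rest₂ = ≤-trans (m≤n+m _ Zg) rest₁
      qs = quot-scale p Z p1 pZ
      W : ℕ
      W = proj₁ qs

theorem8p1 : (d r : ℕ) → 1 ≤ d → 1 ≤ r →
    -- δ = δn / δd with 0 < δ < 1
    (δn δd : ℕ) → 1 ≤ δn → δn < δd →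
    (P : Poly d) → HasDegree P → Intersective P → IncreasingPos P →
    -- the fixed p-adic zeros z_p (with multiplicities m_p)
    (ζ : PAdicZeros P) →
    (s t : ℕ) → 1 ≤ s → S0≤ d (s + t) →
    (L₁ : Vec ℤ s) → NonDegenerate L₁ → gcdV L₁ ≡ 1 → linear L₁ (ones s) ≡ + 0 →
    (L₂ : Vec ℤ t) → NonDegenerate L₂ →
    -- c = cn / cd > 0
    ∃ λ (cn : ℕ) → ∃ λ (cd : ℕ) → 1 ≤ cn × 1 ≤ cd ×
    ((D : ℕ) → 1 ≤ D →
    (rD : ℤ) → IsRD (PAdicZeros.zs ζ) D rD →
    ∃ λ (Z₀ : ℕ) → (Z : ℕ) → Z₀ ≤ Z →
    (N : ℕ) → PD P (PAdicZeros.mult ζ) D rD (+ Z) ≡ + N →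
    (𝒜 : Fin r → ℕ → Bool) →
    (∀ i n → 𝒜 i n ≡ true → 1 ≤ n × n ≤ N) →
    (∀ i → δn * N ≤ δd * card (𝒜 i) N) →
    (𝒞 : Fin r → ℕ → Bool) →
    (∀ k z → 𝒞 k z ≡ true → 1 ≤ z × z ≤ Z) →
    (∀ z → 1 ≤ z → z ≤ Z → ∃ λ k → 𝒞 k z ≡ true) →
    ∃ λ (k : Fin r) → (i : Fin r) →
    cn * (N ^ (s ∸ 1) * Z ^ t)
    ≤ cd * solCount L₁ L₂ (λ z → PD P (PAdicZeros.mult ζ) D rD (+ z)) (𝒜 i) (𝒞 k) N Z)
theorem8p1 zero r () r1
theorem8p1 (suc d) r d1 r1 δn δd δn1 δnd P deg int inc ζ zero t ()
-- With a single variable the vanishing coefficient sum would make the coefficient zero.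
theorem8p1 (suc d) r d1 r1 δn δd δn1 δnd P deg int inc ζ (suc zero) t s1 S0 (b₁ ∷ []) nd g lin0 L₂ nd₂ =
  contradiction (trans (sym (trans (ℤP.+-identityʳ _) (ℤP.*-identityʳ b₁))) lin0) (nd zero)
theorem8p1 (suc d) r d1 r1 δn δd δn1 δnd P deg int inc ζ (suc (suc s)) t s1 S0 (+ zero ∷ bs) nd g lin0 L₂ nd₂ = contradiction refl (nd zero)
theorem8p1 (suc d) r d1 r1 δn δd δn1 δnd P deg int inc ζ (suc (suc s)) t s1 S0 (+ suc b′ ∷ bs) nd g lin0 L₂ nd₂ =
  1 , proj₁ th , ≤-refl , proj₁ (proj₂ th) , proj₂ (proj₂ th)
  where th = theorem-normalised r1 δn δd δn1 δnd P deg ζ (+ suc b′) (+ 1) b′ refl (sym (ℤP.*-identityʳ _)) bs (NonDegenerate⇒NZ (+ suc b′ ∷ bs) nd) (trans (sym (linear-ones (+ suc b′ ∷ bs))) lin0) L₂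
theorem8p1 (suc d) r d1 r1 δn δd δn1 δnd P deg int inc ζ (suc (suc s)) t s1 S0 (-[1+ b′ ] ∷ bs) nd g lin0 L₂ nd₂ =
  1 , proj₁ th , ≤-refl , proj₁ (proj₂ th) , proj₂ (proj₂ th)
  where th = theorem-normalised r1 δn δd δn1 δnd P deg ζ -[1+ b′ ] (ℤ.- + 1) b′ refl (sym (trans (ℤP.*-comm -[1+ b′ ] (ℤ.- + 1)) (ℤP.-1*i≡-i -[1+ b′ ]))) bs (NonDegenerate⇒NZ (-[1+ b′ ] ∷ bs) nd) (trans (sym (linear-ones (-[1+ b′ ] ∷ bs))) lin0) L₂
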